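{- Let $X$ be the smooth projective genus $2$ curve over $\mathbb{Q}$ with affine model $$y^2 = x^6 + \tfrac{18}{5}x^4 + \tfrac{6}{5}x^3 + \tfrac{9}{5}x^2 + \tfrac{6}{5}x + \tfrac{1}{5}.$$ Then $X(\mathbb{Q})$ consists of exactly the $10$ points $$(-1/3 : -1/27 : 1),\ (-1/3 : 1/27 : 1),\ (-1/5 : -21/125 : 1),\ (-1/5 : 21/125 : 1),\ (1 : 3 : 1),$$ $$(1 : -3 : 1),\ (1 : 1 : 0),\ (1 : -1 : 0),\ (-1/2 : -3/8 : 1),\ (-1/2 : 3/8 : 1).$$
   Context: Points of $X$ are written as $(x:y:z)$ in the weighted projective plane with weights $(1,3,1)$, so that $(x:y:1)$ corresponds to the affine point $(x,y)$ and $(1:\pm1:0)$ are the two points at infinity. -}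

module Defs where

open import Data.Nat using (ℕ; suc)
open import Data.Integer using (ℤ; +_)
open import Data.Rational using (ℚ; _/_; _+_; _*_; -_; 0ℚ; 1ℚ)
open import Data.Fin using (Fin; zero; suc)
open import Data.Product using (_×_; _,_; ∃)
open import Relation.Binary.PropositionalEquality using (_≡_; _≢_)
open import Relation.Nullary using (¬_)

-- Points of the weighted projective plane P(1,3,1) over ℚ are represented
-- by triples (x , y , z) of rationals, not all zero, modulo
-- (x , y , z) ~ (λ x , λ³ y , λ z) for λ ∈ ℚ, λ ≠ 0.
Triple : Set
Triple = ℚ × ℚ × ℚ

cube : ℚ → ℚ
cube t = t * t * t

_∼_ : Triple → Triple → Set
(x' , y' , z') ∼ (x , y , z) =
  ∃ λ (l : ℚ) → l ≢ 0ℚ × x' ≡ l * x × y' ≡ cube l * y × z' ≡ l * z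

NonZeroTriple : Triple → Set
NonZeroTriple (x , y , z) = ¬ (x ≡ 0ℚ × y ≡ 0ℚ × z ≡ 0ℚ)

pow : ℚ → ℕ → ℚ
pow t 0 = 1ℚ
pow t (suc n) = t * pow t n

-- Homogenised (weights 1,3,1) equation of X:
-- y² = x⁶ + 18/5 x⁴z² + 6/5 x³z³ + 9/5 x²z⁴ + 6/5 x z⁵ + 1/5 z⁶
XEq : Triple → Set
XEq (x , y , z) =
  y * y ≡ pow x 6 + (+ 18 / 5) * pow x 4 * pow z 2
        + (+ 6 / 5) * pow x 3 * pow z 3
        + (+ 9 / 5) * pow x 2 * pow z 4
        + (+ 6 / 5) * x * pow z 5
        + (+ 1 / 5) * pow z 6

OnX : Triple → Set
OnX P = NonZeroTriple P × XEq P


listed : Fin 10 → Triple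
listed zero = (- (+ 1 / 3)) , (- (+ 1 / 27)) , 1ℚ
listed (suc zero) = (- (+ 1 / 3)) , (+ 1 / 27) , 1ℚ
listed (suc (suc zero)) = (- (+ 1 / 5)) , (- (+ 21 / 125)) , 1ℚ
listed (suc (suc (suc zero))) = (- (+ 1 / 5)) , (+ 21 / 125) , 1ℚ
listed (suc (suc (suc (suc zero)))) = 1ℚ , (+ 3 / 1) , 1ℚ
listed (suc (suc (suc (suc (suc zero))))) = 1ℚ , (- (+ 3 / 1)) , 1ℚ
listed (suc (suc (suc (suc (suc (suc zero)))))) = 1ℚ , 1ℚ , 0ℚ
listed (suc (suc (suc (suc (suc (suc (suc zero))))))) = 1ℚ , (- 1ℚ) , 0ℚ
listed (suc (suc (suc (suc (suc (suc (suc (suc zero)))))))) = (- (+ 1 / 2)) , (- (+ 3 / 8)) , 1ℚ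
listed (suc (suc (suc (suc (suc (suc (suc (suc (suc zero))))))))) = (- (+ 1 / 2)) , (+ 3 / 8) , 1ℚ

{-# OPTIONS --safe #-}
module Submission where

open import Defs
import Algebra.Properties.Ring
open import Algebra.Bundles using (CommutativeRing)
open import Algebra.Structures using (IsCommutativeRing)
open import Data.Bool using (Bool; true; false; if_then_else_; T; _∧_; _∨_; not)
open import Data.Empty using (⊥; ⊥-elim)
open import Data.Fin as Fin using (Fin; zero; suc)
open import Data.Fin.Patterns
open import Data.Fin.Properties as Finₚ using (all?)
open import Data.Integer as ℤ using (ℤ; +_; -[1+_]; ∣_∣)
import Data.Integer.DivMod as ℤD
import Data.Integer.Divisibility.Signed as ℤS
import Data.Integer.Properties as ℤₚ
open import Data.List using (List; []; _∷_)
open import Data.List.Relation.Unary.All using (All; []; _∷_)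
open import Data.Maybe using (Maybe; just; nothing; is-just)
open import Data.Nat as ℕ using (ℕ; zero; suc; _≡ᵇ_; _<ᵇ_)
open import Data.Nat.Coprimality as Coprimality using (Coprime)
import Data.Nat.DivMod as ℕD
import Data.Nat.Divisibility as ℕV
import Data.Nat.GCD as GCD
open import Data.Nat.Induction using (<-wellFounded; <-rec)
import Data.Nat.Properties as ℕₚ
open import Data.Product using (_×_; _,_; ∃; proj₁; proj₂)
open import Data.Product.Properties using (≡-dec)
open import Data.Rational as ℚ using (ℚ; mkℚ; 0ℚ; 1ℚ)
import Data.Rational.Properties as ℚₚ
open import Data.Rational.Unnormalised as ℚᵘ using (mkℚᵘ; *≡*)
import Data.Rational.Unnormalised.Properties as ℚᵘₚ
open import Data.Sum using (_⊎_; inj₁; inj₂)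
open import Data.Unit using (tt)
open import Data.Vec using (Vec; []; _∷_; lookup; map; zipWith; replicate)
import Data.Vec.Properties as Vecₚ
open import Level using (0ℓ)
open import Relation.Binary.PropositionalEquality
open import Relation.Nullary using (¬_; Dec; yes; no)
open import Relation.Nullary.Decidable using (from-yes; _→-dec_)

-- Write x = lW and z = l(U - W) with coprime integers U = u, W = w. Five times the sextic becomes
-- l⁶ f₁ f₂ with f₁ = U³ - 3UW² + 3W³ and f₂ = U³ - 3UW² + 7W³. Both cubics acquire a linear factor
-- over the same cubic field K = ℚ(ε), ε³ = 3ε² + 1, which has discriminant -135 and one real place:
-- f₁ = N(u - θw) and f₂ = N(u - θ₂w), where θ = 1 - ε and θ₂ = 1 - ε - ε⁻¹. A rational point thus
-- makes 5 N(P) N(Q) a square, where P = u - θw and Q = u - θ₂w lie in `𝒪` = ℤ[ε]. The ratio u/w is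
-- 1 + z/x, and it has to be shown that it is one of 1, 2, -1, -2, -4; each of these lines carries
-- two of the ten points.
--
-- Descent to square classes. The ring `𝒪` is Euclidean for the norm (`division`), so a factor of a
-- square that is coprime to its cofactor is a unit times a square (`coprime-factor`), and a unit is
-- ±1 or ±ε times a square (`unit⇒class`). Common factors of P and its cofactor in the square lie
-- above 2, 3 and 5, so P = s c² and Q = t d² for s and t among 64 explicit classes
-- (`linear-class`). A norm condition and congruences at 2, 3 and 5 (`pairs-check`) leave three
-- pairs (s , t) up to sign and a scaling by 5, each with a few residues of (u , w) modulo 8
-- (`Listed`).
--
-- Passage to elliptic curves. Over K the product of the two linear forms and of the quadratic
-- cofactor u² + ρuw + ρ♯w² of u - ρw defines a curve of genus one whose Jacobian is y² = x(x² - αx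
-- + β). A known ratio u₀/v₀ of the same class pair serves as base point, and a second ratio u/w
-- yields a `Datum`, that is a point with x = X/g² and y/x = Z/g, where g is a quarter of the
-- determinant u v₀ - u₀ w (`quarter-datum`).
--
-- Infinite descent at 2. The prime 2 is inert with residue field of 8 elements. If (u , w) is
-- congruent to the base point modulo 8 without having the same ratio, the point is near the origin
-- at 2, and g is a power of 2 times an odd part γ. The determinant is a rational integer, so γ is 1
-- modulo 2, and the direction γ/Z modulo 2 is a fixed element τ. As in the elliptic curve form of
-- Chabauty's method, this one condition is contradictory (`no-point`): when g contains more than
-- one factor 2, the square classes that survive locally force X to be a square, the point lifts
-- through the dual isogeny and then through the isogeny itself, and so is halved with the same
-- direction; when only one factor 2 is left, X is Z²(1 + 4ατ²) modulo 8, which no surviving class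
-- allows. On the dual curve a second class `twist`, the image of the 2-torsion point, can occur;
-- translating by that torsion point produces a point with odd g and even Z, which the sieve modulo
-- 4 excludes (`twisted`). One class that the sieve allows there for the first curve is refuted by
-- translating with a known point of its torsor (`Translation`).
--
-- The remaining residues modulo 8 contain no known ratio. In two cases g is odd and a sieve modulo
-- 4 suffices (`near-residual`); in the last one another quotient, built from the quadratic
-- cofactors of P and of Q, is sieved modulo 8 (`Split-II`).

infixl 6 _⊕_ _⊖_
infixl 7 _⊗_

-- Polynomial identities by normalisation.

data Expr (n : ℕ) : Set where
  v : Fin n → Expr n
  # : ℤ → Expr n
  _⊕_ _⊗_ _⊖_ : Expr n → Expr n → Expr n

Mono : ℕ → Set
Mono = Vec ℕ

Poly : ℕ → Set
Poly n = List (Mono n × ℤ)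

data Ord : Set where before same after : Ord

cmpℕ : ℕ → ℕ → Ord
cmpℕ j k = if j ≡ᵇ k then same else (if j <ᵇ k then before else after)

cmp : ∀ {n} → Mono n → Mono n → Ord
cmp [] [] = same
cmp (j ∷ m) (k ∷ m′) with cmpℕ j k
... | before = before
... | same = cmp m m′
... | after = after

insert : ∀ {n} → Mono n → ℤ → Poly n → Poly n
insert m c [] = (m , c) ∷ []
insert m c ((m′ , c′) ∷ p) with cmp m m′
... | before = (m , c) ∷ (m′ , c′) ∷ p
... | same = (m′ , c ℤ.+ c′) ∷ p
... | after = (m′ , c′) ∷ insert m c p

addP : ∀ {n} → Poly n → Poly n → Poly n
addP [] q = q
addP ((m , c) ∷ p) q = insert m c (addP p q)

mulT : ∀ {n} → Mono n → ℤ → Poly n → Poly n → Poly n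
mulT m c [] r = r
mulT m c ((m′ , c′) ∷ p) r = insert (zipWith ℕ._+_ m m′) (c ℤ.* c′) (mulT m c p r)

mulP : ∀ {n} → Poly n → Poly n → Poly n
mulP [] q = []
mulP ((m , c) ∷ p) q = mulT m c q (mulP p q)

negP : ∀ {n} → Poly n → Poly n
negP [] = []
negP ((m , c) ∷ p) = (m , ℤ.- c) ∷ negP p

varM : ∀ {n} → Fin n → Mono n
varM zero = 1 ∷ replicate _ 0
varM (suc i) = 0 ∷ varM i

norm : ∀ {n} → Expr n → Poly n
norm (v i) = (varM i , + 1) ∷ []
norm (# k) = (replicate _ 0 , k) ∷ []
norm (e ⊕ f) = addP (norm e) (norm f)
norm (e ⊗ f) = mulP (norm e) (norm f)
norm (e ⊖ f) = addP (norm e) (negP (norm f))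

isZero : ∀ {n} → Poly n → Bool
isZero [] = true
isZero ((m , + 0) ∷ p) = isZero p
isZero (_ ∷ p) = false

cmpℕ-same : ∀ j k → cmpℕ j k ≡ same → j ≡ k
cmpℕ-same j k e with j ≡ᵇ k in q
... | true = ℕₚ.≡ᵇ⇒≡ j k (subst (λ b → Data.Bool.T b) (sym q) tt)
cmpℕ-same j k e | false with j <ᵇ k
cmpℕ-same j k () | false | true
cmpℕ-same j k () | false | false

cmp-same : ∀ {n} (m m′ : Mono n) → cmp m m′ ≡ same → m ≡ m′
cmp-same [] [] e = refl
cmp-same (j ∷ m) (k ∷ m′) e with cmpℕ j k in q
... | same = cong₂ _∷_ (cmpℕ-same j k q) (cmp-same m m′ e)

-- Serves for ℤ, for the cubic ring `𝒪` and for ℚ, so that one normaliser with integer coefficients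
-- proves identities in all three.
record ℤ-Algebra : Set₁ where
  infixl 6 _+_
  infixl 7 _*_
  infix 8 -_
  field
    A : Set
    _+_ _*_ : A → A → A
    -_ : A → A
    𝟘 𝟙 : A
    isCommutativeRing : IsCommutativeRing _≡_ _+_ _*_ -_ 𝟘 𝟙
    ι : ℤ → A
    ι-+ : ∀ m n → ι (m ℤ.+ n) ≡ ι m + ι n
    ι-* : ∀ m n → ι (m ℤ.* n) ≡ ι m * ι n
    ι-neg : ∀ m → ι (ℤ.- m) ≡ - ι m
    ι-0 : ι (ℤ.+ 0) ≡ 𝟘
    ι-1 : ι (ℤ.+ 1) ≡ 𝟙

  commutativeRing : CommutativeRing 0ℓ 0ℓ
  commutativeRing = record { isCommutativeRing = isCommutativeRing }

module Identities (R : ℤ-Algebra) where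

  open ℤ-Algebra R
  open CommutativeRing commutativeRing using
    (_-_; +-assoc; +-comm; +-identityˡ; +-identityʳ; *-assoc; *-comm; *-identityˡ; *-identityʳ; distribˡ; distribʳ; zeroˡ; zeroʳ; -‿inverseˡ; -‿inverseʳ)
  private module RP = Algebra.Properties.Ring (CommutativeRing.ring commutativeRing)
  open ≡-Reasoning

  ⟦_⟧ : ∀ {n} → Expr n → Vec A n → A
  ⟦ v i ⟧ ρ = lookup ρ i
  ⟦ # k ⟧ ρ = ι k
  ⟦ e ⊕ f ⟧ ρ = ⟦ e ⟧ ρ + ⟦ f ⟧ ρ
  ⟦ e ⊗ f ⟧ ρ = ⟦ e ⟧ ρ * ⟦ f ⟧ ρ
  ⟦ e ⊖ f ⟧ ρ = ⟦ e ⟧ ρ - ⟦ f ⟧ ρ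

  power : A → ℕ → A
  power x zero = 𝟙
  power x (suc k) = x * power x k

  evalM : ∀ {n} → Mono n → Vec A n → A
  evalM [] [] = 𝟙
  evalM (k ∷ m) (x ∷ ρ) = power x k * evalM m ρ

  evalP : ∀ {n} → Poly n → Vec A n → A
  evalP [] ρ = 𝟘
  evalP ((m , c) ∷ p) ρ = ι c * evalM m ρ + evalP p ρ

  private
    swap₃ : ∀ x y z → x + (y + z) ≡ y + (x + z)
    swap₃ x y z = trans (sym (+-assoc x y z)) (trans (cong (λ w → w + z) (+-comm x y)) (+-assoc y x z))

  insert-sound : ∀ {n} (m : Mono n) c p ρ → evalP (insert m c p) ρ ≡ ι c * evalM m ρ + evalP p ρ
  insert-sound m c [] ρ = refl
  insert-sound m c ((m′ , c′) ∷ p) ρ with cmp m m′ in q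
  ... | before = refl
  ... | after = trans (cong (λ w → ι c′ * evalM m′ ρ + w) (insert-sound m c p ρ)) (swap₃ _ _ _)
  ... | same with cmp-same m m′ q
  ... | refl = begin
    ι (c ℤ.+ c′) * evalM m ρ + evalP p ρ ≡⟨ cong (λ w → w * evalM m ρ + evalP p ρ) (ι-+ c c′) ⟩
    (ι c + ι c′) * evalM m ρ + evalP p ρ ≡⟨ cong (λ w → w + evalP p ρ) (distribʳ (evalM m ρ) (ι c) (ι c′)) ⟩
    (ι c * evalM m ρ + ι c′ * evalM m ρ) + evalP p ρ ≡⟨ +-assoc _ _ _ ⟩
    ι c * evalM m ρ + (ι c′ * evalM m ρ + evalP p ρ) ∎

  addP-sound : ∀ {n} (p q : Poly n) ρ → evalP (addP p q) ρ ≡ evalP p ρ + evalP q ρ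
  addP-sound [] q ρ = sym (+-identityˡ _)
  addP-sound ((m , c) ∷ p) q ρ = trans (insert-sound m c (addP p q) ρ)
    (trans (cong (λ w → ι c * evalM m ρ + w) (addP-sound p q ρ)) (sym (+-assoc _ _ _)))

  power-+ : ∀ x j k → power x (j ℕ.+ k) ≡ power x j * power x k
  power-+ x zero k = sym (*-identityˡ _)
  power-+ x (suc j) k = trans (cong (x *_) (power-+ x j k)) (sym (*-assoc x _ _))

  private
    exch : ∀ w x y z → (w * x) * (y * z) ≡ (w * y) * (x * z)
    exch w x y z = begin
      (w * x) * (y * z) ≡⟨ *-assoc w x (y * z) ⟩
      w * (x * (y * z)) ≡⟨ cong (w *_) (trans (sym (*-assoc x y z)) (trans (cong (_* z) (*-comm x y)) (*-assoc y x z))) ⟩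
      w * (y * (x * z)) ≡⟨ sym (*-assoc w y (x * z)) ⟩
      (w * y) * (x * z) ∎

  evalM-* : ∀ {n} (m m′ : Mono n) ρ → evalM (zipWith ℕ._+_ m m′) ρ ≡ evalM m ρ * evalM m′ ρ
  evalM-* [] [] [] = sym (*-identityˡ 𝟙)
  evalM-* (j ∷ m) (k ∷ m′) (x ∷ ρ) = trans (cong₂ _*_ (power-+ x j k) (evalM-* m m′ ρ)) (exch _ _ _ _)

  mulT-sound : ∀ {n} (m : Mono n) c p r ρ → evalP (mulT m c p r) ρ ≡ (ι c * evalM m ρ) * evalP p ρ + evalP r ρ
  mulT-sound m c [] r ρ = sym (trans (cong (λ w → w + evalP r ρ) (zeroʳ _)) (+-identityˡ _))
  mulT-sound m c ((m′ , c′) ∷ p) r ρ = begin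
    evalP (insert (zipWith ℕ._+_ m m′) (c ℤ.* c′) (mulT m c p r)) ρ
      ≡⟨ insert-sound (zipWith ℕ._+_ m m′) (c ℤ.* c′) (mulT m c p r) ρ ⟩
    ι (c ℤ.* c′) * evalM (zipWith ℕ._+_ m m′) ρ + evalP (mulT m c p r) ρ
      ≡⟨ cong₂ _+_ (trans (cong₂ _*_ (ι-* c c′) (evalM-* m m′ ρ)) (exch _ _ _ _)) (mulT-sound m c p r ρ) ⟩
    (ι c * evalM m ρ) * (ι c′ * evalM m′ ρ) + ((ι c * evalM m ρ) * evalP p ρ + evalP r ρ)
      ≡⟨ sym (+-assoc _ _ _) ⟩
    ((ι c * evalM m ρ) * (ι c′ * evalM m′ ρ) + (ι c * evalM m ρ) * evalP p ρ) + evalP r ρ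
      ≡⟨ cong (λ w → w + evalP r ρ) (sym (distribˡ _ _ _)) ⟩
    (ι c * evalM m ρ) * (ι c′ * evalM m′ ρ + evalP p ρ) + evalP r ρ ∎

  mulP-sound : ∀ {n} (p q : Poly n) ρ → evalP (mulP p q) ρ ≡ evalP p ρ * evalP q ρ
  mulP-sound [] q ρ = sym (zeroˡ _)
  mulP-sound ((m , c) ∷ p) q ρ = trans (mulT-sound m c q (mulP p q) ρ)
    (trans (cong (λ w → (ι c * evalM m ρ) * evalP q ρ + w) (mulP-sound p q ρ)) (sym (distribʳ _ _ _)))

  negP-sound : ∀ {n} (p : Poly n) ρ → evalP (negP p) ρ ≡ - evalP p ρ
  negP-sound [] ρ = sym RP.-0#≈0#
  negP-sound ((m , c) ∷ p) ρ = trans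
    (cong₂ _+_ (trans (cong (_* evalM m ρ) (ι-neg c)) (sym (RP.-‿distribˡ-* _ _))) (negP-sound p ρ))
    (RP.-‿+-comm _ _)

  evalM-0 : ∀ {n} (ρ : Vec A n) → evalM (replicate n 0) ρ ≡ 𝟙
  evalM-0 [] = refl
  evalM-0 (x ∷ ρ) = trans (*-identityˡ _) (evalM-0 ρ)

  varM-sound : ∀ {n} (i : Fin n) ρ → evalM (varM i) ρ ≡ lookup ρ i
  varM-sound zero (x ∷ ρ) = trans (cong₂ _*_ (*-identityʳ x) (evalM-0 ρ)) (*-identityʳ x)
  varM-sound (suc i) (x ∷ ρ) = trans (*-identityˡ _) (varM-sound i ρ)

  norm-sound : ∀ {n} (e : Expr n) ρ → evalP (norm e) ρ ≡ ⟦ e ⟧ ρ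
  norm-sound (v i) ρ = trans (+-identityʳ _) (trans (cong (λ w → w * evalM (varM i) ρ) ι-1) (trans (*-identityˡ _) (varM-sound i ρ)))
  norm-sound (# k) ρ = trans (+-identityʳ _) (trans (cong (ι k *_) (evalM-0 ρ)) (*-identityʳ _))
  norm-sound (e ⊕ f) ρ = trans (addP-sound (norm e) (norm f) ρ) (cong₂ _+_ (norm-sound e ρ) (norm-sound f ρ))
  norm-sound (e ⊗ f) ρ = trans (mulP-sound (norm e) (norm f) ρ) (cong₂ _*_ (norm-sound e ρ) (norm-sound f ρ))
  norm-sound (e ⊖ f) ρ = trans (addP-sound (norm e) (negP (norm f)) ρ)
    (cong₂ _+_ (norm-sound e ρ) (trans (negP-sound (norm f) ρ) (cong (λ w → - w) (norm-sound f ρ))))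

  isZero-sound : ∀ {n} (p : Poly n) ρ → isZero p ≡ true → evalP p ρ ≡ 𝟘
  isZero-sound [] ρ _ = refl
  isZero-sound ((m , ℤ.+ 0) ∷ p) ρ e = trans (cong₂ _+_ (trans (cong (λ w → w * evalM m ρ) ι-0) (zeroˡ _)) (isZero-sound p ρ e)) (+-identityˡ _)

  x-y≡0⇒x≡y : ∀ {x y} → x - y ≡ 𝟘 → x ≡ y
  x-y≡0⇒x≡y {x} {y} e = begin
    x             ≡⟨ sym (+-identityʳ x) ⟩
    x + 𝟘         ≡⟨ cong (λ w → x + w) (sym (-‿inverseˡ y)) ⟩
    x + ((- y) + y) ≡⟨ sym (+-assoc x (- y) y) ⟩
    (x - y) + y   ≡⟨ cong (λ w → w + y) e ⟩
    𝟘 + y         ≡⟨ +-identityˡ y ⟩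
    y ∎

  -- Equality is reduced to a computation on coefficients: the difference is expanded into
  -- monomials, and these cancel over ℤ.
  identity : ∀ {n} (e f : Expr n) → isZero (norm (e ⊖ f)) ≡ true → ∀ ρ → ⟦ e ⟧ ρ ≡ ⟦ f ⟧ ρ
  identity e f z ρ = x-y≡0⇒x≡y (trans (sym (norm-sound (e ⊖ f) ρ)) (isZero-sound (norm (e ⊖ f)) ρ z))

  -- Used for identities that hold only under hypotheses l ≡ r: multiples k (l - r) of them are
  -- added to the right-hand side so that an unconditional polynomial identity arises, and are then
  -- removed one by one. The multipliers are the certificate of ideal membership.
  vanish : ∀ {R k l r} → l ≡ r → R + k * (l - r) ≡ R
  vanish {R} {k} {l} refl = begin
    R + k * (l - l) ≡⟨ cong (λ w → R + k * w) (-‿inverseʳ l) ⟩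
    R + k * 𝟘       ≡⟨ cong (λ w → R + w) (zeroʳ k) ⟩
    R + 𝟘           ≡⟨ +-identityʳ R ⟩
    R ∎

ℤ-algebra : ℤ-Algebra
ℤ-algebra = record
  { isCommutativeRing = CommutativeRing.isCommutativeRing ℤₚ.+-*-commutativeRing
  ; ι = λ n → n ; ι-+ = λ _ _ → refl ; ι-* = λ _ _ → refl ; ι-neg = λ _ → refl ; ι-0 = refl ; ι-1 = refl }

module ℤI = Identities ℤ-algebra

-- The cubic ring ℤ[ε], its norm and its congruences.

record 𝒪 : Set where
  constructor ⟨_,_,_⟩
  field c₁ cε cω : ℤ
open 𝒪 public

≡𝒪 : ∀ {a b c a′ b′ c′} → a ≡ a′ → b ≡ b′ → c ≡ c′ → ⟨ a , b , c ⟩ ≡ ⟨ a′ , b′ , c′ ⟩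
≡𝒪 refl refl refl = refl

ι : ℤ → 𝒪
ι n = ⟨ n , ℤ.+ 0 , ℤ.+ 0 ⟩

infixl 6 _+_ _-_
infixl 7 _*_
infix 8 -_

opaque
  _+_ : 𝒪 → 𝒪 → 𝒪
  ⟨ a , b , c ⟩ + ⟨ d , e , f ⟩ = ⟨ a ℤ.+ d , b ℤ.+ e , c ℤ.+ f ⟩

  -_ : 𝒪 → 𝒪
  - ⟨ a , b , c ⟩ = ⟨ ℤ.- a , ℤ.- b , ℤ.- c ⟩

  _*_ : 𝒪 → 𝒪 → 𝒪
  ⟨ a , b , c ⟩ * ⟨ d , e , f ⟩ =
    ⟨ a ℤ.* d ℤ.+ (b ℤ.* f ℤ.+ c ℤ.* e) ℤ.- ℤ.+ 3 ℤ.* (c ℤ.* f)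
    , a ℤ.* e ℤ.+ b ℤ.* d ℤ.+ (ℤ.+ 3 ℤ.* (b ℤ.* e) ℤ.+ c ℤ.* f)
    , a ℤ.* f ℤ.+ c ℤ.* d ℤ.+ b ℤ.* e ⟩

_-_ : 𝒪 → 𝒪 → 𝒪
x - y = x + (- y)

𝟘 𝟙 : 𝒪
𝟘 = ι (ℤ.+ 0)
𝟙 = ι (ℤ.+ 1)

-- Elements with symbolic coordinates in the basis 1, ε, ω, where ω = ε⁻¹. The multiplication table
-- behind `_⊠_` is ε² = 3ε + ω, εω = 1 and ω² = ε - 3, so ε³ = 3ε² + 1. An identity in `𝒪` becomes
-- three polynomial identities over ℤ.
record 𝒪-Expr (n : ℕ) : Set where
  constructor ⟪_,_,_⟫
  field e₁ eε eω : Expr n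

_⊞_ _⊠_ : ∀ {n} → 𝒪-Expr n → 𝒪-Expr n → 𝒪-Expr n
⟪ a , b , c ⟫ ⊞ ⟪ d , e , f ⟫ = ⟪ a ⊕ d , b ⊕ e , c ⊕ f ⟫
⟪ a , b , c ⟫ ⊠ ⟪ d , e , f ⟫ =
  ⟪ a ⊗ d ⊕ (b ⊗ f ⊕ c ⊗ e) ⊖ # (ℤ.+ 3) ⊗ (c ⊗ f)
  , a ⊗ e ⊕ b ⊗ d ⊕ (# (ℤ.+ 3) ⊗ (b ⊗ e) ⊕ c ⊗ f)
  , a ⊗ f ⊕ c ⊗ d ⊕ b ⊗ e ⟫

x₃ y₃ z₃ : 𝒪-Expr 9
x₃ = ⟪ v 0F , v 1F , v 2F ⟫
y₃ = ⟪ v 3F , v 4F , v 5F ⟫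
z₃ = ⟪ v 6F , v 7F , v 8F ⟫

components : (e f : 𝒪-Expr 9) → let open 𝒪-Expr in
  isZero (norm (e₁ e ⊖ e₁ f)) ≡ Data.Bool.true → isZero (norm (eε e ⊖ eε f)) ≡ Data.Bool.true →
  isZero (norm (eω e ⊖ eω f)) ≡ Data.Bool.true → ∀ ρ →
  ⟨ ℤI.⟦ e₁ e ⟧ ρ , ℤI.⟦ eε e ⟧ ρ , ℤI.⟦ eω e ⟧ ρ ⟩ ≡ ⟨ ℤI.⟦ e₁ f ⟧ ρ , ℤI.⟦ eε f ⟧ ρ , ℤI.⟦ eω f ⟧ ρ ⟩
components e f p q r ρ = ≡𝒪 (ℤI.identity (e₁ e) (e₁ f) p ρ) (ℤI.identity (eε e) (eε f) q ρ) (ℤI.identity (eω e) (eω f) r ρ)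
  where open 𝒪-Expr

opaque
  unfolding _+_ -_ _*_

  +-assoc : ∀ x y z → (x + y) + z ≡ x + (y + z)
  +-assoc ⟨ a , b , c ⟩ ⟨ d , e , f ⟩ ⟨ g , h , i ⟩ = ≡𝒪 (ℤₚ.+-assoc a d g) (ℤₚ.+-assoc b e h) (ℤₚ.+-assoc c f i)

  +-comm : ∀ x y → x + y ≡ y + x
  +-comm ⟨ a , b , c ⟩ ⟨ d , e , f ⟩ = ≡𝒪 (ℤₚ.+-comm a d) (ℤₚ.+-comm b e) (ℤₚ.+-comm c f)

  +-identityˡ : ∀ x → 𝟘 + x ≡ x
  +-identityˡ ⟨ a , b , c ⟩ = ≡𝒪 (ℤₚ.+-identityˡ a) (ℤₚ.+-identityˡ b) (ℤₚ.+-identityˡ c)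

  +-inverseˡ : ∀ x → (- x) + x ≡ 𝟘
  +-inverseˡ ⟨ a , b , c ⟩ = ≡𝒪 (ℤₚ.+-inverseˡ a) (ℤₚ.+-inverseˡ b) (ℤₚ.+-inverseˡ c)

  *-comm : ∀ x y → x * y ≡ y * x
  *-comm ⟨ a , b , c ⟩ ⟨ d , e , f ⟩ = components (x₃ ⊠ y₃) (y₃ ⊠ x₃) refl refl refl (a ∷ b ∷ c ∷ d ∷ e ∷ f ∷ a ∷ b ∷ c ∷ [])

  *-identityˡ : ∀ x → 𝟙 * x ≡ x
  *-identityˡ ⟨ a , b , c ⟩ = components (⟪ # (ℤ.+ 1) , # (ℤ.+ 0) , # (ℤ.+ 0) ⟫ ⊠ x₃) x₃ refl refl refl (a ∷ b ∷ c ∷ a ∷ b ∷ c ∷ a ∷ b ∷ c ∷ [])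

  *-distribˡ-+ : ∀ x y z → x * (y + z) ≡ x * y + x * z
  *-distribˡ-+ ⟨ a , b , c ⟩ ⟨ d , e , f ⟩ ⟨ g , h , i ⟩ =
    components (x₃ ⊠ (y₃ ⊞ z₃)) ((x₃ ⊠ y₃) ⊞ (x₃ ⊠ z₃)) refl refl refl (a ∷ b ∷ c ∷ d ∷ e ∷ f ∷ g ∷ h ∷ i ∷ [])

  *-assoc : ∀ x y z → (x * y) * z ≡ x * (y * z)
  *-assoc ⟨ a , b , c ⟩ ⟨ d , e , f ⟩ ⟨ g , h , i ⟩ =
    components ((x₃ ⊠ y₃) ⊠ z₃) (x₃ ⊠ (y₃ ⊠ z₃)) refl refl refl (a ∷ b ∷ c ∷ d ∷ e ∷ f ∷ g ∷ h ∷ i ∷ [])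

  ι-+ : ∀ m n → ι (m ℤ.+ n) ≡ ι m + ι n
  ι-+ m n = refl

  ι-neg : ∀ m → ι (ℤ.- m) ≡ - ι m
  ι-neg m = refl

  ι-* : ∀ m n → ι (m ℤ.* n) ≡ ι m * ι n
  ι-* m n = components ⟪ v 0F ⊗ v 1F , # (ℤ.+ 0) , # (ℤ.+ 0) ⟫ (⟪ v 0F , # (ℤ.+ 0) , # (ℤ.+ 0) ⟫ ⊠ ⟪ v 1F , # (ℤ.+ 0) , # (ℤ.+ 0) ⟫)
    refl refl refl (m ∷ n ∷ m ∷ m ∷ m ∷ m ∷ m ∷ m ∷ m ∷ [])

𝒪-isCommutativeRing : IsCommutativeRing _≡_ _+_ _*_ (λ x → - x) 𝟘 𝟙
𝒪-isCommutativeRing = record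
  { isRing = record
    { +-isAbelianGroup = record
      { isGroup = record
        { isMonoid = record
          { isSemigroup = record
            { isMagma = record { isEquivalence = isEquivalence ; ∙-cong = cong₂ _+_ }
            ; assoc = +-assoc }
          ; identity = +-identityˡ , λ x → trans (+-comm x 𝟘) (+-identityˡ x) }
        ; inverse = +-inverseˡ , λ x → trans (+-comm x (- x)) (+-inverseˡ x)
        ; ⁻¹-cong = cong (λ x → - x) }
      ; comm = +-comm }
    ; *-cong = cong₂ _*_
    ; *-assoc = *-assoc
    ; *-identity = *-identityˡ , λ x → trans (*-comm x 𝟙) (*-identityˡ x)
    ; distrib = *-distribˡ-+ , λ x y z → trans (*-comm (y + z) x) (trans (*-distribˡ-+ x y z) (cong₂ _+_ (*-comm x y) (*-comm x z))) }
  ; *-comm = *-comm }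

𝒪-algebra : ℤ-Algebra
𝒪-algebra = record { isCommutativeRing = 𝒪-isCommutativeRing ; ι = ι ; ι-+ = ι-+ ; ι-* = ι-* ; ι-neg = ι-neg ; ι-0 = refl ; ι-1 = refl }

module 𝒪I = Identities 𝒪-algebra

-- norm and adjugate

infix 9 _♯

opaque
  N : 𝒪 → ℤ
  N ⟨ a , b , c ⟩ = a ℤ.* a ℤ.* a ℤ.+ b ℤ.* b ℤ.* b ℤ.+ c ℤ.* c ℤ.* c ℤ.+ ℤ.+ 3 ℤ.* (a ℤ.* a ℤ.* b) ℤ.- ℤ.+ 6 ℤ.* (b ℤ.* b ℤ.* c)
    ℤ.+ ℤ.+ 3 ℤ.* (a ℤ.* c ℤ.* c) ℤ.+ ℤ.+ 9 ℤ.* (b ℤ.* c ℤ.* c) ℤ.- ℤ.+ 3 ℤ.* (a ℤ.* b ℤ.* c)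

  -- The product x′x″ of the two other conjugates of x, which is N x / x and hence again has
  -- coordinates in ℤ.
  _♯ : 𝒪 → 𝒪
  ⟨ a , b , c ⟩ ♯ = ⟨ a ℤ.* a ℤ.+ ℤ.+ 3 ℤ.* (a ℤ.* b) ℤ.- b ℤ.* c , c ℤ.* c ℤ.- a ℤ.* b , b ℤ.* b ℤ.- ℤ.+ 3 ℤ.* (b ℤ.* c) ℤ.- a ℤ.* c ⟩

Nᴱ : ∀ {n} → 𝒪-Expr n → Expr n
Nᴱ ⟪ a , b , c ⟫ = a ⊗ a ⊗ a ⊕ b ⊗ b ⊗ b ⊕ c ⊗ c ⊗ c ⊕ # (ℤ.+ 3) ⊗ (a ⊗ a ⊗ b) ⊖ # (ℤ.+ 6) ⊗ (b ⊗ b ⊗ c)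
  ⊕ # (ℤ.+ 3) ⊗ (a ⊗ c ⊗ c) ⊕ # (ℤ.+ 9) ⊗ (b ⊗ c ⊗ c) ⊖ # (ℤ.+ 3) ⊗ (a ⊗ b ⊗ c)

_♯ᴱ : ∀ {n} → 𝒪-Expr n → 𝒪-Expr n
⟪ a , b , c ⟫ ♯ᴱ = ⟪ a ⊗ a ⊕ # (ℤ.+ 3) ⊗ (a ⊗ b) ⊖ b ⊗ c , c ⊗ c ⊖ a ⊗ b , b ⊗ b ⊖ # (ℤ.+ 3) ⊗ (b ⊗ c) ⊖ a ⊗ c ⟫

opaque
  unfolding _+_ -_ _*_ N _♯

  *♯ : ∀ x → x * x ♯ ≡ ι (N x)
  *♯ ⟨ a , b , c ⟩ = components (x₃ ⊠ (x₃ ♯ᴱ)) ⟪ Nᴱ x₃ , # (ℤ.+ 0) , # (ℤ.+ 0) ⟫ refl refl refl (a ∷ b ∷ c ∷ a ∷ b ∷ c ∷ a ∷ b ∷ c ∷ [])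

  N-* : ∀ x y → N (x * y) ≡ N x ℤ.* N y
  N-* ⟨ a , b , c ⟩ ⟨ d , e , f ⟩ = ℤI.identity (Nᴱ (x₃ ⊠ y₃)) (Nᴱ x₃ ⊗ Nᴱ y₃) refl (a ∷ b ∷ c ∷ d ∷ e ∷ f ∷ a ∷ b ∷ c ∷ [])

  ♯-* : ∀ x y → (x * y) ♯ ≡ x ♯ * y ♯
  ♯-* ⟨ a , b , c ⟩ ⟨ d , e , f ⟩ = components ((x₃ ⊠ y₃) ♯ᴱ) ((x₃ ♯ᴱ) ⊠ (y₃ ♯ᴱ)) refl refl refl (a ∷ b ∷ c ∷ d ∷ e ∷ f ∷ a ∷ b ∷ c ∷ [])

opaque
  unfolding N
  N-ι : ∀ n → N (ι n) ≡ n ℤ.* n ℤ.* n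
  N-ι n = ℤI.identity (Nᴱ ⟪ v 0F , # (ℤ.+ 0) , # (ℤ.+ 0) ⟫) (v 0F ⊗ v 0F ⊗ v 0F) refl (n ∷ [])

-- congruences

infix 4 _≈_[_] _∣𝒪_

_∣𝒪_ : 𝒪 → 𝒪 → Set
x ∣𝒪 y = ∃ λ z → y ≡ x * z

record _≈_[_] (x y m : 𝒪) : Set where
  constructor by
  field
    quot : 𝒪
    quot-eq : x ≡ y + m * quot
open _≈_[_] public

≈-refl′ : ∀ x m → x ≡ x + m * ι (ℤ.+ 0)
≈-refl′ x m = 𝒪I.identity (v 0F) (v 0F ⊕ v 1F ⊗ # (ℤ.+ 0)) refl (x ∷ m ∷ [])
≈-sym′ : ∀ x y m k → x ≡ y + m * k → y ≡ x + m * (ι (ℤ.+ 0) - k)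
≈-sym′ x y m k h₁ = trans (𝒪I.identity (v 1F) (v 0F ⊕ v 2F ⊗ (# (ℤ.+ 0) ⊖ v 3F) ⊕ (# (ℤ.+ 0) ⊖ # (ℤ.+ 1)) ⊗ (v 0F ⊖ (v 1F ⊕ v 2F ⊗ v 3F))) refl (x ∷ y ∷ m ∷ k ∷ [])) (𝒪I.vanish h₁)
≈-trans′ : ∀ x y z m k l → x ≡ y + m * k → y ≡ z + m * l → x ≡ z + m * (k + l)
≈-trans′ x y z m k l h₁ h₂ = trans (𝒪I.identity (v 0F) (v 2F ⊕ v 3F ⊗ (v 4F ⊕ v 5F) ⊕ # (ℤ.+ 1) ⊗ (v 0F ⊖ (v 1F ⊕ v 3F ⊗ v 4F)) ⊕ # (ℤ.+ 1) ⊗ (v 1F ⊖ (v 2F ⊕ v 3F ⊗ v 5F))) refl (x ∷ y ∷ z ∷ m ∷ k ∷ l ∷ [])) (trans (𝒪I.vanish h₂) (𝒪I.vanish h₁))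
≈-+′ : ∀ x y x′ y′ m k l → x ≡ x′ + m * k → y ≡ y′ + m * l → x + y ≡ x′ + y′ + m * (k + l)
≈-+′ x y x′ y′ m k l h₁ h₂ = trans (𝒪I.identity (v 0F ⊕ v 1F) (v 2F ⊕ v 3F ⊕ v 4F ⊗ (v 5F ⊕ v 6F) ⊕ # (ℤ.+ 1) ⊗ (v 0F ⊖ (v 2F ⊕ v 4F ⊗ v 5F)) ⊕ # (ℤ.+ 1) ⊗ (v 1F ⊖ (v 3F ⊕ v 4F ⊗ v 6F))) refl (x ∷ y ∷ x′ ∷ y′ ∷ m ∷ k ∷ l ∷ [])) (trans (𝒪I.vanish h₂) (𝒪I.vanish h₁))
≈-∸′ : ∀ x y x′ y′ m k l → x ≡ x′ + m * k → y ≡ y′ + m * l → x - y ≡ x′ - y′ + m * (k - l)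
≈-∸′ x y x′ y′ m k l h₁ h₂ = trans (𝒪I.identity (v 0F ⊖ v 1F) (v 2F ⊖ v 3F ⊕ v 4F ⊗ (v 5F ⊖ v 6F) ⊕ # (ℤ.+ 1) ⊗ (v 0F ⊖ (v 2F ⊕ v 4F ⊗ v 5F)) ⊕ (# (ℤ.+ 0) ⊖ # (ℤ.+ 1)) ⊗ (v 1F ⊖ (v 3F ⊕ v 4F ⊗ v 6F))) refl (x ∷ y ∷ x′ ∷ y′ ∷ m ∷ k ∷ l ∷ [])) (trans (𝒪I.vanish h₂) (𝒪I.vanish h₁))
≈-*′ : ∀ x y x′ y′ m k l → x ≡ x′ + m * k → y ≡ y′ + m * l → x * y ≡ x′ * y′ + m * (k * y + x′ * l)
≈-*′ x y x′ y′ m k l h₁ h₂ = trans (𝒪I.identity (v 0F ⊗ v 1F) (v 2F ⊗ v 3F ⊕ v 4F ⊗ (v 5F ⊗ v 1F ⊕ v 2F ⊗ v 6F) ⊕ v 1F ⊗ (v 0F ⊖ (v 2F ⊕ v 4F ⊗ v 5F)) ⊕ v 2F ⊗ (v 1F ⊖ (v 3F ⊕ v 4F ⊗ v 6F))) refl (x ∷ y ∷ x′ ∷ y′ ∷ m ∷ k ∷ l ∷ [])) (trans (𝒪I.vanish h₂) (𝒪I.vanish h₁))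

≈-refl : ∀ {x m} → x ≈ x [ m ]
≈-refl {x} {m} = by 𝟘 (≈-refl′ x m)

≡⇒≈ : ∀ {x y m} → x ≡ y → x ≈ y [ m ]
≡⇒≈ refl = ≈-refl

≈-sym : ∀ {x y m} → x ≈ y [ m ] → y ≈ x [ m ]
≈-sym {x} {y} {m} (by k e) = by _ (≈-sym′ x y m k e)

≈-trans : ∀ {x y z m} → x ≈ y [ m ] → y ≈ z [ m ] → x ≈ z [ m ]
≈-trans {x} {y} {z} {m} (by k e) (by l f) = by _ (≈-trans′ x y z m k l e f)

≈-+ : ∀ {x y x′ y′ m} → x ≈ x′ [ m ] → y ≈ y′ [ m ] → x + y ≈ x′ + y′ [ m ]
≈-+ {x} {y} {x′} {y′} {m} (by k e) (by l f) = by _ (≈-+′ x y x′ y′ m k l e f)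

≈-- : ∀ {x y x′ y′ m} → x ≈ x′ [ m ] → y ≈ y′ [ m ] → x - y ≈ x′ - y′ [ m ]
≈-- {x} {y} {x′} {y′} {m} (by k e) (by l f) = by _ (≈-∸′ x y x′ y′ m k l e f)

≈-* : ∀ {x y x′ y′ m} → x ≈ x′ [ m ] → y ≈ y′ [ m ] → x * y ≈ x′ * y′ [ m ]
≈-* {x} {y} {x′} {y′} {m} (by k e) (by l f) = by _ (≈-*′ x y x′ y′ m k l e f)

-- exhaustive checks over residues

allUpTo : ℕ → (ℕ → Bool) → Bool
allUpTo zero p = true
allUpTo (suc n) p = p n ∧ allUpTo n p

∧-split : ∀ a b → a ∧ b ≡ true → a ≡ true × b ≡ true
∧-split true b e = refl , e

allUpTo-sound : ∀ n p → allUpTo n p ≡ true → ∀ {i} → i ℕ.< n → p i ≡ true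
allUpTo-sound (suc n) p e {i} i<1+n with ∧-split (p n) (allUpTo n p) e | i ℕ.≟ n
... | q , r | yes refl = q
... | q , r | no i≢n = allUpTo-sound n p r (ℕₚ.≤∧≢⇒< (ℕₚ.≤-pred i<1+n) i≢n)

all𝒪 : ℕ → (𝒪 → Bool) → Bool
all𝒪 n p = allUpTo n λ i → allUpTo n λ j → allUpTo n λ k → p ⟨ ℤ.+ i , ℤ.+ j , ℤ.+ k ⟩

opaque
  unfolding _+_ -_ _*_

  ι-scale : ∀ n a b c → ι n * ⟨ a , b , c ⟩ ≡ ⟨ n ℤ.* a , n ℤ.* b , n ℤ.* c ⟩
  ι-scale n a b c = components (⟪ v 3F , # (ℤ.+ 0) , # (ℤ.+ 0) ⟫ ⊠ x₃) ⟪ v 3F ⊗ v 0F , v 3F ⊗ v 1F , v 3F ⊗ v 2F ⟫ refl refl refl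
    (a ∷ b ∷ c ∷ n ∷ n ∷ n ∷ n ∷ n ∷ n ∷ [])

  residue : ∀ n .{{_ : ℕ.NonZero n}} x → ∃ λ i → ∃ λ j → ∃ λ k → i ℕ.< n × j ℕ.< n × k ℕ.< n × x ≈ ⟨ ℤ.+ i , ℤ.+ j , ℤ.+ k ⟩ [ ι (ℤ.+ n) ]
  residue n ⟨ a , b , c ⟩ = _ , _ , _ , ℤD.n%ℕd<d a n , ℤD.n%ℕd<d b n , ℤD.n%ℕd<d c n ,
    by ⟨ a ℤD./ℕ n , b ℤD./ℕ n , c ℤD./ℕ n ⟩ (trans (≡𝒪 (component a) (component b) (component c))
      (cong (λ w → ⟨ ℤ.+ (a ℤD.%ℕ n) , ℤ.+ (b ℤD.%ℕ n) , ℤ.+ (c ℤD.%ℕ n) ⟩ + w) (sym (ι-scale (ℤ.+ n) (a ℤD./ℕ n) (b ℤD./ℕ n) (c ℤD./ℕ n)))))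
    where
    component : ∀ a → a ≡ ℤ.+ (a ℤD.%ℕ n) ℤ.+ ℤ.+ n ℤ.* (a ℤD./ℕ n)
    component a = trans (ℤD.a≡a%ℕn+[a/ℕn]*n a n) (cong (λ w → ℤ.+ (a ℤD.%ℕ n) ℤ.+ w) (ℤₚ.*-comm (a ℤD./ℕ n) (ℤ.+ n)))

all𝒪-sound : ∀ n .{{_ : ℕ.NonZero n}} p → all𝒪 n p ≡ true → ∀ x → ∃ λ r → x ≈ r [ ι (ℤ.+ n) ] × p r ≡ true
all𝒪-sound n p e x with residue n x
... | i , j , k , i< , j< , k< , x≈r = _ , x≈r ,
  allUpTo-sound n _ (allUpTo-sound n _ (allUpTo-sound n _ e i<) j<) k<

-- decidable divisibility by an integer

opaque
  zero%? : ℤ → (n : ℕ) → .{{_ : ℕ.NonZero n}} → Bool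
  zero%? a n = ∣ a ∣ ℕ.% n ℕ.≡ᵇ 0

T⇒≡true : ∀ {b} → T b → b ≡ true
T⇒≡true {true} _ = refl

≡true⇒T : ∀ {b} → b ≡ true → T b
≡true⇒T refl = _

opaque
  unfolding zero%?

  zero%?-complete : ∀ n .{{_ : ℕ.NonZero n}} k → zero%? (ℤ.+ n ℤ.* k) n ≡ true
  zero%?-complete n k = T⇒≡true (ℕₚ.≡⇒≡ᵇ _ _ (trans (cong (ℕ._% n) (trans (ℤₚ.abs-* (ℤ.+ n) k) (ℕₚ.*-comm n ∣ k ∣))) (ℕD.m*n%n≡0 ∣ k ∣ n)))

  zero%?-sound : ∀ n .{{_ : ℕ.NonZero n}} a → zero%? a n ≡ true → ∃ λ k → a ≡ ℤ.+ n ℤ.* k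
  zero%?-sound n a e with ℤS.∣ᵤ⇒∣ {ℤ.+ n} {a} (ℕV.m%n≡0⇒n∣m ∣ a ∣ n (ℕₚ.≡ᵇ⇒≡ _ _ (≡true⇒T e)))
  ... | ℤS.divides k a≡k*n = k , trans a≡k*n (ℤₚ.*-comm k (ℤ.+ n))

opaque
  div? : (n : ℕ) → .{{_ : ℕ.NonZero n}} → 𝒪 → Bool
  div? n ⟨ a , b , c ⟩ = zero%? a n ∧ (zero%? b n ∧ zero%? c n)

opaque
  unfolding div?

  div?-complete : ∀ n .{{_ : ℕ.NonZero n}} {x} → ι (ℤ.+ n) ∣𝒪 x → div? n x ≡ true
  div?-complete n (⟨ a , b , c ⟩ , refl) rewrite ι-scale (ℤ.+ n) a b c
    | zero%?-complete n a | zero%?-complete n b | zero%?-complete n c = refl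

  div?-sound : ∀ n .{{_ : ℕ.NonZero n}} x → div? n x ≡ true → ι (ℤ.+ n) ∣𝒪 x
  div?-sound n ⟨ a , b , c ⟩ e with ∧-split (zero%? a n) _ e
  ... | e₁ , e′ with ∧-split (zero%? b n) _ e′
  ... | e₂ , e₃ with zero%?-sound n a e₁ | zero%?-sound n b e₂ | zero%?-sound n c e₃
  ... | i , refl | j , refl | k , refl = ⟨ i , j , k ⟩ , sym (ι-scale (ℤ.+ n) i j k)

∣⇒≈0′ : ∀ x m k → x ≡ m * k → x ≡ ι (ℤ.+ 0) + m * k
∣⇒≈0′ x m k h₁ = trans (𝒪I.identity (v 0F) (# (ℤ.+ 0) ⊕ v 1F ⊗ v 2F ⊕ # (ℤ.+ 1) ⊗ (v 0F ⊖ v 1F ⊗ v 2F)) refl (x ∷ m ∷ k ∷ [])) (𝒪I.vanish h₁)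
∣⇒≈0 : ∀ {x m} → m ∣𝒪 x → x ≈ 𝟘 [ m ]
∣⇒≈0 {x} {m} (k , e) = by k (∣⇒≈0′ x m k e)

≈0⇒∣′ : ∀ x m k → x ≡ ι (ℤ.+ 0) + m * k → x ≡ m * k
≈0⇒∣′ x m k h₁ = trans (𝒪I.identity (v 0F) (v 1F ⊗ v 2F ⊕ # (ℤ.+ 1) ⊗ (v 0F ⊖ (# (ℤ.+ 0) ⊕ v 1F ⊗ v 2F))) refl (x ∷ m ∷ k ∷ [])) (𝒪I.vanish h₁)
≈0⇒∣ : ∀ {x m} → x ≈ 𝟘 [ m ] → m ∣𝒪 x
≈0⇒∣ {x} {m} (by k e) = k , ≈0⇒∣′ x m k e

≈⇒∣-′ : ∀ x y m k → x ≡ y + m * k → x - y ≡ m * k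
≈⇒∣-′ x y m k h₁ = trans (𝒪I.identity (v 0F ⊖ v 1F) (v 2F ⊗ v 3F ⊕ # (ℤ.+ 1) ⊗ (v 0F ⊖ (v 1F ⊕ v 2F ⊗ v 3F))) refl (x ∷ y ∷ m ∷ k ∷ [])) (𝒪I.vanish h₁)
≈⇒∣- : ∀ {x y m} → x ≈ y [ m ] → m ∣𝒪 (x - y)
≈⇒∣- {x} {y} {m} (by k e) = k , ≈⇒∣-′ x y m k e

∣-⇒≈′ : ∀ x y m k → x - y ≡ m * k → x ≡ y + m * k
∣-⇒≈′ x y m k h₁ = trans (𝒪I.identity (v 0F) (v 1F ⊕ v 2F ⊗ v 3F ⊕ # (ℤ.+ 1) ⊗ (v 0F ⊖ v 1F ⊖ v 2F ⊗ v 3F)) refl (x ∷ y ∷ m ∷ k ∷ [])) (𝒪I.vanish h₁)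
∣-⇒≈ : ∀ {x y m} → m ∣𝒪 (x - y) → x ≈ y [ m ]
∣-⇒≈ {x} {y} {m} (k , e) = by k (∣-⇒≈′ x y m k e)

∣-resp-≈ : ∀ {x y m} → x ≈ y [ m ] → m ∣𝒪 x → m ∣𝒪 y
∣-resp-≈ p q = ≈0⇒∣ (≈-trans (≈-sym p) (∣⇒≈0 q))

-- the norm modulo n and the absence of zero divisors

opaque
  -- The polarisation x′y″ + x″y′ of `_♯`. In particular `Tr⟨ 𝟙 , x ⟩` is x′ + x″, the trace of x
  -- minus x.
  Tr⟨_,_⟩ : 𝒪 → 𝒪 → 𝒪
  Tr⟨ ⟨ a , b , c ⟩ , ⟨ d , e , f ⟩ ⟩ =
    ⟨ ℤ.+ 2 ℤ.* (a ℤ.* d) ℤ.+ ℤ.+ 3 ℤ.* (a ℤ.* e ℤ.+ b ℤ.* d) ℤ.- (b ℤ.* f ℤ.+ c ℤ.* e)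
    , ℤ.+ 2 ℤ.* (c ℤ.* f) ℤ.- (a ℤ.* e ℤ.+ b ℤ.* d)
    , ℤ.+ 2 ℤ.* (b ℤ.* e) ℤ.- ℤ.+ 3 ℤ.* (b ℤ.* f ℤ.+ c ℤ.* e) ℤ.- (a ℤ.* f ℤ.+ c ℤ.* d) ⟩

Trᴱ : ∀ {n} → 𝒪-Expr n → 𝒪-Expr n → 𝒪-Expr n
Trᴱ ⟪ a , b , c ⟫ ⟪ d , e , f ⟫ =
  ⟪ # (ℤ.+ 2) ⊗ (a ⊗ d) ⊕ # (ℤ.+ 3) ⊗ (a ⊗ e ⊕ b ⊗ d) ⊖ (b ⊗ f ⊕ c ⊗ e)
  , # (ℤ.+ 2) ⊗ (c ⊗ f) ⊖ (a ⊗ e ⊕ b ⊗ d)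
  , # (ℤ.+ 2) ⊗ (b ⊗ e) ⊖ # (ℤ.+ 3) ⊗ (b ⊗ f ⊕ c ⊗ e) ⊖ (a ⊗ f ⊕ c ⊗ d) ⟫

opaque
  unfolding _+_ -_ _*_ _♯ Tr⟨_,_⟩

  ♯-+ : ∀ x y → (x + y) ♯ ≡ x ♯ + Tr⟨ x , y ⟩ + y ♯
  ♯-+ ⟨ a , b , c ⟩ ⟨ d , e , f ⟩ = components ((x₃ ⊞ y₃) ♯ᴱ) (((x₃ ♯ᴱ) ⊞ Trᴱ x₃ y₃) ⊞ (y₃ ♯ᴱ)) refl refl refl (a ∷ b ∷ c ∷ d ∷ e ∷ f ∷ a ∷ b ∷ c ∷ [])

  Tr-+ : ∀ x y z → Tr⟨ x , y + z ⟩ ≡ Tr⟨ x , y ⟩ + Tr⟨ x , z ⟩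
  Tr-+ ⟨ a , b , c ⟩ ⟨ d , e , f ⟩ ⟨ g , h , i ⟩ = components (Trᴱ x₃ (y₃ ⊞ z₃)) (Trᴱ x₃ y₃ ⊞ Trᴱ x₃ z₃) refl refl refl
    (a ∷ b ∷ c ∷ d ∷ e ∷ f ∷ g ∷ h ∷ i ∷ [])

  Tr-comm : ∀ x y → Tr⟨ x , y ⟩ ≡ Tr⟨ y , x ⟩
  Tr-comm ⟨ a , b , c ⟩ ⟨ d , e , f ⟩ = components (Trᴱ x₃ y₃) (Trᴱ y₃ x₃) refl refl refl (a ∷ b ∷ c ∷ d ∷ e ∷ f ∷ a ∷ b ∷ c ∷ [])

  Tr-self : ∀ x → Tr⟨ x , x ⟩ ≡ ι (ℤ.+ 2) * x ♯
  Tr-self ⟨ a , b , c ⟩ = components (Trᴱ x₃ x₃) (⟪ # (ℤ.+ 2) , # (ℤ.+ 0) , # (ℤ.+ 0) ⟫ ⊠ (x₃ ♯ᴱ)) refl refl refl (a ∷ b ∷ c ∷ a ∷ b ∷ c ∷ a ∷ b ∷ c ∷ [])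

  Tr-ι* : ∀ n x y → Tr⟨ x , ι n * y ⟩ ≡ ι n * Tr⟨ x , y ⟩
  Tr-ι* n ⟨ a , b , c ⟩ ⟨ d , e , f ⟩ = components (Trᴱ x₃ (⟪ v 6F , # (ℤ.+ 0) , # (ℤ.+ 0) ⟫ ⊠ y₃)) (⟪ v 6F , # (ℤ.+ 0) , # (ℤ.+ 0) ⟫ ⊠ Trᴱ x₃ y₃) refl refl refl
    (a ∷ b ∷ c ∷ d ∷ e ∷ f ∷ n ∷ n ∷ n ∷ [])

  ♯-ι* : ∀ n x → (ι n * x) ♯ ≡ ι n * (ι n * x ♯)
  ♯-ι* n ⟨ a , b , c ⟩ = components ((⟪ v 3F , # (ℤ.+ 0) , # (ℤ.+ 0) ⟫ ⊠ x₃) ♯ᴱ) (⟪ v 3F , # (ℤ.+ 0) , # (ℤ.+ 0) ⟫ ⊠ (⟪ v 3F , # (ℤ.+ 0) , # (ℤ.+ 0) ⟫ ⊠ (x₃ ♯ᴱ))) refl refl refl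
    (a ∷ b ∷ c ∷ n ∷ n ∷ n ∷ n ∷ n ∷ n ∷ [])

♯-≈′ : ∀ x t n s → x + n * t + n * (n * s) ≡ x + n * (t + n * s)
♯-≈′ x t n s = 𝒪I.identity (v 0F ⊕ v 2F ⊗ v 1F ⊕ v 2F ⊗ (v 2F ⊗ v 3F)) (v 0F ⊕ v 2F ⊗ (v 1F ⊕ v 2F ⊗ v 3F)) refl (x ∷ t ∷ n ∷ s ∷ [])

♯-≈ : ∀ {x y n} → x ≈ y [ ι n ] → x ♯ ≈ y ♯ [ ι n ]
♯-≈ {x} {y} {n} (by k refl) = by _ (trans (♯-+ y (ι n * k)) (trans (cong₂ (λ s t → y ♯ + s + t) (Tr-ι* n y k) (♯-ι* n k)) (♯-≈′ (y ♯) Tr⟨ y , k ⟩ (ι n) (k ♯))))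

ι-≈ : ∀ {a b} n → ι a ≈ ι b [ ι n ] → ∃ λ k → a ≡ b ℤ.+ n ℤ.* k
ι-≈ {a} {b} n (by ⟨ i , j , k ⟩ e) = i , cong c₁ (trans e (trans (cong (λ w → ι b + w) (ι-scale n i j k)) (first b n i j k)))
  where
  opaque
    unfolding _+_
    first : ∀ b n i j k → ι b + ⟨ n ℤ.* i , n ℤ.* j , n ℤ.* k ⟩ ≡ ⟨ b ℤ.+ n ℤ.* i , ℤ.+ 0 ℤ.+ n ℤ.* j , ℤ.+ 0 ℤ.+ n ℤ.* k ⟩
    first b n i j k = refl

N-≈ : ∀ {x y n} → x ≈ y [ ι n ] → ∃ λ k → N x ≡ N y ℤ.+ n ℤ.* k
N-≈ {x} {y} {n} p = ι-≈ n (≈-trans (≡⇒≈ (sym (*♯ x))) (≈-trans (≈-* p (♯-≈ p)) (≡⇒≈ (*♯ y))))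

odd-norm? : 𝒪 → Bool
odd-norm? r = div? 2 r ∨ not (zero%? (N r) 2)

opaque
  unfolding N div? zero%?
  odd-norm-check : all𝒪 2 odd-norm? ≡ true
  odd-norm-check = refl

sub-mod : ∀ a b n k m → a ≡ b ℤ.+ n ℤ.* k → a ≡ n ℤ.* m → b ≡ n ℤ.* (m ℤ.- k)
sub-mod a b n k m h₁ h₂ = trans (ℤI.identity (v 1F) (v 2F ⊗ (v 4F ⊖ v 3F) ⊕ (# (ℤ.+ 0) ⊖ # (ℤ.+ 1)) ⊗ (v 0F ⊖ (v 1F ⊕ v 2F ⊗ v 3F)) ⊕ # (ℤ.+ 1) ⊗ (v 0F ⊖ v 2F ⊗ v 4F)) refl (a ∷ b ∷ n ∷ k ∷ m ∷ [])) (trans (ℤI.vanish {n ℤ.* (m ℤ.- k) ℤ.+ (ℤ.+ 0 ℤ.- ℤ.+ 1) ℤ.* (a ℤ.- (b ℤ.+ n ℤ.* k))} {ℤ.+ 1} h₂) (ℤI.vanish {n ℤ.* (m ℤ.- k)} {ℤ.+ 0 ℤ.- ℤ.+ 1} h₁))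

-- The prime 2 is inert: on the eight residues modulo 2 the norm form is even only at zero.
2∣N⇒2∣ : ∀ x m → N x ≡ ℤ.+ 2 ℤ.* m → ι (ℤ.+ 2) ∣𝒪 x
2∣N⇒2∣ x m e = go (all𝒪-sound 2 odd-norm? odd-norm-check x)
  where
  disj : ∀ a {b} → a ∨ not b ≡ true → b ≡ true → a ≡ true
  disj true _ _ = refl
  disj false {true} () _
  even : ∀ r → (∃ λ k → N x ≡ N r ℤ.+ ℤ.+ 2 ℤ.* k) → zero%? (N r) 2 ≡ true
  even r (k , Nx) = subst (λ w → zero%? w 2 ≡ true) (sym (sub-mod (N x) (N r) (ℤ.+ 2) k m Nx e)) (zero%?-complete 2 (m ℤ.- k))
  go : (∃ λ r → x ≈ r [ ι (ℤ.+ 2) ] × odd-norm? r ≡ true) → ι (ℤ.+ 2) ∣𝒪 x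
  go (r , x≈r , q) = ∣-resp-≈ (≈-sym x≈r) (div?-sound 2 r (disj (div? 2 r) q (even r (N-≈ x≈r))))

size : 𝒪 → ℕ
size ⟨ a , b , c ⟩ = ∣ a ∣ ℕ.+ ∣ b ∣ ℕ.+ ∣ c ∣

size-ι* : ∀ n x → size (ι n * x) ≡ ∣ n ∣ ℕ.* size x
size-ι* n ⟨ a , b , c ⟩ rewrite ι-scale n a b c | ℤₚ.abs-* n a | ℤₚ.abs-* n b | ℤₚ.abs-* n c =
  trans (cong (ℕ._+ ∣ n ∣ ℕ.* ∣ c ∣) (sym (ℕₚ.*-distribˡ-+ (∣ n ∣) (∣ a ∣) (∣ b ∣)))) (sym (ℕₚ.*-distribˡ-+ (∣ n ∣) (∣ a ∣ ℕ.+ ∣ b ∣) (∣ c ∣)))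

size≡0 : ∀ x → size x ≡ 0 → x ≡ 𝟘
size≡0 ⟨ a , b , c ⟩ e = ≡𝒪 (ℤₚ.∣i∣≡0⇒i≡0 (ℕₚ.m+n≡0⇒m≡0 (∣ a ∣) (ℕₚ.m+n≡0⇒m≡0 (∣ a ∣ ℕ.+ ∣ b ∣) e)))
  (ℤₚ.∣i∣≡0⇒i≡0 (ℕₚ.m+n≡0⇒n≡0 (∣ a ∣) (ℕₚ.m+n≡0⇒m≡0 (∣ a ∣ ℕ.+ ∣ b ∣) e))) (ℤₚ.∣i∣≡0⇒i≡0 (ℕₚ.m+n≡0⇒n≡0 (∣ a ∣ ℕ.+ ∣ b ∣) e))

half-norm : ∀ y → N (ι (ℤ.+ 2) * y) ≡ ℤ.+ 0 → N y ≡ ℤ.+ 0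
half-norm y e with ℤₚ.i*j≡0⇒i≡0∨j≡0 (N (ι (ℤ.+ 2))) (trans (sym (N-* (ι (ℤ.+ 2)) y)) e)
... | inj₂ p = p
... | inj₁ p with () ← trans (sym (N-ι (ℤ.+ 2))) p

half< : ∀ k j → suc k ≡ 2 ℕ.* j → j ℕ.< suc k
half< k (suc j) d = subst (suc j ℕ.<_) (sym d) (ℕₚ.m<m+n (suc j) ℕ.z<s)

2*0 : ∀ x → ι (ℤ.+ 2) * ι (ℤ.+ 0) ≡ ι (ℤ.+ 0)
2*0 x = 𝒪I.identity (# (ℤ.+ 2) ⊗ # (ℤ.+ 0)) (# (ℤ.+ 0)) refl (x ∷ [])

-- Infinite descent: a vanishing norm is even, so x is divisible by 2, and the half is smaller and
-- again has norm zero. This makes `𝒪` an integral domain without recourse to an embedding into a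
-- field.
N≡0⇒≡𝟘 : ∀ x → N x ≡ ℤ.+ 0 → x ≡ 𝟘
N≡0⇒≡𝟘 x = <-rec P step (size x) x refl
  where
  P : ℕ → Set
  P k = ∀ x → size x ≡ k → N x ≡ ℤ.+ 0 → x ≡ 𝟘
  halve : ∀ k → (∀ {j} → j ℕ.< suc k → P j) → ∀ x → size x ≡ suc k → N x ≡ ℤ.+ 0 → ι (ℤ.+ 2) ∣𝒪 x → x ≡ 𝟘
  halve k rec .(ι (ℤ.+ 2) * y) s e (y , refl) = trans (cong (λ w → ι (ℤ.+ 2) * w)
    (rec (half< k (size y) (trans (sym s) (size-ι* (ℤ.+ 2) y))) y refl (half-norm y e))) (2*0 𝟘)
  step : ∀ k → (∀ {j} → j ℕ.< k → P j) → P k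
  step zero _ x s _ = size≡0 x s
  step (suc k) rec x s e = halve k rec x s e (2∣N⇒2∣ x (ℤ.+ 0) e)

x*y≡𝟘 : ∀ {x y} → x * y ≡ 𝟘 → x ≡ 𝟘 ⊎ y ≡ 𝟘
x*y≡𝟘 {x} {y} e with ℤₚ.i*j≡0⇒i≡0∨j≡0 (N x) (trans (sym (N-* x y)) (trans (cong N e) (N-ι (ℤ.+ 0))))
... | inj₁ p = inj₁ (N≡0⇒≡𝟘 x p)
... | inj₂ p = inj₂ (N≡0⇒≡𝟘 y p)

cancel′ : ∀ x y z → x * y ≡ x * z → x * (y - z) ≡ ι (ℤ.+ 0)
cancel′ x y z h₁ = trans (𝒪I.identity (v 0F ⊗ (v 1F ⊖ v 2F)) (# (ℤ.+ 0) ⊕ # (ℤ.+ 1) ⊗ (v 0F ⊗ v 1F ⊖ v 0F ⊗ v 2F)) refl (x ∷ y ∷ z ∷ [])) (𝒪I.vanish h₁)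
-≡0′ : ∀ y z → y - z ≡ ι (ℤ.+ 0) → y ≡ z
-≡0′ y z h₁ = trans (𝒪I.identity (v 0F) (v 1F ⊕ # (ℤ.+ 1) ⊗ (v 0F ⊖ v 1F ⊖ # (ℤ.+ 0))) refl (y ∷ z ∷ [])) (𝒪I.vanish h₁)

*-cancelˡ : ∀ {x y z} → ¬ x ≡ 𝟘 → x * y ≡ x * z → y ≡ z
*-cancelˡ {x} {y} {z} x≢0 e with x*y≡𝟘 (cancel′ x y z e)
... | inj₁ x≡0 = ⊥-elim (x≢0 x≡0)
... | inj₂ d = -≡0′ y z d

-- bounds for linear combinations

-- An entry (c , m , k) stands for the summand c m, where ∣m∣ is at most k times a common bound.
comb : List (ℤ × ℤ × ℕ) → ℤ
comb [] = ℤ.+ 0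
comb ((c , m , k) ∷ l) = c ℤ.* m ℤ.+ comb l

weight : List (ℤ × ℤ × ℕ) → ℕ
weight [] = 0
weight ((c , m , k) ∷ l) = ∣ c ∣ ℕ.* k ℕ.+ weight l

Bounded : ℕ → ℤ × ℤ × ℕ → Set
Bounded M (c , m , k) = ∣ m ∣ ℕ.≤ k ℕ.* M

comb-bound : ∀ {M} l → All (Bounded M) l → ∣ comb l ∣ ℕ.≤ weight l ℕ.* M
comb-bound [] [] = ℕ.z≤n
comb-bound {M} ((c , m , k) ∷ l) (m≤ ∷ ps) = begin
  ∣ c ℤ.* m ℤ.+ comb l ∣ ≤⟨ ℤₚ.∣i+j∣≤∣i∣+∣j∣ (c ℤ.* m) (comb l) ⟩
  ∣ c ℤ.* m ∣ ℕ.+ ∣ comb l ∣ ≡⟨ cong (ℕ._+ ∣ comb l ∣) (ℤₚ.abs-* c m) ⟩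
  (∣ c ∣) ℕ.* (∣ m ∣) ℕ.+ ∣ comb l ∣ ≤⟨ ℕₚ.+-mono-≤ (ℕₚ.*-monoʳ-≤ (∣ c ∣) m≤) (comb-bound l ps) ⟩
  (∣ c ∣) ℕ.* (k ℕ.* M) ℕ.+ weight l ℕ.* M ≡⟨ cong (ℕ._+ weight l ℕ.* M) (sym (ℕₚ.*-assoc (∣ c ∣) k M)) ⟩
  ∣ c ∣ ℕ.* k ℕ.* M ℕ.+ weight l ℕ.* M ≡⟨ sym (ℕₚ.*-distribʳ-+ M (∣ c ∣ ℕ.* k) (weight l)) ⟩
  (∣ c ∣ ℕ.* k ℕ.+ weight l) ℕ.* M ∎
  where open ℕₚ.≤-Reasoning

∣*∣≤ : ∀ {a b A B} → ∣ a ∣ ℕ.≤ A → ∣ b ∣ ℕ.≤ B → ∣ a ℤ.* b ∣ ℕ.≤ A ℕ.* B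
∣*∣≤ {a} {b} p q = subst (ℕ._≤ _) (sym (ℤₚ.abs-* a b)) (ℕₚ.*-mono-≤ p q)

-- The Taylor expansion of the norm form at n (a , b , c) with increment (d , e , f), where the
-- components of the increment are bounded by p n, q n and r n.

higher : (p q r : ℕ) (n a b c d e f : ℤ) → List (ℤ × ℤ × ℕ)
higher p q r n a b c d e f =
    (ℤ.+ 3 ℤ.* (a ℤ.* a) ℤ.+ ℤ.+ 6 ℤ.* (a ℤ.* b) ℤ.+ ℤ.+ 3 ℤ.* (c ℤ.* c) ℤ.- ℤ.+ 3 ℤ.* (b ℤ.* c) , n ℤ.* n ℤ.* d , 1 ℕ.* 1 ℕ.* p)
  ∷ (ℤ.+ 3 ℤ.* (b ℤ.* b) ℤ.+ ℤ.+ 3 ℤ.* (a ℤ.* a) ℤ.- ℤ.+ 12 ℤ.* (b ℤ.* c) ℤ.+ ℤ.+ 9 ℤ.* (c ℤ.* c) ℤ.- ℤ.+ 3 ℤ.* (a ℤ.* c) , n ℤ.* n ℤ.* e , 1 ℕ.* 1 ℕ.* q)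
  ∷ (ℤ.+ 3 ℤ.* (c ℤ.* c) ℤ.- ℤ.+ 6 ℤ.* (b ℤ.* b) ℤ.+ ℤ.+ 6 ℤ.* (a ℤ.* c) ℤ.+ ℤ.+ 18 ℤ.* (b ℤ.* c) ℤ.- ℤ.+ 3 ℤ.* (a ℤ.* b) , n ℤ.* n ℤ.* f , 1 ℕ.* 1 ℕ.* r)
  ∷ (ℤ.+ 3 ℤ.* (a ℤ.+ b) , n ℤ.* d ℤ.* d , 1 ℕ.* p ℕ.* p) ∷ (ℤ.+ 3 ℤ.* (b ℤ.- ℤ.+ 2 ℤ.* c) , n ℤ.* e ℤ.* e , 1 ℕ.* q ℕ.* q)
  ∷ (ℤ.+ 3 ℤ.* (c ℤ.+ a ℤ.+ ℤ.+ 3 ℤ.* b) , n ℤ.* f ℤ.* f , 1 ℕ.* r ℕ.* r) ∷ (ℤ.+ 3 ℤ.* (ℤ.+ 2 ℤ.* a ℤ.- c) , n ℤ.* d ℤ.* e , 1 ℕ.* p ℕ.* q)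
  ∷ (ℤ.+ 3 ℤ.* (ℤ.+ 2 ℤ.* c ℤ.- b) , n ℤ.* d ℤ.* f , 1 ℕ.* p ℕ.* r) ∷ (ℤ.+ 3 ℤ.* (ℤ.+ 6 ℤ.* c ℤ.- ℤ.+ 4 ℤ.* b ℤ.- a) , n ℤ.* e ℤ.* f , 1 ℕ.* q ℕ.* r)
  ∷ (ℤ.+ 1 , d ℤ.* d ℤ.* d , p ℕ.* p ℕ.* p) ∷ (ℤ.+ 1 , e ℤ.* e ℤ.* e , q ℕ.* q ℕ.* q) ∷ (ℤ.+ 1 , f ℤ.* f ℤ.* f , r ℕ.* r ℕ.* r)
  ∷ (ℤ.+ 3 , d ℤ.* d ℤ.* e , p ℕ.* p ℕ.* q) ∷ (-[1+ 5 ] , e ℤ.* e ℤ.* f , q ℕ.* q ℕ.* r) ∷ (ℤ.+ 3 , d ℤ.* f ℤ.* f , p ℕ.* r ℕ.* r)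
  ∷ (ℤ.+ 9 , e ℤ.* f ℤ.* f , q ℕ.* r ℕ.* r) ∷ (-[1+ 2 ] , d ℤ.* e ℤ.* f , p ℕ.* q ℕ.* r) ∷ []

private
  combᴱ : ∀ {n} → List (Expr n × Expr n) → Expr n
  combᴱ [] = # (ℤ.+ 0)
  combᴱ ((c , m) ∷ l) = c ⊗ m ⊕ combᴱ l

opaque
  unfolding N
  N-taylor : ∀ p q r n a b c d e f → N ⟨ n ℤ.* a ℤ.+ d , n ℤ.* b ℤ.+ e , n ℤ.* c ℤ.+ f ⟩ ≡ N ⟨ a , b , c ⟩ ℤ.* (n ℤ.* n ℤ.* n) ℤ.+ comb (higher p q r n a b c d e f)
  N-taylor _ _ _ n a b c d e f = ℤI.identity (Nᴱ ⟪ n′ ⊗ a′ ⊕ d′ , n′ ⊗ b′ ⊕ e′ , n′ ⊗ c′ ⊕ f′ ⟫)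
    (Nᴱ ⟪ a′ , b′ , c′ ⟫ ⊗ (n′ ⊗ n′ ⊗ n′) ⊕ combᴱ ( (# (ℤ.+ 3) ⊗ (a′ ⊗ a′) ⊕ # (ℤ.+ 6) ⊗ (a′ ⊗ b′) ⊕ # (ℤ.+ 3) ⊗ (c′ ⊗ c′) ⊖ # (ℤ.+ 3) ⊗ (b′ ⊗ c′) , n′ ⊗ n′ ⊗ d′)
    ∷ (# (ℤ.+ 3) ⊗ (b′ ⊗ b′) ⊕ # (ℤ.+ 3) ⊗ (a′ ⊗ a′) ⊖ # (ℤ.+ 12) ⊗ (b′ ⊗ c′) ⊕ # (ℤ.+ 9) ⊗ (c′ ⊗ c′) ⊖ # (ℤ.+ 3) ⊗ (a′ ⊗ c′) , n′ ⊗ n′ ⊗ e′)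
    ∷ (# (ℤ.+ 3) ⊗ (c′ ⊗ c′) ⊖ # (ℤ.+ 6) ⊗ (b′ ⊗ b′) ⊕ # (ℤ.+ 6) ⊗ (a′ ⊗ c′) ⊕ # (ℤ.+ 18) ⊗ (b′ ⊗ c′) ⊖ # (ℤ.+ 3) ⊗ (a′ ⊗ b′) , n′ ⊗ n′ ⊗ f′)
    ∷ (# (ℤ.+ 3) ⊗ (a′ ⊕ b′) , n′ ⊗ d′ ⊗ d′) ∷ (# (ℤ.+ 3) ⊗ (b′ ⊖ # (ℤ.+ 2) ⊗ c′) , n′ ⊗ e′ ⊗ e′) ∷ (# (ℤ.+ 3) ⊗ (c′ ⊕ a′ ⊕ # (ℤ.+ 3) ⊗ b′) , n′ ⊗ f′ ⊗ f′)
    ∷ (# (ℤ.+ 3) ⊗ (# (ℤ.+ 2) ⊗ a′ ⊖ c′) , n′ ⊗ d′ ⊗ e′) ∷ (# (ℤ.+ 3) ⊗ (# (ℤ.+ 2) ⊗ c′ ⊖ b′) , n′ ⊗ d′ ⊗ f′) ∷ (# (ℤ.+ 3) ⊗ (# (ℤ.+ 6) ⊗ c′ ⊖ # (ℤ.+ 4) ⊗ b′ ⊖ a′) , n′ ⊗ e′ ⊗ f′)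
    ∷ (# (ℤ.+ 1) , d′ ⊗ d′ ⊗ d′) ∷ (# (ℤ.+ 1) , e′ ⊗ e′ ⊗ e′) ∷ (# (ℤ.+ 1) , f′ ⊗ f′ ⊗ f′) ∷ (# (ℤ.+ 3) , d′ ⊗ d′ ⊗ e′) ∷ (# -[1+ 5 ] , e′ ⊗ e′ ⊗ f′)
    ∷ (# (ℤ.+ 3) , d′ ⊗ f′ ⊗ f′) ∷ (# (ℤ.+ 9) , e′ ⊗ f′ ⊗ f′) ∷ (# -[1+ 2 ] , d′ ⊗ e′ ⊗ f′) ∷ []))
    refl (n ∷ a ∷ b ∷ c ∷ d ∷ e ∷ f ∷ [])
    where
    n′ a′ b′ c′ d′ e′ f′ : Expr 7
    n′ = v 0F
    a′ = v 1F
    b′ = v 2F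
    c′ = v 3F
    d′ = v 4F
    e′ = v 5F
    f′ = v 6F

higher-weight : (p q r : ℕ) (a b c : ℤ) → ℕ
higher-weight p q r a b c = weight (higher p q r (ℤ.+ 0) a b c (ℤ.+ 0) (ℤ.+ 0) (ℤ.+ 0))

higher-bound : ∀ p q r n a b c d e f → ∣ d ∣ ℕ.≤ p ℕ.* n → ∣ e ∣ ℕ.≤ q ℕ.* n → ∣ f ∣ ℕ.≤ r ℕ.* n →
  ∣ comb (higher p q r (ℤ.+ n) a b c d e f) ∣ ℕ.≤ higher-weight p q r a b c ℕ.* (n ℕ.* n ℕ.* n)
higher-bound p q r n a b c d e f d≤ e≤ f≤ = comb-bound (higher p q r (ℤ.+ n) a b c d e f)
  (b₃ O O D ∷ b₃ O O E ∷ b₃ O O F ∷ b₃ O D D ∷ b₃ O E E ∷ b₃ O F F ∷ b₃ O D E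
  ∷ b₃ O D F ∷ b₃ O E F ∷ b₃ D D D ∷ b₃ E E E ∷ b₃ F F F ∷ b₃ D D E
  ∷ b₃ E E F ∷ b₃ D F F ∷ b₃ E F F ∷ b₃ D E F ∷ [])
  where
  Term : Set
  Term = ∃ λ k → ∃ λ x → ∣ x ∣ ℕ.≤ k ℕ.* n
  O D E F : Term
  O = 1 , ℤ.+ n , ℕₚ.≤-reflexive (sym (ℕₚ.*-identityˡ n))
  D = p , d , d≤
  E = q , e , e≤
  F = r , f , f≤
  b₃ : ((i , x , _) (j , y , _) (k , z , _) : Term) → ∣ x ℤ.* y ℤ.* z ∣ ℕ.≤ i ℕ.* j ℕ.* k ℕ.* (n ℕ.* n ℕ.* n)
  b₃ (i , x , s) (j , y , t) (k , z , u) = ℕₚ.≤-trans (∣*∣≤ {x ℤ.* y} {z} (∣*∣≤ {x} {y} s t) u)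
    (ℕₚ.≤-reflexive (trans (cong (ℕ._* (k ℕ.* n)) (ℕₚ.[m*n]*[o*p]≡[m*o]*[n*p] i n j n)) (ℕₚ.[m*n]*[o*p]≡[m*o]*[n*p] (i ℕ.* j) (n ℕ.* n) k n)))

-- Euclidean division for the norm.

cell-weight : (a b c : ℤ) → ℕ
cell-weight a b c = ∣ N ⟨ a , b , c ⟩ ∣ ℕ.+ higher-weight 1 1 1 a b c

∣n³∣ : ∀ n → ∣ ℤ.+ n ℤ.* ℤ.+ n ℤ.* ℤ.+ n ∣ ≡ n ℕ.* n ℕ.* n
∣n³∣ n = trans (ℤₚ.abs-* (ℤ.+ n ℤ.* ℤ.+ n) (ℤ.+ n)) (cong (ℕ._* n) (ℤₚ.abs-* (ℤ.+ n) (ℤ.+ n)))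

N-bound : ∀ n a b c d e f → ∣ d ∣ ℕ.≤ n → ∣ e ∣ ℕ.≤ n → ∣ f ∣ ℕ.≤ n →
  ∣ N ⟨ ℤ.+ n ℤ.* a ℤ.+ d , ℤ.+ n ℤ.* b ℤ.+ e , ℤ.+ n ℤ.* c ℤ.+ f ⟩ ∣ ℕ.≤ cell-weight a b c ℕ.* (n ℕ.* n ℕ.* n)
N-bound n a b c d e f d≤ e≤ f≤ = begin
  ∣ N ⟨ ℤ.+ n ℤ.* a ℤ.+ d , ℤ.+ n ℤ.* b ℤ.+ e , ℤ.+ n ℤ.* c ℤ.+ f ⟩ ∣ ≡⟨ cong ∣_∣ (N-taylor 1 1 1 (ℤ.+ n) a b c d e f) ⟩
  ∣ X ℤ.+ Y ∣ ≤⟨ ℤₚ.∣i+j∣≤∣i∣+∣j∣ X Y ⟩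
  ∣ X ∣ ℕ.+ ∣ Y ∣ ≤⟨ ℕₚ.+-mono-≤ (ℕₚ.≤-reflexive (trans (ℤₚ.abs-* (N ⟨ a , b , c ⟩) _) (cong (∣ N ⟨ a , b , c ⟩ ∣ ℕ.*_) (∣n³∣ n))))
      (higher-bound 1 1 1 n a b c d e f (1* d d≤) (1* e e≤) (1* f f≤)) ⟩
  ∣ N ⟨ a , b , c ⟩ ∣ ℕ.* (n ℕ.* n ℕ.* n) ℕ.+ higher-weight 1 1 1 a b c ℕ.* (n ℕ.* n ℕ.* n) ≡⟨ sym (ℕₚ.*-distribʳ-+ (n ℕ.* n ℕ.* n) (∣ N ⟨ a , b , c ⟩ ∣) _) ⟩
  cell-weight a b c ℕ.* (n ℕ.* n ℕ.* n) ∎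
  where
  open ℕₚ.≤-Reasoning
  X = N ⟨ a , b , c ⟩ ℤ.* (ℤ.+ n ℤ.* ℤ.+ n ℤ.* ℤ.+ n)
  Y = comb (higher 1 1 1 (ℤ.+ n) a b c d e f)
  1* : ∀ x → ∣ x ∣ ℕ.≤ n → ∣ x ∣ ℕ.≤ 1 ℕ.* n
  1* x p = subst (∣ x ∣ ℕ.≤_) (sym (ℕₚ.*-identityˡ n)) p

-- The unit cube of ℝ³ is cut into 10³ cells; near every cell there is a lattice point
-- from which the whole cell has norm less than 1 in absolute value.

centre : ℕ → ℤ → ℤ
centre i q = ℤ.+ (2 ℕ.* i ℕ.+ 1) ℤ.- ℤ.+ 20 ℤ.* q

-- Lengths are measured in units of 1/20, so a cell of side 1/10 has half-side 1 and an odd centre,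
-- and norm 1 corresponds to 20³ = 8000.
cell-fits : (i j k : ℕ) → ℤ × ℤ × ℤ → Bool
cell-fits i j k (q , r , s) = cell-weight (centre i q) (centre j r) (centre k s) ℕ.<ᵇ 8000

candidates : List (ℤ × ℤ × ℤ)
candidates = (ℤ.+ 0 , ℤ.+ 1 , ℤ.+ 1) ∷ (ℤ.+ 0 , ℤ.+ 0 , ℤ.+ 0) ∷ (ℤ.+ 1 , ℤ.+ 0 , ℤ.+ 0) ∷ (ℤ.+ 1 , ℤ.+ 0 , ℤ.+ 1) ∷ (ℤ.+ 0 , ℤ.+ 0 , ℤ.+ 1)
  ∷ (ℤ.+ 1 , ℤ.+ 2 , ℤ.+ 1) ∷ (ℤ.+ 0 , ℤ.+ 1 , ℤ.+ 0) ∷ (ℤ.+ 0 , -[1+ 0 ] , ℤ.+ 0) ∷ (ℤ.+ 1 , ℤ.+ 1 , ℤ.+ 0) ∷ (ℤ.+ 1 , ℤ.+ 1 , ℤ.+ 1) ∷ []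

anyᵇ : ∀ {A : Set} → (A → Bool) → List A → Bool
anyᵇ p [] = false
anyᵇ p (x ∷ l) = p x ∨ anyᵇ p l

anyᵇ-sound : ∀ {A : Set} p (l : List A) → anyᵇ p l ≡ true → ∃ λ x → p x ≡ true
anyᵇ-sound p (x ∷ l) e with p x in q
... | true = x , q
... | false = anyᵇ-sound p l e

opaque
  unfolding N
  cells-check : allUpTo 10 (λ i → allUpTo 10 λ j → allUpTo 10 λ k → anyᵇ (cell-fits i j k) candidates) ≡ true
  cells-check = refl

coord-eq : ∀ X r q n s i t q′ → X ≡ r ℤ.+ n ℤ.* q → ℤ.+ 10 ℤ.* r ≡ s ℤ.+ i ℤ.* n → t ≡ ℤ.+ 2 ℤ.* s ℤ.- n → ℤ.+ 20 ℤ.* (X ℤ.- n ℤ.* (q ℤ.+ q′)) ≡ n ℤ.* (ℤ.+ 2 ℤ.* i ℤ.+ ℤ.+ 1 ℤ.- ℤ.+ 20 ℤ.* q′) ℤ.+ t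
coord-eq X r q n s i t q′ h₁ h₂ h₃ = trans (ℤI.identity (# (ℤ.+ 20) ⊗ (v 0F ⊖ v 3F ⊗ (v 2F ⊕ v 7F))) (v 3F ⊗ (# (ℤ.+ 2) ⊗ v 5F ⊕ # (ℤ.+ 1) ⊖ # (ℤ.+ 20) ⊗ v 7F) ⊕ v 6F ⊕ # (ℤ.+ 20) ⊗ (v 0F ⊖ (v 1F ⊕ v 3F ⊗ v 2F)) ⊕ # (ℤ.+ 2) ⊗ (# (ℤ.+ 10) ⊗ v 1F ⊖ (v 4F ⊕ v 5F ⊗ v 3F)) ⊕ (# (ℤ.+ 0) ⊖ # (ℤ.+ 1)) ⊗ (v 6F ⊖ (# (ℤ.+ 2) ⊗ v 4F ⊖ v 3F))) refl (X ∷ r ∷ q ∷ n ∷ s ∷ i ∷ t ∷ q′ ∷ [])) (trans (ℤI.vanish {n ℤ.* (ℤ.+ 2 ℤ.* i ℤ.+ ℤ.+ 1 ℤ.- ℤ.+ 20 ℤ.* q′) ℤ.+ t ℤ.+ ℤ.+ 20 ℤ.* (X ℤ.- (r ℤ.+ n ℤ.* q)) ℤ.+ ℤ.+ 2 ℤ.* (ℤ.+ 10 ℤ.* r ℤ.- (s ℤ.+ i ℤ.* n))} {ℤ.+ 0 ℤ.- ℤ.+ 1} h₃) (trans (ℤI.vanish {n ℤ.* (ℤ.+ 2 ℤ.* i ℤ.+ ℤ.+ 1 ℤ.- ℤ.+ 20 ℤ.* q′) ℤ.+ t ℤ.+ ℤ.+ 20 ℤ.* (X ℤ.- (r ℤ.+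 n ℤ.* q))} {ℤ.+ 2} h₂) (ℤI.vanish {n ℤ.* (ℤ.+ 2 ℤ.* i ℤ.+ ℤ.+ 1 ℤ.- ℤ.+ 20 ℤ.* q′) ℤ.+ t} {ℤ.+ 20} h₁)))

record Coordinate (n : ℕ) (X : ℤ) : Set where
  constructor coord
  field
    i : ℕ
    q t : ℤ
    i<10 : i ℕ.< 10
    t≤n : ∣ t ∣ ℕ.≤ n
    position : ∀ q′ → ℤ.+ 20 ℤ.* (X ℤ.- ℤ.+ n ℤ.* (q ℤ.+ q′)) ≡ ℤ.+ n ℤ.* centre i q′ ℤ.+ t

coordinate : ∀ n .{{_ : ℕ.NonZero n}} X → Coordinate n X
coordinate n X = coord i q t i<10 t≤n λ q′ → trans
    (coord-eq X (ℤ.+ r) q (ℤ.+ n) (ℤ.+ s) (ℤ.+ i) t q′ X≡ r≡ refl)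
    (cong (λ w → ℤ.+ n ℤ.* (w ℤ.- ℤ.+ 20 ℤ.* q′) ℤ.+ t) (sym (trans (ℤₚ.pos-+ (2 ℕ.* i) 1) (cong (ℤ._+ ℤ.+ 1) (ℤₚ.pos-* 2 i)))))
  where
  r = X ℤD.%ℕ n
  q = X ℤD./ℕ n
  s = 10 ℕ.* r ℕ.% n
  i = 10 ℕ.* r ℕ./ n
  t = ℤ.+ 2 ℤ.* ℤ.+ s ℤ.- ℤ.+ n
  X≡ : X ≡ ℤ.+ r ℤ.+ ℤ.+ n ℤ.* q
  X≡ = trans (ℤD.a≡a%ℕn+[a/ℕn]*n X n) (cong (λ w → ℤ.+ r ℤ.+ w) (ℤₚ.*-comm q (ℤ.+ n)))
  r≡ : ℤ.+ 10 ℤ.* ℤ.+ r ≡ ℤ.+ s ℤ.+ ℤ.+ i ℤ.* ℤ.+ n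
  r≡ = trans (sym (ℤₚ.pos-* 10 r)) (trans (cong ℤ.+_ (ℕD.m≡m%n+[m/n]*n (10 ℕ.* r) n))
    (trans (ℤₚ.pos-+ s (i ℕ.* n)) (cong (λ w → ℤ.+ s ℤ.+ w) (ℤₚ.pos-* i n))))
  i<10 : i ℕ.< 10
  i<10 = ℕD.m<n*o⇒m/o<n {10 ℕ.* r} {10} {n} (ℕₚ.*-monoʳ-< 10 (ℤD.n%ℕd<d X n))
  t≤n : ∣ t ∣ ℕ.≤ n
  t≤n with ℕₚ.≤-total n (2 ℕ.* s)
  ... | inj₁ n≤2s = subst (λ w → ∣ w ∣ ℕ.≤ n) (sym (trans (cong (ℤ._- ℤ.+ n) (sym (ℤₚ.pos-* 2 s))) (trans (ℤₚ.m-n≡m⊖n (2 ℕ.* s) n) (ℤₚ.⊖-≥ n≤2s))))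
        (ℕₚ.≤-trans (ℕₚ.∸-monoˡ-≤ n (ℕₚ.*-monoʳ-≤ 2 (ℕₚ.<⇒≤ (ℕD.m%n<n (10 ℕ.* r) n)))) (ℕₚ.≤-reflexive (trans (cong (λ w → n ℕ.+ w ℕ.∸ n) (ℕₚ.+-identityʳ n)) (ℕₚ.m+n∸n≡m n n))))
  ... | inj₂ 2s≤n = subst (λ w → ∣ w ∣ ℕ.≤ n) (sym (trans (cong (ℤ._- ℤ.+ n) (sym (ℤₚ.pos-* 2 s))) (trans (ℤₚ.m-n≡m⊖n (2 ℕ.* s) n) (ℤₚ.⊖-≤ 2s≤n))))
        (subst (ℕ._≤ n) (sym (ℤₚ.∣-i∣≡∣i∣ (ℤ.+ (n ℕ.∸ 2 ℕ.* s)))) (ℕₚ.m∸n≤m n (2 ℕ.* s)))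

opaque
  unfolding _+_ -_

  ⟨⟩-minus : ∀ a b c d e f → ⟨ a , b , c ⟩ - ⟨ d , e , f ⟩ ≡ ⟨ a ℤ.- d , b ℤ.- e , c ℤ.- f ⟩
  ⟨⟩-minus a b c d e f = refl

cell-candidate : ∀ {i j k} → i ℕ.< 10 → j ℕ.< 10 → k ℕ.< 10 → ∃ λ c → cell-fits i j k c ≡ true
cell-candidate {i} {j} {k} i< j< k< = anyᵇ-sound (cell-fits i j k) candidates
  (allUpTo-sound 10 (λ k → anyᵇ (cell-fits i j k) candidates)
    (allUpTo-sound 10 (λ j → allUpTo 10 λ k → anyᵇ (cell-fits i j k) candidates)
      (allUpTo-sound 10 (λ i → allUpTo 10 λ j → allUpTo 10 λ k → anyᵇ (cell-fits i j k) candidates) cells-check i<) j<) k<)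

cube≢0 : ∀ n .{{_ : ℕ.NonZero n}} → ℕ.NonZero (n ℕ.* n ℕ.* n)
cube≢0 n = ℕₚ.m*n≢0 (n ℕ.* n) n {{ℕₚ.m*n≢0 n n}}

N-20 : ∀ A B C a b c → ℤ.+ 20 ℤ.* A ≡ a → ℤ.+ 20 ℤ.* B ≡ b → ℤ.+ 20 ℤ.* C ≡ c → 8000 ℕ.* ∣ N ⟨ A , B , C ⟩ ∣ ≡ ∣ N ⟨ a , b , c ⟩ ∣
N-20 A B C a b c refl refl refl = trans (sym (ℤₚ.abs-* (ℤ.+ 8000) (N ⟨ A , B , C ⟩)))
  (cong ∣_∣ (trans (cong (ℤ._* N ⟨ A , B , C ⟩) (sym (N-ι (ℤ.+ 20)))) (trans (sym (N-* (ι (ℤ.+ 20)) ⟨ A , B , C ⟩)) (cong N (ι-scale (ℤ.+ 20) A B C)))))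

-- The fractional part of γ / n lies in one of the thousand cells, and the lattice point attached to
-- that cell, added to the integral part, is the quotient.
nearby : ∀ n .{{_ : ℕ.NonZero n}} γ → ∃ λ Q → ∣ N (γ - ι (ℤ.+ n) * Q) ∣ ℕ.< n ℕ.* n ℕ.* n
nearby n ⟨ X , Y , Z ⟩ = go (coordinate n X) (coordinate n Y) (coordinate n Z)
  where
  go : Coordinate n X → Coordinate n Y → Coordinate n Z → ∃ λ Q → ∣ N (⟨ X , Y , Z ⟩ - ι (ℤ.+ n) * Q) ∣ ℕ.< n ℕ.* n ℕ.* n
  go (coord i q t i< t≤ eX) (coord j r u j< u≤ eY) (coord k s w k< w≤ eZ) = pick (cell-candidate i< j< k<)
    where
    pick : (∃ λ c → cell-fits i j k c ≡ true) → ∃ λ Q → ∣ N (⟨ X , Y , Z ⟩ - ι (ℤ.+ n) * Q) ∣ ℕ.< n ℕ.* n ℕ.* n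
    pick ((q′ , r′ , s′) , fits) = Q , ℕₚ.*-cancelˡ-< 8000 _ _ (ℕₚ.≤-<-trans bound
        (ℕₚ.*-monoˡ-< (n ℕ.* n ℕ.* n) {{cube≢0 n}} (ℕₚ.<ᵇ⇒< (cell-weight (centre i q′) (centre j r′) (centre k s′)) 8000 (≡true⇒T fits))))
      where
      Q = ⟨ q ℤ.+ q′ , r ℤ.+ r′ , s ℤ.+ s′ ⟩
      A = X ℤ.- ℤ.+ n ℤ.* (q ℤ.+ q′)
      B = Y ℤ.- ℤ.+ n ℤ.* (r ℤ.+ r′)
      C = Z ℤ.- ℤ.+ n ℤ.* (s ℤ.+ s′)
      δ≡ : ⟨ X , Y , Z ⟩ - ι (ℤ.+ n) * Q ≡ ⟨ A , B , C ⟩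
      δ≡ = trans (cong (λ z → ⟨ X , Y , Z ⟩ - z) (ι-scale (ℤ.+ n) (q ℤ.+ q′) (r ℤ.+ r′) (s ℤ.+ s′)))
        (⟨⟩-minus X Y Z (ℤ.+ n ℤ.* (q ℤ.+ q′)) (ℤ.+ n ℤ.* (r ℤ.+ r′)) (ℤ.+ n ℤ.* (s ℤ.+ s′)))
      bound : 8000 ℕ.* ∣ N (⟨ X , Y , Z ⟩ - ι (ℤ.+ n) * Q) ∣ ℕ.≤ cell-weight (centre i q′) (centre j r′) (centre k s′) ℕ.* (n ℕ.* n ℕ.* n)
      bound = subst (ℕ._≤ cell-weight (centre i q′) (centre j r′) (centre k s′) ℕ.* (n ℕ.* n ℕ.* n))
        (sym (trans (cong (λ z → 8000 ℕ.* ∣ N z ∣) δ≡) (N-20 A B C _ _ _ (eX q′) (eY r′) (eZ s′))))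
        (N-bound n (centre i q′) (centre j r′) (centre k s′) t u w t≤ u≤ w≤)

-- Turns division by β into division by a positive integer; the element is the adjugate up to sign.
associate : ∀ β → ∃ λ β′ → β * β′ ≡ ι (ℤ.+ ∣ N β ∣)
associate β with N β | *♯ β
... | ℤ.+ n | e = β ♯ , e
... | -[1+ n ] | e = - β ♯ , trans (neg β (β ♯)) (trans (cong (λ w → 𝟘 - w) e) (trans (sym (trans (ι-+ (ℤ.+ 0) (ℤ.+ suc n)) (cong (λ w → 𝟘 + w) (ι-neg -[1+ n ])))) (cong ι (ℤₚ.+-identityˡ (ℤ.+ suc n)))))
  where
  neg : ∀ x y → x * (- y) ≡ 𝟘 - x * y
  neg x y = trans (cong (λ w → x * w) (sym (+-identityˡ (- y)))) (neg′ x y)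
    where
    neg′ : ∀ x y → x * (ι (ℤ.+ 0) - y) ≡ ι (ℤ.+ 0) - x * y
    neg′ x y = 𝒪I.identity (v 0F ⊗ (# (ℤ.+ 0) ⊖ v 1F)) (# (ℤ.+ 0) ⊖ v 0F ⊗ v 1F) refl (x ∷ y ∷ [])

rem-factor : ∀ α β β′ n Q → β * β′ ≡ n → α * β′ - n * Q ≡ (α - Q * β) * β′
rem-factor α β β′ n Q h₁ = trans (𝒪I.identity (v 0F ⊗ v 2F ⊖ v 3F ⊗ v 4F) ((v 0F ⊖ v 4F ⊗ v 1F) ⊗ v 2F ⊕ v 4F ⊗ (v 1F ⊗ v 2F ⊖ v 3F)) refl (α ∷ β ∷ β′ ∷ n ∷ Q ∷ [])) (𝒪I.vanish h₁)

norm≢0 : ∀ {β} → ¬ β ≡ 𝟘 → ℕ.NonZero ∣ N β ∣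
norm≢0 {β} β≢0 = ℕ.≢-nonZero λ e → β≢0 (N≡0⇒≡𝟘 β (ℤₚ.∣i∣≡0⇒i≡0 e))

-- With β′ from `associate` and n the absolute norm of β, divide α β′ by n. The remainder is (α - Q
-- β) β′, and since the norm of β′ is n² in absolute value, the bound n³ becomes the bound n for α -
-- Q β.
division : ∀ α β → ¬ β ≡ 𝟘 → ∃ λ Q → ∣ N (α - Q * β) ∣ ℕ.< ∣ N β ∣
division α β β≢0 = go (associate β)
  where
  n = ∣ N β ∣
  go : (∃ λ β′ → β * β′ ≡ ι (ℤ.+ n)) → ∃ λ Q → ∣ N (α - Q * β) ∣ ℕ.< n
  go (β′ , ββ′) = finish (nearby n {{norm≢0 β≢0}} (α * β′))
    where
    Nβ′ : ∣ N β′ ∣ ≡ n ℕ.* n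
    Nβ′ = ℕₚ.*-cancelˡ-≡ (∣ N β′ ∣) (n ℕ.* n) n {{norm≢0 β≢0}} (trans (sym (ℤₚ.abs-* (N β) (N β′))) (trans (cong ∣_∣ (trans (sym (N-* β β′)) (trans (cong N ββ′) (N-ι (ℤ.+ n)))))
      (trans (∣n³∣ n) (ℕₚ.*-assoc n n n))))
    lhs : ∀ Q → ∣ N (α * β′ - ι (ℤ.+ n) * Q) ∣ ≡ ∣ N (α - Q * β) ∣ ℕ.* (n ℕ.* n)
    lhs Q = trans (cong (λ w → ∣ N w ∣) (rem-factor α β β′ (ι (ℤ.+ n)) Q ββ′)) (trans (cong ∣_∣ (N-* (α - Q * β) β′))
      (trans (ℤₚ.abs-* (N (α - Q * β)) (N β′)) (cong (∣ N (α - Q * β) ∣ ℕ.*_) Nβ′)))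
    finish : (∃ λ Q → ∣ N (α * β′ - ι (ℤ.+ n) * Q) ∣ ℕ.< n ℕ.* n ℕ.* n) → ∃ λ Q → ∣ N (α - Q * β) ∣ ℕ.< n
    finish (Q , lt) = Q , ℕₚ.*-cancelʳ-< (n ℕ.* n) _ n (subst₂ ℕ._<_ (lhs Q) (ℕₚ.*-assoc n n n) lt)

-- Bézout

record Bézout (α β : 𝒪) : Set where
  constructor bézout
  field
    {g u w} : 𝒪
    g∣α : g ∣𝒪 α
    g∣β : g ∣𝒪 β
    g≡ : g ≡ u * α + w * β

div-comb : ∀ α Q β ρ g x y → α - Q * β ≡ ρ → β ≡ g * x → ρ ≡ g * y → α ≡ g * (Q * x + y)
div-comb α Q β ρ g x y h₁ h₂ h₃ = trans (𝒪I.identity (v 0F) (v 4F ⊗ (v 1F ⊗ v 5F ⊕ v 6F) ⊕ # (ℤ.+ 1) ⊗ (v 0F ⊖ v 1F ⊗ v 2F ⊖ v 3F) ⊕ v 1F ⊗ (v 2F ⊖ v 4F ⊗ v 5F) ⊕ # (ℤ.+ 1) ⊗ (v 3F ⊖ v 4F ⊗ v 6F)) refl (α ∷ Q ∷ β ∷ ρ ∷ g ∷ x ∷ y ∷ [])) (trans (𝒪I.vanish h₃) (trans (𝒪I.vanish h₂) (𝒪I.vanish h₁)))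
lin-comb : ∀ α Q β ρ g u w → α - Q * β ≡ ρ → g ≡ u * β + w * ρ → g ≡ w * α + (u - w * Q) * β
lin-comb α Q β ρ g u w h₁ h₂ = trans (𝒪I.identity (v 4F) (v 6F ⊗ v 0F ⊕ (v 5F ⊖ v 6F ⊗ v 1F) ⊗ v 2F ⊕ (# (ℤ.+ 0) ⊖ v 6F) ⊗ (v 0F ⊖ v 1F ⊗ v 2F ⊖ v 3F) ⊕ # (ℤ.+ 1) ⊗ (v 4F ⊖ (v 5F ⊗ v 2F ⊕ v 6F ⊗ v 3F))) refl (α ∷ Q ∷ β ∷ ρ ∷ g ∷ u ∷ w ∷ [])) (trans (𝒪I.vanish h₂) (𝒪I.vanish h₁))
g∣𝟘 : ∀ g → ι (ℤ.+ 0) ≡ g * ι (ℤ.+ 0)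
g∣𝟘 g = 𝒪I.identity (# (ℤ.+ 0)) (v 0F ⊗ # (ℤ.+ 0)) refl (g ∷ [])
self1 : ∀ g → g ≡ g * ι (ℤ.+ 1)
self1 g = 𝒪I.identity (v 0F) (v 0F ⊗ # (ℤ.+ 1)) refl (g ∷ [])
self2 : ∀ g → g ≡ ι (ℤ.+ 1) * g + ι (ℤ.+ 0) * ι (ℤ.+ 0)
self2 g = 𝒪I.identity (v 0F) (# (ℤ.+ 1) ⊗ v 0F ⊕ # (ℤ.+ 0) ⊗ # (ℤ.+ 0)) refl (g ∷ [])

gcd : ∀ α β → Bézout α β
gcd α β = <-rec P step ∣ N β ∣ α β refl
  where
  P : ℕ → Set
  P k = ∀ α β → ∣ N β ∣ ≡ k → Bézout α β
  step : ∀ k → (∀ {j} → j ℕ.< k → P j) → P k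
  step k rec α β e with ∣ N β ∣ ℕ.≟ 0
  ... | yes z = subst (Bézout α) (sym (N≡0⇒≡𝟘 β (ℤₚ.∣i∣≡0⇒i≡0 z))) (bézout {w = 𝟘} (𝟙 , self1 α) (𝟘 , g∣𝟘 α) (self2 α))
  ... | no n = reduce (division α β λ β≡0 → n (trans (cong (λ w → ∣ N w ∣) β≡0) (cong ∣_∣ (N-ι (ℤ.+ 0)))))
    where
    reduce : (∃ λ Q → ∣ N (α - Q * β) ∣ ℕ.< ∣ N β ∣) → Bézout α β
    reduce (Q , lt) = lift (rec (subst (∣ N (α - Q * β) ∣ ℕ.<_) e lt) β (α - Q * β) refl)
      where
      lift : Bézout β (α - Q * β) → Bézout α β
      lift (bézout {g} {u} {w} (x , p) (y , q) r) = bézout (_ , div-comb α Q β (α - Q * β) g x y refl p q) (x , p) (lin-comb α Q β (α - Q * β) g u w refl r)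

-- units modulo squares

ε ω : 𝒪
ε = ⟨ ℤ.+ 0 , ℤ.+ 1 , ℤ.+ 0 ⟩
ω = ⟨ ℤ.+ 0 , ℤ.+ 0 , ℤ.+ 1 ⟩

_⁺_ : 𝒪 → Bool → 𝒪
x ⁺ true = x
x ⁺ false = 𝟙

-𝟙 : 𝒪
-𝟙 = ι -[1+ 0 ]

opaque
  unfolding _*_ _+_ -_
  ω*ε : ω * ε ≡ 𝟙
  ω*ε = refl
  -𝟙*-𝟙 : -𝟙 * -𝟙 ≡ 𝟙
  -𝟙*-𝟙 = refl

-- The representatives ±1 and ±ε modulo squares. The element x need not be a unit itself, since
-- `root` is arbitrary.
record UnitClass (x : 𝒪) : Set where
  constructor unit-class
  field
    {sgn par} : Bool
    {root} : 𝒪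
    class≡ : x ≡ -𝟙 ⁺ sgn * ε ⁺ par * (root * root)

neg-class₁ : ∀ x m e z → ι (ℤ.+ 0) - x ≡ m * e * (z * z) → m ≡ ι (ℤ.+ 0) - ι (ℤ.+ 1) → x ≡ ι (ℤ.+ 1) * e * (z * z)
neg-class₁ x m e z h₁ h₂ = trans (𝒪I.identity (v 0F) (# (ℤ.+ 1) ⊗ v 2F ⊗ (v 3F ⊗ v 3F) ⊕ (# (ℤ.+ 0) ⊖ # (ℤ.+ 1)) ⊗ (# (ℤ.+ 0) ⊖ v 0F ⊖ v 1F ⊗ v 2F ⊗ (v 3F ⊗ v 3F)) ⊕ (# (ℤ.+ 0) ⊖ v 2F ⊗ (v 3F ⊗ v 3F)) ⊗ (v 1F ⊖ (# (ℤ.+ 0) ⊖ # (ℤ.+ 1)))) refl (x ∷ m ∷ e ∷ z ∷ [])) (trans (𝒪I.vanish h₂) (𝒪I.vanish h₁))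
neg-class₀ : ∀ x m e z → ι (ℤ.+ 0) - x ≡ ι (ℤ.+ 1) * e * (z * z) → m ≡ ι (ℤ.+ 0) - ι (ℤ.+ 1) → x ≡ m * e * (z * z)
neg-class₀ x m e z h₁ h₂ = trans (𝒪I.identity (v 0F) (v 1F ⊗ v 2F ⊗ (v 3F ⊗ v 3F) ⊕ (# (ℤ.+ 0) ⊖ # (ℤ.+ 1)) ⊗ (# (ℤ.+ 0) ⊖ v 0F ⊖ # (ℤ.+ 1) ⊗ v 2F ⊗ (v 3F ⊗ v 3F)) ⊕ (# (ℤ.+ 0) ⊖ v 2F ⊗ (v 3F ⊗ v 3F)) ⊗ (v 1F ⊖ (# (ℤ.+ 0) ⊖ # (ℤ.+ 1)))) refl (x ∷ m ∷ e ∷ z ∷ [])) (trans (𝒪I.vanish h₂) (𝒪I.vanish h₁))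
ε-class₀ : ∀ x s ε ω z → ε * x ≡ s * ι (ℤ.+ 1) * (z * z) → ω * ε ≡ ι (ℤ.+ 1) → x ≡ s * ε * (ω * z * (ω * z))
ε-class₀ x s ε ω z h₁ h₂ = trans (𝒪I.identity (v 0F) (v 1F ⊗ v 2F ⊗ (v 3F ⊗ v 4F ⊗ (v 3F ⊗ v 4F)) ⊕ v 3F ⊗ (v 2F ⊗ v 0F ⊖ v 1F ⊗ # (ℤ.+ 1) ⊗ (v 4F ⊗ v 4F)) ⊕ (# (ℤ.+ 0) ⊖ v 0F ⊖ v 1F ⊗ v 4F ⊗ v 4F ⊗ v 3F) ⊗ (v 3F ⊗ v 2F ⊖ # (ℤ.+ 1))) refl (x ∷ s ∷ ε ∷ ω ∷ z ∷ [])) (trans (𝒪I.vanish h₂) (𝒪I.vanish h₁))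
ε-class₁ : ∀ x s ε ω z → ε * x ≡ s * ε * (z * z) → ω * ε ≡ ι (ℤ.+ 1) → x ≡ s * ι (ℤ.+ 1) * (z * z)
ε-class₁ x s ε ω z h₁ h₂ = trans (𝒪I.identity (v 0F) (v 1F ⊗ # (ℤ.+ 1) ⊗ (v 4F ⊗ v 4F) ⊕ v 3F ⊗ (v 2F ⊗ v 0F ⊖ v 1F ⊗ v 2F ⊗ (v 4F ⊗ v 4F)) ⊕ (v 1F ⊗ v 4F ⊗ v 4F ⊖ v 0F) ⊗ (v 3F ⊗ v 2F ⊖ # (ℤ.+ 1))) refl (x ∷ s ∷ ε ∷ ω ∷ z ∷ [])) (trans (𝒪I.vanish h₂) (𝒪I.vanish h₁))
ω-class₀ : ∀ x s ε ω z → ω * x ≡ s * ι (ℤ.+ 1) * (z * z) → ω * ε ≡ ι (ℤ.+ 1) → x ≡ s * ε * (z * z)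
ω-class₀ x s ε ω z h₁ h₂ = trans (𝒪I.identity (v 0F) (v 1F ⊗ v 2F ⊗ (v 4F ⊗ v 4F) ⊕ v 2F ⊗ (v 3F ⊗ v 0F ⊖ v 1F ⊗ # (ℤ.+ 1) ⊗ (v 4F ⊗ v 4F)) ⊕ (# (ℤ.+ 0) ⊖ v 0F) ⊗ (v 3F ⊗ v 2F ⊖ # (ℤ.+ 1))) refl (x ∷ s ∷ ε ∷ ω ∷ z ∷ [])) (trans (𝒪I.vanish h₂) (𝒪I.vanish h₁))
ω-class₁ : ∀ x s ε ω z → ω * x ≡ s * ε * (z * z) → ω * ε ≡ ι (ℤ.+ 1) → x ≡ s * ι (ℤ.+ 1) * (ε * z * (ε * z))
ω-class₁ x s ε ω z h₁ h₂ = trans (𝒪I.identity (v 0F) (v 1F ⊗ # (ℤ.+ 1) ⊗ (v 2F ⊗ v 4F ⊗ (v 2F ⊗ v 4F)) ⊕ v 2F ⊗ (v 3F ⊗ v 0F ⊖ v 1F ⊗ v 2F ⊗ (v 4F ⊗ v 4F)) ⊕ (# (ℤ.+ 0) ⊖ v 0F) ⊗ (v 3F ⊗ v 2F ⊖ # (ℤ.+ 1))) refl (x ∷ s ∷ ε ∷ ω ∷ z ∷ [])) (trans (𝒪I.vanish h₂) (𝒪I.vanish h₁))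

ε*-class : ∀ {x} → UnitClass (ε * x) → UnitClass x
ε*-class {x} (unit-class {s} {false} {z} e) = unit-class {sgn = s} {par = true} (ε-class₀ x _ ε ω z e ω*ε)
ε*-class {x} (unit-class {s} {true} {z} e) = unit-class {sgn = s} {par = false} (ε-class₁ x _ ε ω z e ω*ε)

ω*-class : ∀ {x} → UnitClass (ω * x) → UnitClass x
ω*-class {x} (unit-class {s} {false} {z} e) = unit-class {sgn = s} {par = true} (ω-class₀ x _ ε ω z e ω*ε)
ω*-class {x} (unit-class {s} {true} {z} e) = unit-class {sgn = s} {par = false} (ω-class₁ x _ ε ω z e ω*ε)

-- Small units are found among ± εʲ for -3 ≤ j ≤ 3.
private
  _≡ᶻ_ : ℤ → ℤ → Bool
  (ℤ.+ m) ≡ᶻ (ℤ.+ n) = m ℕ.≡ᵇ n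
  -[1+ m ] ≡ᶻ -[1+ n ] = m ℕ.≡ᵇ n
  _ ≡ᶻ _ = false

  ≡ᶻ-sound : ∀ m n → (m ≡ᶻ n) ≡ true → m ≡ n
  ≡ᶻ-sound (ℤ.+ m) (ℤ.+ n) e = cong ℤ.+_ (ℕₚ.≡ᵇ⇒≡ m n (≡true⇒T e))
  ≡ᶻ-sound -[1+ m ] -[1+ n ] e = cong -[1+_] (ℕₚ.≡ᵇ⇒≡ m n (≡true⇒T e))

_≡ᵒ_ : 𝒪 → 𝒪 → Bool
⟨ a , b , c ⟩ ≡ᵒ ⟨ d , e , f ⟩ = (a ≡ᶻ d) ∧ ((b ≡ᶻ e) ∧ (c ≡ᶻ f))

≡ᵒ-sound : ∀ x y → (x ≡ᵒ y) ≡ true → x ≡ y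
≡ᵒ-sound ⟨ a , b , c ⟩ ⟨ d , e , f ⟩ h with ∧-split (a ≡ᶻ d) _ h
... | p , h′ with ∧-split (b ≡ᶻ e) _ h′
... | q , r = ≡𝒪 (≡ᶻ-sound a d p) (≡ᶻ-sound b e q) (≡ᶻ-sound c f r)

small-units : List (Bool × Bool × 𝒪)
small-units = (false , false , 𝟙) ∷ (true , false , 𝟙) ∷ (false , true , 𝟙) ∷ (true , true , 𝟙) ∷ (false , true , ω) ∷ (true , true , ω)
  ∷ (false , false , ω) ∷ (true , false , ω) ∷ (false , false , ε) ∷ (true , false , ε) ∷ (false , true , ε) ∷ (true , true , ε)
  ∷ (false , true , ω * ω) ∷ (true , true , ω * ω) ∷ (false , false , ω * ω) ∷ (true , false , ω * ω)  ∷ []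

is-unit-of : 𝒪 → Bool × Bool × 𝒪 → Bool
is-unit-of x (s , p , z) = x ≡ᵒ (-𝟙 ⁺ s * ε ⁺ p * (z * z))

shifted : ℕ → ℕ → ℤ
shifted h i = ℤ.+ i ℤ.- ℤ.+ h

unshift : ∀ h a → ∣ a ∣ ℕ.≤ h → ∃ λ i → i ℕ.< suc (2 ℕ.* h) × a ≡ shifted h i
unshift h (ℤ.+ m) m≤h = h ℕ.+ m , ℕ.s≤s (ℕₚ.+-monoʳ-≤ h (ℕₚ.≤-trans m≤h (ℕₚ.≤-reflexive (sym (ℕₚ.+-identityʳ h))))) ,
  sym (trans (ℤₚ.m-n≡m⊖n (h ℕ.+ m) h) (trans (ℤₚ.⊖-≥ (ℕₚ.m≤m+n h m)) (cong ℤ.+_ (ℕₚ.m+n∸m≡n h m))))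
unshift h -[1+ m ] m<h = h ℕ.∸ suc m , ℕ.s≤s (ℕₚ.≤-trans (ℕₚ.m∸n≤m h (suc m)) (ℕₚ.m≤m+n h _)) ,
  sym (trans (ℤₚ.m-n≡m⊖n (h ℕ.∸ suc m) h) (trans (ℤₚ.⊖-≤ (ℕₚ.m∸n≤m h (suc m))) (cong (λ w → ℤ.- ℤ.+ w) (ℕₚ.m∸[m∸n]≡n m<h))))

small? : 𝒪 → Bool
small? x = not (∣ N x ∣ ℕ.≡ᵇ 1) ∨ anyᵇ (is-unit-of x) small-units

opaque
  unfolding _*_ _+_ -_ N
  small-check : allUpTo 21 (λ i → allUpTo 11 λ j → allUpTo 11 λ k → small? ⟨ shifted 10 i , shifted 5 j , shifted 5 k ⟩) ≡ true
  small-check = refl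

⇒-elim : ∀ {a b} → not a ∨ b ≡ true → a ≡ true → b ≡ true
⇒-elim {true} e _ = e

∨-split : ∀ a {b} → a ∨ b ≡ true → a ≡ true ⊎ b ≡ true
∨-split true _ = inj₁ refl
∨-split false e = inj₂ e

small-unit-class : ∀ x → ∣ c₁ x ∣ ℕ.≤ 10 → ∣ cε x ∣ ℕ.≤ 5 → ∣ cω x ∣ ℕ.≤ 5 → ∣ N x ∣ ≡ 1 → UnitClass x
small-unit-class ⟨ a , b , c ⟩ a≤ b≤ c≤ = go (unshift 10 a a≤) (unshift 5 b b≤) (unshift 5 c c≤)
  where
  x = ⟨ a , b , c ⟩
  found : (∃ λ u → is-unit-of x u ≡ true) → UnitClass x
  found ((s , p , z) , e) = unit-class {sgn = s} {par = p} {root = z} (≡ᵒ-sound x _ e)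
  go : (∃ λ i → i ℕ.< 21 × a ≡ shifted 10 i) → (∃ λ i → i ℕ.< 11 × b ≡ shifted 5 i) → (∃ λ i → i ℕ.< 11 × c ≡ shifted 5 i) →
    ∣ N x ∣ ≡ 1 → UnitClass x
  go (i , i< , refl) (j , j< , refl) (k , k< , refl) N≡1 = found (anyᵇ-sound (is-unit-of x) small-units
    (⇒-elim {∣ N x ∣ ℕ.≡ᵇ 1} (allUpTo-sound 11 (λ k → small? ⟨ shifted 10 i , shifted 5 j , shifted 5 k ⟩)
      (allUpTo-sound 11 (λ j → allUpTo 11 λ k → small? ⟨ shifted 10 i , shifted 5 j , shifted 5 k ⟩)
        (allUpTo-sound 21 (λ i → allUpTo 11 λ j → allUpTo 11 λ k → small? ⟨ shifted 10 i , shifted 5 j , shifted 5 k ⟩) small-check i<) j<) k<)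
      (T⇒≡true (ℕₚ.≡⇒≡ᵇ (∣ N x ∣) 1 N≡1))))

-- The outer shell of the cube [-1,1]³ is cut into cells of side 1/10: on each cell either the norm
-- form is bounded away from 0, or multiplication by ε or by ω decreases the supremum norm.

record Lattice (n : ℕ) (y : ℤ) : Set where
  constructor lattice
  field
    i : ℕ
    t : ℤ
    i<20 : i ℕ.< 20
    t≤n : ∣ t ∣ ℕ.≤ n
    position : ℤ.+ 20 ℤ.* y ≡ ℤ.+ n ℤ.* centre i (ℤ.+ 1) ℤ.+ t

boundary : ℕ → Bool
boundary i = (i ℕ.≡ᵇ 0) ∨ (i ℕ.≡ᵇ 19)

-- fits k n bounds c y + d y′ by k n
fits? : ℕ → (c d e e′ : ℤ) → Bool
fits? k c d e e′ = (∣ c ℤ.* e ℤ.+ d ℤ.* e′ ∣ ℕ.+ (∣ c ∣ ℕ.+ ∣ d ∣)) ℕ.<ᵇ (20 ℕ.* k)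

-- The first centre is doubled because the cube uses the coordinates (a , 2b , 2c); after scaling by
-- 40 the increments are bounded by 2n, n and n. If the norm of 40 x is at least 64 n³ throughout
-- the cell, then norm ±1 gives 64000 ≥ 64 n³, hence n ≤ 10.
large? : (a b c : ℤ) → Bool
large? a b c = (64 ℕ.+ higher-weight 2 1 1 (ℤ.+ 2 ℤ.* a) b c) ℕ.≤ᵇ ∣ N ⟨ ℤ.+ 2 ℤ.* a , b , c ⟩ ∣

-- Multiplication by ε sends (a , b , c) to (c , a + 3b , b), and multiplication by ω sends it to (b
-- - 3c , c , a). The tests bound the entries of the image in the norm `sup`; the entry c under ε
-- needs no test, as 2c is already bounded.
ε-shrinks? ω-shrinks? : (a b c : ℤ) → Bool
ε-shrinks? a b c = fits? 1 (ℤ.+ 2) (ℤ.+ 3) a b ∧ fits? 1 (ℤ.+ 1) (ℤ.+ 0) b a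
ω-shrinks? a b c = fits? 2 (ℤ.+ 1) -[1+ 2 ] b c ∧ (fits? 1 (ℤ.+ 1) (ℤ.+ 0) c a ∧ fits? 1 (ℤ.+ 2) (ℤ.+ 0) a b)

shell? : (i j k : ℕ) → Bool
shell? i j k = not (boundary i ∨ (boundary j ∨ boundary k)) ∨
  (large? (centre i (ℤ.+ 1)) (centre j (ℤ.+ 1)) (centre k (ℤ.+ 1)) ∨
  (ε-shrinks? (centre i (ℤ.+ 1)) (centre j (ℤ.+ 1)) (centre k (ℤ.+ 1)) ∨ ω-shrinks? (centre i (ℤ.+ 1)) (centre j (ℤ.+ 1)) (centre k (ℤ.+ 1))))

opaque
  unfolding N
  shell-check : allUpTo 20 (λ i → allUpTo 20 λ j → allUpTo 20 λ k → shell? i j k) ≡ true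
  shell-check = refl

lattice-eq : ∀ y n z i s t → z ≡ y ℤ.+ n → ℤ.+ 10 ℤ.* z ≡ s ℤ.+ i ℤ.* n → t ≡ ℤ.+ 2 ℤ.* s ℤ.- n → ℤ.+ 20 ℤ.* y ≡ n ℤ.* (ℤ.+ 2 ℤ.* i ℤ.+ ℤ.+ 1 ℤ.- ℤ.+ 20) ℤ.+ t
lattice-eq y n z i s t h₁ h₂ h₃ = trans (ℤI.identity (# (ℤ.+ 20) ⊗ v 0F) (v 1F ⊗ (# (ℤ.+ 2) ⊗ v 3F ⊕ # (ℤ.+ 1) ⊖ # (ℤ.+ 20)) ⊕ v 5F ⊕ (# (ℤ.+ 0) ⊖ # (ℤ.+ 20)) ⊗ (v 2F ⊖ (v 0F ⊕ v 1F)) ⊕ # (ℤ.+ 2) ⊗ (# (ℤ.+ 10) ⊗ v 2F ⊖ (v 4F ⊕ v 3F ⊗ v 1F)) ⊕ (# (ℤ.+ 0) ⊖ # (ℤ.+ 1)) ⊗ (v 5F ⊖ (# (ℤ.+ 2) ⊗ v 4F ⊖ v 1F))) refl (y ∷ n ∷ z ∷ i ∷ s ∷ t ∷ [])) (trans (ℤI.vanish {n ℤ.* (ℤ.+ 2 ℤ.* i ℤ.+ ℤ.+ 1 ℤ.- ℤ.+ 20) ℤ.+ t ℤ.+ (ℤ.+ 0 ℤ.- ℤ.+ 20) ℤ.* (z ℤ.- (y ℤ.+ n)) ℤ.+ ℤ.+ 2 ℤ.* (ℤ.+ 10 ℤ.* z ℤ.- (s ℤ.+ i ℤ.* n))} {ℤ.+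 0 ℤ.- ℤ.+ 1} h₃) (trans (ℤI.vanish {n ℤ.* (ℤ.+ 2 ℤ.* i ℤ.+ ℤ.+ 1 ℤ.- ℤ.+ 20) ℤ.+ t ℤ.+ (ℤ.+ 0 ℤ.- ℤ.+ 20) ℤ.* (z ℤ.- (y ℤ.+ n))} {ℤ.+ 2} h₂) (ℤI.vanish {n ℤ.* (ℤ.+ 2 ℤ.* i ℤ.+ ℤ.+ 1 ℤ.- ℤ.+ 20) ℤ.+ t} {ℤ.+ 0 ℤ.- ℤ.+ 20} h₁)))

centre-ℤ : ∀ i → centre i (ℤ.+ 1) ≡ ℤ.+ 2 ℤ.* ℤ.+ i ℤ.+ ℤ.+ 1 ℤ.- ℤ.+ 20
centre-ℤ i = cong (ℤ._- ℤ.+ 20) (trans (ℤₚ.pos-+ (2 ℕ.* i) 1) (cong (ℤ._+ ℤ.+ 1) (ℤₚ.pos-* 2 i)))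

offset : ℕ → ℕ → ℤ
offset s n = ℤ.+ 2 ℤ.* ℤ.+ s ℤ.- ℤ.+ n

offset-bound : ∀ s n → s ℕ.≤ n → ∣ offset s n ∣ ℕ.≤ n
offset-bound s n s≤n with ℕₚ.≤-total n (2 ℕ.* s)
... | inj₁ n≤2s = subst (λ w → ∣ w ∣ ℕ.≤ n) (sym (trans (cong (ℤ._- ℤ.+ n) (sym (ℤₚ.pos-* 2 s))) (trans (ℤₚ.m-n≡m⊖n (2 ℕ.* s) n) (ℤₚ.⊖-≥ n≤2s))))
      (ℕₚ.≤-trans (ℕₚ.∸-monoˡ-≤ n (ℕₚ.*-monoʳ-≤ 2 s≤n)) (ℕₚ.≤-reflexive (trans (cong (λ w → n ℕ.+ w ℕ.∸ n) (ℕₚ.+-identityʳ n)) (ℕₚ.m+n∸n≡m n n))))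
... | inj₂ 2s≤n = subst (λ w → ∣ w ∣ ℕ.≤ n) (sym (trans (cong (ℤ._- ℤ.+ n) (sym (ℤₚ.pos-* 2 s))) (trans (ℤₚ.m-n≡m⊖n (2 ℕ.* s) n) (ℤₚ.⊖-≤ 2s≤n))))
      (subst (ℕ._≤ n) (sym (ℤₚ.∣-i∣≡∣i∣ (ℤ.+ (n ℕ.∸ 2 ℕ.* s)))) (ℕₚ.m∸n≤m n (2 ℕ.* s)))

lattice-from : ∀ n y z i s → ℤ.+ z ≡ y ℤ.+ ℤ.+ n → 10 ℕ.* z ≡ s ℕ.+ i ℕ.* n → i ℕ.< 20 → s ℕ.≤ n → Lattice n y
lattice-from n y z i s z≡ e i< s≤ = lattice i (offset s n) i< (offset-bound s n s≤)
  (trans (lattice-eq y (ℤ.+ n) (ℤ.+ z) (ℤ.+ i) (ℤ.+ s) (offset s n) z≡ e′ refl) (cong (λ w → ℤ.+ n ℤ.* w ℤ.+ offset s n) (sym (centre-ℤ i))))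
  where
  e′ : ℤ.+ 10 ℤ.* ℤ.+ z ≡ ℤ.+ s ℤ.+ ℤ.+ i ℤ.* ℤ.+ n
  e′ = trans (sym (ℤₚ.pos-* 10 z)) (trans (cong ℤ.+_ e) (trans (ℤₚ.pos-+ s (i ℕ.* n)) (cong (λ w → ℤ.+ s ℤ.+ w) (ℤₚ.pos-* i n))))

record Translated (n : ℕ) (y : ℤ) : Set where
  constructor translated
  field
    z : ℕ
    z≡ : ℤ.+ z ≡ y ℤ.+ ℤ.+ n
    z≤2n : z ℕ.≤ 2 ℕ.* n
    ends : ∣ y ∣ ≡ n → z ≡ 0 ⊎ z ≡ 2 ℕ.* n

translate : ∀ n y → ∣ y ∣ ℕ.≤ n → Translated n y
translate n (ℤ.+ m) m≤n = translated (m ℕ.+ n) refl (ℕₚ.+-mono-≤ m≤n (ℕₚ.≤-reflexive (sym (ℕₚ.+-identityʳ n))))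
  λ { refl → inj₂ (cong (m ℕ.+_) (sym (ℕₚ.+-identityʳ m))) }
translate n -[1+ m ] m<n = translated (n ℕ.∸ suc m) (sym (ℤₚ.⊖-≥ m<n)) (ℕₚ.≤-trans (ℕₚ.m∸n≤m n (suc m)) (ℕₚ.m≤m+n n _))
  λ { refl → inj₁ (ℕₚ.n∸n≡0 (suc m)) }

Extreme : ∀ {n y} → Lattice n y → Set
Extreme {n} {y} l = ∣ y ∣ ≡ n → boundary (Lattice.i l) ≡ true

lattice-point : ∀ n .{{_ : ℕ.NonZero n}} y → ∣ y ∣ ℕ.≤ n → ∃ λ (l : Lattice n y) → Extreme l
lattice-point n y y≤n = go (translate n y y≤n)
  where
  go : Translated n y → ∃ λ (l : Lattice n y) → Extreme l
  go (translated z z≡ z≤2n ends) with z ℕ.≟ 2 ℕ.* n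
  ... | yes e = lattice-from n y z 19 n z≡ (trans (cong (10 ℕ.*_) e) (trans (sym (ℕₚ.*-assoc 10 2 n)) refl)) ℕₚ.≤-refl ℕₚ.≤-refl , λ _ → refl
  ... | no z≢2n = lattice-from n y z (10 ℕ.* z ℕ./ n) (10 ℕ.* z ℕ.% n) z≡ (ℕD.m≡m%n+[m/n]*n (10 ℕ.* z) n)
        (ℕD.m<n*o⇒m/o<n {10 ℕ.* z} {20} {n} (ℕₚ.<-≤-trans (ℕₚ.*-monoʳ-< 10 (ℕₚ.≤∧≢⇒< z≤2n z≢2n)) (ℕₚ.≤-reflexive (sym (ℕₚ.*-assoc 10 2 n)))))
        (ℕₚ.<⇒≤ (ℕD.m%n<n (10 ℕ.* z) n)) , λ y≡n → extreme (ends y≡n)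
    where
    extreme : z ≡ 0 ⊎ z ≡ 2 ℕ.* n → boundary (10 ℕ.* z ℕ./ n) ≡ true
    extreme (inj₁ z≡0) = cong boundary (trans (cong (λ w → 10 ℕ.* w ℕ./ n) z≡0) (ℕD.0/n≡0 n))
    extreme (inj₂ e) = ⊥-elim (z≢2n e)

fits-eq : ∀ c d y y′ n e e′ t t′ → ℤ.+ 20 ℤ.* y ≡ n ℤ.* e ℤ.+ t → ℤ.+ 20 ℤ.* y′ ≡ n ℤ.* e′ ℤ.+ t′ → ℤ.+ 20 ℤ.* (c ℤ.* y ℤ.+ d ℤ.* y′) ≡ (c ℤ.* e ℤ.+ d ℤ.* e′) ℤ.* n ℤ.+ (c ℤ.* t ℤ.+ d ℤ.* t′)
fits-eq c d y y′ n e e′ t t′ h₁ h₂ = trans (ℤI.identity (# (ℤ.+ 20) ⊗ (v 0F ⊗ v 2F ⊕ v 1F ⊗ v 3F)) ((v 0F ⊗ v 5F ⊕ v 1F ⊗ v 6F) ⊗ v 4F ⊕ (v 0F ⊗ v 7F ⊕ v 1F ⊗ v 8F) ⊕ v 0F ⊗ (# (ℤ.+ 20) ⊗ v 2F ⊖ (v 4F ⊗ v 5F ⊕ v 7F)) ⊕ v 1F ⊗ (# (ℤ.+ 20) ⊗ v 3F ⊖ (v 4F ⊗ v 6F ⊕ v 8F))) refl (c ∷ d ∷ y ∷ y′ ∷ n ∷ e ∷ e′ ∷ t ∷ t′ ∷ [])) (trans (ℤI.vanish {(c ℤ.* e ℤ.+ d ℤ.* e′) ℤ.* n ℤ.+ (c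 ℤ.* t ℤ.+ d ℤ.* t′) ℤ.+ c ℤ.* (ℤ.+ 20 ℤ.* y ℤ.- (n ℤ.* e ℤ.+ t))} {d} h₂) (ℤI.vanish {(c ℤ.* e ℤ.+ d ℤ.* e′) ℤ.* n ℤ.+ (c ℤ.* t ℤ.+ d ℤ.* t′)} {c} h₁))

fits-sound : ∀ k c d n .{{_ : ℕ.NonZero n}} y y′ e e′ t t′ → ℤ.+ 20 ℤ.* y ≡ ℤ.+ n ℤ.* e ℤ.+ t → ℤ.+ 20 ℤ.* y′ ≡ ℤ.+ n ℤ.* e′ ℤ.+ t′ →
  ∣ t ∣ ℕ.≤ n → ∣ t′ ∣ ℕ.≤ n → fits? k c d e e′ ≡ true → ∣ c ℤ.* y ℤ.+ d ℤ.* y′ ∣ ℕ.< k ℕ.* n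
fits-sound k c d n y y′ e e′ t t′ h h′ t≤ t′≤ f = ℕₚ.*-cancelˡ-< 20 _ _ (begin-strict
  20 ℕ.* ∣ c ℤ.* y ℤ.+ d ℤ.* y′ ∣ ≡⟨ sym (ℤₚ.abs-* (ℤ.+ 20) (c ℤ.* y ℤ.+ d ℤ.* y′)) ⟩
  ∣ ℤ.+ 20 ℤ.* (c ℤ.* y ℤ.+ d ℤ.* y′) ∣ ≡⟨ cong ∣_∣ (fits-eq c d y y′ (ℤ.+ n) e e′ t t′ h h′) ⟩
  ∣ E ℤ.* ℤ.+ n ℤ.+ (c ℤ.* t ℤ.+ d ℤ.* t′) ∣ ≤⟨ ℤₚ.∣i+j∣≤∣i∣+∣j∣ (E ℤ.* ℤ.+ n) (c ℤ.* t ℤ.+ d ℤ.* t′) ⟩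
  ∣ E ℤ.* ℤ.+ n ∣ ℕ.+ ∣ c ℤ.* t ℤ.+ d ℤ.* t′ ∣ ≤⟨ ℕₚ.+-mono-≤ (ℕₚ.≤-reflexive (ℤₚ.abs-* E (ℤ.+ n))) (ℕₚ.≤-trans (ℤₚ.∣i+j∣≤∣i∣+∣j∣ (c ℤ.* t) (d ℤ.* t′))
     (ℕₚ.+-mono-≤ (∣*∣≤ {c} {t} ℕₚ.≤-refl t≤) (∣*∣≤ {d} {t′} ℕₚ.≤-refl t′≤))) ⟩
  (∣ E ∣) ℕ.* n ℕ.+ ((∣ c ∣) ℕ.* n ℕ.+ (∣ d ∣) ℕ.* n) ≡⟨ cong ((∣ E ∣) ℕ.* n ℕ.+_) (sym (ℕₚ.*-distribʳ-+ n (∣ c ∣) (∣ d ∣))) ⟩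
  (∣ E ∣) ℕ.* n ℕ.+ (∣ c ∣ ℕ.+ ∣ d ∣) ℕ.* n ≡⟨ sym (ℕₚ.*-distribʳ-+ n (∣ E ∣) (∣ c ∣ ℕ.+ ∣ d ∣)) ⟩
  (∣ E ∣ ℕ.+ (∣ c ∣ ℕ.+ ∣ d ∣)) ℕ.* n <⟨ ℕₚ.*-monoˡ-< n (ℕₚ.<ᵇ⇒< _ (20 ℕ.* k) (≡true⇒T f)) ⟩
  20 ℕ.* k ℕ.* n ≡⟨ ℕₚ.*-assoc 20 k n ⟩
  20 ℕ.* (k ℕ.* n) ∎)
  where
  open ℕₚ.≤-Reasoning
  E = c ℤ.* e ℤ.+ d ℤ.* e′

add-sub : ∀ a b → a ≡ a ℤ.+ b ℤ.- b
add-sub a b = ℤI.identity (v 0F) (v 0F ⊕ v 1F ⊖ v 1F) refl (a ∷ b ∷ [])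

large-bound : ∀ n W K H A c → ∣ K ℤ.* (ℤ.+ n ℤ.* ℤ.+ n ℤ.* ℤ.+ n) ℤ.+ H ∣ ≡ A → ∣ H ∣ ℕ.≤ W ℕ.* (n ℕ.* n ℕ.* n) →
  c ℕ.+ W ℕ.≤ ∣ K ∣ → n ℕ.* n ℕ.* n ℕ.* c ℕ.≤ A
large-bound n W K H A c e H≤ K≥ = ℕₚ.+-cancelʳ-≤ (M ℕ.* W) (M ℕ.* c) A (begin
    M ℕ.* c ℕ.+ M ℕ.* W ≡⟨ sym (ℕₚ.*-distribˡ-+ M c W) ⟩
    M ℕ.* (c ℕ.+ W) ≤⟨ ℕₚ.*-monoʳ-≤ M K≥ ⟩
    M ℕ.* ∣ K ∣ ≡⟨ trans (ℕₚ.*-comm M (∣ K ∣)) (sym (trans (ℤₚ.abs-* K n³) (cong ((∣ K ∣) ℕ.*_) (∣n³∣ n)))) ⟩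
    ∣ K ℤ.* n³ ∣ ≡⟨ cong ∣_∣ (add-sub (K ℤ.* n³) H) ⟩
    ∣ K ℤ.* n³ ℤ.+ H ℤ.- H ∣ ≤⟨ ℤₚ.∣i-j∣≤∣i∣+∣j∣ (K ℤ.* n³ ℤ.+ H) H ⟩
    ∣ K ℤ.* n³ ℤ.+ H ∣ ℕ.+ ∣ H ∣ ≤⟨ ℕₚ.+-mono-≤ (ℕₚ.≤-reflexive e) (ℕₚ.≤-trans H≤ (ℕₚ.≤-reflexive (ℕₚ.*-comm W M))) ⟩
    A ℕ.+ M ℕ.* W ∎)
  where
  open ℕₚ.≤-Reasoning
  M = n ℕ.* n ℕ.* n
  n³ = ℤ.+ n ℤ.* ℤ.+ n ℤ.* ℤ.+ n

cube≤⇒≤ : ∀ n k c .{{_ : ℕ.NonZero c}} → n ℕ.* n ℕ.* n ℕ.* c ℕ.≤ k ℕ.* k ℕ.* k ℕ.* c → n ℕ.≤ k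
cube≤⇒≤ n k c h = ℕₚ.≮⇒≥ λ k<n → ℕₚ.<⇒≱ (ℕₚ.*-mono-< (ℕₚ.*-mono-< k<n k<n) k<n) (ℕₚ.*-cancelʳ-≤ (n ℕ.* n ℕ.* n) (k ℕ.* k ℕ.* k) c h)

large⇒≤10 : ∀ n W K H → ∣ K ℤ.* (ℤ.+ n ℤ.* ℤ.+ n ℤ.* ℤ.+ n) ℤ.+ H ∣ ≡ 64000 → ∣ H ∣ ℕ.≤ W ℕ.* (n ℕ.* n ℕ.* n) →
  64 ℕ.+ W ℕ.≤ ∣ K ∣ → n ℕ.≤ 10
large⇒≤10 n W K H e H≤ K≥ = cube≤⇒≤ n 10 64 (large-bound n W K H 64000 64 e H≤ K≥)

opaque
  unfolding N _*_
  N-ε : N ε ≡ ℤ.+ 1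
  N-ε = refl
  N-ω : N ω ≡ ℤ.+ 1
  N-ω = refl

  ε*-components : ∀ a b c → ε * ⟨ a , b , c ⟩ ≡ ⟨ c , a ℤ.+ ℤ.+ 3 ℤ.* b , b ⟩
  ε*-components a b c = components (⟪ # (ℤ.+ 0) , # (ℤ.+ 1) , # (ℤ.+ 0) ⟫ ⊠ x₃) ⟪ v 2F , v 0F ⊕ # (ℤ.+ 3) ⊗ v 1F , v 1F ⟫ refl refl refl
    (a ∷ b ∷ c ∷ a ∷ b ∷ c ∷ a ∷ b ∷ c ∷ [])

  ω*-components : ∀ a b c → ω * ⟨ a , b , c ⟩ ≡ ⟨ b ℤ.- ℤ.+ 3 ℤ.* c , c , a ⟩
  ω*-components a b c = components (⟪ # (ℤ.+ 0) , # (ℤ.+ 0) , # (ℤ.+ 1) ⟫ ⊠ x₃) ⟪ v 1F ⊖ # (ℤ.+ 3) ⊗ v 2F , v 2F , v 0F ⟫ refl refl refl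
    (a ∷ b ∷ c ∷ a ∷ b ∷ c ∷ a ∷ b ∷ c ∷ [])

sup : 𝒪 → ℕ
sup ⟨ a , b , c ⟩ = ∣ a ∣ ℕ.⊔ (∣ ℤ.+ 2 ℤ.* b ∣ ℕ.⊔ ∣ ℤ.+ 2 ℤ.* c ∣)

sup-< : ∀ {a b c n} → ∣ a ∣ ℕ.< n → ∣ ℤ.+ 2 ℤ.* b ∣ ℕ.< n → ∣ ℤ.+ 2 ℤ.* c ∣ ℕ.< n → sup ⟨ a , b , c ⟩ ℕ.< n
sup-< p q r = ℕₚ.⊔-lub p (ℕₚ.⊔-lub q r)

half-≤ : ∀ b k → ∣ ℤ.+ 2 ℤ.* b ∣ ℕ.≤ 2 ℕ.* k → ∣ b ∣ ℕ.≤ k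
half-≤ b k h = ℕₚ.*-cancelˡ-≤ 2 (subst (ℕ._≤ 2 ℕ.* k) (ℤₚ.abs-* (ℤ.+ 2) b) h)

half-< : ∀ b n → ∣ ℤ.+ 2 ℤ.* b ∣ ℕ.< 2 ℕ.* n → ∣ b ∣ ℕ.< n
half-< b n h = ℕₚ.*-cancelˡ-< 2 (∣ b ∣) n (subst (ℕ._< 2 ℕ.* n) (ℤₚ.abs-* (ℤ.+ 2) b) h)

ε-lin : ∀ a b → ℤ.+ 2 ℤ.* (a ℤ.+ ℤ.+ 3 ℤ.* b) ≡ ℤ.+ 2 ℤ.* a ℤ.+ ℤ.+ 3 ℤ.* (ℤ.+ 2 ℤ.* b)
ε-lin a b = ℤI.identity (# (ℤ.+ 2) ⊗ (v 0F ⊕ # (ℤ.+ 3) ⊗ v 1F)) (# (ℤ.+ 2) ⊗ v 0F ⊕ # (ℤ.+ 3) ⊗ (# (ℤ.+ 2) ⊗ v 1F)) refl (a ∷ b ∷ [])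
id-lin : ∀ y z → y ≡ ℤ.+ 1 ℤ.* y ℤ.+ ℤ.+ 0 ℤ.* z
id-lin y z = ℤI.identity (v 0F) (# (ℤ.+ 1) ⊗ v 0F ⊕ # (ℤ.+ 0) ⊗ v 1F) refl (y ∷ z ∷ [])
ω-lin₀ : ∀ a b → ℤ.+ 2 ℤ.* a ≡ ℤ.+ 2 ℤ.* a ℤ.+ ℤ.+ 0 ℤ.* (ℤ.+ 2 ℤ.* b)
ω-lin₀ a b = ℤI.identity (# (ℤ.+ 2) ⊗ v 0F) (# (ℤ.+ 2) ⊗ v 0F ⊕ # (ℤ.+ 0) ⊗ (# (ℤ.+ 2) ⊗ v 1F)) refl (a ∷ b ∷ [])

ω-lin : ∀ b c → ℤ.+ 2 ℤ.* (b ℤ.- ℤ.+ 3 ℤ.* c) ≡ ℤ.+ 1 ℤ.* (ℤ.+ 2 ℤ.* b) ℤ.+ -[1+ 2 ] ℤ.* (ℤ.+ 2 ℤ.* c)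
ω-lin b c = ℤI.identity (# (ℤ.+ 2) ⊗ (v 0F ⊖ # (ℤ.+ 3) ⊗ v 1F)) (# (ℤ.+ 1) ⊗ (# (ℤ.+ 2) ⊗ v 0F) ⊕ # -[1+ 2 ] ⊗ (# (ℤ.+ 2) ⊗ v 1F)) refl (b ∷ c ∷ [])

two-first : ∀ a n e t → ℤ.+ 20 ℤ.* a ≡ n ℤ.* e ℤ.+ t → ℤ.+ 40 ℤ.* a ≡ n ℤ.* (ℤ.+ 2 ℤ.* e) ℤ.+ ℤ.+ 2 ℤ.* t
two-first a n e t h₁ = trans (ℤI.identity (# (ℤ.+ 40) ⊗ v 0F) (v 1F ⊗ (# (ℤ.+ 2) ⊗ v 2F) ⊕ # (ℤ.+ 2) ⊗ v 3F ⊕ # (ℤ.+ 2) ⊗ (# (ℤ.+ 20) ⊗ v 0F ⊖ (v 1F ⊗ v 2F ⊕ v 3F))) refl (a ∷ n ∷ e ∷ t ∷ [])) (ℤI.vanish {n ℤ.* (ℤ.+ 2 ℤ.* e) ℤ.+ ℤ.+ 2 ℤ.* t} {ℤ.+ 2} h₁)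
two-other : ∀ b n e t → ℤ.+ 20 ℤ.* (ℤ.+ 2 ℤ.* b) ≡ n ℤ.* e ℤ.+ t → ℤ.+ 40 ℤ.* b ≡ n ℤ.* e ℤ.+ t
two-other b n e t h₁ = trans (ℤI.identity (# (ℤ.+ 40) ⊗ v 0F) (v 1F ⊗ v 2F ⊕ v 3F ⊕ # (ℤ.+ 1) ⊗ (# (ℤ.+ 20) ⊗ (# (ℤ.+ 2) ⊗ v 0F) ⊖ (v 1F ⊗ v 2F ⊕ v 3F))) refl (b ∷ n ∷ e ∷ t ∷ [])) (ℤI.vanish {n ℤ.* e ℤ.+ t} {ℤ.+ 1} h₁)

N-40 : ∀ x → ∣ N x ∣ ≡ 1 → ∣ N (ι (ℤ.+ 40) * x) ∣ ≡ 64000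
N-40 x e = trans (cong ∣_∣ (N-* (ι (ℤ.+ 40)) x)) (trans (ℤₚ.abs-* (N (ι (ℤ.+ 40))) (N x))
  (trans (cong₂ (λ u w → ∣ u ∣ ℕ.* w) (N-ι (ℤ.+ 40)) e) refl))

not-large : ∀ a b c n e f g t u w → ∣ N ⟨ a , b , c ⟩ ∣ ≡ 1 → 10 ℕ.< n →
  ℤ.+ 20 ℤ.* a ≡ ℤ.+ n ℤ.* e ℤ.+ t → ℤ.+ 20 ℤ.* (ℤ.+ 2 ℤ.* b) ≡ ℤ.+ n ℤ.* f ℤ.+ u → ℤ.+ 20 ℤ.* (ℤ.+ 2 ℤ.* c) ≡ ℤ.+ n ℤ.* g ℤ.+ w →
  ∣ t ∣ ℕ.≤ n → ∣ u ∣ ℕ.≤ n → ∣ w ∣ ℕ.≤ n → large? e f g ≡ true → ⊥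
not-large a b c n e f g t u w N≡1 10<n ea eb ec t≤ u≤ w≤ l = ℕₚ.<⇒≱ 10<n (large⇒≤10 n (higher-weight 2 1 1 (ℤ.+ 2 ℤ.* e) f g) K H
    (trans (cong ∣_∣ (sym (trans scaled (N-taylor 2 1 1 (ℤ.+ n) (ℤ.+ 2 ℤ.* e) f g (ℤ.+ 2 ℤ.* t) u w)))) (N-40 ⟨ a , b , c ⟩ N≡1))
    (higher-bound 2 1 1 n (ℤ.+ 2 ℤ.* e) f g (ℤ.+ 2 ℤ.* t) u w (∣*∣≤ {ℤ.+ 2} {t} ℕₚ.≤-refl t≤) (one u u≤) (one w w≤))
    (ℕₚ.≤ᵇ⇒≤ _ _ (≡true⇒T l)))
  where
  K = N ⟨ ℤ.+ 2 ℤ.* e , f , g ⟩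
  H = comb (higher 2 1 1 (ℤ.+ n) (ℤ.+ 2 ℤ.* e) f g (ℤ.+ 2 ℤ.* t) u w)
  one : ∀ x → ∣ x ∣ ℕ.≤ n → ∣ x ∣ ℕ.≤ 1 ℕ.* n
  one x p = subst (∣ x ∣ ℕ.≤_) (sym (ℕₚ.*-identityˡ n)) p
  scaled : N (ι (ℤ.+ 40) * ⟨ a , b , c ⟩) ≡ N ⟨ ℤ.+ n ℤ.* (ℤ.+ 2 ℤ.* e) ℤ.+ ℤ.+ 2 ℤ.* t , ℤ.+ n ℤ.* f ℤ.+ u , ℤ.+ n ℤ.* g ℤ.+ w ⟩
  scaled = cong N (trans (ι-scale (ℤ.+ 40) a b c) (≡𝒪 (two-first a (ℤ.+ n) e t ea) (two-other b (ℤ.+ n) f u eb) (two-other c (ℤ.+ n) g w ec)))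

shell-cases : ∀ {i j k} → i ℕ.< 20 → j ℕ.< 20 → k ℕ.< 20 → shell? i j k ≡ true
shell-cases {i} {j} {k} i< j< k< = allUpTo-sound 20 (λ k → shell? i j k) (allUpTo-sound 20 (λ j → allUpTo 20 λ k → shell? i j k)
  (allUpTo-sound 20 (λ i → allUpTo 20 λ j → allUpTo 20 λ k → shell? i j k) shell-check {i} i<) {j} j<) {k} k<

∨-introˡ : ∀ {a b} → a ≡ true → a ∨ b ≡ true
∨-introˡ refl = refl

∨-introʳ : ∀ a {b} → b ≡ true → a ∨ b ≡ true
∨-introʳ true _ = refl
∨-introʳ false e = e

⊔-attained : ∀ a b c → let n = a ℕ.⊔ (b ℕ.⊔ c) in a ≡ n ⊎ b ≡ n ⊎ c ≡ n
⊔-attained a b c with ℕₚ.⊔-sel a (b ℕ.⊔ c) | ℕₚ.⊔-sel b c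
... | inj₁ p | _ = inj₁ (sym p)
... | inj₂ p | inj₁ q = inj₂ (inj₁ (trans (sym q) (sym p)))
... | inj₂ p | inj₂ q = inj₂ (inj₂ (trans (sym q) (sym p)))

N≡1-* : ∀ u x → N u ≡ ℤ.+ 1 → ∣ N x ∣ ≡ 1 → ∣ N (u * x) ∣ ≡ 1
N≡1-* u x p q = trans (cong ∣_∣ (N-* u x)) (trans (cong (λ w → ∣ w ℤ.* N x ∣) p) (trans (cong ∣_∣ (ℤₚ.*-identityˡ (N x))) q))

-- Replaces the theory of the regulator by reduction: as long as `sup x` exceeds 10, the position of
-- x on the shell shows that multiplication by ε or by ε⁻¹ makes it smaller, because the cells where
-- neither works have too large a norm for a unit. What remains is a finite list.
unit⇒class : ∀ x → ∣ N x ∣ ≡ 1 → UnitClass x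
unit⇒class x = <-rec P step (sup x) x refl
  where
  P : ℕ → Set
  P n = ∀ x → sup x ≡ n → ∣ N x ∣ ≡ 1 → UnitClass x

  step : ∀ n → (∀ {m} → m ℕ.< n → P m) → P n
  step n rec x@(⟨ a , b , c ⟩) refl N≡1 with n ℕ.≤? 10
  ... | yes n≤10 = small-unit-class x (ℕₚ.≤-trans a≤n n≤10) (half-≤ b 5 (ℕₚ.≤-trans b≤n n≤10)) (half-≤ c 5 (ℕₚ.≤-trans c≤n n≤10)) N≡1
    where
    a≤n : ∣ a ∣ ℕ.≤ n
    a≤n = ℕₚ.m≤m⊔n (∣ a ∣) _
    b≤n : ∣ ℤ.+ 2 ℤ.* b ∣ ℕ.≤ n
    b≤n = ℕₚ.≤-trans (ℕₚ.m≤m⊔n _ _) (ℕₚ.m≤n⊔m (∣ a ∣) _)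
    c≤n : ∣ ℤ.+ 2 ℤ.* c ∣ ℕ.≤ n
    c≤n = ℕₚ.≤-trans (ℕₚ.m≤n⊔m (∣ ℤ.+ 2 ℤ.* b ∣) _) (ℕₚ.m≤n⊔m (∣ a ∣) _)
  ... | no n≰10 = go (lattice-point n {{n≢0}} a a≤n) (lattice-point n {{n≢0}} (ℤ.+ 2 ℤ.* b) b≤n) (lattice-point n {{n≢0}} (ℤ.+ 2 ℤ.* c) c≤n)
    where
    10<n : 10 ℕ.< n
    10<n = ℕₚ.≰⇒> n≰10
    n≢0 : ℕ.NonZero n
    n≢0 = ℕ.>-nonZero (ℕₚ.<-trans ℕ.z<s 10<n)
    a≤n : ∣ a ∣ ℕ.≤ n
    a≤n = ℕₚ.m≤m⊔n (∣ a ∣) _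
    b≤n : ∣ ℤ.+ 2 ℤ.* b ∣ ℕ.≤ n
    b≤n = ℕₚ.≤-trans (ℕₚ.m≤m⊔n _ _) (ℕₚ.m≤n⊔m (∣ a ∣) _)
    c≤n : ∣ ℤ.+ 2 ℤ.* c ∣ ℕ.≤ n
    c≤n = ℕₚ.≤-trans (ℕₚ.m≤n⊔m (∣ ℤ.+ 2 ℤ.* b ∣) _) (ℕₚ.m≤n⊔m (∣ a ∣) _)
    n<2n : n ℕ.< 2 ℕ.* n
    n<2n = ℕₚ.m<m+n n (ℕₚ.<-≤-trans (ℕₚ.<-trans ℕ.z<s 10<n) (ℕₚ.≤-reflexive (sym (ℕₚ.+-identityʳ n))))
    go : (∃ λ (l : Lattice n a) → Extreme l) → (∃ λ (l : Lattice n (ℤ.+ 2 ℤ.* b)) → Extreme l) → (∃ λ (l : Lattice n (ℤ.+ 2 ℤ.* c)) → Extreme l) → UnitClass x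
    -- One coordinate attains the supremum, so the cell lies on the outer shell and `shell-check`
    -- applies to it.
    go (lattice i t i< t≤ ea , xa) (lattice j u j< u≤ eb , xb) (lattice k w k< w≤ ec , xc) =
      decide (∨-split (large? e f g) (⇒-elim {boundary i ∨ (boundary j ∨ boundary k)} (shell-cases {i} {j} {k} i< j< k<) on-boundary))
      where
      e = centre i (ℤ.+ 1)
      f = centre j (ℤ.+ 1)
      g = centre k (ℤ.+ 1)
      on-boundary : boundary i ∨ (boundary j ∨ boundary k) ≡ true
      on-boundary with ⊔-attained (∣ a ∣) (∣ ℤ.+ 2 ℤ.* b ∣) (∣ ℤ.+ 2 ℤ.* c ∣)
      ... | inj₁ p = ∨-introˡ (xa p)
      ... | inj₂ (inj₁ p) = ∨-introʳ (boundary i) (∨-introˡ (xb p))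
      ... | inj₂ (inj₂ p) = ∨-introʳ (boundary i) (∨-introʳ (boundary j) (xc p))
      fit : ∀ m p q y y′ {e e′ t t′} → ℤ.+ 20 ℤ.* y ≡ ℤ.+ n ℤ.* e ℤ.+ t → ℤ.+ 20 ℤ.* y′ ≡ ℤ.+ n ℤ.* e′ ℤ.+ t′ →
        ∣ t ∣ ℕ.≤ n → ∣ t′ ∣ ℕ.≤ n → fits? m p q e e′ ≡ true → ∣ p ℤ.* y ℤ.+ q ℤ.* y′ ∣ ℕ.< m ℕ.* n
      fit m p q y y′ {e} {e′} {t} {t′} = fits-sound m p q n {{n≢0}} y y′ e e′ t t′
      small : ∀ {z z′} → z ≡ z′ → ∣ z′ ∣ ℕ.< 1 ℕ.* n → ∣ z ∣ ℕ.< n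
      small refl h = subst (_ ℕ.<_) (ℕₚ.*-identityˡ n) h
      shrink-ε : ε-shrinks? e f g ≡ true → UnitClass x
      shrink-ε h = finish (∧-split (fits? 1 (ℤ.+ 2) (ℤ.+ 3) e f) _ h)
        where
        finish : fits? 1 (ℤ.+ 2) (ℤ.+ 3) e f ≡ true × fits? 1 (ℤ.+ 1) (ℤ.+ 0) f e ≡ true → UnitClass x
        finish (h₁ , h₂) = ε*-class (rec (subst (λ z → sup z ℕ.< n) (sym (ε*-components a b c)) (sup-<
            {c} {a ℤ.+ ℤ.+ 3 ℤ.* b} {b} (half-< c n (ℕₚ.≤-<-trans c≤n n<2n))
            (small (ε-lin a b) (fit 1 (ℤ.+ 2) (ℤ.+ 3) a (ℤ.+ 2 ℤ.* b) ea eb t≤ u≤ h₁))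
            (small (id-lin (ℤ.+ 2 ℤ.* b) a) (fit 1 (ℤ.+ 1) (ℤ.+ 0) (ℤ.+ 2 ℤ.* b) a eb ea u≤ t≤ h₂)))) (ε * x) refl (N≡1-* ε x N-ε N≡1))
      shrink-ω : ω-shrinks? e f g ≡ true → UnitClass x
      shrink-ω h = finish (∧-split (fits? 2 (ℤ.+ 1) -[1+ 2 ] f g) _ h)
        where
        finish : fits? 2 (ℤ.+ 1) -[1+ 2 ] f g ≡ true × (fits? 1 (ℤ.+ 1) (ℤ.+ 0) g e ∧ fits? 1 (ℤ.+ 2) (ℤ.+ 0) e f) ≡ true → UnitClass x
        finish (h₁ , h′) = ω*-class (rec (subst (λ z → sup z ℕ.< n) (sym (ω*-components a b c)) (sup-<
            {b ℤ.- ℤ.+ 3 ℤ.* c} {c} {a} (half-< (b ℤ.- ℤ.+ 3 ℤ.* c) n (subst (λ z → ∣ z ∣ ℕ.< 2 ℕ.* n) (sym (ω-lin b c)) (fit 2 (ℤ.+ 1) -[1+ 2 ] (ℤ.+ 2 ℤ.* b) (ℤ.+ 2 ℤ.* c) eb ec u≤ w≤ h₁)))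
            (small (id-lin (ℤ.+ 2 ℤ.* c) a) (fit 1 (ℤ.+ 1) (ℤ.+ 0) (ℤ.+ 2 ℤ.* c) a ec ea w≤ t≤ (proj₁ h₂₃)))
            (small (ω-lin₀ a b) (fit 1 (ℤ.+ 2) (ℤ.+ 0) a (ℤ.+ 2 ℤ.* b) ea eb t≤ u≤ (proj₂ h₂₃))))) (ω * x) refl (N≡1-* ω x N-ω N≡1))
          where
          h₂₃ : fits? 1 (ℤ.+ 1) (ℤ.+ 0) g e ≡ true × fits? 1 (ℤ.+ 2) (ℤ.+ 0) e f ≡ true
          h₂₃ = ∧-split (fits? 1 (ℤ.+ 1) (ℤ.+ 0) g e) _ h′
      decide : large? e f g ≡ true ⊎ (ε-shrinks? e f g ∨ ω-shrinks? e f g) ≡ true → UnitClass x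
      decide (inj₁ l) = ⊥-elim (not-large a b c n e f g t u w N≡1 10<n ea eb ec t≤ u≤ w≤ l)
      decide (inj₂ s) with ∨-split (ε-shrinks? e f g) s
      ... | inj₁ h = shrink-ε h
      ... | inj₂ h = shrink-ω h

-- coprimality

record Cop (α β : 𝒪) : Set where
  constructor cop
  field
    {u w} : 𝒪
    cop≡ : u * α + w * β ≡ 𝟙

cop-sym′ : ∀ α β u w → u * α + w * β ≡ ι (ℤ.+ 1) → w * β + u * α ≡ ι (ℤ.+ 1)
cop-sym′ α β u w h₁ = trans (𝒪I.identity (v 3F ⊗ v 1F ⊕ v 2F ⊗ v 0F) (# (ℤ.+ 1) ⊕ # (ℤ.+ 1) ⊗ (v 2F ⊗ v 0F ⊕ v 3F ⊗ v 1F ⊖ # (ℤ.+ 1))) refl (α ∷ β ∷ u ∷ w ∷ [])) (𝒪I.vanish h₁)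
cop-*′ : ∀ α β γ u w x y → u * α + w * β ≡ ι (ℤ.+ 1) → x * α + y * γ ≡ ι (ℤ.+ 1) → (u * (x * α + y * γ) + w * x * β) * α + w * y * (β * γ) ≡ ι (ℤ.+ 1)
cop-*′ α β γ u w x y h₁ h₂ = trans (𝒪I.identity ((v 3F ⊗ (v 5F ⊗ v 0F ⊕ v 6F ⊗ v 2F) ⊕ v 4F ⊗ v 5F ⊗ v 1F) ⊗ v 0F ⊕ v 4F ⊗ v 6F ⊗ (v 1F ⊗ v 2F)) (# (ℤ.+ 1) ⊕ (v 5F ⊗ v 0F ⊕ v 6F ⊗ v 2F) ⊗ (v 3F ⊗ v 0F ⊕ v 4F ⊗ v 1F ⊖ # (ℤ.+ 1)) ⊕ # (ℤ.+ 1) ⊗ (v 5F ⊗ v 0F ⊕ v 6F ⊗ v 2F ⊖ # (ℤ.+ 1))) refl (α ∷ β ∷ γ ∷ u ∷ w ∷ x ∷ y ∷ [])) (trans (𝒪I.vanish h₂) (𝒪I.vanish h₁))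
cop-∣′ : ∀ α β k γ u w → u * γ + w * β ≡ ι (ℤ.+ 1) → γ ≡ α * k → u * k * α + w * β ≡ ι (ℤ.+ 1)
cop-∣′ α β k γ u w h₁ h₂ = trans (𝒪I.identity (v 4F ⊗ v 2F ⊗ v 0F ⊕ v 5F ⊗ v 1F) (# (ℤ.+ 1) ⊕ # (ℤ.+ 1) ⊗ (v 4F ⊗ v 3F ⊕ v 5F ⊗ v 1F ⊖ # (ℤ.+ 1)) ⊕ (# (ℤ.+ 0) ⊖ v 4F) ⊗ (v 3F ⊖ v 0F ⊗ v 2F)) refl (α ∷ β ∷ k ∷ γ ∷ u ∷ w ∷ [])) (trans (𝒪I.vanish h₂) (𝒪I.vanish h₁))
euclid′ : ∀ α β γ k u w → u * α + w * β ≡ ι (ℤ.+ 1) → β * γ ≡ α * k → γ ≡ α * (u * γ + w * k)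
euclid′ α β γ k u w h₁ h₂ = trans (𝒪I.identity (v 2F) (v 0F ⊗ (v 4F ⊗ v 2F ⊕ v 5F ⊗ v 3F) ⊕ (# (ℤ.+ 0) ⊖ v 2F) ⊗ (v 4F ⊗ v 0F ⊕ v 5F ⊗ v 1F ⊖ # (ℤ.+ 1)) ⊕ v 5F ⊗ (v 1F ⊗ v 2F ⊖ v 0F ⊗ v 3F)) refl (α ∷ β ∷ γ ∷ k ∷ u ∷ w ∷ [])) (trans (𝒪I.vanish h₂) (𝒪I.vanish h₁))
cop-shift′ : ∀ α β k u w → u * α + w * (β + α * k) ≡ ι (ℤ.+ 1) → (u + w * k) * α + w * β ≡ ι (ℤ.+ 1)
cop-shift′ α β k u w h₁ = trans (𝒪I.identity ((v 3F ⊕ v 4F ⊗ v 2F) ⊗ v 0F ⊕ v 4F ⊗ v 1F) (# (ℤ.+ 1) ⊕ # (ℤ.+ 1) ⊗ (v 3F ⊗ v 0F ⊕ v 4F ⊗ (v 1F ⊕ v 0F ⊗ v 2F) ⊖ # (ℤ.+ 1))) refl (α ∷ β ∷ k ∷ u ∷ w ∷ [])) (𝒪I.vanish h₁)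

cop-sym : ∀ {α β} → Cop α β → Cop β α
cop-sym {α} {β} (cop {u} {w} e) = cop (cop-sym′ α β u w e)

cop-* : ∀ {α β γ} → Cop α β → Cop α γ → Cop α (β * γ)
cop-* {α} {β} {γ} (cop {u} {w} e) (cop {x} {y} f) = cop (cop-*′ α β γ u w x y e f)

cop-∣ˡ : ∀ {α β γ} → α ∣𝒪 γ → Cop γ β → Cop α β
cop-∣ˡ {α} {β} {γ} (k , p) (cop {u} {w} e) = cop (cop-∣′ α β k γ u w e p)

cop-∣ʳ : ∀ {α β γ} → β ∣𝒪 γ → Cop α γ → Cop α β
cop-∣ʳ d c = cop-sym (cop-∣ˡ d (cop-sym c))

cop-shift : ∀ {α β} k → Cop α (β + α * k) → Cop α β
cop-shift {α} {β} k (cop {u} {w} e) = cop (cop-shift′ α β k u w e)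

euclid : ∀ {α β γ} → Cop α β → α ∣𝒪 (β * γ) → α ∣𝒪 γ
euclid {α} {β} {γ} (cop {u} {w} e) (k , p) = _ , euclid′ α β γ k u w e p

cop-𝟙′ : ∀ α → ι (ℤ.+ 0) ≡ ι (ℤ.+ 0) → ι (ℤ.+ 0) * α + ι (ℤ.+ 1) * ι (ℤ.+ 1) ≡ ι (ℤ.+ 1)
cop-𝟙′ α h₁ = trans (𝒪I.identity (# (ℤ.+ 0) ⊗ v 0F ⊕ # (ℤ.+ 1) ⊗ # (ℤ.+ 1)) (# (ℤ.+ 1) ⊕ # (ℤ.+ 1) ⊗ (# (ℤ.+ 0) ⊖ # (ℤ.+ 0))) refl (α ∷ [])) (𝒪I.vanish h₁)
cop-𝟙 : ∀ {α} → Cop α 𝟙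
cop-𝟙 {α} = cop (cop-𝟙′ α refl)

∣-trans′ : ∀ x y z k l → y ≡ x * k → z ≡ y * l → z ≡ x * (k * l)
∣-trans′ x y z k l h₁ h₂ = trans (𝒪I.identity (v 2F) (v 0F ⊗ (v 3F ⊗ v 4F) ⊕ v 4F ⊗ (v 1F ⊖ v 0F ⊗ v 3F) ⊕ # (ℤ.+ 1) ⊗ (v 2F ⊖ v 1F ⊗ v 4F)) refl (x ∷ y ∷ z ∷ k ∷ l ∷ [])) (trans (𝒪I.vanish h₂) (𝒪I.vanish h₁))
∣-trans : ∀ {x y z} → x ∣𝒪 y → y ∣𝒪 z → x ∣𝒪 z
∣-trans {x} {y} {z} (k , p) (l , q) = _ , ∣-trans′ x y z k l p q

∣*ʳ′ : ∀ x y → y * x ≡ x * y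
∣*ʳ′ x y = 𝒪I.identity (v 1F ⊗ v 0F) (v 0F ⊗ v 1F) refl (x ∷ y ∷ [])
∣*ˡ : ∀ {x} y → x ∣𝒪 (x * y)
∣*ˡ y = y , refl
∣*ʳ : ∀ {x} y → x ∣𝒪 (y * x)
∣*ʳ {x} y = y , ∣*ʳ′ x y

-- squares

𝟘≢𝟙 : ¬ 𝟘 ≡ 𝟙
𝟘≢𝟙 e with cong c₁ e
... | ()

*≢𝟘 : ∀ {x y} → ¬ x ≡ 𝟘 → ¬ y ≡ 𝟘 → ¬ x * y ≡ 𝟘
*≢𝟘 x≢0 y≢0 e with x*y≡𝟘 e
... | inj₁ p = x≢0 p
... | inj₂ p = y≢0 p

*𝟘 : ∀ x → x * ι (ℤ.+ 0) ≡ ι (ℤ.+ 0)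
*𝟘 x = 𝒪I.identity (v 0F ⊗ # (ℤ.+ 0)) (# (ℤ.+ 0)) refl (x ∷ [])
𝟘* : ∀ x → ι (ℤ.+ 0) * x ≡ ι (ℤ.+ 0)
𝟘* x = 𝒪I.identity (# (ℤ.+ 0) ⊗ v 0F) (# (ℤ.+ 0)) refl (x ∷ [])

*≢𝟘⇒ˡ : ∀ {x y} → ¬ x * y ≡ 𝟘 → ¬ x ≡ 𝟘
*≢𝟘⇒ˡ {x} {y} n refl = n (𝟘* y)
*≢𝟘⇒ʳ : ∀ {x y} → ¬ x * y ≡ 𝟘 → ¬ y ≡ 𝟘
*≢𝟘⇒ʳ {x} {y} n refl = n (*𝟘 x)

gcd-one : ∀ g α β u w x y → g ≡ u * α + w * β → α ≡ g * x → β ≡ g * y → g * (u * x + w * y) ≡ g * ι (ℤ.+ 1)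
gcd-one g α β u w x y h₁ h₂ h₃ = trans (𝒪I.identity (v 0F ⊗ (v 3F ⊗ v 5F ⊕ v 4F ⊗ v 6F)) (v 0F ⊗ # (ℤ.+ 1) ⊕ (# (ℤ.+ 0) ⊖ # (ℤ.+ 1)) ⊗ (v 0F ⊖ (v 3F ⊗ v 1F ⊕ v 4F ⊗ v 2F)) ⊕ (# (ℤ.+ 0) ⊖ v 3F) ⊗ (v 1F ⊖ v 0F ⊗ v 5F) ⊕ (# (ℤ.+ 0) ⊖ v 4F) ⊗ (v 2F ⊖ v 0F ⊗ v 6F)) refl (g ∷ α ∷ β ∷ u ∷ w ∷ x ∷ y ∷ [])) (trans (𝒪I.vanish h₃) (trans (𝒪I.vanish h₂) (𝒪I.vanish h₁)))

record Gcd (α β : 𝒪) : Set where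
  constructor mk-gcd
  field
    {g α′ β′} : 𝒪
    α≡ : α ≡ g * α′
    β≡ : β ≡ g * β′
    coprime : Cop α′ β′

reduced-gcd : ∀ α β → ¬ α ≡ 𝟘 → Gcd α β
reduced-gcd α β α≢0 = go (gcd α β)
  where
  go : Bézout α β → Gcd α β
  go (bézout {g} {u} {w} (x , p) (y , q) r) = mk-gcd p q (cop (*-cancelˡ (λ g≡0 → α≢0 (trans p (trans (cong (λ z → z * x) g≡0) (𝟘* x)))) (gcd-one g α β u w x y r p q)))

sq-div₁ : ∀ g h x h′ x′ y → x * x ≡ h * h * y → h ≡ g * h′ → x ≡ g * x′ → g * g * (x′ * x′) ≡ g * g * (h′ * h′ * y)
sq-div₁ g h x h′ x′ y h₁ h₂ h₃ = trans (𝒪I.identity (v 0F ⊗ v 0F ⊗ (v 4F ⊗ v 4F)) (v 0F ⊗ v 0F ⊗ (v 3F ⊗ v 3F ⊗ v 5F) ⊕ # (ℤ.+ 1) ⊗ (v 2F ⊗ v 2F ⊖ v 1F ⊗ v 1F ⊗ v 5F) ⊕ (v 1F ⊗ v 5F ⊕ v 0F ⊗ v 3F ⊗ v 5F) ⊗ (v 1F ⊖ v 0F ⊗ v 3F) ⊕ (# (ℤ.+ 0) ⊖ v 2F ⊖ v 0F ⊗ v 4F) ⊗ (v 2F ⊖ v 0F ⊗ v 4F)) refl (g ∷ h ∷ x ∷ h′ ∷ x′ ∷ y ∷ [])) (trans (𝒪I.vanish h₃) (trans (𝒪I.vanish h₂) (𝒪I.vanish h₁)))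
sq-div₂ : ∀ x′ h′ y → x′ * x′ ≡ h′ * h′ * y → x′ * x′ ≡ h′ * (h′ * y)
sq-div₂ x′ h′ y h₁ = trans (𝒪I.identity (v 0F ⊗ v 0F) (v 1F ⊗ (v 1F ⊗ v 2F) ⊕ # (ℤ.+ 1) ⊗ (v 0F ⊗ v 0F ⊖ v 1F ⊗ v 1F ⊗ v 2F)) refl (x′ ∷ h′ ∷ y ∷ [])) (𝒪I.vanish h₁)
sq-div₃ : ∀ g h x h′ x′ k → h ≡ g * h′ → x ≡ g * x′ → ι (ℤ.+ 1) ≡ h′ * k → x ≡ h * (k * x′)
sq-div₃ g h x h′ x′ k h₁ h₂ h₃ = trans (𝒪I.identity (v 2F) (v 1F ⊗ (v 5F ⊗ v 4F) ⊕ (# (ℤ.+ 0) ⊖ v 5F ⊗ v 4F) ⊗ (v 1F ⊖ v 0F ⊗ v 3F) ⊕ # (ℤ.+ 1) ⊗ (v 2F ⊖ v 0F ⊗ v 4F) ⊕ v 0F ⊗ v 4F ⊗ (# (ℤ.+ 1) ⊖ v 3F ⊗ v 5F)) refl (g ∷ h ∷ x ∷ h′ ∷ x′ ∷ k ∷ [])) (trans (𝒪I.vanish h₃) (trans (𝒪I.vanish h₂) (𝒪I.vanish h₁)))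
x*𝟙 : ∀ x → x * ι (ℤ.+ 1) ≡ x
x*𝟙 x = 𝒪I.identity (v 0F ⊗ # (ℤ.+ 1)) (v 0F) refl (x ∷ [])

-- After division by the greatest common divisor, h′ is coprime to x′ and divides x′², so h′ is a
-- unit.
sq-divides : ∀ {h x y} → ¬ h ≡ 𝟘 → x * x ≡ h * h * y → h ∣𝒪 x
sq-divides {h} {x} {y} h≢0 e = go (reduced-gcd h x h≢0)
  where
  go : Gcd h x → h ∣𝒪 x
  go (mk-gcd {g} {h′} {x′} p q c) = _ , sq-div₃ g h x h′ x′ (proj₁ h′∣1) p q (proj₂ h′∣1)
    where
    g≢0 : ¬ g ≡ 𝟘
    g≢0 g≡0 = h≢0 (trans p (trans (cong (λ z → z * h′) g≡0) (𝟘* h′)))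
    h′∣1 : h′ ∣𝒪 𝟙
    h′∣1 = euclid (cop-* c c) (subst (h′ ∣𝒪_) (sym (x*𝟙 (x′ * x′))) (_ , sq-div₂ x′ h′ y (*-cancelˡ (*≢𝟘 g≢0 g≢0) (sq-div₁ g h x h′ x′ y e p q))))

unit-norm : ∀ {x y} → x * y ≡ 𝟙 → ∣ N x ∣ ≡ 1
unit-norm {x} {y} e = ℕₚ.m*n≡1⇒m≡1 (∣ N x ∣) (∣ N y ∣) (trans (sym (ℤₚ.abs-* (N x) (N y))) (cong ∣_∣ (trans (sym (N-* x y)) (trans (cong N e) (N-ι (ℤ.+ 1))))))

unit-inverse : ∀ s j → ∃ λ i → (-𝟙 ⁺ s * ε ⁺ j) * i ≡ 𝟙
unit-inverse s j = -𝟙 ⁺ s * ω ⁺ j , inv s j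
  where
  inv₂ : ∀ m e w → m * m ≡ 𝟙 → w * e ≡ 𝟙 → (m * e) * (m * w) ≡ 𝟙
  inv₂′ : ∀ m e w → m * m ≡ ι (ℤ.+ 1) → w * e ≡ ι (ℤ.+ 1) → m * e * (m * w) ≡ ι (ℤ.+ 1)
  inv₂′ m e w h₁ h₂ = trans (𝒪I.identity (v 0F ⊗ v 1F ⊗ (v 0F ⊗ v 2F)) (# (ℤ.+ 1) ⊕ v 2F ⊗ v 1F ⊗ (v 0F ⊗ v 0F ⊖ # (ℤ.+ 1)) ⊕ # (ℤ.+ 1) ⊗ (v 2F ⊗ v 1F ⊖ # (ℤ.+ 1))) refl (m ∷ e ∷ w ∷ [])) (trans (𝒪I.vanish h₂) (𝒪I.vanish h₁))
  inv₂ = inv₂′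
  sq : ∀ s → -𝟙 ⁺ s * -𝟙 ⁺ s ≡ 𝟙
  sq true = -𝟙*-𝟙
  sq false = *-identityˡ 𝟙
  ωε : ∀ j → ω ⁺ j * ε ⁺ j ≡ 𝟙
  ωε true = ω*ε
  ωε false = *-identityˡ 𝟙
  inv : ∀ s j → (-𝟙 ⁺ s * ε ⁺ j) * (-𝟙 ⁺ s * ω ⁺ j) ≡ 𝟙
  inv s j = inv₂ (-𝟙 ⁺ s) (ε ⁺ j) (ω ⁺ j) (sq s) (ωε j)

cps₁ : ∀ α β γ δ u w → α * β ≡ γ * γ → δ ≡ u * α + w * γ → δ * δ ≡ α * (u * u * α + ι (ℤ.+ 2) * u * w * γ + w * w * β)
cps₁ α β γ δ u w h₁ h₂ = trans (𝒪I.identity (v 3F ⊗ v 3F) (v 0F ⊗ (v 4F ⊗ v 4F ⊗ v 0F ⊕ # (ℤ.+ 2) ⊗ v 4F ⊗ v 5F ⊗ v 2F ⊕ v 5F ⊗ v 5F ⊗ v 1F) ⊕ (# (ℤ.+ 0) ⊖ v 5F ⊗ v 5F) ⊗ (v 0F ⊗ v 1F ⊖ v 2F ⊗ v 2F) ⊕ (v 3F ⊕ v 4F ⊗ v 0F ⊕ v 5F ⊗ v 2F) ⊗ (v 3F ⊖ (v 4F ⊗ v 0F ⊕ v 5F ⊗ v 2F))) refl (α ∷ β ∷ γ ∷ δ ∷ u ∷ w ∷ [])) (trans (𝒪I.vanish h₂) (𝒪I.vanish h₁))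
cps₂ : ∀ α β γ δ x y s t → α * β ≡ γ * γ → α ≡ δ * x → γ ≡ δ * y → s * α + t * β ≡ ι (ℤ.+ 1) → α ≡ δ * δ * (s * x * x + t * y * y)
cps₂ α β γ δ x y s t h₁ h₂ h₃ h₄ = trans (𝒪I.identity (v 0F) (v 3F ⊗ v 3F ⊗ (v 6F ⊗ v 4F ⊗ v 4F ⊕ v 7F ⊗ v 5F ⊗ v 5F) ⊕ v 7F ⊗ (v 0F ⊗ v 1F ⊖ v 2F ⊗ v 2F) ⊕ (v 6F ⊗ v 0F ⊕ v 6F ⊗ v 3F ⊗ v 4F) ⊗ (v 0F ⊖ v 3F ⊗ v 4F) ⊕ (v 7F ⊗ v 2F ⊕ v 7F ⊗ v 3F ⊗ v 5F) ⊗ (v 2F ⊖ v 3F ⊗ v 5F) ⊕ (# (ℤ.+ 0) ⊖ v 0F) ⊗ (v 6F ⊗ v 0F ⊕ v 7F ⊗ v 1F ⊖ # (ℤ.+ 1))) refl (α ∷ β ∷ γ ∷ δ ∷ x ∷ y ∷ s ∷ t ∷ [])) (trans (𝒪I.vanish h₄) (trans (𝒪I.vanish h₃) (trans (𝒪I.vanish h₂) (𝒪I.vanish h₁))))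
cps₃ : ∀ α δ x y → δ * δ ≡ α * x → α ≡ δ * δ * y → α * (y * x) ≡ α * ι (ℤ.+ 1)
cps₃ α δ x y h₁ h₂ = trans (𝒪I.identity (v 0F ⊗ (v 3F ⊗ v 2F)) (v 0F ⊗ # (ℤ.+ 1) ⊕ (# (ℤ.+ 0) ⊖ v 3F) ⊗ (v 1F ⊗ v 1F ⊖ v 0F ⊗ v 2F) ⊕ (# (ℤ.+ 0) ⊖ # (ℤ.+ 1)) ⊗ (v 0F ⊖ v 1F ⊗ v 1F ⊗ v 3F)) refl (α ∷ δ ∷ x ∷ y ∷ [])) (trans (𝒪I.vanish h₂) (𝒪I.vanish h₁))
cps₄ : ∀ α δ y c r → α ≡ δ * δ * y → y ≡ c * (r * r) → α ≡ c * (r * δ * (r * δ))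
cps₄ α δ y c r h₁ h₂ = trans (𝒪I.identity (v 0F) (v 3F ⊗ (v 4F ⊗ v 1F ⊗ (v 4F ⊗ v 1F)) ⊕ # (ℤ.+ 1) ⊗ (v 0F ⊖ v 1F ⊗ v 1F ⊗ v 2F) ⊕ v 1F ⊗ v 1F ⊗ (v 2F ⊖ v 3F ⊗ (v 4F ⊗ v 4F))) refl (α ∷ δ ∷ y ∷ c ∷ r ∷ [])) (trans (𝒪I.vanish h₂) (𝒪I.vanish h₁))

-- A factor of a square that is coprime to its cofactor is a unit times a square.
coprime-factor : ∀ {α β γ} → ¬ α ≡ 𝟘 → Cop α β → α * β ≡ γ * γ → UnitClass α
coprime-factor {α} {β} {γ} α≢0 (cop {s} {t} c) e = go (gcd α γ)
  where
  go : Bézout α γ → UnitClass α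
  go (bézout {δ} {u} {w} (x , p) (y , q) r) = finish (unit⇒class _ (unit-norm (*-cancelˡ α≢0 (cps₃ α δ _ _ δ² α≡))))
    where
    -- Here δ is a greatest common divisor of α and γ. It turns out that α divides δ² because γ² =
    -- αβ, and δ² divides α because α and β are coprime; so α is δ² times a unit.
    δ² = cps₁ α β γ δ u w e r
    α≡ = cps₂ α β γ δ x y s t e p q c
    finish : UnitClass (s * x * x + t * y * y) → UnitClass α
    finish (unit-class {σ} {j} {z} f) = unit-class {sgn = σ} {par = j} (cps₄ α δ _ (-𝟙 ⁺ σ * ε ⁺ j) z α≡ f)

-- the primes above 2, 3 and 5

record Prime𝒪 (π : 𝒪) : Set where
  field
    split : ∀ x → π ∣𝒪 x ⊎ Cop x π
    norm≥2 : 2 ℕ.≤ ∣ N π ∣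

-- The relations are θ³ = -3ε and ρ₅²π₅ = 5, while 2 stays prime. The same θ = 1 - ε is the root of
-- t³ - 3t + 3 that occurs in the linear form u - θw.
𝟚 θ π₅ ρ₅ : 𝒪
𝟚 = ι (ℤ.+ 2)
θ = ⟨ ℤ.+ 1 , -[1+ 0 ] , ℤ.+ 0 ⟩
π₅ = ⟨ ℤ.+ 1 , ℤ.+ 1 , ℤ.+ 0 ⟩
ρ₅ = ⟨ ℤ.+ 2 , -[1+ 0 ] , ℤ.+ 0 ⟩

opaque
  unfolding _+_ _*_ -_
  decompose : ∀ a b c → ⟨ a , b , c ⟩ ≡ ι a + ι b * ε + ι c * ω
  decompose a b c = components x₃ ((⟪ v 0F , # (ℤ.+ 0) , # (ℤ.+ 0) ⟫ ⊞ (⟪ v 1F , # (ℤ.+ 0) , # (ℤ.+ 0) ⟫ ⊠ ⟪ # (ℤ.+ 0) , # (ℤ.+ 1) , # (ℤ.+ 0) ⟫))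
    ⊞ (⟪ v 2F , # (ℤ.+ 0) , # (ℤ.+ 0) ⟫ ⊠ ⟪ # (ℤ.+ 0) , # (ℤ.+ 0) , # (ℤ.+ 1) ⟫)) refl refl refl (a ∷ b ∷ c ∷ a ∷ b ∷ c ∷ a ∷ b ∷ c ∷ [])

-- A prime of degree one, described by its residue map onto the field of p elements: ε and ω map to
-- e and w, and `inverses` records that each nonzero residue modulo p is invertible.
record ResiduePrime : Set where
  field
    π : 𝒪
    p : ℕ
    {{p≢0}} : ℕ.NonZero p
    e w : ℤ
    kε kω cofactor : 𝒪
    ε≡ : ε ≡ ι e + π * kε
    ω≡ : ω ≡ ι w + π * kω
    p≡ : ι (ℤ.+ p) ≡ π * cofactor
    inverses : allUpTo p (λ r → (r ℕ.≡ᵇ 0) ∨ not (allUpTo p λ i → not ((i ℕ.* r) ℕ.% p ℕ.≡ᵇ 1))) ≡ true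
    2≤norm : 2 ℕ.≤ ∣ N π ∣

  residueℤ : 𝒪 → ℤ
  residueℤ ⟨ a , b , c ⟩ = a ℤ.+ b ℤ.* e ℤ.+ c ℤ.* w

  residueℕ : 𝒪 → ℕ
  residueℕ x = residueℤ x ℤD.%ℕ p

  res′ : ∀ a b c E W e w π k l → E ≡ e + π * k → W ≡ w + π * l → a + b * E + c * W ≡ a + b * e + c * w + π * (b * k + c * l)
  res′ a b c E W e w π k l h₁ h₂ = trans (𝒪I.identity (v 0F ⊕ v 1F ⊗ v 3F ⊕ v 2F ⊗ v 4F) (v 0F ⊕ v 1F ⊗ v 5F ⊕ v 2F ⊗ v 6F ⊕ v 7F ⊗ (v 1F ⊗ v 8F ⊕ v 2F ⊗ v 9F) ⊕ v 1F ⊗ (v 3F ⊖ (v 5F ⊕ v 7F ⊗ v 8F)) ⊕ v 2F ⊗ (v 4F ⊖ (v 6F ⊕ v 7F ⊗ v 9F))) refl (a ∷ b ∷ c ∷ E ∷ W ∷ e ∷ w ∷ π ∷ k ∷ l ∷ [])) (trans (𝒪I.vanish h₂) (𝒪I.vanish h₁))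
  red′ : ∀ r q p π c → p ≡ π * c → r + q * p ≡ r + π * (q * c)
  red′ r q p π c h₁ = trans (𝒪I.identity (v 0F ⊕ v 1F ⊗ v 2F) (v 0F ⊕ v 3F ⊗ (v 1F ⊗ v 4F) ⊕ v 1F ⊗ (v 2F ⊖ v 3F ⊗ v 4F)) refl (r ∷ q ∷ p ∷ π ∷ c ∷ [])) (𝒪I.vanish h₁)

  ≈residueℤ : ∀ x → x ≈ ι (residueℤ x) [ π ]
  ≈residueℤ ⟨ a , b , c ⟩ = ≈-trans (≡⇒≈ (decompose a b c)) (≈-trans (by _ (res′ (ι a) (ι b) (ι c) ε ω (ι e) (ι w) π kε kω ε≡ ω≡))
    (≡⇒≈ (sym (trans (ι-+ (a ℤ.+ b ℤ.* e) (c ℤ.* w)) (cong₂ _+_ (trans (ι-+ a (b ℤ.* e)) (cong (λ z → ι a + z) (ι-* b e))) (ι-* c w))))))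

  ≈residue : ∀ x → x ≈ ι (ℤ.+ residueℕ x) [ π ]
  ≈residue x = ≈-trans (≈residueℤ x) (≈-trans (≡⇒≈ (trans (cong ι (ℤD.a≡a%ℕn+[a/ℕn]*n (residueℤ x) p)) (trans (ι-+ _ _) (cong (λ z → ι (ℤ.+ residueℕ x) + z) (ι-* _ (ℤ.+ p))))))
    (by _ (red′ (ι (ℤ.+ residueℕ x)) (ι (residueℤ x ℤD./ℕ p)) (ι (ℤ.+ p)) π cofactor p≡)))

  inv′ : ∀ x r π k i t p c → x ≡ r + π * k → i * r ≡ ι (ℤ.+ 1) + t * p → p ≡ π * c → i * x + (ι (ℤ.+ 0) - (i * k + t * c)) * π ≡ ι (ℤ.+ 1)
  inv′ x r π k i t p c h₁ h₂ h₃ = trans (𝒪I.identity (v 4F ⊗ v 0F ⊕ (# (ℤ.+ 0) ⊖ (v 4F ⊗ v 3F ⊕ v 5F ⊗ v 7F)) ⊗ v 2F) (# (ℤ.+ 1) ⊕ v 4F ⊗ (v 0F ⊖ (v 1F ⊕ v 2F ⊗ v 3F)) ⊕ # (ℤ.+ 1) ⊗ (v 4F ⊗ v 1F ⊖ (# (ℤ.+ 1) ⊕ v 5F ⊗ v 6F)) ⊕ v 5F ⊗ (v 6F ⊖ v 2F ⊗ v 7F)) refl (x ∷ r ∷ π ∷ k ∷ i ∷ t ∷ p ∷ c ∷ [])) (trans (𝒪I.vanish h₃) (trans (𝒪I.vanish h₂) (𝒪I.vanish h₁)))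

  invertible : ∀ x i t → ι (ℤ.+ i) * ι (ℤ.+ residueℕ x) ≡ 𝟙 + ι (ℤ.+ t) * ι (ℤ.+ p) → Cop x π
  invertible x i t h = go (≈residue x)
    where
    go : x ≈ ι (ℤ.+ residueℕ x) [ π ] → Cop x π
    go (by k q) = cop (inv′ x (ι (ℤ.+ residueℕ x)) π k (ι (ℤ.+ i)) (ι (ℤ.+ t)) (ι (ℤ.+ p)) cofactor q h p≡)

  ι-euclid : ∀ m n t → m ℕ.* n ≡ 1 ℕ.+ t ℕ.* p → ι (ℤ.+ m) * ι (ℤ.+ n) ≡ 𝟙 + ι (ℤ.+ t) * ι (ℤ.+ p)
  ι-euclid m n t h = trans (sym (ι-* (ℤ.+ m) (ℤ.+ n))) (trans (cong ι (trans (sym (ℤₚ.pos-* m n)) (trans (cong ℤ.+_ h) (trans (ℤₚ.pos-+ 1 (t ℕ.* p)) (cong (λ z → ℤ.+ 1 ℤ.+ z) (ℤₚ.pos-* t p))))))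
    (trans (ι-+ (ℤ.+ 1) (ℤ.+ t ℤ.* ℤ.+ p)) (cong (λ z → 𝟙 + z) (ι-* (ℤ.+ t) (ℤ.+ p)))))

  find : ∀ n (f : ℕ → Bool) → not (allUpTo n λ i → not (f i)) ≡ true → ∃ λ i → f i ≡ true
  find zero f ()
  find (suc n) f e with f n in q
  ... | true = n , q
  ... | false = find n f e

  residue-split : ∀ x → residueℕ x ≡ 0 ⊎ Cop x π
  residue-split x = go (∨-split (residueℕ x ℕ.≡ᵇ 0) (allUpTo-sound p _ inverses (ℤD.n%ℕd<d (residueℤ x) p)))
    where
    go : (residueℕ x ℕ.≡ᵇ 0) ≡ true ⊎ not (allUpTo p λ i → not ((i ℕ.* residueℕ x) ℕ.% p ℕ.≡ᵇ 1)) ≡ true → residueℕ x ≡ 0 ⊎ Cop x π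
    go (inj₁ z) = inj₁ (ℕₚ.≡ᵇ⇒≡ _ 0 (≡true⇒T z))
    go (inj₂ h) = found (find p _ h)
      where
      found : (∃ λ i → ((i ℕ.* residueℕ x) ℕ.% p ℕ.≡ᵇ 1) ≡ true) → residueℕ x ≡ 0 ⊎ Cop x π
      found (i , q) = inj₂ (invertible x i (i ℕ.* residueℕ x ℕ./ p) (ι-euclid i (residueℕ x) _
        (trans (ℕD.m≡m%n+[m/n]*n (i ℕ.* residueℕ x) p) (cong (ℕ._+ i ℕ.* residueℕ x ℕ./ p ℕ.* p) (ℕₚ.≡ᵇ⇒≡ ((i ℕ.* residueℕ x) ℕ.% p) 1 (≡true⇒T q))))))

  residue≡0⇒∣ : ∀ x → residueℕ x ≡ 0 → π ∣𝒪 x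
  residue≡0⇒∣ x z = ≈0⇒∣ (≈-trans (≈residue x) (≡⇒≈ (cong (λ r → ι (ℤ.+ r)) z)))

  split : ∀ x → π ∣𝒪 x ⊎ Cop x π
  split x with residue-split x
  ... | inj₁ z = inj₁ (residue≡0⇒∣ x z)
  ... | inj₂ c = inj₂ c

  not-both : ∀ {x} → π ∣𝒪 x → Cop x π → ⊥
  not-both {x} (k , p) (cop {u} {w} c) = ℕₚ.<⇒≱ 2≤norm (ℕₚ.≤-reflexive (unit-norm (both′ x π k u w p c)))
    where
    both′ : ∀ x π k u w → x ≡ π * k → u * x + w * π ≡ ι (ℤ.+ 1) → π * (u * k + w) ≡ ι (ℤ.+ 1)
    both′ x π k u w h₁ h₂ = trans (𝒪I.identity (v 1F ⊗ (v 3F ⊗ v 2F ⊕ v 4F)) (# (ℤ.+ 1) ⊕ (# (ℤ.+ 0) ⊖ v 3F) ⊗ (v 0F ⊖ v 1F ⊗ v 2F) ⊕ # (ℤ.+ 1) ⊗ (v 3F ⊗ v 0F ⊕ v 4F ⊗ v 1F ⊖ # (ℤ.+ 1))) refl (x ∷ π ∷ k ∷ u ∷ w ∷ [])) (trans (𝒪I.vanish h₂) (𝒪I.vanish h₁))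

  ∣⇒residue≡0 : ∀ x → π ∣𝒪 x → residueℕ x ≡ 0
  ∣⇒residue≡0 x d with residue-split x
  ... | inj₁ z = z
  ... | inj₂ c = ⊥-elim (not-both d c)

  prime : Prime𝒪 π
  prime = record { split = split ; norm≥2 = 2≤norm }

opaque
  unfolding _+_ _*_ -_ N

  θ-ε : ε ≡ 𝟙 + θ * -𝟙
  θ-ε = refl
  θ-ω : ω ≡ 𝟙 + θ * ω
  θ-ω = refl
  θ∣3 : ι (ℤ.+ 3) ≡ θ * ⟨ ℤ.+ 2 , -[1+ 0 ] , -[1+ 0 ] ⟩
  θ∣3 = refl
  π₅-ε : ε ≡ -𝟙 + π₅ * 𝟙
  π₅-ε = refl
  π₅-ω : ω ≡ -𝟙 + π₅ * ω
  π₅-ω = refl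
  π₅∣5 : ι (ℤ.+ 5) ≡ π₅ * ⟨ ℤ.+ 4 , -[1+ 0 ] , ℤ.+ 1 ⟩
  π₅∣5 = refl
  ρ₅-ε : ε ≡ ι (ℤ.+ 2) + ρ₅ * -𝟙
  ρ₅-ε = refl
  ρ₅-ω : ω ≡ ι (ℤ.+ 3) + ρ₅ * ⟨ -[1+ 0 ] , ℤ.+ 1 , ℤ.+ 1 ⟩
  ρ₅-ω = refl
  ρ₅∣5 : ι (ℤ.+ 5) ≡ ρ₅ * ⟨ ℤ.+ 2 , -[1+ 1 ] , -[1+ 0 ] ⟩
  ρ₅∣5 = refl
  N-θ : 2 ℕ.≤ ∣ N θ ∣
  N-θ = ℕ.s≤s (ℕ.s≤s ℕ.z≤n)
  N-π₅ : 2 ℕ.≤ ∣ N π₅ ∣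
  N-π₅ = ℕ.s≤s (ℕ.s≤s ℕ.z≤n)
  N-ρ₅ : 2 ℕ.≤ ∣ N ρ₅ ∣
  N-ρ₅ = ℕ.s≤s (ℕ.s≤s ℕ.z≤n)
  N-𝟚 : 2 ℕ.≤ ∣ N 𝟚 ∣
  N-𝟚 = ℕ.s≤s (ℕ.s≤s ℕ.z≤n)

at-θ at-π₅ at-ρ₅ : ResiduePrime
at-θ = record { π = θ ; p = 3 ; e = ℤ.+ 1 ; w = ℤ.+ 1 ; ε≡ = θ-ε ; ω≡ = θ-ω ; p≡ = θ∣3 ; inverses = refl ; 2≤norm = N-θ }
at-π₅ = record { π = π₅ ; p = 5 ; e = -[1+ 0 ] ; w = -[1+ 0 ] ; ε≡ = π₅-ε ; ω≡ = π₅-ω ; p≡ = π₅∣5 ; inverses = refl ; 2≤norm = N-π₅ }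
at-ρ₅ = record { π = ρ₅ ; p = 5 ; e = ℤ.+ 2 ; w = ℤ.+ 3 ; ε≡ = ρ₅-ε ; ω≡ = ρ₅-ω ; p≡ = ρ₅∣5 ; inverses = refl ; 2≤norm = N-ρ₅ }

odd-cop : ∀ x c n q → x * c ≡ n → n ≡ ι (ℤ.+ 1) + ι (ℤ.+ 2) * q → c * x + (ι (ℤ.+ 0) - q) * ι (ℤ.+ 2) ≡ ι (ℤ.+ 1)
odd-cop x c n q h₁ h₂ = trans (𝒪I.identity (v 1F ⊗ v 0F ⊕ (# (ℤ.+ 0) ⊖ v 3F) ⊗ # (ℤ.+ 2)) (# (ℤ.+ 1) ⊕ # (ℤ.+ 1) ⊗ (v 0F ⊗ v 1F ⊖ v 2F) ⊕ # (ℤ.+ 1) ⊗ (v 2F ⊖ (# (ℤ.+ 1) ⊕ # (ℤ.+ 2) ⊗ v 3F))) refl (x ∷ c ∷ n ∷ q ∷ [])) (trans (𝒪I.vanish h₂) (𝒪I.vanish h₁))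

prime-𝟚 : Prime𝒪 𝟚
prime-𝟚 = record { split = split ; norm≥2 = N-𝟚 }
  where
  split : ∀ x → 𝟚 ∣𝒪 x ⊎ Cop x 𝟚
  split x = go (N x ℤD.%ℕ 2) refl (ℤD.n%ℕd<d (N x) 2)
    where
    expand : ∀ r → r ≡ N x ℤD.%ℕ 2 → N x ≡ ℤ.+ r ℤ.+ ℤ.+ 2 ℤ.* (N x ℤD./ℕ 2)
    expand r e = trans (ℤD.a≡a%ℕn+[a/ℕn]*n (N x) 2) (cong₂ (λ s q → ℤ.+ s ℤ.+ q) (sym e) (ℤₚ.*-comm (N x ℤD./ℕ 2) (ℤ.+ 2)))
    go : ∀ r → r ≡ N x ℤD.%ℕ 2 → r ℕ.< 2 → 𝟚 ∣𝒪 x ⊎ Cop x 𝟚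
    go 0 e _ = inj₁ (2∣N⇒2∣ x (N x ℤD./ℕ 2) (trans (expand 0 e) (ℤₚ.+-identityˡ _)))
    go 1 e _ = inj₂ (cop (odd-cop x (x ♯) (ι (N x)) (ι (N x ℤD./ℕ 2)) (*♯ x)
      (trans (cong ι (expand 1 e)) (trans (ι-+ (ℤ.+ 1) (ℤ.+ 2 ℤ.* (N x ℤD./ℕ 2))) (cong (λ z → 𝟙 + z) (ι-* (ℤ.+ 2) (N x ℤD./ℕ 2)))))))
    go (suc (suc r)) e (ℕ.s≤s (ℕ.s≤s ()))

-- removing the prime factors π

record Stripped (π P : 𝒪) : Set where
  constructor stripped
  field
    par : Bool
    r P′ : 𝒪
    P≡ : P ≡ π ⁺ par * (r * r) * P′
    cop-π : Cop P′ π

strip₀ : ∀ P → P ≡ P → P ≡ ι (ℤ.+ 1) * (ι (ℤ.+ 1) * ι (ℤ.+ 1)) * P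
strip₀ P h₁ = trans (𝒪I.identity (v 0F) (# (ℤ.+ 1) ⊗ (# (ℤ.+ 1) ⊗ # (ℤ.+ 1)) ⊗ v 0F ⊕ # (ℤ.+ 0) ⊗ (v 0F ⊖ v 0F)) refl (P ∷ [])) (𝒪I.vanish h₁)
strip₁ : ∀ P π r P₁ P′ → P ≡ π * P₁ → P₁ ≡ π * (r * r) * P′ → P ≡ ι (ℤ.+ 1) * (π * r * (π * r)) * P′
strip₁ P π r P₁ P′ h₁ h₂ = trans (𝒪I.identity (v 0F) (# (ℤ.+ 1) ⊗ (v 1F ⊗ v 2F ⊗ (v 1F ⊗ v 2F)) ⊗ v 4F ⊕ # (ℤ.+ 1) ⊗ (v 0F ⊖ v 1F ⊗ v 3F) ⊕ v 1F ⊗ (v 3F ⊖ v 1F ⊗ (v 2F ⊗ v 2F) ⊗ v 4F)) refl (P ∷ π ∷ r ∷ P₁ ∷ P′ ∷ [])) (trans (𝒪I.vanish h₂) (𝒪I.vanish h₁))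
strip₂ : ∀ P π r P₁ P′ → P ≡ π * P₁ → P₁ ≡ ι (ℤ.+ 1) * (r * r) * P′ → P ≡ π * (r * r) * P′
strip₂ P π r P₁ P′ h₁ h₂ = trans (𝒪I.identity (v 0F) (v 1F ⊗ (v 2F ⊗ v 2F) ⊗ v 4F ⊕ # (ℤ.+ 1) ⊗ (v 0F ⊖ v 1F ⊗ v 3F) ⊕ v 1F ⊗ (v 3F ⊖ # (ℤ.+ 1) ⊗ (v 2F ⊗ v 2F) ⊗ v 4F)) refl (P ∷ π ∷ r ∷ P₁ ∷ P′ ∷ [])) (trans (𝒪I.vanish h₂) (𝒪I.vanish h₁))

strip : ∀ {π} → Prime𝒪 π → ∀ P → ¬ P ≡ 𝟘 → Stripped π P
strip {π} pr P P≢0 = <-rec A step ∣ N P ∣ P refl P≢0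
  where
  open Prime𝒪 pr
  A : ℕ → Set
  A k = ∀ P → ∣ N P ∣ ≡ k → ¬ P ≡ 𝟘 → Stripped π P
  step : ∀ k → (∀ {j} → j ℕ.< k → A j) → A k
  step k rec P e P≢0 = go (Prime𝒪.split pr P)
    where
    go : π ∣𝒪 P ⊎ Cop P π → Stripped π P
    go (inj₂ c) = stripped false 𝟙 P (strip₀ P refl) c
    go (inj₁ (P₁ , q)) = extend (rec smaller P₁ refl P₁≢0)
      where
      P₁≢0 : ¬ P₁ ≡ 𝟘
      P₁≢0 z = P≢0 (trans q (trans (cong (λ x → π * x) z) (*𝟘 π)))
      smaller : ∣ N P₁ ∣ ℕ.< k
      smaller = subst (∣ N P₁ ∣ ℕ.<_) (trans (sym (trans (cong (λ x → ∣ N x ∣) q) (trans (cong ∣_∣ (N-* π P₁)) (ℤₚ.abs-* (N π) (N P₁))))) e)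
        (ℕₚ.<-≤-trans (ℕₚ.m<m+n (∣ N P₁ ∣) {∣ N P₁ ∣ ℕ.+ 0} (ℕₚ.<-≤-trans (ℕₚ.n≢0⇒n>0 (λ z → P₁≢0 (N≡0⇒≡𝟘 P₁ (ℤₚ.∣i∣≡0⇒i≡0 z)))) (ℕₚ.m≤m+n _ 0))) (ℕₚ.*-monoˡ-≤ (∣ N P₁ ∣) norm≥2))
      extend : Stripped π P₁ → Stripped π P
      extend (stripped true r P′ f c) = stripped false (π * r) P′ (strip₁ P π r P₁ P′ q f) c
      extend (stripped false r P′ f c) = stripped true r P′ (strip₂ P π r P₁ P′ q f) c

-- square classes supported at the units and the primes above 2, 3, 5

record Class : Set where
  constructor cls
  field s-1 sε s2 sθ sρ sπ : Bool

⟦_⟧ᶜ : Class → 𝒪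
⟦ cls n e t h q p ⟧ᶜ = -𝟙 ⁺ n * ε ⁺ e * (𝟚 ⁺ t * θ ⁺ h * ρ₅ ⁺ q * π₅ ⁺ p)

record CopS (x : 𝒪) : Set where
  constructor copS
  field
    cop-2 : Cop x 𝟚
    cop-θ : Cop x θ
    cop-ρ : Cop x ρ₅
    cop-π : Cop x π₅

cop-⁺ : ∀ {x π} b → Cop x π → Cop x (π ⁺ b)
cop-⁺ true c = c
cop-⁺ false c = cop-𝟙

strip-all : ∀ P a b c d k l m n P₁ P₂ P₃ P₄ → P ≡ a * (k * k) * P₁ → P₁ ≡ b * (l * l) * P₂ → P₂ ≡ c * (m * m) * P₃ → P₃ ≡ d * (n * n) * P₄ → P ≡ a * b * c * d * (k * l * m * n * (k * l * m * n)) * P₄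
strip-all P a b c d k l m n P₁ P₂ P₃ P₄ h₁ h₂ h₃ h₄ = trans (𝒪I.identity (v 0F) (v 1F ⊗ v 2F ⊗ v 3F ⊗ v 4F ⊗ (v 5F ⊗ v 6F ⊗ v 7F ⊗ v 8F ⊗ (v 5F ⊗ v 6F ⊗ v 7F ⊗ v 8F)) ⊗ v (Fin.suc (Fin.suc (Fin.suc 9F))) ⊕ # (ℤ.+ 1) ⊗ (v 0F ⊖ v 1F ⊗ (v 5F ⊗ v 5F) ⊗ v 9F) ⊕ v 1F ⊗ v 5F ⊗ v 5F ⊗ (v 9F ⊖ v 2F ⊗ (v 6F ⊗ v 6F) ⊗ v (Fin.suc 9F)) ⊕ v 1F ⊗ v 5F ⊗ v 5F ⊗ v 2F ⊗ v 6F ⊗ v 6F ⊗ (v (Fin.suc 9F) ⊖ v 3F ⊗ (v 7F ⊗ v 7F) ⊗ v (Fin.suc (Fin.suc 9F))) ⊕ v 1F ⊗ v 5F ⊗ v 5F ⊗ v 2F ⊗ v 6F ⊗ v 6F ⊗ v 3F ⊗ v 7F ⊗ v 7F ⊗ (v (Fin.suc (Fin.suc 9F)) ⊖ v 4F ⊗ (v 8F ⊗ v 8F) ⊗ v (Fin.suc (Fin.suc (Fin.suc 9F))))) refl (P ∷ a ∷ b ∷ c ∷ d ∷ k ∷ l ∷ m ∷ n ∷ P₁ ∷ P₂ ∷ P₃ ∷ P₄ ∷ [])) (trans (𝒪I.vanish h₄) (trans (𝒪I.vanish h₃) (trans (𝒪I.vanish h₂) (𝒪I.vanish h₁))))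
strip-sq : ∀ P τ r P₄ R y → P ≡ τ * (r * r) * P₄ → P * R ≡ y * y → y * y ≡ r * r * (P₄ * (τ * R))
strip-sq P τ r P₄ R y h₁ h₂ = trans (𝒪I.identity (v 5F ⊗ v 5F) (v 2F ⊗ v 2F ⊗ (v 3F ⊗ (v 1F ⊗ v 4F)) ⊕ v 4F ⊗ (v 0F ⊖ v 1F ⊗ (v 2F ⊗ v 2F) ⊗ v 3F) ⊕ (# (ℤ.+ 0) ⊖ # (ℤ.+ 1)) ⊗ (v 0F ⊗ v 4F ⊖ v 5F ⊗ v 5F)) refl (P ∷ τ ∷ r ∷ P₄ ∷ R ∷ y ∷ [])) (trans (𝒪I.vanish h₂) (𝒪I.vanish h₁))
sq-cancel : ∀ r x y k → y * y ≡ r * r * x → y ≡ r * k → r * r * x ≡ r * r * (k * k)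
sq-cancel r x y k h₁ h₂ = trans (𝒪I.identity (v 0F ⊗ v 0F ⊗ v 1F) (v 0F ⊗ v 0F ⊗ (v 3F ⊗ v 3F) ⊕ (# (ℤ.+ 0) ⊖ # (ℤ.+ 1)) ⊗ (v 2F ⊗ v 2F ⊖ v 0F ⊗ v 0F ⊗ v 1F) ⊕ (v 2F ⊕ v 0F ⊗ v 3F) ⊗ (v 2F ⊖ v 0F ⊗ v 3F)) refl (r ∷ x ∷ y ∷ k ∷ [])) (trans (𝒪I.vanish h₂) (𝒪I.vanish h₁))
smooth-class : ∀ P τ r P₄ u z → P ≡ τ * (r * r) * P₄ → P₄ ≡ u * (z * z) → P ≡ u * τ * (r * z * (r * z))
smooth-class P τ r P₄ u z h₁ h₂ = trans (𝒪I.identity (v 0F) (v 4F ⊗ v 1F ⊗ (v 2F ⊗ v 5F ⊗ (v 2F ⊗ v 5F)) ⊕ # (ℤ.+ 1) ⊗ (v 0F ⊖ v 1F ⊗ (v 2F ⊗ v 2F) ⊗ v 3F) ⊕ v 1F ⊗ v 2F ⊗ v 2F ⊗ (v 3F ⊖ v 4F ⊗ (v 5F ⊗ v 5F))) refl (P ∷ τ ∷ r ∷ P₄ ∷ u ∷ z ∷ [])) (trans (𝒪I.vanish h₂) (𝒪I.vanish h₁))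

sq-quotient : ∀ {r x y} → ¬ r ≡ 𝟘 → y * y ≡ r * r * x → ∃ λ k → y ≡ r * k × x ≡ k * k
sq-quotient {r} {x} {y} r≢0 e = go (sq-divides r≢0 e)
  where
  go : r ∣𝒪 y → ∃ λ k → y ≡ r * k × x ≡ k * k
  go (k , f) = k , f , *-cancelˡ (*≢𝟘 r≢0 r≢0) (sq-cancel r x y k e f)

-- Removing the primes above 2, 3 and 5 from P leaves a factor P₄ coprime to everything else in the
-- square P₄ τ R, hence a unit times a square. The unit and the parities of the removed exponents
-- make up the class.
smooth-part : ∀ {P R y} → ¬ P ≡ 𝟘 → P * R ≡ y * y → (∀ P′ → P′ ∣𝒪 P → CopS P′ → Cop P′ R) → ∃ λ s → ∃ λ h → P ≡ ⟦ s ⟧ᶜ * (h * h)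
smooth-part {P} {R} {y} P≢0 PR≡ coprime = go₁ (strip prime-𝟚 P P≢0)
  where
  go₁ : Stripped 𝟚 P → ∃ λ s → ∃ λ h → P ≡ ⟦ s ⟧ᶜ * (h * h)
  go₁ (stripped t k P₁ e₁ c₁′) = go₂ (strip (ResiduePrime.prime at-θ) P₁ (*≢𝟘⇒ʳ (subst (λ z → ¬ z ≡ 𝟘) e₁ P≢0)))
    where
    go₂ : Stripped θ P₁ → ∃ λ s → ∃ λ h → P ≡ ⟦ s ⟧ᶜ * (h * h)
    go₂ (stripped h l P₂ e₂ c₂) = go₃ (strip (ResiduePrime.prime at-ρ₅) P₂ (*≢𝟘⇒ʳ (subst (λ z → ¬ z ≡ 𝟘) e₂ (*≢𝟘⇒ʳ (subst (λ z → ¬ z ≡ 𝟘) e₁ P≢0)))))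
      where
      go₃ : Stripped ρ₅ P₂ → ∃ λ s → ∃ λ h → P ≡ ⟦ s ⟧ᶜ * (h * h)
      go₃ (stripped q m P₃ e₃ c₃) = go₄ (strip (ResiduePrime.prime at-π₅) P₃
        (*≢𝟘⇒ʳ (subst (λ z → ¬ z ≡ 𝟘) e₃ (*≢𝟘⇒ʳ (subst (λ z → ¬ z ≡ 𝟘) e₂ (*≢𝟘⇒ʳ (subst (λ z → ¬ z ≡ 𝟘) e₁ P≢0)))))))
        where
        go₄ : Stripped π₅ P₃ → ∃ λ s → ∃ λ h → P ≡ ⟦ s ⟧ᶜ * (h * h)
        go₄ (stripped p n P₄ e₄ c₄) = finish (sq-quotient r≢0 (strip-sq P τ r P₄ R y P≡ PR≡))
          where
          τ r : 𝒪
          τ = 𝟚 ⁺ t * θ ⁺ h * ρ₅ ⁺ q * π₅ ⁺ p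
          r = k * l * m * n
          P≡ : P ≡ τ * (r * r) * P₄
          P≡ = strip-all P (𝟚 ⁺ t) (θ ⁺ h) (ρ₅ ⁺ q) (π₅ ⁺ p) k l m n P₁ P₂ P₃ P₄ e₁ e₂ e₃ e₄
          nz : ¬ τ * (r * r) * P₄ ≡ 𝟘
          nz z = P≢0 (trans P≡ z)
          r≢0 : ¬ r ≡ 𝟘
          r≢0 = *≢𝟘⇒ˡ (*≢𝟘⇒ʳ (*≢𝟘⇒ˡ nz))
          P₄∣P₃ : P₄ ∣𝒪 P₃
          P₄∣P₃ = subst (P₄ ∣𝒪_) (sym e₄) (∣*ʳ _)
          P₄∣P₂ : P₄ ∣𝒪 P₂
          P₄∣P₂ = ∣-trans P₄∣P₃ (subst (P₃ ∣𝒪_) (sym e₃) (∣*ʳ _))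
          P₄∣P₁ : P₄ ∣𝒪 P₁
          P₄∣P₁ = ∣-trans P₄∣P₂ (subst (P₂ ∣𝒪_) (sym e₂) (∣*ʳ _))
          P₄∣P : P₄ ∣𝒪 P
          P₄∣P = ∣-trans P₄∣P₁ (subst (P₁ ∣𝒪_) (sym e₁) (∣*ʳ _))
          cS : CopS P₄
          cS = copS (cop-∣ˡ P₄∣P₁ c₁′) (cop-∣ˡ P₄∣P₂ c₂) (cop-∣ˡ P₄∣P₃ c₃) c₄
          copτ : Cop P₄ τ
          copτ = cop-* (cop-* (cop-* (cop-⁺ t (CopS.cop-2 cS)) (cop-⁺ h (CopS.cop-θ cS))) (cop-⁺ q (CopS.cop-ρ cS))) (cop-⁺ p c₄)
          finish : (∃ λ k → y ≡ r * k × P₄ * (τ * R) ≡ k * k) → ∃ λ s → ∃ λ h → P ≡ ⟦ s ⟧ᶜ * (h * h)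
          finish (k , _ , e) = conclude (coprime-factor (*≢𝟘⇒ʳ nz) (cop-* copτ (coprime P₄ P₄∣P cS)) e)
            where
            conclude : UnitClass P₄ → ∃ λ s → ∃ λ h → P ≡ ⟦ s ⟧ᶜ * (h * h)
            conclude (unit-class {σ} {j} {z} f) = cls σ j t h q p , r * z , smooth-class P τ r P₄ (-𝟙 ⁺ σ * ε ⁺ j) z P≡ f

-- Points on curves with a 2-torsion point, and their torsors.

Smooth : 𝒪 → Set
Smooth β = ∀ P → CopS P → Cop P β

-- A point on y² = x (x² - α x + β) with x = X / g², see _Datum_ below, in lowest terms.
quartic : (α β s h q : 𝒪) → 𝒪
quartic α β s h q = s * (s * s * (h * h * (h * h)) - α * s * (h * h) * (q * q) + β * (q * q * (q * q)))

-- The point is x = X / g² with y / x = Z / g. The partner gives X̄ / g² = β / x, the x-coordinate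
-- of the translate by the 2-torsion point (0 , 0), so that this translation just exchanges X and
-- X̄.
record Datum (α β X g : 𝒪) : Set where
  constructor datum
  field
    X̄ Z : 𝒪
    product : X * X̄ ≡ β * (g * g * (g * g))
    sum : X + X̄ ≡ Z * Z + α * (g * g)

-- The first step of descent by a 2-isogeny: x = s h² / q² in lowest terms with s the class,
-- together with the point (h , q , t) on the torsor attached to s. The factor g′ is common to
-- numerator and denominator.
record NormalForm (α β X g : 𝒪) : Set where
  field
    class : Class
    h q g′ t : 𝒪
    X≡ : X ≡ ⟦ class ⟧ᶜ * (h * g′ * (h * g′))
    g≡ : g ≡ q * g′
    coprime : Cop (⟦ class ⟧ᶜ * (h * h)) q
    on-quartic : t * t ≡ quartic α β ⟦ class ⟧ᶜ h q

nf₁ : ∀ X Y Z g α β δ P Q → X * Y ≡ β * (g * g * (g * g)) → X + Y ≡ Z * Z + α * (g * g) → X ≡ δ * P → g * g ≡ δ * Q → δ * (δ * (P * P - α * P * Q + β * (Q * Q))) ≡ δ * (P * Z * Z)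
nf₁ X Y Z g α β δ P Q h₁ h₂ h₃ h₄ = trans (𝒪I.identity (v 6F ⊗ (v 6F ⊗ (v 7F ⊗ v 7F ⊖ v 4F ⊗ v 7F ⊗ v 8F ⊕ v 5F ⊗ (v 8F ⊗ v 8F)))) (v 6F ⊗ (v 7F ⊗ v 2F ⊗ v 2F) ⊕ (# (ℤ.+ 0) ⊖ # (ℤ.+ 1)) ⊗ (v 0F ⊗ v 1F ⊖ v 5F ⊗ (v 3F ⊗ v 3F ⊗ (v 3F ⊗ v 3F))) ⊕ v 0F ⊗ (v 0F ⊕ v 1F ⊖ (v 2F ⊗ v 2F ⊕ v 4F ⊗ (v 3F ⊗ v 3F))) ⊕ (# (ℤ.+ 0) ⊖ v 6F ⊗ v 7F ⊖ v 0F ⊕ v 2F ⊗ v 2F ⊕ v 4F ⊗ v 6F ⊗ v 8F) ⊗ (v 0F ⊖ v 6F ⊗ v 7F) ⊕ (# (ℤ.+ 0) ⊖ v 5F ⊗ (v 6F ⊗ v 8F ⊕ v 3F ⊗ v 3F) ⊕ v 4F ⊗ v 0F) ⊗ (v 3F ⊗ v 3F ⊖ v 6F ⊗ v 8F)) refl (X ∷ Y ∷ Z ∷ g ∷ α ∷ β ∷ δ ∷ P ∷ Q ∷ [])) (trans (𝒪I.vanish h₄) (trans (𝒪I.vanish h₃) (trans (𝒪I.vanish h₂) (𝒪I.vanish h₁))))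
nf₂ : ∀ Z g α β δ P Q → δ * (P * P - α * P * Q + β * (Q * Q)) ≡ P * Z * Z → g * g ≡ δ * Q → P * Q * Z * (P * Q * Z) ≡ g * g * (Q * (P * (P * P - α * P * Q + β * (Q * Q))))
nf₂ Z g α β δ P Q h₁ h₂ = trans (𝒪I.identity (v 5F ⊗ v 6F ⊗ v 0F ⊗ (v 5F ⊗ v 6F ⊗ v 0F)) (v 1F ⊗ v 1F ⊗ (v 6F ⊗ (v 5F ⊗ (v 5F ⊗ v 5F ⊖ v 2F ⊗ v 5F ⊗ v 6F ⊕ v 3F ⊗ (v 6F ⊗ v 6F)))) ⊕ (# (ℤ.+ 0) ⊖ v 5F ⊗ v 6F ⊗ v 6F) ⊗ (v 4F ⊗ (v 5F ⊗ v 5F ⊖ v 2F ⊗ v 5F ⊗ v 6F ⊕ v 3F ⊗ (v 6F ⊗ v 6F)) ⊖ v 5F ⊗ v 0F ⊗ v 0F) ⊕ (# (ℤ.+ 0) ⊖ v 6F ⊗ v 5F ⊗ (v 5F ⊗ v 5F ⊖ v 2F ⊗ v 5F ⊗ v 6F ⊕ v 3F ⊗ (v 6F ⊗ v 6F))) ⊗ (v 1F ⊗ v 1F ⊖ v 4F ⊗ v 6F)) refl (Z ∷ g ∷ α ∷ β ∷ δ ∷ P ∷ Q ∷ [])) (trans (𝒪I.vanish h₂) (𝒪I.vanish h₁))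
nf₃ : ∀ Q R y u z → Q * R ≡ y * y → Q ≡ u * (z * z) → y * y ≡ z * z * (u * R)
nf₃ Q R y u z h₁ h₂ = trans (𝒪I.identity (v 2F ⊗ v 2F) (v 4F ⊗ v 4F ⊗ (v 3F ⊗ v 1F) ⊕ (# (ℤ.+ 0) ⊖ # (ℤ.+ 1)) ⊗ (v 0F ⊗ v 1F ⊖ v 2F ⊗ v 2F) ⊕ v 1F ⊗ (v 0F ⊖ v 3F ⊗ (v 4F ⊗ v 4F))) refl (Q ∷ R ∷ y ∷ u ∷ z ∷ [])) (trans (𝒪I.vanish h₂) (𝒪I.vanish h₁))
nf₄ : ∀ u z Q → Q ≡ u * (z * z) → u * z * (u * z) ≡ u * Q
nf₄ u z Q h₁ = trans (𝒪I.identity (v 0F ⊗ v 1F ⊗ (v 0F ⊗ v 1F)) (v 0F ⊗ v 2F ⊕ (# (ℤ.+ 0) ⊖ v 0F) ⊗ (v 2F ⊖ v 0F ⊗ (v 1F ⊗ v 1F))) refl (u ∷ z ∷ Q ∷ [])) (𝒪I.vanish h₁)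
nf₅ : ∀ u P Q q α β y → q * q ≡ u * Q → u * (P * (P * P - α * P * Q + β * (Q * Q))) ≡ y * y → u * P * (u * P * (u * P) - α * (u * P) * (q * q) + β * (q * q * (q * q))) ≡ u * y * (u * y)
nf₅ u P Q q α β y h₁ h₂ = trans (𝒪I.identity (v 0F ⊗ v 1F ⊗ (v 0F ⊗ v 1F ⊗ (v 0F ⊗ v 1F) ⊖ v 4F ⊗ (v 0F ⊗ v 1F) ⊗ (v 3F ⊗ v 3F) ⊕ v 5F ⊗ (v 3F ⊗ v 3F ⊗ (v 3F ⊗ v 3F)))) (v 0F ⊗ v 6F ⊗ (v 0F ⊗ v 6F) ⊕ (v 0F ⊗ v 1F ⊗ v 5F ⊗ (v 3F ⊗ v 3F ⊕ v 0F ⊗ v 2F) ⊖ v 0F ⊗ v 1F ⊗ v 4F ⊗ v 0F ⊗ v 1F) ⊗ (v 3F ⊗ v 3F ⊖ v 0F ⊗ v 2F) ⊕ v 0F ⊗ v 0F ⊗ (v 0F ⊗ (v 1F ⊗ (v 1F ⊗ v 1F ⊖ v 4F ⊗ v 1F ⊗ v 2F ⊕ v 5F ⊗ (v 2F ⊗ v 2F))) ⊖ v 6F ⊗ v 6F)) refl (u ∷ P ∷ Q ∷ q ∷ α ∷ β ∷ y ∷ [])) (trans (𝒪I.vanish h₂) (𝒪I.vanish h₁))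
nf₆ : ∀ P q α β → P * P - α * P * (q * q) + β * (q * q * (q * q)) ≡ β * (q * q * (q * q)) + P * (P - α * (q * q))
nf₆ P q α β = 𝒪I.identity (v 0F ⊗ v 0F ⊖ v 2F ⊗ v 0F ⊗ (v 1F ⊗ v 1F) ⊕ v 3F ⊗ (v 1F ⊗ v 1F ⊗ (v 1F ⊗ v 1F))) (v 3F ⊗ (v 1F ⊗ v 1F ⊗ (v 1F ⊗ v 1F)) ⊕ v 0F ⊗ (v 0F ⊖ v 2F ⊗ (v 1F ⊗ v 1F))) refl (P ∷ q ∷ α ∷ β ∷ [])
nf₆′ : ∀ k p → k * p ≡ p * k
nf₆′ k p = 𝒪I.identity (v 0F ⊗ v 1F) (v 1F ⊗ v 0F) refl (k ∷ p ∷ [])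
nf₇ : ∀ P R s h w → P * R ≡ w * w → P ≡ s * (h * h) → w * w ≡ h * h * (s * R)
nf₇ P R s h w h₁ h₂ = trans (𝒪I.identity (v 4F ⊗ v 4F) (v 3F ⊗ v 3F ⊗ (v 2F ⊗ v 1F) ⊕ (# (ℤ.+ 0) ⊖ # (ℤ.+ 1)) ⊗ (v 0F ⊗ v 1F ⊖ v 4F ⊗ v 4F) ⊕ v 1F ⊗ (v 0F ⊖ v 2F ⊗ (v 3F ⊗ v 3F))) refl (P ∷ R ∷ s ∷ h ∷ w ∷ [])) (trans (𝒪I.vanish h₂) (𝒪I.vanish h₁))
nf₈ : ∀ s h q α β P → P ≡ s * (h * h) → s * (P * P - α * P * (q * q) + β * (q * q * (q * q))) ≡ s * (s * s * (h * h * (h * h)) - α * s * (h * h) * (q * q) + β * (q * q * (q * q)))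
nf₈ s h q α β P h₁ = trans (𝒪I.identity (v 0F ⊗ (v 5F ⊗ v 5F ⊖ v 3F ⊗ v 5F ⊗ (v 2F ⊗ v 2F) ⊕ v 4F ⊗ (v 2F ⊗ v 2F ⊗ (v 2F ⊗ v 2F)))) (v 0F ⊗ (v 0F ⊗ v 0F ⊗ (v 1F ⊗ v 1F ⊗ (v 1F ⊗ v 1F)) ⊖ v 3F ⊗ v 0F ⊗ (v 1F ⊗ v 1F) ⊗ (v 2F ⊗ v 2F) ⊕ v 4F ⊗ (v 2F ⊗ v 2F ⊗ (v 2F ⊗ v 2F))) ⊕ (v 0F ⊗ (v 5F ⊕ v 0F ⊗ v 1F ⊗ v 1F) ⊖ v 0F ⊗ v 3F ⊗ v 2F ⊗ v 2F) ⊗ (v 5F ⊖ v 0F ⊗ (v 1F ⊗ v 1F))) refl (s ∷ h ∷ q ∷ α ∷ β ∷ P ∷ [])) (𝒪I.vanish h₁)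
nf₉ : ∀ X g δ P Q u q → X ≡ δ * P → g * g ≡ δ * Q → q * q ≡ u * Q → X * (q * q) ≡ u * P * (g * g)
nf₉ X g δ P Q u q h₁ h₂ h₃ = trans (𝒪I.identity (v 0F ⊗ (v 6F ⊗ v 6F)) (v 5F ⊗ v 3F ⊗ (v 1F ⊗ v 1F) ⊕ v 6F ⊗ v 6F ⊗ (v 0F ⊖ v 2F ⊗ v 3F) ⊕ (# (ℤ.+ 0) ⊖ v 5F ⊗ v 3F) ⊗ (v 1F ⊗ v 1F ⊖ v 2F ⊗ v 4F) ⊕ v 2F ⊗ v 3F ⊗ (v 6F ⊗ v 6F ⊖ v 5F ⊗ v 4F)) refl (X ∷ g ∷ δ ∷ P ∷ Q ∷ u ∷ q ∷ [])) (trans (𝒪I.vanish h₃) (trans (𝒪I.vanish h₂) (𝒪I.vanish h₁)))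
nf₁₀ : ∀ X g P q g′ → X * (q * q) ≡ P * (g * g) → g ≡ q * g′ → q * q * X ≡ q * q * (P * (g′ * g′))
nf₁₀ X g P q g′ h₁ h₂ = trans (𝒪I.identity (v 3F ⊗ v 3F ⊗ v 0F) (v 3F ⊗ v 3F ⊗ (v 2F ⊗ (v 4F ⊗ v 4F)) ⊕ # (ℤ.+ 1) ⊗ (v 0F ⊗ (v 3F ⊗ v 3F) ⊖ v 2F ⊗ (v 1F ⊗ v 1F)) ⊕ v 2F ⊗ (v 1F ⊕ v 3F ⊗ v 4F) ⊗ (v 1F ⊖ v 3F ⊗ v 4F)) refl (X ∷ g ∷ P ∷ q ∷ g′ ∷ [])) (trans (𝒪I.vanish h₂) (𝒪I.vanish h₁))
nf₁₁ : ∀ X P g s h → X ≡ P * (g * g) → P ≡ s * (h * h) → X ≡ s * (h * g * (h * g))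
nf₁₁ X P g s h h₁ h₂ = trans (𝒪I.identity (v 0F) (v 3F ⊗ (v 4F ⊗ v 2F ⊗ (v 4F ⊗ v 2F)) ⊕ # (ℤ.+ 1) ⊗ (v 0F ⊖ v 1F ⊗ (v 2F ⊗ v 2F)) ⊕ v 2F ⊗ v 2F ⊗ (v 1F ⊖ v 3F ⊗ (v 4F ⊗ v 4F))) refl (X ∷ P ∷ g ∷ s ∷ h ∷ [])) (trans (𝒪I.vanish h₂) (𝒪I.vanish h₁))
cop-unit′ : ∀ u i x → u * i ≡ ι (ℤ.+ 1) → i * u + ι (ℤ.+ 0) * x ≡ ι (ℤ.+ 1)
cop-unit′ u i x h₁ = trans (𝒪I.identity (v 1F ⊗ v 0F ⊕ # (ℤ.+ 0) ⊗ v 2F) (# (ℤ.+ 1) ⊕ # (ℤ.+ 1) ⊗ (v 0F ⊗ v 1F ⊖ # (ℤ.+ 1))) refl (u ∷ i ∷ x ∷ [])) (𝒪I.vanish h₁)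

-- In lowest terms x = P / Q, the product Q P (P² - αPQ + βQ²) is a square and Q is coprime to the
-- rest, so Q is a unit times a square. Once Q is a square q², a common factor of P and P² - αPq² +
-- βq⁴ divides βq⁴ and is coprime to q, so it lies above 2, 3 or 5 and `smooth-part` applies to P.
normal-form : ∀ {α β X g} → Smooth β → ¬ X ≡ 𝟘 → ¬ g ≡ 𝟘 → Datum α β X g → NormalForm α β X g
normal-form {α} {β} {X} {g} smooth X≢0 g≢0 (datum X̄ Z product sum) = go (reduced-gcd X (g * g) X≢0)
  where
  go : Gcd X (g * g) → NormalForm α β X g
  go (mk-gcd {δ} {P} {Q} X≡ gg≡ cPQ) = at-Q (sq-quotient g≢0 (nf₂ Z g α β δ P Q (*-cancelˡ δ≢0 (nf₁ X X̄ Z g α β δ P Q product sum X≡ gg≡)) gg≡))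
    where
    δP≢0 : ¬ δ * P ≡ 𝟘
    δP≢0 z = X≢0 (trans X≡ z)
    δ≢0 : ¬ δ ≡ 𝟘
    δ≢0 = *≢𝟘⇒ˡ δP≢0
    Q≢0 : ¬ Q ≡ 𝟘
    Q≢0 = *≢𝟘⇒ʳ (λ z → *≢𝟘 g≢0 g≢0 (trans gg≡ z))
    R = P * P - α * P * Q + β * (Q * Q)
    cQR : Cop Q (P * R)
    cQR = cop-* cQP (cop-shift (α * P - β * Q) (subst (Cop Q) (sym (r-shift P Q α β)) (cop-* cQP cQP)))
      where
      cQP = cop-sym cPQ
      r-shift : ∀ P Q α β → P * P - α * P * Q + β * (Q * Q) + Q * (α * P - β * Q) ≡ P * P
      r-shift P Q α β = 𝒪I.identity (v 0F ⊗ v 0F ⊖ v 2F ⊗ v 0F ⊗ v 1F ⊕ v 3F ⊗ (v 1F ⊗ v 1F) ⊕ v 1F ⊗ (v 2F ⊗ v 0F ⊖ v 3F ⊗ v 1F)) (v 0F ⊗ v 0F) refl (P ∷ Q ∷ α ∷ β ∷ [])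
    at-Q : (∃ λ k → P * Q * Z ≡ g * k × Q * (P * R) ≡ k * k) → NormalForm α β X g
    at-Q (y₀ , _ , QPR≡) = at-υ (coprime-factor Q≢0 cQR QPR≡)
      where
      at-υ : UnitClass Q → NormalForm α β X g
      at-υ (unit-class {σ} {j} {z} Q≡) = at-z (sq-quotient z≢0 (nf₃ Q (P * R) y₀ υ z QPR≡ Q≡)) (unit-inverse σ j)
        where
        υ = -𝟙 ⁺ σ * ε ⁺ j
        z≢0 : ¬ z ≡ 𝟘
        z≢0 = *≢𝟘⇒ˡ (*≢𝟘⇒ʳ (λ w → Q≢0 (trans Q≡ w)))
        -- Multiplying P and Q by the unit υ turns the denominator into the exact square (υz)².
        q = υ * z
        qq≡ : q * q ≡ υ * Q
        qq≡ = nf₄ υ z Q Q≡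
        P₁ = υ * P
        R₁ = P₁ * P₁ - α * P₁ * (q * q) + β * (q * q * (q * q))
        at-z : (∃ λ k → y₀ ≡ z * k × υ * (P * R) ≡ k * k) → (∃ λ i → υ * i ≡ 𝟙) → NormalForm α β X g
        at-z (y₁ , _ , υPR≡) (i , υi≡) = at-P (smooth-part P₁≢0 P₁R₁≡ coprimeR)
          where
          υ-cop : ∀ {x} → Cop x υ
          υ-cop {x} = cop-sym (cop (cop-unit′ υ i x υi≡))
          υ≢0 : ¬ υ ≡ 𝟘
          υ≢0 = *≢𝟘⇒ˡ (λ e → 𝟘≢𝟙 (trans (sym e) υi≡))
          P₁≢0 : ¬ P₁ ≡ 𝟘
          P₁≢0 = *≢𝟘 υ≢0 (*≢𝟘⇒ʳ δP≢0)
          q≢0 : ¬ q ≡ 𝟘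
          q≢0 = *≢𝟘 υ≢0 z≢0
          cP₁q : Cop P₁ q
          cP₁q = cop-∣ʳ (∣*ˡ q) (subst (Cop P₁) (sym qq≡) (cop-* υ-cop (cop-sym (cop-* (cop-sym (cop-sym υ-cop)) (cop-sym cPQ)))))
          P₁R₁≡ : P₁ * R₁ ≡ υ * y₁ * (υ * y₁)
          P₁R₁≡ = nf₅ υ P Q q α β y₁ qq≡ υPR≡
          coprimeR : ∀ P′ → P′ ∣𝒪 P₁ → CopS P′ → Cop P′ R₁
          coprimeR P′ d@(k , f) c = subst (Cop P′) (sym (nf₆ P₁ q α β)) (shift (cop-* (smooth P′ c) (cop-* (cop-* cq cq) (cop-* cq cq))))
            where
            cq : Cop P′ q
            cq = cop-∣ˡ d cP₁q
            shift : Cop P′ (β * (q * q * (q * q))) → Cop P′ (β * (q * q * (q * q)) + P₁ * (P₁ - α * (q * q)))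
            shift c = cop-shift (𝟘 - k * (P₁ - α * (q * q))) (subst (Cop P′) (unshift′ (β * (q * q * (q * q))) P₁ P′ k (P₁ - α * (q * q)) f) c)
              where
              unshift′ : ∀ x p p′ k w → p ≡ p′ * k → x ≡ x + p * w + p′ * (ι (ℤ.+ 0) - k * w)
              unshift′ x p p′ k w h₁ = trans (𝒪I.identity (v 0F) (v 0F ⊕ v 1F ⊗ v 4F ⊕ v 2F ⊗ (# (ℤ.+ 0) ⊖ v 3F ⊗ v 4F) ⊕ (# (ℤ.+ 0) ⊖ v 4F) ⊗ (v 1F ⊖ v 2F ⊗ v 3F)) refl (x ∷ p ∷ p′ ∷ k ∷ w ∷ [])) (𝒪I.vanish h₁)
          at-P : (∃ λ s → ∃ λ h → P₁ ≡ ⟦ s ⟧ᶜ * (h * h)) → NormalForm α β X g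
          at-P (s , h , P₁≡) = finish (sq-quotient h≢0 (nf₇ P₁ R₁ ⟦ s ⟧ᶜ h (υ * y₁) P₁R₁≡ P₁≡)) (sq-divides q≢0 (proj₂ qq∣gg))
            where
            h≢0 : ¬ h ≡ 𝟘
            h≢0 = *≢𝟘⇒ˡ (*≢𝟘⇒ʳ (λ e → P₁≢0 (trans P₁≡ e)))
            Xqq≡ : X * (q * q) ≡ P₁ * (g * g)
            Xqq≡ = nf₉ X g δ P Q υ q X≡ gg≡ qq≡
            qq∣gg : (q * q) ∣𝒪 (g * g)
            qq∣gg = euclid (cop-sym (cop-* cP₁q cP₁q)) (X , trans (sym Xqq≡) (nf₆′ X (q * q)))
            finish : (∃ λ k → υ * y₁ ≡ h * k × ⟦ s ⟧ᶜ * R₁ ≡ k * k) → q ∣𝒪 g → NormalForm α β X g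
            finish (t , _ , sR₁≡) (g′ , g≡) = record
              { class = s ; h = h ; q = q ; g′ = g′ ; t = t
              ; X≡ = nf₁₁ X P₁ g′ ⟦ s ⟧ᶜ h (*-cancelˡ (*≢𝟘 q≢0 q≢0) (nf₁₀ X g P₁ q g′ Xqq≡ g≡)) P₁≡
              ; g≡ = g≡
              ; coprime = subst (λ w → Cop w q) P₁≡ cP₁q
              ; on-quartic = trans (sym sR₁≡) (nf₈ ⟦ s ⟧ᶜ h q α β P₁ P₁≡) }

-- local insolubility

power : 𝒪 → ℕ → 𝒪
power x zero = 𝟙
power x (suc n) = x * power x n

weaken′ : ∀ x y π m k → x ≡ y + π * m * k → x ≡ y + m * (π * k)
weaken′ x y π m k h₁ = trans (𝒪I.identity (v 0F) (v 1F ⊕ v 3F ⊗ (v 2F ⊗ v 4F) ⊕ # (ℤ.+ 1) ⊗ (v 0F ⊖ (v 1F ⊕ v 2F ⊗ v 3F ⊗ v 4F))) refl (x ∷ y ∷ π ∷ m ∷ k ∷ [])) (𝒪I.vanish h₁)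

≈-weaken : ∀ {x y π m} → x ≈ y [ π * m ] → x ≈ y [ m ]
≈-weaken {x} {y} {π} {m} (by k e) = by _ (weaken′ x y π m k e)

≈-weaken-pow : ∀ {x y π} n f → x ≈ y [ power π (f ℕ.+ n) ] → x ≈ y [ power π n ]
≈-weaken-pow n zero e = e
≈-weaken-pow n (suc f) e = ≈-weaken-pow n f (≈-weaken e)

quartic-≈ : ∀ α β s {h h′ q q′ m} → h ≈ h′ [ m ] → q ≈ q′ [ m ] → quartic α β s h q ≈ quartic α β s h′ q′ [ m ]
quartic-≈ α β s e f = ≈-* ≈-refl (≈-+ (≈-- (≈-* ≈-refl (≈-* (≈-* e e) (≈-* e e))) (≈-* (≈-* ≈-refl (≈-* e e)) (≈-* f f))) (≈-* ≈-refl (≈-* (≈-* f f) (≈-* f f))))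

scale-quartic : ∀ t s a b h q l → t * t ≡ s * (s * s * (h * h * (h * h)) - a * s * (h * h) * (q * q) + b * (q * q * (q * q))) → l * l * t * (l * l * t) ≡ s * (s * s * (l * h * (l * h) * (l * h * (l * h))) - a * s * (l * h * (l * h)) * (l * q * (l * q)) + b * (l * q * (l * q) * (l * q * (l * q))))
scale-quartic t s a b h q l h₁ = trans (𝒪I.identity (v 6F ⊗ v 6F ⊗ v 0F ⊗ (v 6F ⊗ v 6F ⊗ v 0F)) (v 1F ⊗ (v 1F ⊗ v 1F ⊗ (v 6F ⊗ v 4F ⊗ (v 6F ⊗ v 4F) ⊗ (v 6F ⊗ v 4F ⊗ (v 6F ⊗ v 4F))) ⊖ v 2F ⊗ v 1F ⊗ (v 6F ⊗ v 4F ⊗ (v 6F ⊗ v 4F)) ⊗ (v 6F ⊗ v 5F ⊗ (v 6F ⊗ v 5F)) ⊕ v 3F ⊗ (v 6F ⊗ v 5F ⊗ (v 6F ⊗ v 5F) ⊗ (v 6F ⊗ v 5F ⊗ (v 6F ⊗ v 5F)))) ⊕ v 6F ⊗ v 6F ⊗ v 6F ⊗ v 6F ⊗ (v 0F ⊗ v 0F ⊖ v 1F ⊗ (v 1F ⊗ v 1F ⊗ (v 4F ⊗ v 4F ⊗ (v 4F ⊗ v 4F)) ⊖ v 2F ⊗ v 1F ⊗ (v 4F ⊗ v 4F) ⊗ (v 5F ⊗ v 5F) ⊕ v 3F ⊗ (v 5F ⊗ v 5F ⊗ (v 5F ⊗ v 5F))))) refl (t ∷ s ∷ a ∷ b ∷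 h ∷ q ∷ l ∷ [])) (𝒪I.vanish h₁)

not-not : ∀ b → not (not b) ≡ true → b ≡ true
not-not true _ = refl

module Local (R : ResiduePrime) where
  open ResiduePrime R

  -- Division by π as multiplication by `cofactor` followed by division of the coordinates by p. It
  -- is meaningful only when `exact?` holds.
  quot? : 𝒪 → 𝒪
  quot? x with x * cofactor
  ... | ⟨ a , b , c ⟩ = ⟨ a ℤD./ℕ p , b ℤD./ℕ p , c ℤD./ℕ p ⟩

  exact? : 𝒪 → Bool
  exact? x = x ≡ᵒ (π * quot? x)

  unit? : 𝒪 → Bool
  unit? x = not (residueℕ x ℕ.≡ᵇ 0)

  nonresidue? : 𝒪 → Bool
  nonresidue? x = allUpTo p λ i → unit? (ι (ℤ.+ i) * ι (ℤ.+ i) - x)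

  -- With n digits of precision, x is no square at π if its valuation is odd, or even with a leading
  -- digit that is not a quadratic residue. With no digits left nothing is claimed.
  not-square? : ℕ → 𝒪 → Bool
  not-square? 0 x = false
  not-square? 1 x = nonresidue? x
  not-square? (suc (suc n)) x = if exact? x then unit? (quot? x) ∨ (exact? (quot? x) ∧ not-square? n (quot? (quot? x))) else nonresidue? x

  F : (α β s h : 𝒪) → 𝒪
  F α β s h = quartic α β s h 𝟙

  -- A search through the tree of π-adic digits of h with q = 1: a node is closed when the quartic
  -- is no square to the precision to which h is known, and is otherwise split according to the next
  -- digit.
  insoluble? : (α β s : 𝒪) → ℕ → ℕ → 𝒪 → Bool
  insoluble? α β s zero n h = not-square? n (F α β s h)
  insoluble? α β s (suc f) n h = not-square? n (F α β s h) ∨ allUpTo p λ d → insoluble? α β s f (suc n) (h + power π n * ι (ℤ.+ d))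

  -- no solution with q divisible by π
  infinite? : 𝒪 → Bool
  infinite? s = allUpTo p λ i → allUpTo p λ j →
    unit? (ι (ℤ.+ i) * ι (ℤ.+ i) - s * (s * s * (ι (ℤ.+ j) * ι (ℤ.+ j) * (ι (ℤ.+ j) * ι (ℤ.+ j))))) ∨ not (unit? (s * (ι (ℤ.+ j) * ι (ℤ.+ j))))

  kill? : (α β s : 𝒪) → ℕ → Bool
  kill? α β s k = infinite? s ∧ insoluble? α β s k 0 𝟘

  unit?-sound : ∀ x → unit? x ≡ true → ¬ π ∣𝒪 x
  unit?-sound x u d with residueℕ x ℕ.≡ᵇ 0 | ℕₚ.≡⇒≡ᵇ (residueℕ x) 0 (∣⇒residue≡0 x d)
  unit?-sound x () d | true | _

  π∣sq : ∀ {x} → π ∣𝒪 (x * x) → π ∣𝒪 x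
  π∣sq {x} d with split x
  ... | inj₁ e = e
  ... | inj₂ c = ⊥-elim (not-both d (cop-sym (cop-* (cop-sym c) (cop-sym c))))

  nonresidue?-sound : ∀ x t → nonresidue? x ≡ true → ¬ (t * t ≈ x [ π ])
  nonresidue?-sound x t h e = unit?-sound _ (allUpTo-sound p (λ i → unit? (ι (ℤ.+ i) * ι (ℤ.+ i) - x)) h {residueℕ t} (ℤD.n%ℕd<d (residueℤ t) p))
    (≈⇒∣- (≈-trans (≈-* (≈-sym (≈residue t)) (≈-sym (≈residue t))) e))

  π-weaken : ∀ x y π k → x ≡ y + π * ι (ℤ.+ 1) * k → x ≡ y + π * k
  π-weaken x y π k h₁ = trans (𝒪I.identity (v 0F) (v 1F ⊕ v 2F ⊗ v 3F ⊕ # (ℤ.+ 1) ⊗ (v 0F ⊖ (v 1F ⊕ v 2F ⊗ # (ℤ.+ 1) ⊗ v 3F))) refl (x ∷ y ∷ π ∷ k ∷ [])) (𝒪I.vanish h₁)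
  πs-weaken : ∀ x y π m k → x ≡ y + π * m * k → x ≡ y + π * (m * k)
  πs-weaken x y π m k h₁ = trans (𝒪I.identity (v 0F) (v 1F ⊕ v 2F ⊗ (v 3F ⊗ v 4F) ⊕ # (ℤ.+ 1) ⊗ (v 0F ⊖ (v 1F ⊕ v 2F ⊗ v 3F ⊗ v 4F))) refl (x ∷ y ∷ π ∷ m ∷ k ∷ [])) (𝒪I.vanish h₁)
  sq-exact : ∀ x π y t m k → t * t ≡ x + π * m * k → x ≡ π * y → t * t ≡ π * (y + m * k)
  sq-exact x π y t m k h₁ h₂ = trans (𝒪I.identity (v 3F ⊗ v 3F) (v 1F ⊗ (v 2F ⊕ v 4F ⊗ v 5F) ⊕ # (ℤ.+ 1) ⊗ (v 3F ⊗ v 3F ⊖ (v 0F ⊕ v 1F ⊗ v 4F ⊗ v 5F)) ⊕ # (ℤ.+ 1) ⊗ (v 0F ⊖ v 1F ⊗ v 2F)) refl (x ∷ π ∷ y ∷ t ∷ m ∷ k ∷ [])) (trans (𝒪I.vanish h₂) (𝒪I.vanish h₁))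
  sq-exact₂ : ∀ x π y t u m k → t * t ≡ x + π * (π * m) * k → x ≡ π * y → t ≡ π * u → π * y ≡ π * (π * (u * u - m * k))
  sq-exact₂ x π y t u m k h₁ h₂ h₃ = trans (𝒪I.identity (v 1F ⊗ v 2F) (v 1F ⊗ (v 1F ⊗ (v 4F ⊗ v 4F ⊖ v 5F ⊗ v 6F)) ⊕ (# (ℤ.+ 0) ⊖ # (ℤ.+ 1)) ⊗ (v 3F ⊗ v 3F ⊖ (v 0F ⊕ v 1F ⊗ (v 1F ⊗ v 5F) ⊗ v 6F)) ⊕ (# (ℤ.+ 0) ⊖ # (ℤ.+ 1)) ⊗ (v 0F ⊖ v 1F ⊗ v 2F) ⊕ (v 3F ⊕ v 1F ⊗ v 4F) ⊗ (v 3F ⊖ v 1F ⊗ v 4F)) refl (x ∷ π ∷ y ∷ t ∷ u ∷ m ∷ k ∷ [])) (trans (𝒪I.vanish h₃) (trans (𝒪I.vanish h₂) (𝒪I.vanish h₁)))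
  sq-exact₃ : ∀ x π y z t u m k → t * t ≡ x + π * (π * m) * k → x ≡ π * y → y ≡ π * z → t ≡ π * u → π * π * (u * u) ≡ π * π * (z + m * k)
  sq-exact₃ x π y z t u m k h₁ h₂ h₃ h₄ = trans (𝒪I.identity (v 1F ⊗ v 1F ⊗ (v 5F ⊗ v 5F)) (v 1F ⊗ v 1F ⊗ (v 3F ⊕ v 6F ⊗ v 7F) ⊕ # (ℤ.+ 1) ⊗ (v 4F ⊗ v 4F ⊖ (v 0F ⊕ v 1F ⊗ (v 1F ⊗ v 6F) ⊗ v 7F)) ⊕ # (ℤ.+ 1) ⊗ (v 0F ⊖ v 1F ⊗ v 2F) ⊕ v 1F ⊗ (v 2F ⊖ v 1F ⊗ v 3F) ⊕ (# (ℤ.+ 0) ⊖ v 4F ⊖ v 1F ⊗ v 5F) ⊗ (v 4F ⊖ v 1F ⊗ v 5F)) refl (x ∷ π ∷ y ∷ z ∷ t ∷ u ∷ m ∷ k ∷ [])) (trans (𝒪I.vanish h₄) (trans (𝒪I.vanish h₃) (trans (𝒪I.vanish h₂) (𝒪I.vanish h₁))))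

  π≢𝟘 : ¬ π ≡ 𝟘
  π≢𝟘 e = ℕₚ.<⇒≱ 2≤norm (subst (λ z → ∣ N z ∣ ℕ.≤ 1) (sym e) (subst (λ z → ∣ z ∣ ℕ.≤ 1) (sym (N-ι (ℤ.+ 0))) ℕ.z≤n))

  not-square?-sound : ∀ n x t → not-square? n x ≡ true → ¬ (t * t ≈ x [ power π n ])
  not-square?-sound 1 x t h (by k e) = nonresidue?-sound x t h (by _ (π-weaken (t * t) x π k e))
  not-square?-sound (suc (suc n)) x t h (by k e) with exact? x in ex
  ... | false = nonresidue?-sound x t h (by _ (πs-weaken (t * t) x π (π * power π n) k e))
  ... | true = go (π∣sq (_ , sq-exact x π (quot? x) t (π * power π n) k e x≡))
    where
    y = quot? x
    z = quot? y
    x≡ : x ≡ π * y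
    x≡ = ≡ᵒ-sound x _ ex
    go : π ∣𝒪 t → ⊥
    go (u , t≡) with ∨-split (unit? y) h
    ... | inj₁ un = unit?-sound y un (_ , *-cancelˡ π≢𝟘 (sq-exact₂ x π y t u (power π n) k e x≡ t≡))
    ... | inj₂ h′ with ∧-split (exact? y) _ h′
    ... | y≡ , h″ = not-square?-sound n z u h″ (by k (*-cancelˡ (*≢𝟘 π≢𝟘 π≢𝟘) (sq-exact₃ x π y z t u (power π n) k e x≡ (≡ᵒ-sound y _ y≡) t≡)))

  digit : ∀ h m z d π k → z ≡ d + π * k → h + m * z ≡ h + m * d + π * m * k
  digit h m z d π k h₁ = trans (𝒪I.identity (v 0F ⊕ v 1F ⊗ v 2F) (v 0F ⊕ v 1F ⊗ v 3F ⊕ v 4F ⊗ v 1F ⊗ v 5F ⊕ v 1F ⊗ (v 2F ⊖ (v 3F ⊕ v 4F ⊗ v 5F))) refl (h ∷ m ∷ z ∷ d ∷ π ∷ k ∷ [])) (𝒪I.vanish h₁)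

  insoluble?-sound : ∀ α β s f n h z t → insoluble? α β s f n h ≡ true → ¬ (t * t ≈ F α β s (h + power π n * z) [ power π (f ℕ.+ n) ])
  insoluble?-sound α β s f n h z t e sq = go f e sq
    where
    near : ∀ {f} → t * t ≈ F α β s (h + power π n * z) [ power π (f ℕ.+ n) ] → t * t ≈ F α β s h [ power π n ]
    near {f} sq = ≈-trans (≈-weaken-pow n f sq) (quartic-≈ α β s (by z refl) ≈-refl)
    go : ∀ f → insoluble? α β s f n h ≡ true → t * t ≈ F α β s (h + power π n * z) [ power π (f ℕ.+ n) ] → ⊥
    go zero e sq = not-square?-sound n (F α β s h) t e (near {zero} sq)
    go (suc f) e sq with ∨-split (not-square? n (F α β s h)) e
    ... | inj₁ ns = not-square?-sound n (F α β s h) t ns (near {suc f} sq)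
    ... | inj₂ all = refine (≈residue z)
      where
      d = residueℕ z
      refine : z ≈ ι (ℤ.+ d) [ π ] → ⊥
      refine (by k q) = insoluble?-sound α β s f (suc n) (h + power π n * ι (ℤ.+ d)) k t
        (allUpTo-sound p (λ d → insoluble? α β s f (suc n) (h + power π n * ι (ℤ.+ d))) all {d} (ℤD.n%ℕd<d (residueℤ z) p))
        (subst₂ (λ h′ m → t * t ≈ F α β s h′ [ power π m ]) (digit h (power π n) z (ι (ℤ.+ d)) π k q) (sym (ℕₚ.+-suc f n)) sq)

  cop-pow : ∀ {x} n → Cop x π → Cop x (power π n)
  cop-pow zero c = cop-𝟙
  cop-pow (suc n) c = cop-* c (cop-pow n c)

  -- If π divides q, then coprimality makes s h² a unit at π and the equation modulo π is t² = s³h⁴,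
  -- which `infinite?` excludes. Otherwise q has an inverse modulo πᵏ, and scaling by it reduces to
  -- q = 1.
  kill : ∀ {α β X g} k (nf : NormalForm α β X g) → kill? α β ⟦ NormalForm.class nf ⟧ᶜ k ≡ true → ⊥
  kill {α} {β} k nf e = go (split q)
    where
    open NormalForm nf
    s = ⟦ class ⟧ᶜ
    tests = ∧-split (infinite? s) _ e
    go : π ∣𝒪 q ⊎ Cop q π → ⊥
    go (inj₁ π∣q) = decide (∨-split (unit? value) (allUpTo-sound p _ (allUpTo-sound p _ (proj₁ tests) {residueℕ t} (ℤD.n%ℕd<d (residueℤ t) p)) {residueℕ h} (ℤD.n%ℕd<d (residueℤ h) p)))
      where
      t₀ h₀ : 𝒪
      t₀ = ι (ℤ.+ residueℕ t)
      h₀ = ι (ℤ.+ residueℕ h)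
      value = t₀ * t₀ - s * (s * s * (h₀ * h₀ * (h₀ * h₀)))
      q≈0 : q ≈ 𝟘 [ π ]
      q≈0 = ∣⇒≈0 π∣q
      at-infinity : ∀ s a b h → s * (s * s * (h * h * (h * h)) - a * s * (h * h) * (ι (ℤ.+ 0) * ι (ℤ.+ 0)) + b * (ι (ℤ.+ 0) * ι (ℤ.+ 0) * (ι (ℤ.+ 0) * ι (ℤ.+ 0)))) ≡ s * (s * s * (h * h * (h * h)))
      at-infinity s a b h = 𝒪I.identity (v 0F ⊗ (v 0F ⊗ v 0F ⊗ (v 3F ⊗ v 3F ⊗ (v 3F ⊗ v 3F)) ⊖ v 1F ⊗ v 0F ⊗ (v 3F ⊗ v 3F) ⊗ (# (ℤ.+ 0) ⊗ # (ℤ.+ 0)) ⊕ v 2F ⊗ (# (ℤ.+ 0) ⊗ # (ℤ.+ 0) ⊗ (# (ℤ.+ 0) ⊗ # (ℤ.+ 0))))) (v 0F ⊗ (v 0F ⊗ v 0F ⊗ (v 3F ⊗ v 3F ⊗ (v 3F ⊗ v 3F)))) refl (s ∷ a ∷ b ∷ h ∷ [])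
      value≈0 : t₀ * t₀ ≈ s * (s * s * (h₀ * h₀ * (h₀ * h₀))) [ π ]
      value≈0 = ≈-trans (≈-* (≈-sym (≈residue t)) (≈-sym (≈residue t))) (≈-trans (≡⇒≈ on-quartic)
        (≈-trans (quartic-≈ α β s (≈residue h) q≈0) (≡⇒≈ (at-infinity s α β h₀))))
      decide : unit? value ≡ true ⊎ not (unit? (s * (h₀ * h₀))) ≡ true → ⊥
      decide (inj₁ u) = unit?-sound value u (≈⇒∣- value≈0)
      decide (inj₂ n) = not-both π∣q (cop-∣ʳ π∣sh² (cop-sym coprime))
        where
        π∣sh² : π ∣𝒪 (s * (h * h))
        π∣sh² = ∣-resp-≈ (≈-* ≈-refl (≈-* (≈-sym (≈residue h)) (≈-sym (≈residue h)))) (residue≡0⇒∣ (s * (h₀ * h₀)) (ℕₚ.≡ᵇ⇒≡ _ 0 (≡true⇒T (not-not (residueℕ (s * (h₀ * h₀)) ℕ.≡ᵇ 0) n))))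
    go (inj₂ c) = finite (cop-pow k c)
      where
      finite : Cop q (power π k) → ⊥
      finite (cop {u} {w} f) = insoluble?-sound α β s k 0 𝟘 (u * h) (u * u * t) (proj₂ tests)
        (≈-trans (≡⇒≈ (scale-quartic t s α β h q u on-quartic))
          (quartic-≈ α β s (≡⇒≈ (start (u * h))) (subst (λ m → u * q ≈ 𝟙 [ power π m ]) (sym (ℕₚ.+-identityʳ k)) (by (𝟘 - w) (one′ (u * q) w (power π k) f)))))
        where
        one′ : ∀ x w m → x + w * m ≡ ι (ℤ.+ 1) → x ≡ ι (ℤ.+ 1) + m * (ι (ℤ.+ 0) - w)
        one′ x w m h₁ = trans (𝒪I.identity (v 0F) (# (ℤ.+ 1) ⊕ v 2F ⊗ (# (ℤ.+ 0) ⊖ v 1F) ⊕ # (ℤ.+ 1) ⊗ (v 0F ⊕ v 1F ⊗ v 2F ⊖ # (ℤ.+ 1))) refl (x ∷ w ∷ m ∷ [])) (𝒪I.vanish h₁)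
        start : ∀ z → z ≡ ι (ℤ.+ 0) + ι (ℤ.+ 1) * z
        start z = 𝒪I.identity (v 0F) (# (ℤ.+ 0) ⊕ # (ℤ.+ 1) ⊗ v 0F) refl (z ∷ [])

-- parity

Odd : 𝒪 → Set
Odd x = Cop x 𝟚

𝟜 𝟠 : 𝒪
𝟜 = ι (ℤ.+ 4)
𝟠 = ι (ℤ.+ 8)

even-odd′ : ∀ x k u w → x ≡ ι (ℤ.+ 2) * k → u * x + w * ι (ℤ.+ 2) ≡ ι (ℤ.+ 1) → ι (ℤ.+ 2) * (u * k + w) ≡ ι (ℤ.+ 1)
even-odd′ x k u w h₁ h₂ = trans (𝒪I.identity (# (ℤ.+ 2) ⊗ (v 2F ⊗ v 1F ⊕ v 3F)) (# (ℤ.+ 1) ⊕ (# (ℤ.+ 0) ⊖ v 2F) ⊗ (v 0F ⊖ # (ℤ.+ 2) ⊗ v 1F) ⊕ # (ℤ.+ 1) ⊗ (v 2F ⊗ v 0F ⊕ v 3F ⊗ # (ℤ.+ 2) ⊖ # (ℤ.+ 1))) refl (x ∷ k ∷ u ∷ w ∷ [])) (trans (𝒪I.vanish h₂) (𝒪I.vanish h₁))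

even-odd : ∀ {x} → 𝟚 ∣𝒪 x → Odd x → ⊥
even-odd {x} (k , p) (cop {u} {w} e) = ℕₚ.<⇒≱ (Prime𝒪.norm≥2 prime-𝟚) (ℕₚ.≤-reflexive (unit-norm (even-odd′ x k u w p e)))

parity : ∀ x → 𝟚 ∣𝒪 x ⊎ Odd x
parity = Prime𝒪.split prime-𝟚

odd≢𝟘 : ∀ {x} → Odd x → ¬ x ≡ 𝟘
odd≢𝟘 o e = even-odd (𝟘 , trans e (sym (*𝟘 𝟚))) o

odd-* : ∀ {x y} → Odd x → Odd y → Odd (x * y)
odd-* a b = cop-sym (cop-* (cop-sym a) (cop-sym b))

odd-*ˡ : ∀ {x y} → Odd (x * y) → Odd x
odd-*ˡ {x} {y} = cop-∣ˡ (∣*ˡ y)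

odd-*ʳ : ∀ {x y} → Odd (x * y) → Odd y
odd-*ʳ {x} {y} = cop-∣ˡ (∣*ʳ x)

even-sq : ∀ {x} → 𝟚 ∣𝒪 (x * x) → 𝟚 ∣𝒪 x
even-sq {x} d = go (parity x)
  where
  go : 𝟚 ∣𝒪 x ⊎ Odd x → 𝟚 ∣𝒪 x
  go (inj₁ e) = e
  go (inj₂ o) = ⊥-elim (even-odd d (odd-* o o))

odd-shift : ∀ x y k u w → x ≡ y + ι (ℤ.+ 2) * k → u * x + w * ι (ℤ.+ 2) ≡ ι (ℤ.+ 1) → u * y + (w + u * k) * ι (ℤ.+ 2) ≡ ι (ℤ.+ 1)
odd-shift x y k u w h₁ h₂ = trans (𝒪I.identity (v 3F ⊗ v 1F ⊕ (v 4F ⊕ v 3F ⊗ v 2F) ⊗ # (ℤ.+ 2)) (# (ℤ.+ 1) ⊕ (# (ℤ.+ 0) ⊖ v 3F) ⊗ (v 0F ⊖ (v 1F ⊕ # (ℤ.+ 2) ⊗ v 2F)) ⊕ # (ℤ.+ 1) ⊗ (v 3F ⊗ v 0F ⊕ v 4F ⊗ # (ℤ.+ 2) ⊖ # (ℤ.+ 1))) refl (x ∷ y ∷ k ∷ u ∷ w ∷ [])) (trans (𝒪I.vanish h₂) (𝒪I.vanish h₁))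

odd-≈ : ∀ {x y} → x ≈ y [ 𝟚 ] → Odd x → Odd y
odd-≈ {x} {y} (by k e) (cop {u} {w} f) = cop (odd-shift x y k u w e f)

weaken-42 : ∀ x y k → x ≡ y + ι (ℤ.+ 4) * k → x ≡ y + ι (ℤ.+ 2) * (ι (ℤ.+ 2) * k)
weaken-42 x y k h₁ = trans (𝒪I.identity (v 0F) (v 1F ⊕ # (ℤ.+ 2) ⊗ (# (ℤ.+ 2) ⊗ v 2F) ⊕ # (ℤ.+ 1) ⊗ (v 0F ⊖ (v 1F ⊕ # (ℤ.+ 4) ⊗ v 2F))) refl (x ∷ y ∷ k ∷ [])) (𝒪I.vanish h₁)
weaken-84 : ∀ x y k → x ≡ y + ι (ℤ.+ 8) * k → x ≡ y + ι (ℤ.+ 4) * (ι (ℤ.+ 2) * k)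
weaken-84 x y k h₁ = trans (𝒪I.identity (v 0F) (v 1F ⊕ # (ℤ.+ 4) ⊗ (# (ℤ.+ 2) ⊗ v 2F) ⊕ # (ℤ.+ 1) ⊗ (v 0F ⊖ (v 1F ⊕ # (ℤ.+ 8) ⊗ v 2F))) refl (x ∷ y ∷ k ∷ [])) (𝒪I.vanish h₁)
weaken-82 : ∀ x y k → x ≡ y + ι (ℤ.+ 8) * k → x ≡ y + ι (ℤ.+ 2) * (ι (ℤ.+ 4) * k)
weaken-82 x y k h₁ = trans (𝒪I.identity (v 0F) (v 1F ⊕ # (ℤ.+ 2) ⊗ (# (ℤ.+ 4) ⊗ v 2F) ⊕ # (ℤ.+ 1) ⊗ (v 0F ⊖ (v 1F ⊕ # (ℤ.+ 8) ⊗ v 2F))) refl (x ∷ y ∷ k ∷ [])) (𝒪I.vanish h₁)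
4⇒2 : ∀ {x y} → x ≈ y [ 𝟜 ] → x ≈ y [ 𝟚 ]
4⇒2 {x} {y} (by k e) = by _ (weaken-42 x y k e)
8⇒4 : ∀ {x y} → x ≈ y [ 𝟠 ] → x ≈ y [ 𝟜 ]
8⇒4 {x} {y} (by k e) = by _ (weaken-84 x y k e)
8⇒2 : ∀ {x y} → x ≈ y [ 𝟠 ] → x ≈ y [ 𝟚 ]
8⇒2 {x} {y} (by k e) = by _ (weaken-82 x y k e)

sq-lift₂ : ∀ x y k → x ≡ y + ι (ℤ.+ 2) * k → x * x ≡ y * y + ι (ℤ.+ 4) * (y * k + k * k)
sq-lift₂ x y k h₁ = trans (𝒪I.identity (v 0F ⊗ v 0F) (v 1F ⊗ v 1F ⊕ # (ℤ.+ 4) ⊗ (v 1F ⊗ v 2F ⊕ v 2F ⊗ v 2F) ⊕ (v 0F ⊕ v 1F ⊕ # (ℤ.+ 2) ⊗ v 2F) ⊗ (v 0F ⊖ (v 1F ⊕ # (ℤ.+ 2) ⊗ v 2F))) refl (x ∷ y ∷ k ∷ [])) (𝒪I.vanish h₁)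
sq-lift₄ : ∀ x y k → x ≡ y + ι (ℤ.+ 4) * k → x * x ≡ y * y + ι (ℤ.+ 8) * (y * k + ι (ℤ.+ 2) * k * k)
sq-lift₄ x y k h₁ = trans (𝒪I.identity (v 0F ⊗ v 0F) (v 1F ⊗ v 1F ⊕ # (ℤ.+ 8) ⊗ (v 1F ⊗ v 2F ⊕ # (ℤ.+ 2) ⊗ v 2F ⊗ v 2F) ⊕ (v 0F ⊕ v 1F ⊕ # (ℤ.+ 4) ⊗ v 2F) ⊗ (v 0F ⊖ (v 1F ⊕ # (ℤ.+ 4) ⊗ v 2F))) refl (x ∷ y ∷ k ∷ [])) (𝒪I.vanish h₁)

²-2⇒4 : ∀ {x y} → x ≈ y [ 𝟚 ] → x * x ≈ y * y [ 𝟜 ]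
²-2⇒4 {x} {y} (by k e) = by _ (sq-lift₂ x y k e)
²-4⇒8 : ∀ {x y} → x ≈ y [ 𝟜 ] → x * x ≈ y * y [ 𝟠 ]
²-4⇒8 {x} {y} (by k e) = by _ (sq-lift₄ x y k e)

scale-42 : ∀ x y k → x ≡ y + ι (ℤ.+ 2) * k → ι (ℤ.+ 4) * x ≡ ι (ℤ.+ 4) * y + ι (ℤ.+ 8) * k
scale-42 x y k h₁ = trans (𝒪I.identity (# (ℤ.+ 4) ⊗ v 0F) (# (ℤ.+ 4) ⊗ v 1F ⊕ # (ℤ.+ 8) ⊗ v 2F ⊕ # (ℤ.+ 4) ⊗ (v 0F ⊖ (v 1F ⊕ # (ℤ.+ 2) ⊗ v 2F))) refl (x ∷ y ∷ k ∷ [])) (𝒪I.vanish h₁)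
4*-2⇒8 : ∀ {x y} → x ≈ y [ 𝟚 ] → 𝟜 * x ≈ 𝟜 * y [ 𝟠 ]
4*-2⇒8 {x} {y} (by k e) = by k (scale-42 x y k e)

√-sum : ∀ x y k → x * x ≡ y * y + ι (ℤ.+ 2) * k → (x - y) * (x - y) ≡ ι (ℤ.+ 2) * (y * y + k - x * y)
√-sum x y k h₁ = trans (𝒪I.identity ((v 0F ⊖ v 1F) ⊗ (v 0F ⊖ v 1F)) (# (ℤ.+ 2) ⊗ (v 1F ⊗ v 1F ⊕ v 2F ⊖ v 0F ⊗ v 1F) ⊕ # (ℤ.+ 1) ⊗ (v 0F ⊗ v 0F ⊖ (v 1F ⊗ v 1F ⊕ # (ℤ.+ 2) ⊗ v 2F))) refl (x ∷ y ∷ k ∷ [])) (𝒪I.vanish h₁)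
√-≈2 : ∀ {x y} → x * x ≈ y * y [ 𝟚 ] → x ≈ y [ 𝟚 ]
√-≈2 {x} {y} (by k e) = ∣-⇒≈ (even-sq (_ , √-sum x y k e))

√₈₁ : ∀ x y j k → x * x ≡ y * y + ι (ℤ.+ 8) * k → x ≡ y + ι (ℤ.+ 2) * j → ι (ℤ.+ 4) * (j * (j + y)) ≡ ι (ℤ.+ 4) * (ι (ℤ.+ 2) * k)
√₈₁ x y j k h₁ h₂ = trans (𝒪I.identity (# (ℤ.+ 4) ⊗ (v 2F ⊗ (v 2F ⊕ v 1F))) (# (ℤ.+ 4) ⊗ (# (ℤ.+ 2) ⊗ v 3F) ⊕ # (ℤ.+ 1) ⊗ (v 0F ⊗ v 0F ⊖ (v 1F ⊗ v 1F ⊕ # (ℤ.+ 8) ⊗ v 3F)) ⊕ (# (ℤ.+ 0) ⊖ v 0F ⊖ v 1F ⊖ # (ℤ.+ 2) ⊗ v 2F) ⊗ (v 0F ⊖ (v 1F ⊕ # (ℤ.+ 2) ⊗ v 2F))) refl (x ∷ y ∷ j ∷ k ∷ [])) (trans (𝒪I.vanish h₂) (𝒪I.vanish h₁))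
√₈₂ : ∀ x y j i → x ≡ y + ι (ℤ.+ 2) * j → j ≡ ι (ℤ.+ 2) * i → x ≡ y + ι (ℤ.+ 4) * i
√₈₂ x y j i h₁ h₂ = trans (𝒪I.identity (v 0F) (v 1F ⊕ # (ℤ.+ 4) ⊗ v 3F ⊕ # (ℤ.+ 1) ⊗ (v 0F ⊖ (v 1F ⊕ # (ℤ.+ 2) ⊗ v 2F)) ⊕ # (ℤ.+ 2) ⊗ (v 2F ⊖ # (ℤ.+ 2) ⊗ v 3F)) refl (x ∷ y ∷ j ∷ i ∷ [])) (trans (𝒪I.vanish h₂) (𝒪I.vanish h₁))
√₈₃ : ∀ x y j i → x ≡ y + ι (ℤ.+ 2) * j → j + y ≡ ι (ℤ.+ 2) * i → x ≡ ι (ℤ.+ 0) - y + ι (ℤ.+ 4) * i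
√₈₃ x y j i h₁ h₂ = trans (𝒪I.identity (v 0F) (# (ℤ.+ 0) ⊖ v 1F ⊕ # (ℤ.+ 4) ⊗ v 3F ⊕ # (ℤ.+ 1) ⊗ (v 0F ⊖ (v 1F ⊕ # (ℤ.+ 2) ⊗ v 2F)) ⊕ # (ℤ.+ 2) ⊗ (v 2F ⊕ v 1F ⊖ # (ℤ.+ 2) ⊗ v 3F)) refl (x ∷ y ∷ j ∷ i ∷ [])) (trans (𝒪I.vanish h₂) (𝒪I.vanish h₁))

ι≢𝟘 : ∀ n → ¬ ι (ℤ.+ suc n) ≡ 𝟘
ι≢𝟘 n e with cong c₁ e
... | ()

-- The squares agree modulo 2, so x = y + 2j because 2 is prime. The congruence modulo 8 then says
-- that 2 divides j (j + y), and the two factors correspond to the two signs.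
√-≈8 : ∀ {x y} → x * x ≈ y * y [ 𝟠 ] → x ≈ y [ 𝟜 ] ⊎ x ≈ 𝟘 - y [ 𝟜 ]
√-≈8 {x} {y} (by k e) = go (√-≈2 (8⇒2 (by k e)))
  where
  go : x ≈ y [ 𝟚 ] → x ≈ y [ 𝟜 ] ⊎ x ≈ 𝟘 - y [ 𝟜 ]
  go (by j f) = half (parity j)
    where
    half : 𝟚 ∣𝒪 j ⊎ Odd j → x ≈ y [ 𝟜 ] ⊎ x ≈ 𝟘 - y [ 𝟜 ]
    half (inj₁ (i , g)) = inj₁ (by i (√₈₂ x y j i f g))
    half (inj₂ o) = other (euclid (cop-sym o) (_ , *-cancelˡ (ι≢𝟘 3) (√₈₁ x y j k e f)))
      where
      other : 𝟚 ∣𝒪 (j + y) → x ≈ y [ 𝟜 ] ⊎ x ≈ 𝟘 - y [ 𝟜 ]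
      other (i , g) = inj₂ (by i (√₈₃ x y j i f g))

neg² : ∀ x → (ι (ℤ.+ 0) - x) * (ι (ℤ.+ 0) - x) ≡ x * x
neg² x = 𝒪I.identity ((# (ℤ.+ 0) ⊖ v 0F) ⊗ (# (ℤ.+ 0) ⊖ v 0F)) (v 0F ⊗ v 0F) refl (x ∷ [])
neg-≈ : ∀ x y k → x ≡ ι (ℤ.+ 0) - y + ι (ℤ.+ 4) * k → ι (ℤ.+ 0) - x ≡ y + ι (ℤ.+ 4) * (ι (ℤ.+ 0) - k)
neg-≈ x y k h₁ = trans (𝒪I.identity (# (ℤ.+ 0) ⊖ v 0F) (v 1F ⊕ # (ℤ.+ 4) ⊗ (# (ℤ.+ 0) ⊖ v 2F) ⊕ (# (ℤ.+ 0) ⊖ # (ℤ.+ 1)) ⊗ (v 0F ⊖ (# (ℤ.+ 0) ⊖ v 1F ⊕ # (ℤ.+ 4) ⊗ v 2F))) refl (x ∷ y ∷ k ∷ [])) (𝒪I.vanish h₁)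

√-sign : ∀ {x y} → x * x ≈ y * y [ 𝟠 ] → ∃ λ z → z * z ≡ x * x × z ≈ y [ 𝟜 ]
√-sign {x} {y} e = go (√-≈8 e)
  where
  go : x ≈ y [ 𝟜 ] ⊎ x ≈ 𝟘 - y [ 𝟜 ] → ∃ λ z → z * z ≡ x * x × z ≈ y [ 𝟜 ]
  go (inj₁ f) = x , refl , f
  go (inj₂ (by k f)) = 𝟘 - x , neg² x , by _ (neg-≈ x y k f)

inverse₈ : ∀ y u w → u * y + w * (ι (ℤ.+ 2) * (ι (ℤ.+ 2) * (ι (ℤ.+ 2) * ι (ℤ.+ 1)))) ≡ ι (ℤ.+ 1) → u * y ≡ ι (ℤ.+ 1) + ι (ℤ.+ 8) * (ι (ℤ.+ 0) - w)
inverse₈ y u w h₁ = trans (𝒪I.identity (v 1F ⊗ v 0F) (# (ℤ.+ 1) ⊕ # (ℤ.+ 8) ⊗ (# (ℤ.+ 0) ⊖ v 2F) ⊕ # (ℤ.+ 1) ⊗ (v 1F ⊗ v 0F ⊕ v 2F ⊗ (# (ℤ.+ 2) ⊗ (# (ℤ.+ 2) ⊗ (# (ℤ.+ 2) ⊗ # (ℤ.+ 1)))) ⊖ # (ℤ.+ 1))) refl (y ∷ u ∷ w ∷ [])) (𝒪I.vanish h₁)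

odd-inverse : ∀ {y} → Odd y → ∃ λ i → i * y ≈ 𝟙 [ 𝟠 ]
odd-inverse {y} o = go (cop-* o (cop-* o (cop-* o cop-𝟙)))
  where
  go : Cop y (power 𝟚 3) → ∃ λ i → i * y ≈ 𝟙 [ 𝟠 ]
  go (cop {u} {w} e) = u , by _ (inverse₈ y u w e)

collect-square : ∀ i s y → i * i * (s * (y * y)) ≡ s * (i * y * (i * y))
collect-square i s y = 𝒪I.identity (v 0F ⊗ v 0F ⊗ (v 1F ⊗ (v 2F ⊗ v 2F))) (v 1F ⊗ (v 0F ⊗ v 2F ⊗ (v 0F ⊗ v 2F))) refl (i ∷ s ∷ y ∷ [])
s*1*1 : ∀ s → s * (ι (ℤ.+ 1) * ι (ℤ.+ 1)) ≡ s
s*1*1 s = 𝒪I.identity (v 0F ⊗ (# (ℤ.+ 1) ⊗ # (ℤ.+ 1))) (v 0F) refl (s ∷ [])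

class-≈ : ∀ {X s y} → X ≡ s * (y * y) → Odd X → ∃ λ i → s ≈ i * i * X [ 𝟠 ]
class-≈ {X} {s} {y} X≡ oX = go (odd-inverse (odd-*ˡ (odd-*ʳ (subst Odd X≡ oX))))
  where
  go : (∃ λ i → i * y ≈ 𝟙 [ 𝟠 ]) → ∃ λ i → s ≈ i * i * X [ 𝟠 ]
  go (i , e) = i , ≈-sym (≈-trans (≡⇒≈ (trans (cong (λ x → i * i * x) X≡) (collect-square i s y))) (≈-trans (≈-* ≈-refl (≈-* e e)) (≡⇒≈ (s*1*1 s))))

unit-part : ∀ i z e → i * i * (z * z * (ι (ℤ.+ 1) + ι (ℤ.+ 4) * e)) * (ι (ℤ.+ 1) - ι (ℤ.+ 4) * e) ≡ i * z * (i * z) + ι (ℤ.+ 8) * (ι (ℤ.+ 0) - ι (ℤ.+ 2) * e * e * i * z * i * z)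
unit-part i z e = 𝒪I.identity (v 0F ⊗ v 0F ⊗ (v 1F ⊗ v 1F ⊗ (# (ℤ.+ 1) ⊕ # (ℤ.+ 4) ⊗ v 2F)) ⊗ (# (ℤ.+ 1) ⊖ # (ℤ.+ 4) ⊗ v 2F)) (v 0F ⊗ v 1F ⊗ (v 0F ⊗ v 1F) ⊕ # (ℤ.+ 8) ⊗ (# (ℤ.+ 0) ⊖ # (ℤ.+ 2) ⊗ v 2F ⊗ v 2F ⊗ v 0F ⊗ v 1F ⊗ v 0F ⊗ v 1F)) refl (i ∷ z ∷ e ∷ [])

-- The square factors have odd roots that can be inverted modulo 8, and 1 - 4e is the inverse of 1 +
-- 4e modulo 8.
class₈ : ∀ {X s y Z} e → X ≡ s * (y * y) → Odd X → X ≈ Z * Z * (𝟙 + 𝟜 * e) [ 𝟠 ] → ∃ λ w → s * (𝟙 - 𝟜 * e) ≈ w * w [ 𝟠 ]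
class₈ {X} {s} {y} {Z} e X≡ oX X≈ = go (class-≈ X≡ oX)
  where
  go : (∃ λ i → s ≈ i * i * X [ 𝟠 ]) → ∃ λ w → s * (𝟙 - 𝟜 * e) ≈ w * w [ 𝟠 ]
  go (i , f) = i * Z , ≈-trans (≈-* (≈-trans f (≈-* ≈-refl X≈)) ≈-refl) (by _ (unit-part i Z e))

move-square : ∀ i b g → i * i * (b * (g * g)) ≡ b * (i * g * (i * g))
move-square i b g = 𝒪I.identity (v 0F ⊗ v 0F ⊗ (v 1F ⊗ (v 2F ⊗ v 2F))) (v 1F ⊗ (v 0F ⊗ v 2F ⊗ (v 0F ⊗ v 2F))) refl (i ∷ b ∷ g ∷ [])

class₄ : ∀ {X s y b g} → X ≡ s * (y * y) → Odd X → X ≈ b * (g * g) [ 𝟜 ] → ∃ λ w → s ≈ b * (w * w) [ 𝟜 ]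
class₄ {X} {s} {y} {b} {g} X≡ oX X≈ = go (class-≈ X≡ oX)
  where
  go : (∃ λ i → s ≈ i * i * X [ 𝟠 ]) → ∃ λ w → s ≈ b * (w * w) [ 𝟜 ]
  go (i , f) = i * g , ≈-trans (8⇒4 f) (≈-trans (≈-* ≈-refl X≈) (≡⇒≈ (move-square i b g)))

-- sieving square classes

-- A square modulo 8 depends on its root modulo 4 only, and a square modulo 4 on its root modulo 2;
-- hence the ranges of the searches.
excludes₈ excludes₄ : 𝒪 → 𝒪 → Bool
excludes₈ e s = all𝒪 4 λ w → not (div? 8 (s * (𝟙 - 𝟜 * e) - w * w))
excludes₄ b s = all𝒪 2 λ w → not (div? 4 (s - b * (w * w)))

not-true : ∀ {b} → b ≡ true → not b ≡ true → ⊥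
not-true refl ()

excludes₈-sound : ∀ e s → excludes₈ e s ≡ true → ¬ ∃ λ w → s * (𝟙 - 𝟜 * e) ≈ w * w [ 𝟠 ]
excludes₈-sound e s t (w , f) = go (all𝒪-sound 4 (λ w → not (div? 8 (s * (𝟙 - 𝟜 * e) - w * w))) t w)
  where
  go : (∃ λ r → w ≈ r [ 𝟜 ] × not (div? 8 (s * (𝟙 - 𝟜 * e) - r * r)) ≡ true) → ⊥
  go (r , w≈r , p) = not-true (div?-complete 8 (≈⇒∣- (≈-trans f (²-4⇒8 w≈r)))) p

excludes₄-sound : ∀ b s → excludes₄ b s ≡ true → ¬ ∃ λ w → s ≈ b * (w * w) [ 𝟜 ]
excludes₄-sound b s t (w , f) = go (all𝒪-sound 2 (λ w → not (div? 4 (s - b * (w * w)))) t w)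
  where
  go : (∃ λ r → w ≈ r [ 𝟚 ] × not (div? 4 (s - b * (r * r))) ≡ true) → ⊥
  go (r , w≈r , p) = not-true (div?-complete 4 (≈⇒∣- (≈-trans f (≈-* ≈-refl (²-2⇒4 w≈r))))) p

allBool : (Bool → Bool) → Bool
allBool p = p true ∧ p false

allBool-sound : ∀ p → allBool p ≡ true → ∀ b → p b ≡ true
allBool-sound p e true = proj₁ (∧-split (p true) (p false) e)
allBool-sound p e false = proj₂ (∧-split (p true) (p false) e)

allClasses : (Class → Bool) → Bool
allClasses p = allBool λ a → allBool λ b → allBool λ c → allBool λ d → allBool λ e → allBool λ f → p (cls a b c d e f)

allClasses-sound : ∀ p → allClasses p ≡ true → ∀ s → p s ≡ true
allClasses-sound p t (cls a b c d e f) = allBool-sound (λ f → p (cls a b c d e f)) (allBool-sound (λ e → allBool λ f → p (cls a b c d e f)) (allBool-sound (λ d → allBool λ e → allBool λ f → p (cls a b c d e f)) (allBool-sound (λ c → allBool λ d → allBool λ e → allBool λ f → p (cls a b c d e f)) (allBool-sound (λ b → allBool λ c → allBool λ d → allBool λ e → allBool λ f → p (cls a b c d e f)) (allBool-sound (λ a → allBool λ b → allBool λ c → allBool λ d → allBool λ e → allBool λ f → p (cls a b c d e f)) t a) b) c) d) e) f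

opaque
 -- Insolubility of the torsor at one of the primes above 3 and 5; the numbers are depths of the
 -- digit search.
 dead? : (α β : 𝒪) → 𝒪 → Bool
 dead? α β s = Local.kill? at-θ α β s 5 ∨ (Local.kill? at-π₅ α β s 4 ∨ Local.kill? at-ρ₅ α β s 5)

∨-case : ∀ {A : Set} a b → (a ≡ true → A) → (b ≡ true → A) → a ∨ b ≡ true → A
∨-case true b f g e = f e
∨-case false b f g e = g e

opaque
 unfolding dead?
 dead-sound : ∀ {α β X g} (nf : NormalForm α β X g) → dead? α β ⟦ NormalForm.class nf ⟧ᶜ ≡ true → ⊥
 dead-sound {α} {β} nf = ∨-case (Local.kill? at-θ α β ⟦ NormalForm.class nf ⟧ᶜ 5) _ (Local.kill at-θ 5 nf)
   (∨-case (Local.kill? at-π₅ α β ⟦ NormalForm.class nf ⟧ᶜ 4) _ (Local.kill at-π₅ 4 nf) (Local.kill at-ρ₅ 5 nf))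

-- Each of the 64 classes must violate the condition at 2, or be allowed, or have a torsor without
-- local points above 3 or 5. What is allowed thus contains the part of the isogeny Selmer group
-- that meets the condition at 2.
sieve? : (α β : 𝒪) (allowed : Class → Bool) (excluded : 𝒪 → Bool) → Bool
sieve? α β allowed excluded = allClasses λ s → excluded ⟦ s ⟧ᶜ ∨ (allowed s ∨ dead? α β ⟦ s ⟧ᶜ)

sieve : ∀ {α β X g} allowed excluded → sieve? α β allowed excluded ≡ true → (nf : NormalForm α β X g) →
  ¬ excluded ⟦ NormalForm.class nf ⟧ᶜ ≡ true → allowed (NormalForm.class nf) ≡ true
sieve {α} {β} allowed excluded t nf n = ∨-case (excluded ⟦ s ⟧ᶜ) _ (λ e → ⊥-elim (n e))
  (∨-case (allowed s) _ (λ a → a) (λ d → ⊥-elim (dead-sound nf d)))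
  (allClasses-sound (λ s → excluded ⟦ s ⟧ᶜ ∨ (allowed s ∨ dead? α β ⟦ s ⟧ᶜ)) t s)
  where
  s = NormalForm.class nf

none trivial-class trivial-or-twist : Class → Bool
none _ = false
trivial-class (cls false false false false false false) = true
trivial-class _ = false
trivial-or-twist (cls false false false false false false) = true
trivial-or-twist (cls false true false true false true) = true
trivial-or-twist _ = false

-- For the three curves below the coefficient b of the dual curve is this class times a square
-- (`b≡twistI` and its analogues), so this is the image of the dual 2-torsion point (0 , 0) under
-- the descent map.
twist : 𝒪
twist = ⟦ cls false true false true false true ⟧ᶜ

trivial-value : ∀ y → ι (ℤ.+ 1) * ι (ℤ.+ 1) * (ι (ℤ.+ 1) * ι (ℤ.+ 1) * ι (ℤ.+ 1) * ι (ℤ.+ 1)) * (y * y) ≡ y * y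
trivial-value y = 𝒪I.identity (# (ℤ.+ 1) ⊗ # (ℤ.+ 1) ⊗ (# (ℤ.+ 1) ⊗ # (ℤ.+ 1) ⊗ # (ℤ.+ 1) ⊗ # (ℤ.+ 1)) ⊗ (v 0F ⊗ v 0F)) (v 0F ⊗ v 0F) refl (y ∷ [])

trivial-square : ∀ s → trivial-class s ≡ true → ∀ {X y} → X ≡ ⟦ s ⟧ᶜ * (y * y) → X ≡ y * y
trivial-square (cls false false false false false false) _ {X} {y} e = trans e (trivial-value y)

trivial-or-twist-square : ∀ s → trivial-or-twist s ≡ true → ∀ {X y} → X ≡ ⟦ s ⟧ᶜ * (y * y) → X ≡ y * y ⊎ X ≡ twist * (y * y)
trivial-or-twist-square (cls false false false false false false) _ {X} {y} e = inj₁ (trans e (trivial-value y))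
trivial-or-twist-square (cls false true false true false true) _ e = inj₂ e

-- the two roots of a datum

other-root : ∀ X X̄ Z α g m k → X + X̄ ≡ Z * Z + α * (g * g) → X̄ ≡ m * k → X ≡ Z * Z + α * (g * g) + m * (ι (ℤ.+ 0) - k)
other-root X X̄ Z α g m k h₁ h₂ = trans (𝒪I.identity (v 0F) (v 2F ⊗ v 2F ⊕ v 3F ⊗ (v 4F ⊗ v 4F) ⊕ v 5F ⊗ (# (ℤ.+ 0) ⊖ v 6F) ⊕ # (ℤ.+ 1) ⊗ (v 0F ⊕ v 1F ⊖ (v 2F ⊗ v 2F ⊕ v 3F ⊗ (v 4F ⊗ v 4F))) ⊕ (# (ℤ.+ 0) ⊖ # (ℤ.+ 1)) ⊗ (v 1F ⊖ v 5F ⊗ v 6F)) refl (X ∷ X̄ ∷ Z ∷ α ∷ g ∷ m ∷ k ∷ [])) (trans (𝒪I.vanish h₂) (𝒪I.vanish h₁))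

-- Since m divides X X̄ and is coprime to X, it divides X̄; the sum of the two roots then determines
-- X modulo m.
odd-root : ∀ {α β X g m} → Cop m X → m ∣𝒪 (β * (g * g * (g * g))) → (d : Datum α β X g) → X ≈ Datum.Z d * Datum.Z d + α * (g * g) [ m ]
odd-root {α} {β} {X} {g} {m} c m∣ (datum X̄ Z product sum) = go (euclid c (subst (m ∣𝒪_) (sym product) m∣))
  where
  go : m ∣𝒪 X̄ → X ≈ Z * Z + α * (g * g) [ m ]
  go (k , e) = by _ (other-root X X̄ Z α g m k sum e)

record OddRoot (α β g Z : 𝒪) : Set where
  constructor odd-datum
  field
    {X X̄} : 𝒪
    odd : Odd X
    product : X * X̄ ≡ β * (g * g * (g * g))
    sum : X + X̄ ≡ Z * Z + α * (g * g)

*-swap : ∀ x y → x * y ≡ y * x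
*-swap x y = 𝒪I.identity (v 0F ⊗ v 1F) (v 1F ⊗ v 0F) refl (x ∷ y ∷ [])
+-swap : ∀ x y → x + y ≡ y + x
+-swap x y = 𝒪I.identity (v 0F ⊕ v 1F) (v 1F ⊕ v 0F) refl (x ∷ y ∷ [])
even-sum : ∀ X X̄ S k l → X ≡ ι (ℤ.+ 2) * k → X̄ ≡ ι (ℤ.+ 2) * l → X + X̄ ≡ S → S ≡ ι (ℤ.+ 2) * (k + l)
even-sum X X̄ S k l h₁ h₂ h₃ = trans (𝒪I.identity (v 2F) (# (ℤ.+ 2) ⊗ (v 3F ⊕ v 4F) ⊕ # (ℤ.+ 1) ⊗ (v 0F ⊖ # (ℤ.+ 2) ⊗ v 3F) ⊕ # (ℤ.+ 1) ⊗ (v 1F ⊖ # (ℤ.+ 2) ⊗ v 4F) ⊕ (# (ℤ.+ 0) ⊖ # (ℤ.+ 1)) ⊗ (v 0F ⊕ v 1F ⊖ v 2F)) refl (X ∷ X̄ ∷ S ∷ k ∷ l ∷ [])) (trans (𝒪I.vanish h₃) (trans (𝒪I.vanish h₂) (𝒪I.vanish h₁)))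

-- An odd sum has an odd summand, and choosing X̄ instead of X amounts to a translation by (0 , 0).
select-odd : ∀ {α β X g} → (d : Datum α β X g) → Odd (Datum.Z d * Datum.Z d + α * (g * g)) → OddRoot α β g (Datum.Z d)
select-odd {α} {β} {X} {g} (datum X̄ Z product sum) o = go (parity X) (parity X̄)
  where
  go : 𝟚 ∣𝒪 X ⊎ Odd X → 𝟚 ∣𝒪 X̄ ⊎ Odd X̄ → OddRoot α β g Z
  go (inj₂ oX) _ = odd-datum oX product sum
  go (inj₁ _) (inj₂ oX̄) = odd-datum oX̄ (trans (*-swap X̄ X) product) (trans (+-swap X̄ X) sum)
  go (inj₁ (k , p)) (inj₁ (l , q)) = ⊥-elim (even-odd (_ , even-sum X X̄ _ k l p q sum) o)

root : ∀ {α β g Z} (o : OddRoot α β g Z) → Datum α β (OddRoot.X o) g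
root {Z = Z} (odd-datum {X} {X̄} _ p s) = datum X̄ Z p s

-- the dual isogeny

dual₀ : ∀ X̄ f h α β G → f * f * X̄ ≡ β * (ι (ℤ.+ 2) * G * (ι (ℤ.+ 2) * G) * (ι (ℤ.+ 2) * G * (ι (ℤ.+ 2) * G))) → f * f + X̄ ≡ (ι (ℤ.+ 2) * h - f) * (ι (ℤ.+ 2) * h - f) + α * (ι (ℤ.+ 2) * G * (ι (ℤ.+ 2) * G)) → ι (ℤ.+ 4) * (f * f * (h * (f - h))) ≡ ι (ℤ.+ 4) * (α * (f * f) * (G * G) - ι (ℤ.+ 4) * β * (G * G * (G * G)))
dual₀ X̄ f h α β G h₁ h₂ = trans (𝒪I.identity (# (ℤ.+ 4) ⊗ (v 1F ⊗ v 1F ⊗ (v 2F ⊗ (v 1F ⊖ v 2F)))) (# (ℤ.+ 4) ⊗ (v 3F ⊗ (v 1F ⊗ v 1F) ⊗ (v 5F ⊗ v 5F) ⊖ # (ℤ.+ 4) ⊗ v 4F ⊗ (v 5F ⊗ v 5F ⊗ (v 5F ⊗ v 5F))) ⊕ (# (ℤ.+ 0) ⊖ # (ℤ.+ 1)) ⊗ (v 1F ⊗ v 1F ⊗ v 0F ⊖ v 4F ⊗ (# (ℤ.+ 2) ⊗ v 5F ⊗ (# (ℤ.+ 2) ⊗ v 5F) ⊗ (# (ℤ.+ 2) ⊗ v 5F ⊗ (# (ℤ.+ 2) ⊗ v 5F)))) ⊕ v 1F ⊗ v 1F ⊗ (v 1F ⊗ v 1F ⊕ v 0F ⊖ ((#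 (ℤ.+ 2) ⊗ v 2F ⊖ v 1F) ⊗ (# (ℤ.+ 2) ⊗ v 2F ⊖ v 1F) ⊕ v 3F ⊗ (# (ℤ.+ 2) ⊗ v 5F ⊗ (# (ℤ.+ 2) ⊗ v 5F))))) refl (X̄ ∷ f ∷ h ∷ α ∷ β ∷ G ∷ [])) (trans (𝒪I.vanish h₂) (𝒪I.vanish h₁))
dual₁ : ∀ f h α β b G → f * f * (h * (f - h)) ≡ α * (f * f) * (G * G) - ι (ℤ.+ 4) * β * (G * G * (G * G)) → b ≡ α * α - ι (ℤ.+ 4) * β → (f * h - α * (G * G)) * (f * (f - h) - α * (G * G)) ≡ b * (G * G * (G * G))
dual₁ f h α β b G h₁ h₂ = trans (𝒪I.identity ((v 0F ⊗ v 1F ⊖ v 2F ⊗ (v 5F ⊗ v 5F)) ⊗ (v 0F ⊗ (v 0F ⊖ v 1F) ⊖ v 2F ⊗ (v 5F ⊗ v 5F))) (v 4F ⊗ (v 5F ⊗ v 5F ⊗ (v 5F ⊗ v 5F)) ⊕ # (ℤ.+ 1) ⊗ (v 0F ⊗ v 0F ⊗ (v 1F ⊗ (v 0F ⊖ v 1F)) ⊖ (v 2F ⊗ (v 0F ⊗ v 0F) ⊗ (v 5F ⊗ v 5F) ⊖ # (ℤ.+ 4) ⊗ v 3F ⊗ (v 5F ⊗ v 5F ⊗ (v 5F ⊗ v 5F)))) ⊕ (# (ℤ.+ 0) ⊖ v 5F ⊗ v 5F ⊗ v 5F ⊗ v 5F) ⊗ (v 4F ⊖ (v 2F ⊗ v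 2F ⊖ # (ℤ.+ 4) ⊗ v 3F))) refl (f ∷ h ∷ α ∷ β ∷ b ∷ G ∷ [])) (trans (𝒪I.vanish h₂) (𝒪I.vanish h₁))
dual₂ : ∀ f h α G → f * h - α * (G * G) + (f * (f - h) - α * (G * G)) ≡ f * f + (ι (ℤ.+ 0) - ι (ℤ.+ 2) * α) * (G * G)
dual₂ f h α G = 𝒪I.identity (v 0F ⊗ v 1F ⊖ v 2F ⊗ (v 3F ⊗ v 3F) ⊕ (v 0F ⊗ (v 0F ⊖ v 1F) ⊖ v 2F ⊗ (v 3F ⊗ v 3F))) (v 0F ⊗ v 0F ⊕ (# (ℤ.+ 0) ⊖ # (ℤ.+ 2) ⊗ v 2F) ⊗ (v 3F ⊗ v 3F)) refl (f ∷ h ∷ α ∷ G ∷ [])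

half-equation : ∀ {α β X G f h} (d : Datum α β X (𝟚 * G)) → f * f ≡ X → Datum.Z d ≡ 𝟚 * h - f →
  f * f * (h * (f - h)) ≡ α * (f * f) * (G * G) - 𝟜 * β * (G * G * (G * G))
half-equation {α} {β} {_} {G} {f} {h} (datum X̄ _ product sum) refl refl = *-cancelˡ (ι≢𝟘 3) (dual₀ X̄ f h α β G product sum)

-- When x is the square of f / 2G, the point is the image under the dual isogeny of a point on y² =
-- x (x² + 2αx + b). The parity relation Z = 2h - f makes the lift integral with half the
-- denominator, and f becomes its new Z.
dual : ∀ {α β b X G f h} (d : Datum α β X (𝟚 * G)) → f * f ≡ X → Datum.Z d ≡ 𝟚 * h - f → b ≡ α * α - 𝟜 * β → Datum (𝟘 - 𝟚 * α) b (f * h - α * (G * G)) G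
dual {α} {β} {b} {X} {G} {f} {h} d f²≡ Z≡ b≡ = datum (f * (f - h) - α * (G * G)) f (dual₁ f h α β b G (half-equation d f²≡ Z≡) b≡) (dual₂ f h α G)

untwist₁ : ∀ P α β b G → P ≡ (ι (ℤ.+ 0) - ι (ℤ.+ 2) * α) * (ι (ℤ.+ 0) - ι (ℤ.+ 2) * α) * (G * G * (G * G)) - ι (ℤ.+ 4) * b * (G * G * (G * G)) → b ≡ α * α - ι (ℤ.+ 4) * β → P ≡ β * (ι (ℤ.+ 2) * G * (ι (ℤ.+ 2) * G) * (ι (ℤ.+ 2) * G * (ι (ℤ.+ 2) * G)))
untwist₁ P α β b G h₁ h₂ = trans (𝒪I.identity (v 0F) (v 2F ⊗ (# (ℤ.+ 2) ⊗ v 4F ⊗ (# (ℤ.+ 2) ⊗ v 4F) ⊗ (# (ℤ.+ 2) ⊗ v 4F ⊗ (# (ℤ.+ 2) ⊗ v 4F))) ⊕ # (ℤ.+ 1) ⊗ (v 0F ⊖ ((# (ℤ.+ 0) ⊖ # (ℤ.+ 2) ⊗ v 1F) ⊗ (# (ℤ.+ 0) ⊖ # (ℤ.+ 2) ⊗ v 1F) ⊗ (v 4F ⊗ v 4F ⊗ (v 4F ⊗ v 4F)) ⊖ # (ℤ.+ 4) ⊗ v 3F ⊗ (v 4F ⊗ v 4F ⊗ (v 4F ⊗ v 4F)))) ⊕ (# (ℤ.+ 0) ⊖ # (ℤ.+ 4) ⊗ v 4F ⊗ v 4F ⊗ v 4F ⊗ v 4F) ⊗ (v 3F ⊖ (v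 1F ⊗ v 1F ⊖ # (ℤ.+ 4) ⊗ v 2F))) refl (P ∷ α ∷ β ∷ b ∷ G ∷ [])) (trans (𝒪I.vanish h₂) (𝒪I.vanish h₁))
untwist₂ : ∀ S M α G → S ≡ M * M + (ι (ℤ.+ 0) - ι (ℤ.+ 2) * (ι (ℤ.+ 0) - ι (ℤ.+ 2) * α)) * (G * G) → S ≡ M * M + α * (ι (ℤ.+ 2) * G * (ι (ℤ.+ 2) * G))
untwist₂ S M α G h₁ = trans (𝒪I.identity (v 0F) (v 1F ⊗ v 1F ⊕ v 2F ⊗ (# (ℤ.+ 2) ⊗ v 3F ⊗ (# (ℤ.+ 2) ⊗ v 3F)) ⊕ # (ℤ.+ 1) ⊗ (v 0F ⊖ (v 1F ⊗ v 1F ⊕ (# (ℤ.+ 0) ⊖ # (ℤ.+ 2) ⊗ (# (ℤ.+ 0) ⊖ # (ℤ.+ 2) ⊗ v 2F)) ⊗ (v 3F ⊗ v 3F)))) refl (S ∷ M ∷ α ∷ G ∷ [])) (𝒪I.vanish h₁)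
untwist₃ : ∀ α b G → ((ι (ℤ.+ 0) - ι (ℤ.+ 2) * α) * (ι (ℤ.+ 0) - ι (ℤ.+ 2) * α) - ι (ℤ.+ 4) * b) * (G * G * (G * G)) ≡ (ι (ℤ.+ 0) - ι (ℤ.+ 2) * α) * (ι (ℤ.+ 0) - ι (ℤ.+ 2) * α) * (G * G * (G * G)) - ι (ℤ.+ 4) * b * (G * G * (G * G))
untwist₃ α b G = 𝒪I.identity (((# (ℤ.+ 0) ⊖ # (ℤ.+ 2) ⊗ v 0F) ⊗ (# (ℤ.+ 0) ⊖ # (ℤ.+ 2) ⊗ v 0F) ⊖ # (ℤ.+ 4) ⊗ v 1F) ⊗ (v 2F ⊗ v 2F ⊗ (v 2F ⊗ v 2F))) ((# (ℤ.+ 0) ⊖ # (ℤ.+ 2) ⊗ v 0F) ⊗ (# (ℤ.+ 0) ⊖ # (ℤ.+ 2) ⊗ v 0F) ⊗ (v 2F ⊗ v 2F ⊗ (v 2F ⊗ v 2F)) ⊖ # (ℤ.+ 4) ⊗ v 1F ⊗ (v 2F ⊗ v 2F ⊗ (v 2F ⊗ v 2F))) refl (α ∷ b ∷ G ∷ [])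

-- The dual of the dual has coefficients 4α and 16β and is the original curve rescaled by 2, which
-- doubles the denominator.
untwist : ∀ {α β b X G} → b ≡ α * α - 𝟜 * β → (d : Datum (𝟘 - 𝟚 * (𝟘 - 𝟚 * α)) ((𝟘 - 𝟚 * α) * (𝟘 - 𝟚 * α) - 𝟜 * b) X G) → Datum α β X (𝟚 * G)
untwist {α} {β} {b} {X} {G} b≡ (datum X̄ Z product sum) = datum X̄ Z
  (untwist₁ (X * X̄) α β b G (trans product (untwist₃ α b G)) b≡) (untwist₂ (X + X̄) Z α G sum)

times-power : ℕ → 𝒪 → 𝒪
times-power zero γ = γ
times-power (suc n) γ = 𝟚 * times-power n γ

times-power₁ : ∀ γ x p → x ≡ p * γ → ι (ℤ.+ 2) * x ≡ ι (ℤ.+ 2) * p * γ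
times-power₁ γ x p h₁ = trans (𝒪I.identity (# (ℤ.+ 2) ⊗ v 1F) (# (ℤ.+ 2) ⊗ v 2F ⊗ v 0F ⊕ # (ℤ.+ 2) ⊗ (v 1F ⊖ v 2F ⊗ v 0F)) refl (γ ∷ x ∷ p ∷ [])) (𝒪I.vanish h₁)
times-power₀ : ∀ γ → γ ≡ ι (ℤ.+ 1) * γ
times-power₀ γ = 𝒪I.identity (v 0F) (# (ℤ.+ 1) ⊗ v 0F) refl (γ ∷ [])

times-power≡ : ∀ n γ → times-power n γ ≡ power 𝟚 n * γ
times-power≡ zero γ = times-power₀ γ
times-power≡ (suc n) γ = times-power₁ γ (times-power n γ) (power 𝟚 n) (times-power≡ n γ)

times-power≢𝟘 : ∀ n {γ} → Odd γ → ¬ times-power n γ ≡ 𝟘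
times-power≢𝟘 zero o = odd≢𝟘 o
times-power≢𝟘 (suc n) o = *≢𝟘 (ι≢𝟘 1) (times-power≢𝟘 n o)

odd-pow : ∀ {y} n → Odd y → Cop y (power 𝟚 n)
odd-pow zero o = cop-𝟙
odd-pow (suc n) o = cop-* o (odd-pow n o)

odd-8 : ∀ {y} → Odd y → Cop 𝟠 y
odd-8 o = cop-sym (subst (Cop _) eight (odd-pow 3 o))
  where
  opaque
    unfolding _*_
    eight : power 𝟚 3 ≡ 𝟠
    eight = refl

odd-4 : ∀ {y} → Odd y → Cop 𝟜 y
odd-4 o = cop-sym (subst (Cop _) four (odd-pow 2 o))
  where
  opaque
    unfolding _*_
    four : power 𝟚 2 ≡ 𝟜
    four = refl

-- Infinite descent on points near the origin at 2.

module Descent (α β b β₄ r : 𝒪)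
  (b≡ : b ≡ α * α - 𝟜 * β) (β≡ : β ≡ 𝟜 * β₄) (b≡twist : b ≡ twist * (r * r)) (odd-α : Odd α)
  (smooth-β : Smooth β) (smooth-b : Smooth b)
  -- Classes that the sieve of the twisted case may leave over and that need a separate refutation;
  -- there are none for the second and third curves.
  (exceptional : Class → Bool)
  (exceptional-⊥ : ∀ {X g} → Odd X → Odd g → (d : Datum α β X g) → 𝟚 ∣𝒪 Datum.Z d → (nf : NormalForm α β X g) → exceptional (NormalForm.class nf) ≡ true → ⊥)
  (sieve-α : sieve? α β trivial-class (excludes₈ 𝟘) ≡ true)
  (sieve-dual : sieve? (𝟘 - 𝟚 * α) b trivial-or-twist (excludes₈ 𝟘) ≡ true)
  (sieve-twist : sieve? α β exceptional (excludes₄ α) ≡ true)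
  where

  tw₀ : ∀ f W M̃ K b γ α → f * f + (ι (ℤ.+ 0) - ι (ℤ.+ 2) * α) * (K * γ * (K * γ)) ≡ W + K * K * M̃ * (K * K * M̃) → W * (M̃ * M̃) ≡ b * (γ * γ * (γ * γ)) → M̃ * f * (M̃ * f) ≡ b * (γ * γ * (γ * γ)) + K * K * (M̃ * M̃) * (K * K * (M̃ * M̃) + ι (ℤ.+ 2) * α * (γ * γ))
  tw₀ f W M̃ K b γ α h₁ h₂ = trans (𝒪I.identity (v 2F ⊗ v 0F ⊗ (v 2F ⊗ v 0F)) (v 4F ⊗ (v 5F ⊗ v 5F ⊗ (v 5F ⊗ v 5F)) ⊕ v 3F ⊗ v 3F ⊗ (v 2F ⊗ v 2F) ⊗ (v 3F ⊗ v 3F ⊗ (v 2F ⊗ v 2F) ⊕ # (ℤ.+ 2) ⊗ v 6F ⊗ (v 5F ⊗ v 5F)) ⊕ v 2F ⊗ v 2F ⊗ (v 0F ⊗ v 0F ⊕ (# (ℤ.+ 0) ⊖ # (ℤ.+ 2) ⊗ v 6F) ⊗ (v 3F ⊗ v 5F ⊗ (v 3F ⊗ v 5F)) ⊖ (v 1F ⊕ v 3F ⊗ v 3F ⊗ v 2F ⊗ (v 3F ⊗ v 3F ⊗ v 2F))) ⊕ # (ℤ.+ 1) ⊗ (v 1F ⊗ (v 2F ⊗ v 2F) ⊖ v 4F ⊗ (v 5F ⊗ v 5F ⊗ (v 5F ⊗ v 5F)))) refl (f ∷ W ∷ M̃ ∷ K ∷ b ∷ γ ∷ α ∷ [])) (trans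 (𝒪I.vanish h₂) (𝒪I.vanish h₁))
  tw₁ : ∀ f M̃ K b γ α β → M̃ * f * (M̃ * f) ≡ b * (γ * γ * (γ * γ)) + ι (ℤ.+ 2) * K * (ι (ℤ.+ 2) * K) * (M̃ * M̃) * (ι (ℤ.+ 2) * K * (ι (ℤ.+ 2) * K) * (M̃ * M̃) + ι (ℤ.+ 2) * α * (γ * γ)) → b ≡ α * α - ι (ℤ.+ 4) * β → M̃ * f * (M̃ * f) ≡ α * (γ * γ) * (α * (γ * γ)) + ι (ℤ.+ 2) * (ι (ℤ.+ 2) * K * K * (M̃ * M̃) * (ι (ℤ.+ 2) * K * (ι (ℤ.+ 2) * K) * (M̃ * M̃) + ι (ℤ.+ 2) * α * (γ * γ)) - ι (ℤ.+ 2) * β * (γ * γ * (γ * γ)))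
  tw₁ f M̃ K b γ α β h₁ h₂ = trans (𝒪I.identity (v 1F ⊗ v 0F ⊗ (v 1F ⊗ v 0F)) (v 5F ⊗ (v 4F ⊗ v 4F) ⊗ (v 5F ⊗ (v 4F ⊗ v 4F)) ⊕ # (ℤ.+ 2) ⊗ (# (ℤ.+ 2) ⊗ v 2F ⊗ v 2F ⊗ (v 1F ⊗ v 1F) ⊗ (# (ℤ.+ 2) ⊗ v 2F ⊗ (# (ℤ.+ 2) ⊗ v 2F) ⊗ (v 1F ⊗ v 1F) ⊕ # (ℤ.+ 2) ⊗ v 5F ⊗ (v 4F ⊗ v 4F)) ⊖ # (ℤ.+ 2) ⊗ v 6F ⊗ (v 4F ⊗ v 4F ⊗ (v 4F ⊗ v 4F))) ⊕ # (ℤ.+ 1) ⊗ (v 1F ⊗ v 0F ⊗ (v 1F ⊗ v 0F) ⊖ (v 3F ⊗ (v 4F ⊗ v 4F ⊗ (v 4F ⊗ v 4F)) ⊕ # (ℤ.+ 2) ⊗ v 2F ⊗ (# (ℤ.+ 2) ⊗ v 2F) ⊗ (v 1F ⊗ v 1F) ⊗ (# (ℤ.+ 2) ⊗ v 2F ⊗ (# (ℤ.+ 2) ⊗ v 2F) ⊗ (v 1F ⊗ v 1F) ⊕ # (ℤ.+ 2) ⊗ v 5F ⊗ (v 4F ⊗ v 4F)))) ⊕ v 4F ⊗ v 4F ⊗ v 4F ⊗ v 4F ⊗ (v 3F ⊖ (v 5F ⊗ v 5F ⊖ # (ℤ.+ 4) ⊗ v 6F))) refl (f ∷ M̃ ∷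 K ∷ b ∷ γ ∷ α ∷ β ∷ [])) (trans (𝒪I.vanish h₂) (𝒪I.vanish h₁))
  tw₂ : ∀ f M̃ K b γ α β j → M̃ * f * (M̃ * f) ≡ b * (γ * γ * (γ * γ)) + ι (ℤ.+ 2) * K * (ι (ℤ.+ 2) * K) * (M̃ * M̃) * (ι (ℤ.+ 2) * K * (ι (ℤ.+ 2) * K) * (M̃ * M̃) + ι (ℤ.+ 2) * α * (γ * γ)) → b ≡ α * α - ι (ℤ.+ 4) * β → M̃ * f ≡ α * (γ * γ) + ι (ℤ.+ 2) * j → ι (ℤ.+ 4) * ((j + α * (γ * γ) + ι (ℤ.+ 2) * K * K * (M̃ * M̃)) * (j + α * (γ * γ) + ι (ℤ.+ 2) * K * K * (M̃ * M̃) - M̃ * f)) ≡ ι (ℤ.+ 4) * (β * (γ * γ * (γ * γ)))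
  tw₂ f M̃ K b γ α β j h₁ h₂ h₃ = trans (𝒪I.identity (# (ℤ.+ 4) ⊗ ((v 7F ⊕ v 5F ⊗ (v 4F ⊗ v 4F) ⊕ # (ℤ.+ 2) ⊗ v 2F ⊗ v 2F ⊗ (v 1F ⊗ v 1F)) ⊗ (v 7F ⊕ v 5F ⊗ (v 4F ⊗ v 4F) ⊕ # (ℤ.+ 2) ⊗ v 2F ⊗ v 2F ⊗ (v 1F ⊗ v 1F) ⊖ v 1F ⊗ v 0F))) (# (ℤ.+ 4) ⊗ (v 6F ⊗ (v 4F ⊗ v 4F ⊗ (v 4F ⊗ v 4F))) ⊕ (# (ℤ.+ 0) ⊖ # (ℤ.+ 1)) ⊗ (v 1F ⊗ v 0F ⊗ (v 1F ⊗ v 0F) ⊖ (v 3F ⊗ (v 4F ⊗ v 4F ⊗ (v 4F ⊗ v 4F)) ⊕ # (ℤ.+ 2) ⊗ v 2F ⊗ (# (ℤ.+ 2) ⊗ v 2F) ⊗ (v 1F ⊗ v 1F) ⊗ (# (ℤ.+ 2) ⊗ v 2F ⊗ (# (ℤ.+ 2) ⊗ v 2F) ⊗ (v 1F ⊗ v 1F) ⊕ # (ℤ.+ 2) ⊗ v 5F ⊗ (v 4F ⊗ v 4F)))) ⊕ (# (ℤ.+ 0) ⊖ v 4F ⊗ v 4F ⊗ v 4F ⊗ v 4F) ⊗ (v 3F ⊖ (v 5F ⊗ v 5F ⊖ # (ℤ.+ 4) ⊗ v 6F)) ⊕ (v 1F ⊗ v 0F ⊖ # (ℤ.+ 3) ⊗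 v 5F ⊗ v 4F ⊗ v 4F ⊖ # (ℤ.+ 2) ⊗ v 7F ⊖ # (ℤ.+ 8) ⊗ v 2F ⊗ v 2F ⊗ v 1F ⊗ v 1F) ⊗ (v 1F ⊗ v 0F ⊖ (v 5F ⊗ (v 4F ⊗ v 4F) ⊕ # (ℤ.+ 2) ⊗ v 7F))) refl (f ∷ M̃ ∷ K ∷ b ∷ γ ∷ α ∷ β ∷ j ∷ [])) (trans (𝒪I.vanish h₃) (trans (𝒪I.vanish h₂) (𝒪I.vanish h₁)))
  tw₃ : ∀ f M̃ K γ α j → M̃ * f ≡ α * (γ * γ) + ι (ℤ.+ 2) * j → j + α * (γ * γ) + ι (ℤ.+ 2) * K * K * (M̃ * M̃) + (j + α * (γ * γ) + ι (ℤ.+ 2) * K * K * (M̃ * M̃) - M̃ * f) ≡ ι (ℤ.+ 2) * (K * M̃) * (ι (ℤ.+ 2) * (K * M̃)) + α * (γ * γ)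
  tw₃ f M̃ K γ α j h₁ = trans (𝒪I.identity (v 5F ⊕ v 4F ⊗ (v 3F ⊗ v 3F) ⊕ # (ℤ.+ 2) ⊗ v 2F ⊗ v 2F ⊗ (v 1F ⊗ v 1F) ⊕ (v 5F ⊕ v 4F ⊗ (v 3F ⊗ v 3F) ⊕ # (ℤ.+ 2) ⊗ v 2F ⊗ v 2F ⊗ (v 1F ⊗ v 1F) ⊖ v 1F ⊗ v 0F)) (# (ℤ.+ 2) ⊗ (v 2F ⊗ v 1F) ⊗ (# (ℤ.+ 2) ⊗ (v 2F ⊗ v 1F)) ⊕ v 4F ⊗ (v 3F ⊗ v 3F) ⊕ (# (ℤ.+ 0) ⊖ # (ℤ.+ 1)) ⊗ (v 1F ⊗ v 0F ⊖ (v 4F ⊗ (v 3F ⊗ v 3F) ⊕ # (ℤ.+ 2) ⊗ v 5F))) refl (f ∷ M̃ ∷ K ∷ γ ∷ α ∷ j ∷ [])) (𝒪I.vanish h₁)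

  -- Translating the dual point by (0 , 0) makes its x-coordinate a square up to the known factors,
  -- so the translate comes from a point of the original curve. That point has the odd denominator γ
  -- and an even Z, hence an odd root congruent to αγ² modulo 4, against `sieve-twist`.
  twisted-datum : ∀ {f W M̃ γ} m (let K = power 𝟚 m) → Odd γ → W * (M̃ * M̃) ≡ b * (γ * γ * (γ * γ)) →
    f * f + (𝟘 - 𝟚 * α) * (𝟚 * K * γ * (𝟚 * K * γ)) ≡ W + 𝟚 * K * (𝟚 * K) * M̃ * (𝟚 * K * (𝟚 * K) * M̃) → ⊥
  twisted-datum {f} {W} {M̃} {γ} m oγ W≡ sum = go (√-≈2 (by _ (tw₁ f M̃ K b γ α β e b≡)))
    where
    K = power 𝟚 m
    e = tw₀ f W M̃ (𝟚 * K) b γ α sum W≡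
    go : M̃ * f ≈ α * (γ * γ) [ 𝟚 ] → ⊥
    go (by j g) = finish (select-odd d odd-sum)
      where
      d : Datum α β (j + α * (γ * γ) + 𝟚 * K * K * (M̃ * M̃)) γ
      d = datum _ (𝟚 * (K * M̃)) (*-cancelˡ (ι≢𝟘 3) (tw₂ f M̃ K b γ α β j e b≡ g)) (tw₃ f M̃ K γ α j g)
      even-part : ∀ x y → y ≡ ι (ℤ.+ 2) * x * (ι (ℤ.+ 2) * x) + y + ι (ℤ.+ 2) * (ι (ℤ.+ 0) - ι (ℤ.+ 2) * x * x)
      even-part x y = 𝒪I.identity (v 1F) (# (ℤ.+ 2) ⊗ v 0F ⊗ (# (ℤ.+ 2) ⊗ v 0F) ⊕ v 1F ⊕ # (ℤ.+ 2) ⊗ (# (ℤ.+ 0) ⊖ # (ℤ.+ 2) ⊗ v 0F ⊗ v 0F)) refl (x ∷ y ∷ [])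
      drop-4 : ∀ x y → ι (ℤ.+ 2) * x * (ι (ℤ.+ 2) * x) + y ≡ y + ι (ℤ.+ 4) * (x * x)
      drop-4 x y = 𝒪I.identity (# (ℤ.+ 2) ⊗ v 0F ⊗ (# (ℤ.+ 2) ⊗ v 0F) ⊕ v 1F) (v 1F ⊕ # (ℤ.+ 4) ⊗ (v 0F ⊗ v 0F)) refl (x ∷ y ∷ [])
      odd-sum : Odd (𝟚 * (K * M̃) * (𝟚 * (K * M̃)) + α * (γ * γ))
      odd-sum = odd-≈ (by _ (even-part (K * M̃) (α * (γ * γ)))) (odd-* odd-α (odd-* oγ oγ))
      finish : OddRoot α β γ (𝟚 * (K * M̃)) → ⊥
      finish o = at (normal-form smooth-β (odd≢𝟘 (OddRoot.odd o)) (odd≢𝟘 oγ) (root o))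
        where
        four-part : ∀ β β₄ x → β ≡ ι (ℤ.+ 4) * β₄ → β * x ≡ ι (ℤ.+ 4) * (β₄ * x)
        four-part β β₄ x h₁ = trans (𝒪I.identity (v 0F ⊗ v 2F) (# (ℤ.+ 4) ⊗ (v 1F ⊗ v 2F) ⊕ v 2F ⊗ (v 0F ⊖ # (ℤ.+ 4) ⊗ v 1F)) refl (β ∷ β₄ ∷ x ∷ [])) (𝒪I.vanish h₁)
        at : NormalForm α β (OddRoot.X o) γ → ⊥
        at nf = exceptional-⊥ (OddRoot.odd o) oγ (root o) (K * M̃ , refl) nf
          (sieve exceptional (excludes₄ α) sieve-twist nf λ t → excludes₄-sound α _ t
            (class₄ (NormalForm.X≡ nf) (OddRoot.odd o)
              (≈-trans (odd-root (odd-4 (OddRoot.odd o)) (_ , four-part β β₄ (γ * γ * (γ * γ)) β≡) (root o)) (by _ (drop-4 (K * M̃) (α * (γ * γ)))))))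

  tws₁ : ∀ τ y W̄ r G W b → W * W̄ ≡ b * (G * G * (G * G)) → W ≡ τ * (y * y) → b ≡ τ * (r * r) → τ * (r * (G * G) * (r * (G * G))) ≡ τ * (y * y * W̄)
  tws₁ τ y W̄ r G W b h₁ h₂ h₃ = trans (𝒪I.identity (v 0F ⊗ (v 3F ⊗ (v 4F ⊗ v 4F) ⊗ (v 3F ⊗ (v 4F ⊗ v 4F)))) (v 0F ⊗ (v 1F ⊗ v 1F ⊗ v 2F) ⊕ (# (ℤ.+ 0) ⊖ # (ℤ.+ 1)) ⊗ (v 5F ⊗ v 2F ⊖ v 6F ⊗ (v 4F ⊗ v 4F ⊗ (v 4F ⊗ v 4F))) ⊕ v 2F ⊗ (v 5F ⊖ v 0F ⊗ (v 1F ⊗ v 1F)) ⊕ (# (ℤ.+ 0) ⊖ v 4F ⊗ v 4F ⊗ v 4F ⊗ v 4F) ⊗ (v 6F ⊖ v 0F ⊗ (v 3F ⊗ v 3F))) refl (τ ∷ y ∷ W̄ ∷ r ∷ G ∷ W ∷ b ∷ [])) (trans (𝒪I.vanish h₃) (trans (𝒪I.vanish h₂) (𝒪I.vanish h₁)))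
  tws₂ : ∀ y M̄ r G K γ → r * (G * G) ≡ y * M̄ → G ≡ K * γ → y * M̄ ≡ K * K * (r * (γ * γ))
  tws₂ y M̄ r G K γ h₁ h₂ = trans (𝒪I.identity (v 0F ⊗ v 1F) (v 4F ⊗ v 4F ⊗ (v 2F ⊗ (v 5F ⊗ v 5F)) ⊕ (# (ℤ.+ 0) ⊖ # (ℤ.+ 1)) ⊗ (v 2F ⊗ (v 3F ⊗ v 3F) ⊖ v 0F ⊗ v 1F) ⊕ (v 2F ⊗ v 3F ⊕ v 2F ⊗ v 4F ⊗ v 5F) ⊗ (v 3F ⊖ v 4F ⊗ v 5F)) refl (y ∷ M̄ ∷ r ∷ G ∷ K ∷ γ ∷ [])) (trans (𝒪I.vanish h₂) (𝒪I.vanish h₁))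
  tws₃ : ∀ y M̄ r K M̃ γ → y * M̄ ≡ K * K * (r * (γ * γ)) → M̄ ≡ K * K * M̃ → K * K * (y * M̃) ≡ K * K * (r * (γ * γ))
  tws₃ y M̄ r K M̃ γ h₁ h₂ = trans (𝒪I.identity (v 3F ⊗ v 3F ⊗ (v 0F ⊗ v 4F)) (v 3F ⊗ v 3F ⊗ (v 2F ⊗ (v 5F ⊗ v 5F)) ⊕ # (ℤ.+ 1) ⊗ (v 0F ⊗ v 1F ⊖ v 3F ⊗ v 3F ⊗ (v 2F ⊗ (v 5F ⊗ v 5F))) ⊕ (# (ℤ.+ 0) ⊖ v 0F) ⊗ (v 1F ⊖ v 3F ⊗ v 3F ⊗ v 4F)) refl (y ∷ M̄ ∷ r ∷ K ∷ M̃ ∷ γ ∷ [])) (trans (𝒪I.vanish h₂) (𝒪I.vanish h₁))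
  tws₄ : ∀ τ y W M̃ r γ b → y * M̃ ≡ r * (γ * γ) → W ≡ τ * (y * y) → b ≡ τ * (r * r) → W * (M̃ * M̃) ≡ b * (γ * γ * (γ * γ))
  tws₄ τ y W M̃ r γ b h₁ h₂ h₃ = trans (𝒪I.identity (v 2F ⊗ (v 3F ⊗ v 3F)) (v 6F ⊗ (v 5F ⊗ v 5F ⊗ (v 5F ⊗ v 5F)) ⊕ (v 0F ⊗ v 1F ⊗ v 3F ⊕ v 0F ⊗ v 4F ⊗ v 5F ⊗ v 5F) ⊗ (v 1F ⊗ v 3F ⊖ v 4F ⊗ (v 5F ⊗ v 5F)) ⊕ v 3F ⊗ v 3F ⊗ (v 2F ⊖ v 0F ⊗ (v 1F ⊗ v 1F)) ⊕ (# (ℤ.+ 0) ⊖ v 5F ⊗ v 5F ⊗ v 5F ⊗ v 5F) ⊗ (v 6F ⊖ v 0F ⊗ (v 4F ⊗ v 4F))) refl (τ ∷ y ∷ W ∷ M̃ ∷ r ∷ γ ∷ b ∷ [])) (trans (𝒪I.vanish h₃) (trans (𝒪I.vanish h₂) (𝒪I.vanish h₁)))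
  tws₅ : ∀ W W̄ S f α G K γ M̄ M̃ → W + W̄ ≡ f * f + (ι (ℤ.+ 0) - ι (ℤ.+ 2) * α) * (G * G) → W̄ ≡ M̄ * M̄ → M̄ ≡ K * K * M̃ → G ≡ K * γ → f * f + (ι (ℤ.+ 0) - ι (ℤ.+ 2) * α) * (K * γ * (K * γ)) ≡ W + K * K * M̃ * (K * K * M̃)
  tws₅ W W̄ S f α G K γ M̄ M̃ h₁ h₂ h₃ h₄ = trans (𝒪I.identity (v 3F ⊗ v 3F ⊕ (# (ℤ.+ 0) ⊖ # (ℤ.+ 2) ⊗ v 4F) ⊗ (v 6F ⊗ v 7F ⊗ (v 6F ⊗ v 7F))) (v 0F ⊕ v 6F ⊗ v 6F ⊗ v 9F ⊗ (v 6F ⊗ v 6F ⊗ v 9F) ⊕ (# (ℤ.+ 0) ⊖ # (ℤ.+ 1)) ⊗ (v 0F ⊕ v 1F ⊖ (v 3F ⊗ v 3F ⊕ (# (ℤ.+ 0) ⊖ # (ℤ.+ 2) ⊗ v 4F) ⊗ (v 5F ⊗ v 5F))) ⊕ # (ℤ.+ 1) ⊗ (v 1F ⊖ v 8F ⊗ v 8F) ⊕ (v 8F ⊕ v 6F ⊗ v 6F ⊗ v 9F) ⊗ (v 8F ⊖ v 6F ⊗ v 6F ⊗ v 9F) ⊕ (# (ℤ.+ 2) ⊗ v 4F ⊗ v 5F ⊕ # (ℤ.+ 2) ⊗ v 4F ⊗ v 6F ⊗ v 7F) ⊗ (v 5F ⊖ v 6F ⊗ v 7F)) refl (W ∷ W̄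 ∷ S ∷ f ∷ α ∷ G ∷ K ∷ γ ∷ M̄ ∷ M̃ ∷ [])) (trans (𝒪I.vanish h₄) (trans (𝒪I.vanish h₃) (trans (𝒪I.vanish h₂) (𝒪I.vanish h₁))))

  -- As W and b are both `twist` times squares, the partner W̄ is a square M̄². The odd y times M̄
  -- equals r G², so the square of the 2-power in G divides M̄ and can be removed.
  twisted : ∀ {W f y γ} m → Odd γ → Odd W → W ≡ twist * (y * y) → (d : Datum (𝟘 - 𝟚 * α) b W (times-power (suc m) γ)) → Datum.Z d ≡ f → ⊥
  twisted {W} {f} {y} {γ} m oγ oW W≡ (datum W̄ _ product sum) refl = go (sq-quotient (odd≢𝟘 oy) (*-cancelˡ twist≢𝟘 (tws₁ twist y W̄ r G W b product W≡ b≡twist)))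
    where
    G = times-power (suc m) γ
    K = power 𝟚 (suc m)
    K≢𝟘 : ¬ K * K ≡ 𝟘
    K≢𝟘 = *≢𝟘 (power≢𝟘 (suc m)) (power≢𝟘 (suc m))
      where
      power≢𝟘 : ∀ n → ¬ power 𝟚 n ≡ 𝟘
      power≢𝟘 zero e = 𝟘≢𝟙 (sym e)
      power≢𝟘 (suc n) = *≢𝟘 (ι≢𝟘 1) (power≢𝟘 n)
    oy : Odd y
    oy = odd-*ˡ (odd-*ʳ (subst Odd W≡ oW))
    twist≢𝟘 : ¬ twist ≡ 𝟘
    twist≢𝟘 = odd≢𝟘 (odd-*ˡ (subst Odd W≡ oW))
    go : (∃ λ M̄ → r * (G * G) ≡ y * M̄ × W̄ ≡ M̄ * M̄) → ⊥
    go (M̄ , e , W̄≡) = reduce (euclid (cop-sym (cop-* (odd-pow (suc m) oy) (odd-pow (suc m) oy))) (_ , yM̄≡))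
      where
      yM̄≡ = tws₂ y M̄ r G K γ e (times-power≡ (suc m) γ)
      reduce : (K * K) ∣𝒪 M̄ → ⊥
      reduce (M̃ , M̄≡) = twisted-datum m oγ
        (tws₄ twist y W M̃ r γ b (*-cancelˡ K≢𝟘 (tws₃ y M̄ r K M̃ γ yM̄≡ M̄≡)) W≡ b≡twist)
        (tws₅ W W̄ 𝟘 f α G K γ M̄ M̃ sum W̄≡ M̄≡ (times-power≡ (suc m) γ))

  eighth : ∀ β β₄ γ → β ≡ ι (ℤ.+ 4) * β₄ → β * (ι (ℤ.+ 2) * γ * (ι (ℤ.+ 2) * γ) * (ι (ℤ.+ 2) * γ * (ι (ℤ.+ 2) * γ))) ≡ ι (ℤ.+ 8) * (ι (ℤ.+ 8) * β₄ * (γ * γ * (γ * γ)))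
  eighth β β₄ γ h₁ = trans (𝒪I.identity (v 0F ⊗ (# (ℤ.+ 2) ⊗ v 2F ⊗ (# (ℤ.+ 2) ⊗ v 2F) ⊗ (# (ℤ.+ 2) ⊗ v 2F ⊗ (# (ℤ.+ 2) ⊗ v 2F)))) (# (ℤ.+ 8) ⊗ (# (ℤ.+ 8) ⊗ v 1F ⊗ (v 2F ⊗ v 2F ⊗ (v 2F ⊗ v 2F))) ⊕ # (ℤ.+ 16) ⊗ v 2F ⊗ v 2F ⊗ v 2F ⊗ v 2F ⊗ (v 0F ⊖ # (ℤ.+ 4) ⊗ v 1F)) refl (β ∷ β₄ ∷ γ ∷ [])) (𝒪I.vanish h₁)
  level₁-split : ∀ Z α γ → Z * Z + α * (ι (ℤ.+ 2) * γ * (ι (ℤ.+ 2) * γ)) ≡ Z * Z + ι (ℤ.+ 4) * (α * (γ * γ))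
  level₁-split Z α γ = 𝒪I.identity (v 0F ⊗ v 0F ⊕ v 1F ⊗ (# (ℤ.+ 2) ⊗ v 2F ⊗ (# (ℤ.+ 2) ⊗ v 2F))) (v 0F ⊗ v 0F ⊕ # (ℤ.+ 4) ⊗ (v 1F ⊗ (v 2F ⊗ v 2F))) refl (Z ∷ α ∷ γ ∷ [])
  level₁-join : ∀ Z α τ → Z * Z + ι (ℤ.+ 4) * (α * (τ * Z * (τ * Z))) ≡ Z * Z * (ι (ℤ.+ 1) + ι (ℤ.+ 4) * (α * (τ * τ)))
  level₁-join Z α τ = 𝒪I.identity (v 0F ⊗ v 0F ⊕ # (ℤ.+ 4) ⊗ (v 1F ⊗ (v 2F ⊗ v 0F ⊗ (v 2F ⊗ v 0F)))) (v 0F ⊗ v 0F ⊗ (# (ℤ.+ 1) ⊕ # (ℤ.+ 4) ⊗ (v 1F ⊗ (v 2F ⊗ v 2F)))) refl (Z ∷ α ∷ τ ∷ [])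
  level₂-drop : ∀ Z α G → Z * Z + α * (ι (ℤ.+ 2) * (ι (ℤ.+ 2) * G) * (ι (ℤ.+ 2) * (ι (ℤ.+ 2) * G))) ≡ Z * Z * (ι (ℤ.+ 1) + ι (ℤ.+ 4) * ι (ℤ.+ 0)) + ι (ℤ.+ 8) * (ι (ℤ.+ 2) * α * (G * G))
  level₂-drop Z α G = 𝒪I.identity (v 0F ⊗ v 0F ⊕ v 1F ⊗ (# (ℤ.+ 2) ⊗ (# (ℤ.+ 2) ⊗ v 2F) ⊗ (# (ℤ.+ 2) ⊗ (# (ℤ.+ 2) ⊗ v 2F)))) (v 0F ⊗ v 0F ⊗ (# (ℤ.+ 1) ⊕ # (ℤ.+ 4) ⊗ # (ℤ.+ 0)) ⊕ # (ℤ.+ 8) ⊗ (# (ℤ.+ 2) ⊗ v 1F ⊗ (v 2F ⊗ v 2F))) refl (Z ∷ α ∷ G ∷ [])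
  even-sum′ : ∀ Z α G → Z * Z ≡ Z * Z + α * (ι (ℤ.+ 2) * G * (ι (ℤ.+ 2) * G)) + ι (ℤ.+ 2) * (ι (ℤ.+ 0) - ι (ℤ.+ 2) * α * (G * G))
  even-sum′ Z α G = 𝒪I.identity (v 0F ⊗ v 0F) (v 0F ⊗ v 0F ⊕ v 1F ⊗ (# (ℤ.+ 2) ⊗ v 2F ⊗ (# (ℤ.+ 2) ⊗ v 2F)) ⊕ # (ℤ.+ 2) ⊗ (# (ℤ.+ 0) ⊖ # (ℤ.+ 2) ⊗ v 1F ⊗ (v 2F ⊗ v 2F))) refl (Z ∷ α ∷ G ∷ [])
  half-sum : ∀ f Z k → f ≡ Z + ι (ℤ.+ 4) * k → Z ≡ ι (ℤ.+ 2) * (Z + ι (ℤ.+ 2) * k) - f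
  half-sum f Z k h₁ = trans (𝒪I.identity (v 1F) (# (ℤ.+ 2) ⊗ (v 1F ⊕ # (ℤ.+ 2) ⊗ v 2F) ⊖ v 0F ⊕ # (ℤ.+ 1) ⊗ (v 0F ⊖ (v 1F ⊕ # (ℤ.+ 4) ⊗ v 2F))) refl (f ∷ Z ∷ k ∷ [])) (𝒪I.vanish h₁)
  half-2 : ∀ f Z k → f ≡ Z + ι (ℤ.+ 4) * k → Z ≡ Z + ι (ℤ.+ 2) * k + ι (ℤ.+ 2) * (ι (ℤ.+ 0) - k)
  half-2 f Z k h₁ = trans (𝒪I.identity (v 1F) (v 1F ⊕ # (ℤ.+ 2) ⊗ v 2F ⊕ # (ℤ.+ 2) ⊗ (# (ℤ.+ 0) ⊖ v 2F) ⊕ # (ℤ.+ 0) ⊗ (v 0F ⊖ (v 1F ⊕ # (ℤ.+ 4) ⊗ v 2F))) refl (f ∷ Z ∷ k ∷ [])) (𝒪I.vanish h₁)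
  f*f*1 : ∀ f → f * f ≡ f * f * (ι (ℤ.+ 1) + ι (ℤ.+ 4) * ι (ℤ.+ 0))
  f*f*1 f = 𝒪I.identity (v 0F ⊗ v 0F) (v 0F ⊗ v 0F ⊗ (# (ℤ.+ 1) ⊕ # (ℤ.+ 4) ⊗ # (ℤ.+ 0))) refl (f ∷ [])
  δ-four : ∀ f h α β G → f * f * (h * (f - h)) ≡ α * (f * f) * (ι (ℤ.+ 2) * G * (ι (ℤ.+ 2) * G)) - ι (ℤ.+ 4) * β * (ι (ℤ.+ 2) * G * (ι (ℤ.+ 2) * G) * (ι (ℤ.+ 2) * G * (ι (ℤ.+ 2) * G))) → f * f * h * (f - h) ≡ ι (ℤ.+ 4) * (α * (f * f) * (G * G) - ι (ℤ.+ 16) * β * (G * G * (G * G)))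
  δ-four f h α β G h₁ = trans (𝒪I.identity (v 0F ⊗ v 0F ⊗ v 1F ⊗ (v 0F ⊖ v 1F)) (# (ℤ.+ 4) ⊗ (v 2F ⊗ (v 0F ⊗ v 0F) ⊗ (v 4F ⊗ v 4F) ⊖ # (ℤ.+ 16) ⊗ v 3F ⊗ (v 4F ⊗ v 4F ⊗ (v 4F ⊗ v 4F))) ⊕ # (ℤ.+ 1) ⊗ (v 0F ⊗ v 0F ⊗ (v 1F ⊗ (v 0F ⊖ v 1F)) ⊖ (v 2F ⊗ (v 0F ⊗ v 0F) ⊗ (# (ℤ.+ 2) ⊗ v 4F ⊗ (# (ℤ.+ 2) ⊗ v 4F)) ⊖ # (ℤ.+ 4) ⊗ v 3F ⊗ (# (ℤ.+ 2) ⊗ v 4F ⊗ (# (ℤ.+ 2) ⊗ v 4F) ⊗ (# (ℤ.+ 2) ⊗ v 4F ⊗ (# (ℤ.+ 2) ⊗ v 4F)))))) refl (f ∷ h ∷ α ∷ β ∷ G ∷ [])) (𝒪I.vanish h₁)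
  W-eight : ∀ f h α β G → f * f * (h * (f - h)) ≡ α * (f * f) * (ι (ℤ.+ 2) * G * (ι (ℤ.+ 2) * G)) - ι (ℤ.+ 4) * β * (ι (ℤ.+ 2) * G * (ι (ℤ.+ 2) * G) * (ι (ℤ.+ 2) * G * (ι (ℤ.+ 2) * G))) → f * f * (f * h - α * (ι (ℤ.+ 2) * G * (ι (ℤ.+ 2) * G)) - h * h) ≡ ι (ℤ.+ 8) * (ι (ℤ.+ 0) - ι (ℤ.+ 8) * β * (G * G * (G * G)))
  W-eight f h α β G h₁ = trans (𝒪I.identity (v 0F ⊗ v 0F ⊗ (v 0F ⊗ v 1F ⊖ v 2F ⊗ (# (ℤ.+ 2) ⊗ v 4F ⊗ (# (ℤ.+ 2) ⊗ v 4F)) ⊖ v 1F ⊗ v 1F)) (# (ℤ.+ 8) ⊗ (# (ℤ.+ 0) ⊖ # (ℤ.+ 8) ⊗ v 3F ⊗ (v 4F ⊗ v 4F ⊗ (v 4F ⊗ v 4F))) ⊕ # (ℤ.+ 1) ⊗ (v 0F ⊗ v 0F ⊗ (v 1F ⊗ (v 0F ⊖ v 1F)) ⊖ (v 2F ⊗ (v 0F ⊗ v 0F) ⊗ (# (ℤ.+ 2) ⊗ v 4F ⊗ (# (ℤ.+ 2) ⊗ v 4F)) ⊖ # (ℤ.+ 4) ⊗ v 3F ⊗ (# (ℤ.+ 2) ⊗ v 4F ⊗ (# (ℤ.+ 2) ⊗ v 4F) ⊗ (# (ℤ.+ 2) ⊗ v 4F ⊗ (# (ℤ.+ 2) ⊗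 v 4F)))))) refl (f ∷ h ∷ α ∷ β ∷ G ∷ [])) (𝒪I.vanish h₁)

  new-root : ∀ f M j → M ≡ f + ι (ℤ.+ 4) * j → f ≡ ι (ℤ.+ 2) * (f + ι (ℤ.+ 2) * j) - M
  new-root f M j h₁ = trans (𝒪I.identity (v 0F) (# (ℤ.+ 2) ⊗ (v 0F ⊕ # (ℤ.+ 2) ⊗ v 2F) ⊖ v 1F ⊕ # (ℤ.+ 1) ⊗ (v 1F ⊖ (v 0F ⊕ # (ℤ.+ 4) ⊗ v 2F))) refl (f ∷ M ∷ j ∷ [])) (𝒪I.vanish h₁)

  module _ (τ : 𝒪) (sieve₁ : sieve? α β none (excludes₈ (α * (τ * τ))) ≡ true) where

    -- The quotient g / Z is a local parameter at the origin, and the hypothesis fixes the class of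
    -- γ / Z modulo 2. Halving a point lowers m and preserves this class, because the new Z agrees
    -- with the old one modulo 4; so the argument ends at m = 0, where `sieve₁` contradicts it.
    no-point : ∀ m {γ X} → Odd γ → (d : Datum α β X (𝟚 * times-power m γ)) → γ ≈ τ * Datum.Z d [ 𝟚 ] → ⊥
    odd-point : ∀ m {γ X} → Odd γ → Odd X → (d : Datum α β X (𝟚 * times-power m γ)) → γ ≈ τ * Datum.Z d [ 𝟚 ] → ⊥

    no-point m {γ} oγ d γ≈ = odd-point m oγ (OddRoot.odd o) (root o) γ≈
      where
      Z = Datum.Z d
      oZ : Odd Z
      oZ = odd-*ʳ (odd-≈ γ≈ oγ)
      o = select-odd d (odd-≈ (by _ (even-sum′ Z α (times-power m γ))) (odd-* oZ oZ))

    -- At the lowest level the term αg² = 4αγ² is visible modulo 8 and equals 4ατ²Z² there.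
    odd-point zero {γ} {X} oγ oX d γ≈ = at (normal-form smooth-β (odd≢𝟘 oX) (times-power≢𝟘 1 oγ) d)
      where
      Z = Datum.Z d
      X≈ : X ≈ Z * Z * (𝟙 + 𝟜 * (α * (τ * τ))) [ 𝟠 ]
      X≈ = ≈-trans (odd-root (odd-8 oX) (_ , eighth β β₄ γ β≡) d) (≈-trans (≡⇒≈ (level₁-split Z α γ))
        (≈-trans (≈-+ ≈-refl (4*-2⇒8 (≈-* ≈-refl (≈-* γ≈ γ≈)))) (≡⇒≈ (level₁-join Z α τ))))
      at : NormalForm α β X (𝟚 * γ) → ⊥
      at nf = absurd (sieve none (excludes₈ (α * (τ * τ))) sieve₁ nf λ t → excludes₈-sound (α * (τ * τ)) _ t (class₈ (α * (τ * τ)) (NormalForm.X≡ nf) oX X≈))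
        where
        absurd : false ≡ true → ⊥
        absurd ()
    -- At higher levels αg² vanishes modulo 8, so X is the square Z² modulo 8 and only the trivial
    -- class survives.
    odd-point (suc m) {γ} {X} oγ oX d γ≈ = at (normal-form smooth-β (odd≢𝟘 oX) (times-power≢𝟘 (suc (suc m)) oγ) d)
      where
      Z = Datum.Z d
      G = times-power (suc m) γ
      G′ = times-power m γ
      X≈ : X ≈ Z * Z * (𝟙 + 𝟜 * 𝟘) [ 𝟠 ]
      X≈ = ≈-trans (odd-root (odd-8 oX) (_ , eighth β β₄ G β≡) d) (by _ (level₂-drop Z α G′))
      at : NormalForm α β X (𝟚 * G) → ⊥
      at nf = signed (√-sign (≈-trans (≡⇒≈ (sym X≡y²)) (≈-trans X≈ (≡⇒≈ (sym (f*f*1 Z))))))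
        where
        y = NormalForm.h nf * NormalForm.g′ nf
        X≡y² : X ≡ y * y
        X≡y² = trivial-square (NormalForm.class nf) (sieve trivial-class (excludes₈ 𝟘) sieve-α nf λ t → excludes₈-sound 𝟘 _ t (class₈ 𝟘 (NormalForm.X≡ nf) oX X≈)) (NormalForm.X≡ nf)
        signed : (∃ λ f → f * f ≡ y * y × f ≈ Z [ 𝟜 ]) → ⊥
        signed (f , f²≡ , by k f≡) = dual-point (normal-form smooth-b (odd≢𝟘 oW) (times-power≢𝟘 (suc m) oγ) d′)
          where
          h = Z + 𝟚 * k
          W = f * h - α * (G * G)
          f²≡X : f * f ≡ X
          f²≡X = trans f²≡ (sym X≡y²)
          of : Odd f
          of = odd-*ˡ (subst Odd (sym f²≡X) oX)
          Z≡ : Z ≡ 𝟚 * h - f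
          Z≡ = half-sum f Z k f≡
          d′ : Datum (𝟘 - 𝟚 * α) b W G
          d′ = dual d f²≡X Z≡ b≡
          e₀ = half-equation d f²≡X Z≡
          -- The half equation makes f² (W - h²) a multiple of 8, and f is odd; so the dual point
          -- also has a square x-coordinate modulo 8.
          W≈h² : W ≈ h * h [ 𝟠 ]
          W≈h² = ∣-⇒≈ (euclid (cop-sym (cop-sym (odd-8 (odd-* of of)))) (_ , W-eight f h α β G′ e₀))
          oh : Odd h
          oh = odd-≈ (by _ (half-2 f Z k f≡)) (odd-*ʳ (odd-≈ γ≈ oγ))
          f≈h : f ≈ h [ 𝟜 ]
          f≈h = ∣-⇒≈ (euclid (odd-4 (odd-* (odd-* of of) oh)) (_ , δ-four f h α β G′ e₀))
          oW : Odd W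
          oW = odd-≈ (≈-sym (8⇒2 W≈h²)) (odd-* oh oh)
          dual-point : NormalForm (𝟘 - 𝟚 * α) b W G → ⊥
          dual-point nf′ = alternatives (trivial-or-twist-square (NormalForm.class nf′)
              (sieve trivial-or-twist (excludes₈ 𝟘) sieve-dual nf′ λ t → excludes₈-sound 𝟘 _ t (class₈ 𝟘 (NormalForm.X≡ nf′) oW (≈-trans W≈h² (≡⇒≈ (f*f*1 h))))) (NormalForm.X≡ nf′))
            where
            y′ = NormalForm.h nf′ * NormalForm.g′ nf′
            -- The second lift completes the halving of the point: after rescaling, the exponent of
            -- 2 has dropped by one and M, congruent to f and hence to Z modulo 4, is the new Z.
            descend : (∃ λ M → M * M ≡ y′ * y′ × M ≈ f [ 𝟜 ]) → W ≡ y′ * y′ → ⊥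
            descend (M , M²≡ , by j M≡) W≡ = no-point m oγ (untwist b≡ (dual d′ (trans M²≡ (sym W≡)) (new-root f M j M≡) refl))
              (≈-trans γ≈ (≈-* ≈-refl (≈-sym (4⇒2 (≈-trans (by j M≡) (by k f≡))))))
            alternatives : W ≡ y′ * y′ ⊎ W ≡ twist * (y′ * y′) → ⊥
            alternatives (inj₁ W≡) = descend (√-sign (≈-trans (≡⇒≈ (sym W≡)) (≈-trans W≈h² (≈-sym (²-4⇒8 f≈h))))) W≡
            alternatives (inj₂ W≡) = twisted m oγ oW W≡ d′ refl

-- From square values of linear forms to points of an elliptic curve.

opaque
  unfolding _+_ -_ _*_ _♯ Tr⟨_,_⟩

  Tr² : ∀ x y → Tr⟨ x , y ⟩ * Tr⟨ x , y ⟩ ≡ Tr⟨ x * x , y * y ⟩ + 𝟚 * (x ♯ * y ♯)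
  Tr² ⟨ a , b , c ⟩ ⟨ d , e , f ⟩ = components (Trᴱ x₃ y₃ ⊠ Trᴱ x₃ y₃) (Trᴱ (x₃ ⊠ x₃) (y₃ ⊠ y₃) ⊞ (⟪ # (ℤ.+ 2) , # (ℤ.+ 0) , # (ℤ.+ 0) ⟫ ⊠ ((x₃ ♯ᴱ) ⊠ (y₃ ♯ᴱ)))) refl refl refl
    (a ∷ b ∷ c ∷ d ∷ e ∷ f ∷ a ∷ b ∷ c ∷ [])

  ♯-Tr : ∀ z x y → z ♯ * Tr⟨ x , y ⟩ ≡ Tr⟨ z * x , z * y ⟩
  ♯-Tr ⟨ a , b , c ⟩ ⟨ d , e , f ⟩ ⟨ g , h , i ⟩ = components ((x₃ ♯ᴱ) ⊠ Trᴱ y₃ z₃) (Trᴱ (x₃ ⊠ y₃) (x₃ ⊠ z₃)) refl refl refl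
    (a ∷ b ∷ c ∷ d ∷ e ∷ f ∷ g ∷ h ∷ i ∷ [])

  ♯-linear : ∀ u w x → (ι u + ι w * x) ♯ ≡ ι u * ι u + ι u * ι w * Tr⟨ 𝟙 , x ⟩ + ι w * ι w * x ♯
  ♯-linear u w ⟨ a , b , c ⟩ = components ((U ⊞ (W ⊠ x₃)) ♯ᴱ) (((U ⊠ U) ⊞ ((U ⊠ W) ⊠ Trᴱ ⟪ # (ℤ.+ 1) , # (ℤ.+ 0) , # (ℤ.+ 0) ⟫ x₃)) ⊞ ((W ⊠ W) ⊠ (x₃ ♯ᴱ))) refl refl refl
    (a ∷ b ∷ c ∷ u ∷ u ∷ u ∷ w ∷ w ∷ w ∷ [])
    where
    U W : 𝒪-Expr 9
    U = ⟪ v 3F , # (ℤ.+ 0) , # (ℤ.+ 0) ⟫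
    W = ⟪ v 6F , # (ℤ.+ 0) , # (ℤ.+ 0) ⟫

linear-form : ∀ U V ρ W n t Y → W ≡ ι (ℤ.+ 0) - V → t ≡ ι (ℤ.+ 0) - ρ → Y ≡ U * U + U * W * t + W * W * n → Y ≡ U * U + ρ * U * V + n * (V * V)
linear-form U V ρ W n t Y h₁ h₂ h₃ = trans (𝒪I.identity (v 6F) (v 0F ⊗ v 0F ⊕ v 2F ⊗ v 0F ⊗ v 1F ⊕ v 4F ⊗ (v 1F ⊗ v 1F) ⊕ (v 0F ⊗ v 5F ⊕ (v 3F ⊖ v 1F) ⊗ v 4F) ⊗ (v 3F ⊖ (# (ℤ.+ 0) ⊖ v 1F)) ⊕ (# (ℤ.+ 0) ⊖ v 0F ⊗ v 1F) ⊗ (v 5F ⊖ (# (ℤ.+ 0) ⊖ v 2F)) ⊕ # (ℤ.+ 1) ⊗ (v 6F ⊖ (v 0F ⊗ v 0F ⊕ v 0F ⊗ v 3F ⊗ v 5F ⊕ v 3F ⊗ v 3F ⊗ v 4F))) refl (U ∷ V ∷ ρ ∷ W ∷ n ∷ t ∷ Y ∷ [])) (trans (𝒪I.vanish h₃) (trans (𝒪I.vanish h₂) (𝒪I.vanish h₁)))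
linear-arg : ∀ U V ρ W → W ≡ ι (ℤ.+ 0) - V → U - ρ * V ≡ U + W * ρ
linear-arg U V ρ W h₁ = trans (𝒪I.identity (v 0F ⊖ v 2F ⊗ v 1F) (v 0F ⊕ v 3F ⊗ v 2F ⊕ (# (ℤ.+ 0) ⊖ v 2F) ⊗ (v 3F ⊖ (# (ℤ.+ 0) ⊖ v 1F))) refl (U ∷ V ∷ ρ ∷ W ∷ [])) (𝒪I.vanish h₁)
polar : ∀ A B C D U V P Q ρ n → D ≡ A + B + C → A ≡ U * U + ρ * U * V + n * (V * V) → C ≡ P * P + ρ * P * Q + n * (Q * Q) → D ≡ (U + P) * (U + P) + ρ * (U + P) * (V + Q) + n * ((V + Q) * (V + Q)) → B ≡ ι (ℤ.+ 2) * U * P + ρ * (U * Q + V * P) + ι (ℤ.+ 2) * n * (V * Q)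
polar A B C D U V P Q ρ n h₁ h₂ h₃ h₄ = trans (𝒪I.identity (v 1F) (# (ℤ.+ 2) ⊗ v 4F ⊗ v 6F ⊕ v 8F ⊗ (v 4F ⊗ v 7F ⊕ v 5F ⊗ v 6F) ⊕ # (ℤ.+ 2) ⊗ v 9F ⊗ (v 5F ⊗ v 7F) ⊕ (# (ℤ.+ 0) ⊖ # (ℤ.+ 1)) ⊗ (v 3F ⊖ (v 0F ⊕ v 1F ⊕ v 2F)) ⊕ (# (ℤ.+ 0) ⊖ # (ℤ.+ 1)) ⊗ (v 0F ⊖ (v 4F ⊗ v 4F ⊕ v 8F ⊗ v 4F ⊗ v 5F ⊕ v 9F ⊗ (v 5F ⊗ v 5F))) ⊕ (# (ℤ.+ 0) ⊖ # (ℤ.+ 1)) ⊗ (v 2F ⊖ (v 6F ⊗ v 6F ⊕ v 8F ⊗ v 6F ⊗ v 7F ⊕ v 9F ⊗ (v 7F ⊗ v 7F))) ⊕ # (ℤ.+ 1) ⊗ (v 3F ⊖ ((v 4F ⊕ v 6F) ⊗ (v 4F ⊕ v 6F) ⊕ v 8F ⊗ (v 4F ⊕ v 6F) ⊗ (v 5F ⊕ v 7F) ⊕ v 9F ⊗ ((v 5F ⊕ v 7F) ⊗ (v 5F ⊕ v 7F))))) refl (A ∷ B ∷ C ∷ D ∷ U ∷ V ∷ P ∷ Q ∷ ρ ∷ n ∷ [])) (trans (𝒪I.vanish h₄) (trans (𝒪I.vanish h₃) (trans (𝒪I.vanish h₂) (𝒪I.vanish h₁))))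

form : (ρ n U V : 𝒪) → 𝒪
form ρ n U V = U * U + ρ * U * V + n * (V * V)

polar-form : (ρ n U V P Q : 𝒪) → 𝒪
polar-form ρ n U V P Q = 𝟚 * U * P + ρ * (U * Q + V * P) + 𝟚 * n * (V * Q)

-- The condition says that ρ has trace zero: its other conjugates have sum -ρ and product ρ♯. Hence
-- (u - ρw)♯ is the value at (u , w) of the form u² + ρuw + ρ♯w², whose coefficients lie in `𝒪`.
module Trace-zero (ρ : 𝒪) (trace : Tr⟨ 𝟙 , ρ ⟩ ≡ 𝟘 - ρ) where

  ι-minus : ∀ a → ι (ℤ.- a) ≡ 𝟘 - ι a
  ι-minus a = trans (ι-neg a) (sym (+-identityˡ (- ι a)))

  ♯-form : ∀ a b → (ι a - ρ * ι b) ♯ ≡ form ρ (ρ ♯) (ι a) (ι b)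
  ♯-form a b = linear-form (ι a) (ι b) ρ (ι (ℤ.- b)) (ρ ♯) Tr⟨ 𝟙 , ρ ⟩ _ (ι-minus b) trace
    (trans (cong _♯ (linear-arg (ι a) (ι b) ρ (ι (ℤ.- b)) (ι-minus b))) (♯-linear a (ℤ.- b) ρ))

  add-linear : ∀ U V P Q ρ → U - ρ * V + (P - ρ * Q) ≡ U + P - ρ * (V + Q)
  add-linear U V P Q ρ = 𝒪I.identity (v 0F ⊖ v 4F ⊗ v 1F ⊕ (v 2F ⊖ v 4F ⊗ v 3F)) (v 0F ⊕ v 2F ⊖ v 4F ⊗ (v 1F ⊕ v 3F)) refl (U ∷ V ∷ P ∷ Q ∷ ρ ∷ [])

  Tr-form : ∀ a b c d → Tr⟨ ι a - ρ * ι b , ι c - ρ * ι d ⟩ ≡ polar-form ρ (ρ ♯) (ι a) (ι b) (ι c) (ι d)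
  Tr-form a b c d = polar _ _ _ _ (ι a) (ι b) (ι c) (ι d) ρ (ρ ♯) (♯-+ (ι a - ρ * ι b) (ι c - ρ * ι d)) (♯-form a b) (♯-form c d)
    (trans (cong _♯ (trans (add-linear (ι a) (ι b) (ι c) (ι d) ρ) (cong₂ (λ x y → x - ρ * y) (sym (ι-+ a c)) (sym (ι-+ b d)))))
      (trans (♯-form (a ℤ.+ c) (b ℤ.+ d)) (cong₂ (form ρ (ρ ♯)) (ι-+ a c) (ι-+ b d))))

-- The two factors differ by the sign of T, so their product involves c, C and T only through
-- squares and the product C C₀, and these are known forms in u and w.
product-half : ∀ k K c c₀ C C₀ T L L₀ M M₀ B → k * (c * c) ≡ L → k * (c₀ * c₀) ≡ L₀ → K * (C * C) ≡ M → K * (C₀ * C₀) ≡ M₀ → K * (T * T) ≡ B + ι (ℤ.+ 2) * K * C * C₀ → k * k * K * ((c * c * C₀ + c * c₀ * T + c₀ * c₀ * C) * (c * c * C₀ - c * c₀ * T + c₀ * c₀ * C)) ≡ L * L * M₀ + L₀ * L₀ * M - B * L * L₀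
product-half k K c c₀ C C₀ T L L₀ M M₀ B h₁ h₂ h₃ h₄ h₅ = trans (𝒪I.identity (v 0F ⊗ v 0F ⊗ v 1F ⊗ ((v 2F ⊗ v 2F ⊗ v 5F ⊕ v 2F ⊗ v 3F ⊗ v 6F ⊕ v 3F ⊗ v 3F ⊗ v 4F) ⊗ (v 2F ⊗ v 2F ⊗ v 5F ⊖ v 2F ⊗ v 3F ⊗ v 6F ⊕ v 3F ⊗ v 3F ⊗ v 4F))) (v 7F ⊗ v 7F ⊗ v (Fin.suc 9F) ⊕ v 8F ⊗ v 8F ⊗ v 9F ⊖ v (Fin.suc (Fin.suc 9F)) ⊗ v 7F ⊗ v 8F ⊕ ((v 0F ⊗ v 2F ⊗ v 2F ⊕ v 7F) ⊗ v 1F ⊗ v 5F ⊗ v 5F ⊖ v (Fin.suc (Fin.suc 9F)) ⊗ v 0F ⊗ v 3F ⊗ v 3F) ⊗ (v 0F ⊗ (v 2F ⊗ v 2F) ⊖ v 7F) ⊕ ((v 0F ⊗ v 3F ⊗ v 3F ⊕ v 8F) ⊗ v 1F ⊗ v 4F ⊗ v 4F ⊖ v (Fin.suc (Fin.suc 9F)) ⊗ v 7F) ⊗ (v 0F ⊗ (v 3F ⊗ v 3F) ⊖ v 8F) ⊕ v 8F ⊗ v 8F ⊗ (v 1F ⊗ (v 4F ⊗ v 4F) ⊖ v 9F) ⊕ v 7F ⊗ v 7F ⊗ (v 1F ⊗ (v 5F ⊗ v 5F) ⊖ v (Fin.suc 9F)) ⊕ (# (ℤ.+ 0) ⊖ v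 0F ⊗ v 2F ⊗ v 2F ⊗ v 0F ⊗ v 3F ⊗ v 3F) ⊗ (v 1F ⊗ (v 6F ⊗ v 6F) ⊖ (v (Fin.suc (Fin.suc 9F)) ⊕ # (ℤ.+ 2) ⊗ v 1F ⊗ v 4F ⊗ v 5F))) refl (k ∷ K ∷ c ∷ c₀ ∷ C ∷ C₀ ∷ T ∷ L ∷ L₀ ∷ M ∷ M₀ ∷ B ∷ [])) (trans (𝒪I.vanish h₅) (trans (𝒪I.vanish h₄) (trans (𝒪I.vanish h₃) (trans (𝒪I.vanish h₂) (𝒪I.vanish h₁)))))

sum-half : ∀ k K s c c₀ C C₀ T d d₀ L L₀ M M₀ P P₀ B → k * (c * c) ≡ L → k * (c₀ * c₀) ≡ L₀ → K * (C * C) ≡ M → K * (C₀ * C₀) ≡ M₀ → K * (T * T) ≡ B + ι (ℤ.+ 2) * K * C * C₀ → s * (d * d) ≡ P → s * (d₀ * d₀) ≡ P₀ → k * K * s * ((c * c * C₀ + c * c₀ * T + c₀ * c₀ * C) * (d * d * C₀ + d * d₀ * T + d₀ * d₀ * C) + (c * c * C₀ - c * c₀ * T + c₀ * c₀ * C) * (d * d * C₀ - d * d₀ * T + d₀ * d₀ * C)) ≡ k * K * s * ((c * d₀ + d * c₀) * T * ((c * d₀ + d * c₀) * T)) + (ι (ℤ.+ 2) * L * P * M₀ + ι (ℤ.+ 2) * L₀ * P₀ * M - B * (L * P₀ + L₀ * P))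
sum-half k K s c c₀ C C₀ T d d₀ L L₀ M M₀ P P₀ B h₁ h₂ h₃ h₄ h₅ h₆ h₇ = trans (𝒪I.identity (v 0F ⊗ v 1F ⊗ v 2F ⊗ ((v 3F ⊗ v 3F ⊗ v 6F ⊕ v 3F ⊗ v 4F ⊗ v 7F ⊕ v 4F ⊗ v 4F ⊗ v 5F) ⊗ (v 8F ⊗ v 8F ⊗ v 6F ⊕ v 8F ⊗ v 9F ⊗ v 7F ⊕ v 9F ⊗ v 9F ⊗ v 5F) ⊕ (v 3F ⊗ v 3F ⊗ v 6F ⊖ v 3F ⊗ v 4F ⊗ v 7F ⊕ v 4F ⊗ v 4F ⊗ v 5F) ⊗ (v 8F ⊗ v 8F ⊗ v 6F ⊖ v 8F ⊗ v 9F ⊗ v 7F ⊕ v 9F ⊗ v 9F ⊗ v 5F))) (v 0F ⊗ v 1F ⊗ v 2F ⊗ ((v 3F ⊗ v 9F ⊕ v 8F ⊗ v 4F) ⊗ v 7F ⊗ ((v 3F ⊗ v 9F ⊕ v 8F ⊗ v 4F) ⊗ v 7F)) ⊕ (# (ℤ.+ 2) ⊗ v (Fin.suc 9F) ⊗ v (Fin.suc (Fin.suc (Fin.suc (Fin.suc (Fin.suc 9F))))) ⊗ v (Fin.suc (Fin.suc (Fin.suc (Fin.suc 9F)))) ⊕ # (ℤ.+ 2) ⊗ v (Fin.suc (Fin.suc 9F)) ⊗ v (Fin.suc (Fin.suc (Fin.suc (Fin.suc (Fin.suc (Fin.suc 9F)))))) ⊗ v (Fin.suc (Fin.suc (Fin.suc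 9F))) ⊖ v (Fin.suc (Fin.suc (Fin.suc (Fin.suc (Fin.suc (Fin.suc (Fin.suc 9F))))))) ⊗ (v (Fin.suc 9F) ⊗ v (Fin.suc (Fin.suc (Fin.suc (Fin.suc (Fin.suc (Fin.suc 9F)))))) ⊕ v (Fin.suc (Fin.suc 9F)) ⊗ v (Fin.suc (Fin.suc (Fin.suc (Fin.suc (Fin.suc 9F))))))) ⊕ (# (ℤ.+ 2) ⊗ v 2F ⊗ v 8F ⊗ v 8F ⊗ v 1F ⊗ v 6F ⊗ v 6F ⊖ v (Fin.suc (Fin.suc (Fin.suc (Fin.suc (Fin.suc (Fin.suc (Fin.suc 9F))))))) ⊗ v 2F ⊗ v 9F ⊗ v 9F) ⊗ (v 0F ⊗ (v 3F ⊗ v 3F) ⊖ v (Fin.suc 9F)) ⊕ (# (ℤ.+ 2) ⊗ v 2F ⊗ v 9F ⊗ v 9F ⊗ v 1F ⊗ v 5F ⊗ v 5F ⊖ v (Fin.suc (Fin.suc (Fin.suc (Fin.suc (Fin.suc (Fin.suc (Fin.suc 9F))))))) ⊗ v 2F ⊗ v 8F ⊗ v 8F) ⊗ (v 0F ⊗ (v 4F ⊗ v 4F) ⊖ v (Fin.suc (Fin.suc 9F))) ⊕ # (ℤ.+ 2) ⊗ v (Fin.suc (Fin.suc 9F)) ⊗ v (Fin.suc (Fin.suc (Fin.suc (Fin.suc (Fin.suc (Fin.suc 9F)))))) ⊗ (v 1F ⊗ (v 5F ⊗ v 5F) ⊖ v (Fin.suc (Fin.suc (Fin.suc 9F)))) ⊕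 # (ℤ.+ 2) ⊗ v (Fin.suc 9F) ⊗ v (Fin.suc (Fin.suc (Fin.suc (Fin.suc (Fin.suc 9F))))) ⊗ (v 1F ⊗ (v 6F ⊗ v 6F) ⊖ v (Fin.suc (Fin.suc (Fin.suc (Fin.suc 9F))))) ⊕ (# (ℤ.+ 0) ⊖ v 0F ⊗ v 3F ⊗ v 3F ⊗ v 2F ⊗ v 9F ⊗ v 9F ⊖ v 0F ⊗ v 4F ⊗ v 4F ⊗ v 2F ⊗ v 8F ⊗ v 8F) ⊗ (v 1F ⊗ (v 7F ⊗ v 7F) ⊖ (v (Fin.suc (Fin.suc (Fin.suc (Fin.suc (Fin.suc (Fin.suc (Fin.suc 9F))))))) ⊕ # (ℤ.+ 2) ⊗ v 1F ⊗ v 5F ⊗ v 6F)) ⊕ (# (ℤ.+ 2) ⊗ v (Fin.suc 9F) ⊗ v 1F ⊗ v 6F ⊗ v 6F ⊖ v (Fin.suc (Fin.suc (Fin.suc (Fin.suc (Fin.suc (Fin.suc (Fin.suc 9F))))))) ⊗ v (Fin.suc (Fin.suc 9F))) ⊗ (v 2F ⊗ (v 8F ⊗ v 8F) ⊖ v (Fin.suc (Fin.suc (Fin.suc (Fin.suc (Fin.suc 9F)))))) ⊕ (# (ℤ.+ 2) ⊗ v (Fin.suc (Fin.suc 9F)) ⊗ v 1F ⊗ v 5F ⊗ v 5F ⊖ v (Fin.suc (Fin.suc (Fin.suc (Fin.suc (Fin.suc (Fin.suc (Fin.suc 9F))))))) ⊗ v (Fin.suc 9F)) ⊗ (v 2F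 ⊗ (v 9F ⊗ v 9F) ⊖ v (Fin.suc (Fin.suc (Fin.suc (Fin.suc (Fin.suc (Fin.suc 9F)))))))) refl (k ∷ K ∷ s ∷ c ∷ c₀ ∷ C ∷ C₀ ∷ T ∷ d ∷ d₀ ∷ L ∷ L₀ ∷ M ∷ M₀ ∷ P ∷ P₀ ∷ B ∷ [])) (trans (𝒪I.vanish h₇) (trans (𝒪I.vanish h₆) (trans (𝒪I.vanish h₅) (trans (𝒪I.vanish h₄) (trans (𝒪I.vanish h₃) (trans (𝒪I.vanish h₂) (𝒪I.vanish h₁)))))))

-- The left side is quadratic in either point and vanishes when (U : V) and (P : Q) coincide, so it
-- is a multiple of the squared determinant. The multiplier is the value of the form at (s , 1).
form-identity : ∀ ρ n s U V P Q → (U - s * V) * (U - s * V) * (P * P + ρ * P * Q + n * (Q * Q)) + (P - s * Q) * (P - s * Q) * (U * U + ρ * U * V + n * (V * V)) - (ι (ℤ.+ 2) * U * P + ρ * (U * Q + V * P) + ι (ℤ.+ 2) * n * (V * Q)) * (U - s * V) * (P - s * Q) ≡ (s * s + ρ * s + n) * ((U * Q - P * V) * (U * Q - P * V))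
form-identity ρ n s U V P Q = 𝒪I.identity ((v 3F ⊖ v 2F ⊗ v 4F) ⊗ (v 3F ⊖ v 2F ⊗ v 4F) ⊗ (v 5F ⊗ v 5F ⊕ v 0F ⊗ v 5F ⊗ v 6F ⊕ v 1F ⊗ (v 6F ⊗ v 6F)) ⊕ (v 5F ⊖ v 2F ⊗ v 6F) ⊗ (v 5F ⊖ v 2F ⊗ v 6F) ⊗ (v 3F ⊗ v 3F ⊕ v 0F ⊗ v 3F ⊗ v 4F ⊕ v 1F ⊗ (v 4F ⊗ v 4F)) ⊖ (# (ℤ.+ 2) ⊗ v 3F ⊗ v 5F ⊕ v 0F ⊗ (v 3F ⊗ v 6F ⊕ v 4F ⊗ v 5F) ⊕ # (ℤ.+ 2) ⊗ v 1F ⊗ (v 4F ⊗ v 6F)) ⊗ (v 3F ⊖ v 2F ⊗ v 4F) ⊗ (v 5F ⊖ v 2F ⊗ v 6F)) ((v 2F ⊗ v 2F ⊕ v 0F ⊗ v 2F ⊕ v 1F) ⊗ ((v 3F ⊗ v 6F ⊖ v 5F ⊗ v 4F) ⊗ (v 3F ⊗ v 6F ⊖ v 5F ⊗ v 4F))) refl (ρ ∷ n ∷ s ∷ U ∷ V ∷ P ∷ Q ∷ [])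
form-identity₂ : ∀ ρ n s U V P Q → ι (ℤ.+ 2) * (U - ρ * V) * (U - s * V) * (P * P + ρ * P * Q + n * (Q * Q)) + ι (ℤ.+ 2) * (P - ρ * Q) * (P - s * Q) * (U * U + ρ * U * V + n * (V * V)) - (ι (ℤ.+ 2) * U * P + ρ * (U * Q + V * P) + ι (ℤ.+ 2) * n * (V * Q)) * ((U - ρ * V) * (P - s * Q) + (P - ρ * Q) * (U - s * V)) ≡ (ι (ℤ.+ 3) * ρ * s + ρ * ρ + ι (ℤ.+ 2) * n) * ((U * Q - P * V) * (U * Q - P * V))
form-identity₂ ρ n s U V P Q = 𝒪I.identity (# (ℤ.+ 2) ⊗ (v 3F ⊖ v 0F ⊗ v 4F) ⊗ (v 3F ⊖ v 2F ⊗ v 4F) ⊗ (v 5F ⊗ v 5F ⊕ v 0F ⊗ v 5F ⊗ v 6F ⊕ v 1F ⊗ (v 6F ⊗ v 6F)) ⊕ # (ℤ.+ 2) ⊗ (v 5F ⊖ v 0F ⊗ v 6F) ⊗ (v 5F ⊖ v 2F ⊗ v 6F) ⊗ (v 3F ⊗ v 3F ⊕ v 0F ⊗ v 3F ⊗ v 4F ⊕ v 1F ⊗ (v 4F ⊗ v 4F)) ⊖ (# (ℤ.+ 2) ⊗ v 3F ⊗ v 5F ⊕ v 0F ⊗ (v 3F ⊗ v 6F ⊕ v 4F ⊗ v 5F) ⊕ # (ℤ.+ 2) ⊗ v 1F ⊗ (v 4F ⊗ v 6F)) ⊗ ((v 3F ⊖ v 0F ⊗ v 4F) ⊗ (v 5F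 ⊖ v 2F ⊗ v 6F) ⊕ (v 5F ⊖ v 0F ⊗ v 6F) ⊗ (v 3F ⊖ v 2F ⊗ v 4F))) ((# (ℤ.+ 3) ⊗ v 0F ⊗ v 2F ⊕ v 0F ⊗ v 0F ⊕ # (ℤ.+ 2) ⊗ v 1F) ⊗ ((v 3F ⊗ v 6F ⊖ v 5F ⊗ v 4F) ⊗ (v 3F ⊗ v 6F ⊖ v 5F ⊗ v 4F))) refl (ρ ∷ n ∷ s ∷ U ∷ V ∷ P ∷ Q ∷ [])

assemble-product : ∀ k K s κ F G F′ G′ X Y β a b D → k * k * K * (F * G) ≡ a * (D * D) → s * s * K * (F′ * G′) ≡ b * (D * D) → κ ≡ k * K * s → β ≡ κ * κ * (a * b) → κ * κ * (F * F′) * (κ * κ * (G * G′)) ≡ β * (D * D * (D * D))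
assemble-product k K s κ F G F′ G′ X Y β a b D h₁ h₂ h₃ h₄ = trans (𝒪I.identity (v 3F ⊗ v 3F ⊗ (v 4F ⊗ v 6F) ⊗ (v 3F ⊗ v 3F ⊗ (v 5F ⊗ v 7F))) (v (Fin.suc 9F) ⊗ (v (Fin.suc (Fin.suc (Fin.suc (Fin.suc 9F)))) ⊗ v (Fin.suc (Fin.suc (Fin.suc (Fin.suc 9F)))) ⊗ (v (Fin.suc (Fin.suc (Fin.suc (Fin.suc 9F)))) ⊗ v (Fin.suc (Fin.suc (Fin.suc (Fin.suc 9F)))))) ⊕ v 3F ⊗ v 3F ⊗ v 2F ⊗ v 2F ⊗ v 1F ⊗ v 6F ⊗ v 7F ⊗ (v 0F ⊗ v 0F ⊗ v 1F ⊗ (v 4F ⊗ v 5F) ⊖ v (Fin.suc (Fin.suc 9F)) ⊗ (v (Fin.suc (Fin.suc (Fin.suc (Fin.suc 9F)))) ⊗ v (Fin.suc (Fin.suc (Fin.suc (Fin.suc 9F)))))) ⊕ v 3F ⊗ v 3F ⊗ v (Fin.suc (Fin.suc 9F)) ⊗ v (Fin.suc (Fin.suc (Fin.suc (Fin.suc 9F)))) ⊗ v (Fin.suc (Fin.suc (Fin.suc (Fin.suc 9F)))) ⊗ (v 2F ⊗ v 2F ⊗ v 1F ⊗ (v 6F ⊗ v 7F) ⊖ v (Fin.suc (Fin.suc (Fin.suc 9F))) ⊗ (v (Fin.suc (Fin.suc (Fin.suc (Fin.suc 9F)))) ⊗ v (Fin.suc (Fin.suc (Fin.suc (Fin.suc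 9F)))))) ⊕ v 3F ⊗ v 3F ⊗ v 4F ⊗ v 5F ⊗ v 6F ⊗ v 7F ⊗ (v 3F ⊕ v 0F ⊗ v 1F ⊗ v 2F) ⊗ (v 3F ⊖ v 0F ⊗ v 1F ⊗ v 2F) ⊕ (# (ℤ.+ 0) ⊖ v (Fin.suc (Fin.suc (Fin.suc (Fin.suc 9F)))) ⊗ v (Fin.suc (Fin.suc (Fin.suc (Fin.suc 9F)))) ⊗ v (Fin.suc (Fin.suc (Fin.suc (Fin.suc 9F)))) ⊗ v (Fin.suc (Fin.suc (Fin.suc (Fin.suc 9F))))) ⊗ (v (Fin.suc 9F) ⊖ v 3F ⊗ v 3F ⊗ (v (Fin.suc (Fin.suc 9F)) ⊗ v (Fin.suc (Fin.suc (Fin.suc 9F)))))) refl (k ∷ K ∷ s ∷ κ ∷ F ∷ G ∷ F′ ∷ G′ ∷ X ∷ Y ∷ β ∷ a ∷ b ∷ D ∷ [])) (trans (𝒪I.vanish h₄) (trans (𝒪I.vanish h₃) (trans (𝒪I.vanish h₂) (𝒪I.vanish h₁))))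
assemble-sum : ∀ k K s κ W S α a D E → k * K * s * S ≡ k * K * s * W + a * (D * D) → κ ≡ k * K * s → α ≡ κ * a → κ * κ * S ≡ κ * κ * W + α * (D * D)
assemble-sum k K s κ W S α a D E h₁ h₂ h₃ = trans (𝒪I.identity (v 3F ⊗ v 3F ⊗ v 5F) (v 3F ⊗ v 3F ⊗ v 4F ⊕ v 6F ⊗ (v 8F ⊗ v 8F) ⊕ v 3F ⊗ (v 0F ⊗ v 1F ⊗ v 2F ⊗ v 5F ⊖ (v 0F ⊗ v 1F ⊗ v 2F ⊗ v 4F ⊕ v 7F ⊗ (v 8F ⊗ v 8F))) ⊕ (v 3F ⊗ v 5F ⊖ v 3F ⊗ v 4F) ⊗ (v 3F ⊖ v 0F ⊗ v 1F ⊗ v 2F) ⊕ (# (ℤ.+ 0) ⊖ v 8F ⊗ v 8F) ⊗ (v 6F ⊖ v 3F ⊗ v 7F)) refl (k ∷ K ∷ s ∷ κ ∷ W ∷ S ∷ α ∷ a ∷ D ∷ E ∷ [])) (trans (𝒪I.vanish h₃) (trans (𝒪I.vanish h₂) (𝒪I.vanish h₁)))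
assemble₁ : ∀ κ F F′ G G′ → κ * κ * (F * F′) + κ * κ * (G * G′) ≡ κ * κ * (F * F′ + G * G′)
assemble₁ κ F F′ G G′ = 𝒪I.identity (v 0F ⊗ v 0F ⊗ (v 1F ⊗ v 2F) ⊕ v 0F ⊗ v 0F ⊗ (v 3F ⊗ v 4F)) (v 0F ⊗ v 0F ⊗ (v 1F ⊗ v 2F ⊕ v 3F ⊗ v 4F)) refl (κ ∷ F ∷ F′ ∷ G ∷ G′ ∷ [])
assemble₂ : ∀ κ c d c₀ d₀ T → κ * κ * ((c * d₀ + d * c₀) * T * ((c * d₀ + d * c₀) * T)) ≡ κ * (c * d₀ + d * c₀) * T * (κ * (c * d₀ + d * c₀) * T)
assemble₂ κ c d c₀ d₀ T = 𝒪I.identity (v 0F ⊗ v 0F ⊗ ((v 1F ⊗ v 4F ⊕ v 2F ⊗ v 3F) ⊗ v 5F ⊗ ((v 1F ⊗ v 4F ⊕ v 2F ⊗ v 3F) ⊗ v 5F))) (v 0F ⊗ (v 1F ⊗ v 4F ⊕ v 2F ⊗ v 3F) ⊗ v 5F ⊗ (v 0F ⊗ (v 1F ⊗ v 4F ⊕ v 2F ⊗ v 3F) ⊗ v 5F)) refl (κ ∷ c ∷ d ∷ c₀ ∷ d₀ ∷ T ∷ [])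

quarter-F : ∀ c ν C C₀ t N T → C ≡ C₀ + ι (ℤ.+ 2) * t + ι (ℤ.+ 2) * (ι (ℤ.+ 2) * N) → T ≡ ι (ℤ.+ 2) * C₀ + ι (ℤ.+ 2) * t → (c + ι (ℤ.+ 2) * ν) * (c + ι (ℤ.+ 2) * ν) * C₀ + (c + ι (ℤ.+ 2) * ν) * c * T + c * c * C ≡ ι (ℤ.+ 4) * (c * c * C₀ + ι (ℤ.+ 2) * c * ν * C₀ + ν * ν * C₀ + c * c * t + c * ν * t + c * c * N)
quarter-F c ν C C₀ t N T h₁ h₂ = trans (𝒪I.identity ((v 0F ⊕ # (ℤ.+ 2) ⊗ v 1F) ⊗ (v 0F ⊕ # (ℤ.+ 2) ⊗ v 1F) ⊗ v 3F ⊕ (v 0F ⊕ # (ℤ.+ 2) ⊗ v 1F) ⊗ v 0F ⊗ v 6F ⊕ v 0F ⊗ v 0F ⊗ v 2F) (# (ℤ.+ 4) ⊗ (v 0F ⊗ v 0F ⊗ v 3F ⊕ # (ℤ.+ 2) ⊗ v 0F ⊗ v 1F ⊗ v 3F ⊕ v 1F ⊗ v 1F ⊗ v 3F ⊕ v 0F ⊗ v 0F ⊗ v 4F ⊕ v 0F ⊗ v 1F ⊗ v 4F ⊕ v 0F ⊗ v 0F ⊗ v 5F) ⊕ v 0F ⊗ v 0F ⊗ (v 2F ⊖ (v 3F ⊕ # (ℤ.+ 2) ⊗ v 4F ⊕ # (ℤ.+ 2) ⊗ (# (ℤ.+ 2) ⊗ v 5F))) ⊕ (v 0F ⊕ # (ℤ.+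 2) ⊗ v 1F) ⊗ v 0F ⊗ (v 6F ⊖ (# (ℤ.+ 2) ⊗ v 3F ⊕ # (ℤ.+ 2) ⊗ v 4F))) refl (c ∷ ν ∷ C ∷ C₀ ∷ t ∷ N ∷ T ∷ [])) (trans (𝒪I.vanish h₂) (𝒪I.vanish h₁))
quarter-G : ∀ c ν C C₀ t N T → C ≡ C₀ + ι (ℤ.+ 2) * t + ι (ℤ.+ 2) * (ι (ℤ.+ 2) * N) → T ≡ ι (ℤ.+ 2) * C₀ + ι (ℤ.+ 2) * t → (c + ι (ℤ.+ 2) * ν) * (c + ι (ℤ.+ 2) * ν) * C₀ - (c + ι (ℤ.+ 2) * ν) * c * T + c * c * C ≡ ι (ℤ.+ 4) * (ν * ν * C₀ - c * ν * t + c * c * N)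
quarter-G c ν C C₀ t N T h₁ h₂ = trans (𝒪I.identity ((v 0F ⊕ # (ℤ.+ 2) ⊗ v 1F) ⊗ (v 0F ⊕ # (ℤ.+ 2) ⊗ v 1F) ⊗ v 3F ⊖ (v 0F ⊕ # (ℤ.+ 2) ⊗ v 1F) ⊗ v 0F ⊗ v 6F ⊕ v 0F ⊗ v 0F ⊗ v 2F) (# (ℤ.+ 4) ⊗ (v 1F ⊗ v 1F ⊗ v 3F ⊖ v 0F ⊗ v 1F ⊗ v 4F ⊕ v 0F ⊗ v 0F ⊗ v 5F) ⊕ v 0F ⊗ v 0F ⊗ (v 2F ⊖ (v 3F ⊕ # (ℤ.+ 2) ⊗ v 4F ⊕ # (ℤ.+ 2) ⊗ (# (ℤ.+ 2) ⊗ v 5F))) ⊕ (# (ℤ.+ 0) ⊖ (v 0F ⊕ # (ℤ.+ 2) ⊗ v 1F) ⊗ v 0F) ⊗ (v 6F ⊖ (# (ℤ.+ 2) ⊗ v 3F ⊕ # (ℤ.+ 2) ⊗ v 4F))) refl (c ∷ ν ∷ C ∷ C₀ ∷ t ∷ N ∷ T ∷ [])) (trans (𝒪I.vanish h₂) (𝒪I.vanish h₁))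
quarter-Z : ∀ κ c ν d μ C₀ t T → T ≡ ι (ℤ.+ 2) * C₀ + ι (ℤ.+ 2) * t → κ * ((c + ι (ℤ.+ 2) * ν) * d + (d + ι (ℤ.+ 2) * μ) * c) * T ≡ ι (ℤ.+ 4) * (κ * (c * d + ν * d + μ * c) * (C₀ + t))
quarter-Z κ c ν d μ C₀ t T h₁ = trans (𝒪I.identity (v 0F ⊗ ((v 1F ⊕ # (ℤ.+ 2) ⊗ v 2F) ⊗ v 3F ⊕ (v 3F ⊕ # (ℤ.+ 2) ⊗ v 4F) ⊗ v 1F) ⊗ v 7F) (# (ℤ.+ 4) ⊗ (v 0F ⊗ (v 1F ⊗ v 3F ⊕ v 2F ⊗ v 3F ⊕ v 4F ⊗ v 1F) ⊗ (v 5F ⊕ v 6F)) ⊕ v 0F ⊗ (v 1F ⊗ v 3F ⊕ # (ℤ.+ 2) ⊗ v 2F ⊗ v 3F ⊕ v 3F ⊗ v 1F ⊕ # (ℤ.+ 2) ⊗ v 4F ⊗ v 1F) ⊗ (v 7F ⊖ (# (ℤ.+ 2) ⊗ v 5F ⊕ # (ℤ.+ 2) ⊗ v 6F))) refl (κ ∷ c ∷ ν ∷ d ∷ μ ∷ C₀ ∷ t ∷ T ∷ [])) (𝒪I.vanish h₁)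
quarter-product : ∀ X X̄ κ F F′ G G′ f f′ g g′ β D → κ * κ * (F * F′) * (κ * κ * (G * G′)) ≡ β * (ι (ℤ.+ 4) * D * (ι (ℤ.+ 4) * D) * (ι (ℤ.+ 4) * D * (ι (ℤ.+ 4) * D))) → F ≡ ι (ℤ.+ 4) * f → F′ ≡ ι (ℤ.+ 4) * f′ → G ≡ ι (ℤ.+ 4) * g → G′ ≡ ι (ℤ.+ 4) * g′ → ι (ℤ.+ 256) * (κ * κ * (f * f′) * (κ * κ * (g * g′))) ≡ ι (ℤ.+ 256) * (β * (D * D * (D * D)))
quarter-product X X̄ κ F F′ G G′ f f′ g g′ β D h₁ h₂ h₃ h₄ h₅ = trans (𝒪I.identity (# (ℤ.+ 256) ⊗ (v 2F ⊗ v 2F ⊗ (v 7F ⊗ v 8F) ⊗ (v 2F ⊗ v 2F ⊗ (v 9F ⊗ v (Fin.suc 9F))))) (# (ℤ.+ 256) ⊗ (v (Fin.suc (Fin.suc 9F)) ⊗ (v (Fin.suc (Fin.suc (Fin.suc 9F))) ⊗ v (Fin.suc (Fin.suc (Fin.suc 9F))) ⊗ (v (Fin.suc (Fin.suc (Fin.suc 9F))) ⊗ v (Fin.suc (Fin.suc (Fin.suc 9F)))))) ⊕ # (ℤ.+ 1) ⊗ (v 2F ⊗ v 2F ⊗ (v 3F ⊗ v 4F) ⊗ (v 2F ⊗ v 2F ⊗ (v 5F ⊗ v 6F)) ⊖ v (Fin.suc (Fin.suc 9F)) ⊗ (# (ℤ.+ 4) ⊗ v (Fin.suc (Fin.suc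 (Fin.suc 9F))) ⊗ (# (ℤ.+ 4) ⊗ v (Fin.suc (Fin.suc (Fin.suc 9F)))) ⊗ (# (ℤ.+ 4) ⊗ v (Fin.suc (Fin.suc (Fin.suc 9F))) ⊗ (# (ℤ.+ 4) ⊗ v (Fin.suc (Fin.suc (Fin.suc 9F))))))) ⊕ (# (ℤ.+ 0) ⊖ v 2F ⊗ v 2F ⊗ v 2F ⊗ v 2F ⊗ v 4F ⊗ v 5F ⊗ v 6F) ⊗ (v 3F ⊖ # (ℤ.+ 4) ⊗ v 7F) ⊕ (# (ℤ.+ 0) ⊖ v 2F ⊗ v 2F ⊗ v 2F ⊗ v 2F ⊗ # (ℤ.+ 4) ⊗ v 7F ⊗ v 5F ⊗ v 6F) ⊗ (v 4F ⊖ # (ℤ.+ 4) ⊗ v 8F) ⊕ (# (ℤ.+ 0) ⊖ v 2F ⊗ v 2F ⊗ v 2F ⊗ v 2F ⊗ # (ℤ.+ 16) ⊗ v 7F ⊗ v 8F ⊗ v 6F) ⊗ (v 5F ⊖ # (ℤ.+ 4) ⊗ v 9F) ⊕ (# (ℤ.+ 0) ⊖ v 2F ⊗ v 2F ⊗ v 2F ⊗ v 2F ⊗ # (ℤ.+ 64) ⊗ v 7F ⊗ v 8F ⊗ v 9F) ⊗ (v 6F ⊖ # (ℤ.+ 4) ⊗ v (Fin.suc 9F))) refl (X ∷ X̄ ∷ κ ∷ F ∷ F′ ∷ G ∷ G′ ∷ f ∷ f′ ∷ g ∷ g′ ∷ β ∷ D ∷ [])) (trans (𝒪I.vanish h₅)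 (trans (𝒪I.vanish h₄) (trans (𝒪I.vanish h₃) (trans (𝒪I.vanish h₂) (𝒪I.vanish h₁)))))
quarter-sum : ∀ κ F F′ G G′ f f′ g g′ Z z α D → κ * κ * (F * F′) + κ * κ * (G * G′) ≡ Z * Z + α * (ι (ℤ.+ 4) * D * (ι (ℤ.+ 4) * D)) → F ≡ ι (ℤ.+ 4) * f → F′ ≡ ι (ℤ.+ 4) * f′ → G ≡ ι (ℤ.+ 4) * g → G′ ≡ ι (ℤ.+ 4) * g′ → Z ≡ ι (ℤ.+ 4) * z → ι (ℤ.+ 16) * (κ * κ * (f * f′) + κ * κ * (g * g′)) ≡ ι (ℤ.+ 16) * (z * z + α * (D * D))
quarter-sum κ F F′ G G′ f f′ g g′ Z z α D h₁ h₂ h₃ h₄ h₅ h₆ = trans (𝒪I.identity (# (ℤ.+ 16) ⊗ (v 0F ⊗ v 0F ⊗ (v 5F ⊗ v 6F) ⊕ v 0F ⊗ v 0F ⊗ (v 7F ⊗ v 8F))) (# (ℤ.+ 16) ⊗ (v (Fin.suc 9F) ⊗ v (Fin.suc 9F) ⊕ v (Fin.suc (Fin.suc 9F)) ⊗ (v (Fin.suc (Fin.suc (Fin.suc 9F))) ⊗ v (Fin.suc (Fin.suc (Fin.suc 9F))))) ⊕ # (ℤ.+ 1) ⊗ (v 0F ⊗ v 0F ⊗ (v 1F ⊗ v 2F) ⊕ v 0F ⊗ v 0F ⊗ (v 3F ⊗ v 4F) ⊖ (v 9F ⊗ v 9F ⊕ v (Fin.suc (Fin.suc 9F)) ⊗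 (# (ℤ.+ 4) ⊗ v (Fin.suc (Fin.suc (Fin.suc 9F))) ⊗ (# (ℤ.+ 4) ⊗ v (Fin.suc (Fin.suc (Fin.suc 9F))))))) ⊕ (# (ℤ.+ 0) ⊖ v 0F ⊗ v 0F ⊗ v 2F) ⊗ (v 1F ⊖ # (ℤ.+ 4) ⊗ v 5F) ⊕ (# (ℤ.+ 0) ⊖ v 0F ⊗ v 0F ⊗ # (ℤ.+ 4) ⊗ v 5F) ⊗ (v 2F ⊖ # (ℤ.+ 4) ⊗ v 6F) ⊕ (# (ℤ.+ 0) ⊖ v 0F ⊗ v 0F ⊗ v 4F) ⊗ (v 3F ⊖ # (ℤ.+ 4) ⊗ v 7F) ⊕ (# (ℤ.+ 0) ⊖ v 0F ⊗ v 0F ⊗ # (ℤ.+ 4) ⊗ v 7F) ⊗ (v 4F ⊖ # (ℤ.+ 4) ⊗ v 8F) ⊕ (v 9F ⊕ # (ℤ.+ 4) ⊗ v (Fin.suc 9F)) ⊗ (v 9F ⊖ # (ℤ.+ 4) ⊗ v (Fin.suc 9F))) refl (κ ∷ F ∷ F′ ∷ G ∷ G′ ∷ f ∷ f′ ∷ g ∷ g′ ∷ Z ∷ z ∷ α ∷ D ∷ [])) (trans (𝒪I.vanish h₆) (trans (𝒪I.vanish h₅) (trans (𝒪I.vanish h₄) (trans (𝒪I.vanish h₃) (trans (𝒪I.vanish h₂) (𝒪I.vanish h₁))))))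
digits : ∀ c c₀ ν k → c ≡ c₀ + ι (ℤ.+ 2) * ν + ι (ℤ.+ 4) * k → c ≡ c₀ + ι (ℤ.+ 2) * (ν + ι (ℤ.+ 2) * k)
digits c c₀ ν k h₁ = trans (𝒪I.identity (v 0F) (v 1F ⊕ # (ℤ.+ 2) ⊗ (v 2F ⊕ # (ℤ.+ 2) ⊗ v 3F) ⊕ # (ℤ.+ 1) ⊗ (v 0F ⊖ (v 1F ⊕ # (ℤ.+ 2) ⊗ v 2F ⊕ # (ℤ.+ 4) ⊗ v 3F))) refl (c ∷ c₀ ∷ ν ∷ k ∷ [])) (𝒪I.vanish h₁)
factor-unit : ∀ k x y → k * x - k * y ≡ k * (x - y)
factor-unit k x y = 𝒪I.identity (v 0F ⊗ v 1F ⊖ v 0F ⊗ v 2F) (v 0F ⊗ (v 1F ⊖ v 2F)) refl (k ∷ x ∷ y ∷ [])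

≈-Tr : ∀ {n} x {y z} → y ≈ z [ ι n ] → Tr⟨ x , y ⟩ ≈ Tr⟨ x , z ⟩ [ ι n ]
≈-Tr {n} x {y} {z} (by k e) = by Tr⟨ x , k ⟩ (trans (cong (λ w → Tr⟨ x , w ⟩) e) (trans (Tr-+ x z (ι n * k)) (cong (λ w → Tr⟨ x , z ⟩ + w) (Tr-ι* n x k))))

unit-root : ∀ {k x} c c₁ → Odd k → k * (c * c) ≈ x [ 𝟠 ] → k * (c₁ * c₁) ≈ x [ 𝟠 ] → ∃ λ z → z * z ≡ c * c × z ≈ c₁ [ 𝟜 ]
unit-root {k} {x} c c₁ o p q = √-sign (∣-⇒≈ (euclid (odd-8 o) (subst (𝟠 ∣𝒪_) (factor-unit k (c * c) (c₁ * c₁)) (≈⇒∣- (≈-trans p (≈-sym q))))))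

-- Points near the base point given by (u₀ , v₀ , c₀ , d₀) on the curve k c² = u - ρ w, s d² = u - σ w.
module Base-point (ρ σ k s κ α β : 𝒪) (u₀ v₀ : ℤ) (c₀ d₀ : 𝒪)
  (trace : Tr⟨ 𝟙 , ρ ⟩ ≡ 𝟘 - ρ)
  (κ≡ : κ ≡ k * k ♯ * s)
  (α≡ : α ≡ κ * (ι (ℤ.+ 3) * ρ * σ + ρ * ρ + 𝟚 * ρ ♯))
  (β≡ : β ≡ κ * κ * ((ρ * ρ + ρ * ρ + ρ ♯) * (σ * σ + ρ * σ + ρ ♯)))
  (c₀≡ : k * (c₀ * c₀) ≡ ι u₀ - ρ * ι v₀)
  (d₀≡ : s * (d₀ * d₀) ≡ ι u₀ - σ * ι v₀)
  where

  open Trace-zero ρ trace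

  determinant : ℤ → ℤ → 𝒪
  determinant u w = ι u * ι v₀ - ι u₀ * ι w

  ♯-square : ∀ {c} u w → k * (c * c) ≡ ι u - ρ * ι w → k ♯ * (c ♯ * c ♯) ≡ form ρ (ρ ♯) (ι u) (ι w)
  ♯-square {c} u w e = trans (cong (λ x → k ♯ * x) (sym (♯-* c c))) (trans (sym (♯-* k (c * c))) (trans (cong _♯ e) (♯-form u w)))

  distribute : ∀ K x C C₀ → K * (x + ι (ℤ.+ 2) * (C * C₀)) ≡ K * x + ι (ℤ.+ 2) * K * C * C₀
  distribute K x C C₀ = 𝒪I.identity (v 0F ⊗ (v 1F ⊕ # (ℤ.+ 2) ⊗ (v 2F ⊗ v 3F))) (v 0F ⊗ v 1F ⊕ # (ℤ.+ 2) ⊗ v 0F ⊗ v 2F ⊗ v 3F) refl (K ∷ x ∷ C ∷ C₀ ∷ [])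

  Tr-square : ∀ {c} u w → k * (c * c) ≡ ι u - ρ * ι w →
    k ♯ * (Tr⟨ c , c₀ ⟩ * Tr⟨ c , c₀ ⟩) ≡ polar-form ρ (ρ ♯) (ι u) (ι w) (ι u₀) (ι v₀) + 𝟚 * k ♯ * c ♯ * c₀ ♯
  Tr-square {c} u w e = trans (cong (λ x → k ♯ * x) (Tr² c c₀)) (trans (distribute (k ♯) Tr⟨ c * c , c₀ * c₀ ⟩ (c ♯) (c₀ ♯))
    (cong (λ x → x + 𝟚 * k ♯ * c ♯ * c₀ ♯) (trans (♯-Tr k (c * c) (c₀ * c₀)) (trans (cong₂ Tr⟨_,_⟩ e c₀≡) (Tr-form u w u₀ v₀)))))

  -- The roots of the datum are κ²F₁F₂ and κ²G₁G₂; passing from the F to the G changes the sign of τ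
  -- = `Tr⟨ c , c₀ ⟩`.
  module Quarter (c d τ C : 𝒪) where
    F₁ F₂ G₁ G₂ : 𝒪
    F₁ = c * c * c₀ ♯ + c * c₀ * τ + c₀ * c₀ * C
    F₂ = d * d * c₀ ♯ + d * d₀ * τ + d₀ * d₀ * C
    G₁ = c * c * c₀ ♯ - c * c₀ * τ + c₀ * c₀ * C
    G₂ = d * d * c₀ ♯ - d * d₀ * τ + d₀ * d₀ * C

  module _ {c d : 𝒪} (u w : ℤ) (c≡ : k * (c * c) ≡ ι u - ρ * ι w) (d≡ : s * (d * d) ≡ ι u - σ * ι w) where
    private
      τ = Tr⟨ c , c₀ ⟩
      C = c ♯
      K = k ♯
      C₀ = c₀ ♯
      D = determinant u w
      B = polar-form ρ (ρ ♯) (ι u) (ι w) (ι u₀) (ι v₀)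
      M = form ρ (ρ ♯) (ι u) (ι w)
      M₀ = form ρ (ρ ♯) (ι u₀) (ι v₀)
      L = ι u - ρ * ι w
      L₀ = ι u₀ - ρ * ι v₀
      P = ι u - σ * ι w
      P₀ = ι u₀ - σ * ι v₀
    open Quarter c d τ C

    -- Here β is κ² times the resultant of (u - ρw)(u - σw) and the quadratic form: the form is
    -- evaluated at its two roots ρ and σ, one by each application of `form-identity`.
    full-product : κ * κ * (F₁ * F₂) * (κ * κ * (G₁ * G₂)) ≡ β * (D * D * (D * D))
    full-product = assemble-product k K s κ F₁ G₁ F₂ G₂ C C β (ρ * ρ + ρ * ρ + ρ ♯) (σ * σ + ρ * σ + ρ ♯) D
      (trans (product-half k K c c₀ C C₀ τ L L₀ M M₀ B c≡ c₀≡ (♯-square u w c≡) (♯-square u₀ v₀ c₀≡) (Tr-square u w c≡)) (form-identity ρ (ρ ♯) ρ (ι u) (ι w) (ι u₀) (ι v₀)))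
      (trans (product-half s K d d₀ C C₀ τ P P₀ M M₀ B d≡ d₀≡ (♯-square u w c≡) (♯-square u₀ v₀ c₀≡) (Tr-square u w c≡)) (form-identity ρ (ρ ♯) σ (ι u) (ι w) (ι u₀) (ι v₀)))
      κ≡ β≡

    full-sum : κ * κ * (F₁ * F₂) + κ * κ * (G₁ * G₂) ≡ κ * (c * d₀ + d * c₀) * τ * (κ * (c * d₀ + d * c₀) * τ) + α * (D * D)
    full-sum = trans (assemble₁ κ F₁ F₂ G₁ G₂) (trans
      (assemble-sum k K s κ ((c * d₀ + d * c₀) * τ * ((c * d₀ + d * c₀) * τ)) (F₁ * F₂ + G₁ * G₂) α (ι (ℤ.+ 3) * ρ * σ + ρ * ρ + 𝟚 * ρ ♯) D C
        (trans (sum-half k K s c c₀ C C₀ τ d d₀ L L₀ M M₀ P P₀ B c≡ c₀≡ (♯-square u w c≡) (♯-square u₀ v₀ c₀≡) (Tr-square u w c≡) d≡ d₀≡)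
          (cong (λ x → k * K * s * ((c * d₀ + d * c₀) * τ * ((c * d₀ + d * c₀) * τ)) + x) (form-identity₂ ρ (ρ ♯) σ (ι u) (ι w) (ι u₀) (ι v₀))))
        κ≡ α≡)
      (cong (λ x → x + α * (D * D)) (assemble₂ κ c d c₀ d₀ τ)))

  -- The Z of the datum after cancellation of 4, with c = c₀ + 2ν and d = d₀ + 2μ. Modulo 2 it
  -- depends only on ν and μ modulo 2.
  Z-near : 𝒪 → 𝒪 → 𝒪
  Z-near ν μ = κ * (c₀ * d₀ + ν * d₀ + μ * c₀) * (c₀ ♯ + Tr⟨ c₀ , ν ⟩)

  Z-near-≈ : ∀ {ν ν₁ μ μ₁} → ν ≈ ν₁ [ 𝟚 ] → μ ≈ μ₁ [ 𝟚 ] → Z-near ν μ ≈ Z-near ν₁ μ₁ [ 𝟚 ]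
  Z-near-≈ p q = ≈-* (≈-* ≈-refl (≈-+ (≈-+ ≈-refl (≈-* p ≈-refl)) (≈-* q ≈-refl))) (≈-+ ≈-refl (≈-Tr c₀ p))

  -- As c and d agree with c₀ and d₀ modulo 2, each of F₁, F₂, G₁, G₂ and Z is divisible by 4, and
  -- so is the determinant. Cancelling leaves factors 256 = 4⁴ in the product equation and 16 = 4²
  -- in the sum equation.
  quarter-datum : ∀ {ν μ D′} u w → k * ((c₀ + 𝟚 * ν) * (c₀ + 𝟚 * ν)) ≡ ι u - ρ * ι w → s * ((d₀ + 𝟚 * μ) * (d₀ + 𝟚 * μ)) ≡ ι u - σ * ι w →
    determinant u w ≡ 𝟜 * D′ → ∃ λ X → ∃ λ (d : Datum α β X D′) → Datum.Z d ≡ Z-near ν μ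
  quarter-datum {ν} {μ} {D′} u w c≡ d≡ D≡ = _ , datum _ (Z-near ν μ)
      (*-cancelˡ (ι≢𝟘 255) (quarter-product τ τ κ F₁ F₂ G₁ G₂ _ _ _ _ β D′
        (subst (λ D → κ * κ * (F₁ * F₂) * (κ * κ * (G₁ * G₂)) ≡ β * (D * D * (D * D))) D≡ (full-product u w c≡ d≡)) F₁≡ F₂≡ G₁≡ G₂≡))
      (*-cancelˡ (ι≢𝟘 15) (quarter-sum κ F₁ F₂ G₁ G₂ _ _ _ _ _ (Z-near ν μ) α D′
        (subst (λ D → κ * κ * (F₁ * F₂) + κ * κ * (G₁ * G₂) ≡ κ * (c * d₀ + d * c₀) * τ * (κ * (c * d₀ + d * c₀) * τ) + α * (D * D)) D≡ (full-sum u w c≡ d≡)) F₁≡ F₂≡ G₁≡ G₂≡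
        (quarter-Z κ c₀ ν d₀ μ (c₀ ♯) t τ τ≡)))
    , refl
    where
    c = c₀ + 𝟚 * ν
    d = d₀ + 𝟚 * μ
    τ = Tr⟨ c , c₀ ⟩
    t = Tr⟨ c₀ , ν ⟩
    open Quarter c d τ (c ♯)
    C≡ : c ♯ ≡ c₀ ♯ + 𝟚 * t + 𝟚 * (𝟚 * ν ♯)
    C≡ = trans (♯-+ c₀ (𝟚 * ν)) (cong₂ (λ x y → c₀ ♯ + x + y) (Tr-ι* (ℤ.+ 2) c₀ ν) (♯-ι* (ℤ.+ 2) ν))
    τ≡ : τ ≡ 𝟚 * c₀ ♯ + 𝟚 * t
    τ≡ = trans (Tr-comm c c₀) (trans (Tr-+ c₀ c₀ (𝟚 * ν)) (cong₂ _+_ (Tr-self c₀) (Tr-ι* (ℤ.+ 2) c₀ ν)))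
    F₁≡ = quarter-F c₀ ν (c ♯) (c₀ ♯) t (ν ♯) τ C≡ τ≡
    F₂≡ = quarter-F d₀ μ (c ♯) (c₀ ♯) t (ν ♯) τ C≡ τ≡
    G₁≡ = quarter-G c₀ ν (c ♯) (c₀ ♯) t (ν ♯) τ C≡ τ≡
    G₂≡ = quarter-G d₀ μ (c ♯) (c₀ ♯) t (ν ♯) τ C≡ τ≡

  Near : 𝒪 → 𝒪 → Set
  Near z D′ = ∃ λ X → ∃ λ (d : Datum α β X D′) → Datum.Z d ≈ z [ 𝟚 ]

  -- The residues of u and w modulo 8 determine c² and d² modulo 8, hence c and d modulo 4 up to
  -- sign; the signs are chosen to match the prescribed ν₁ and μ₁.
  near : ∀ {c d} u w u₁ v₁ ν₁ μ₁ D′ → Odd k → Odd s → k * ((c₀ + 𝟚 * ν₁) * (c₀ + 𝟚 * ν₁)) ≈ ι u₁ - ρ * ι v₁ [ 𝟠 ] → s * ((d₀ + 𝟚 * μ₁) * (d₀ + 𝟚 * μ₁)) ≈ ι u₁ - σ * ι v₁ [ 𝟠 ] →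
    ι u ≈ ι u₁ [ 𝟠 ] → ι w ≈ ι v₁ [ 𝟠 ] → k * (c * c) ≡ ι u - ρ * ι w → s * (d * d) ≡ ι u - σ * ι w → determinant u w ≡ 𝟜 * D′ → Near (Z-near ν₁ μ₁) D′
  near {c} {d} u w u₁ v₁ ν₁ μ₁ D′ ok os c₁≈ d₁≈ u≈ v≈ c≡ d≡ D≡ = go
      (unit-root c (c₀ + 𝟚 * ν₁) ok (≈-trans (≡⇒≈ c≡) (≈-- u≈ (≈-* ≈-refl v≈))) c₁≈)
      (unit-root d (d₀ + 𝟚 * μ₁) os (≈-trans (≡⇒≈ d≡) (≈-- u≈ (≈-* ≈-refl v≈))) d₁≈)
    where
    go : (∃ λ z → z * z ≡ c * c × z ≈ c₀ + 𝟚 * ν₁ [ 𝟜 ]) → (∃ λ z → z * z ≡ d * d × z ≈ d₀ + 𝟚 * μ₁ [ 𝟜 ]) → Near (Z-near ν₁ μ₁) D′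
    go (c′ , cc≡ , by x c′≡) (d′ , dd≡ , by y d′≡) = finish (quarter-datum {ν₁ + 𝟚 * x} {μ₁ + 𝟚 * y} {D′} u w
        (subst (λ z → k * (z * z) ≡ ι u - ρ * ι w) (digits c′ c₀ ν₁ x c′≡) (trans (cong (λ z → k * z) cc≡) c≡))
        (subst (λ z → s * (z * z) ≡ ι u - σ * ι w) (digits d′ d₀ μ₁ y d′≡) (trans (cong (λ z → s * z) dd≡) d≡)) D≡)
      where
      finish : (∃ λ X → ∃ λ (d : Datum α β X D′) → Datum.Z d ≡ Z-near (ν₁ + 𝟚 * x) (μ₁ + 𝟚 * y)) → Near (Z-near ν₁ μ₁) D′
      finish (X , d , Z≡) = X , d , ≈-trans (≡⇒≈ Z≡) (Z-near-≈ (by x refl) (by y refl))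

-- integers at 2

odd? : 𝒪 → Bool
odd? x = not (div? 2 x)

odd?-sound : ∀ x → odd? x ≡ true → Odd x
odd?-sound x e = go (parity x)
  where
  go : 𝟚 ∣𝒪 x ⊎ Odd x → Odd x
  go (inj₂ o) = o
  go (inj₁ d) = ⊥-elim (not-true (div?-complete 2 d) e)

≈?-sound : ∀ n .{{_ : ℕ.NonZero n}} x y → div? n (x - y) ≡ true → x ≈ y [ ι (ℤ.+ n) ]
≈?-sound n x y e = ∣-⇒≈ (div?-sound n (x - y) e)

odd-𝟙 : Odd 𝟙
odd-𝟙 = cop-sym cop-𝟙

≈𝟙⇒odd : ∀ {x} → x ≈ 𝟙 [ 𝟚 ] → Odd x
≈𝟙⇒odd e = odd-≈ (≈-sym e) odd-𝟙

-- The place where the rationality of u / w enters: among the seven nonzero residues modulo 2 in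
-- `𝒪`, the odd part of a rational integer can only have the residue 1.
record 2-adic (n : ℤ) : Set where
  field
    exponent : ℕ
    odd-part : 𝒪
    ≡power : ι n ≡ times-power exponent odd-part
    ≈𝟙 : odd-part ≈ 𝟙 [ 𝟚 ]

2-adic-form : ∀ n → ¬ n ≡ ℤ.+ 0 → 2-adic n
2-adic-form n n≢0 = <-rec A step ∣ n ∣ n refl n≢0
  where
  A : ℕ → Set
  A k = ∀ n → ∣ n ∣ ≡ k → ¬ n ≡ ℤ.+ 0 → 2-adic n
  step : ∀ k → (∀ {j} → j ℕ.< k → A j) → A k
  step k rec n n≡ n≢0 = go (n ℤD.%ℕ 2) (n ℤD./ℕ 2) (ℤD.n%ℕd<d n 2) (ℤD.a≡a%ℕn+[a/ℕn]*n n 2)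
    where
    go : ∀ r q → r ℕ.< 2 → n ≡ ℤ.+ r ℤ.+ q ℤ.* ℤ.+ 2 → 2-adic n
    go 1 q _ e = record { exponent = 0 ; odd-part = ι n ; ≡power = refl ; ≈𝟙 = by (ι q) (trans (cong ι (trans e (cong (λ z → ℤ.+ 1 ℤ.+ z) (ℤₚ.*-comm q (ℤ.+ 2))))) (trans (ι-+ (ℤ.+ 1) _) (cong (λ z → 𝟙 + z) (ι-* (ℤ.+ 2) q)))) }
    go (suc (suc r)) q (ℕ.s≤s (ℕ.s≤s ())) e
    go 0 q _ e = double (rec smaller q refl q≢0)
      where
      n≡2q : n ≡ ℤ.+ 2 ℤ.* q
      n≡2q = trans e (trans (ℤₚ.+-identityˡ _) (ℤₚ.*-comm q (ℤ.+ 2)))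
      q≢0 : ¬ q ≡ ℤ.+ 0
      q≢0 z = n≢0 (trans n≡2q (trans (cong (λ x → ℤ.+ 2 ℤ.* x) z) refl))
      smaller : ∣ q ∣ ℕ.< k
      smaller = subst (∣ q ∣ ℕ.<_) (trans (trans (sym (ℤₚ.abs-* (ℤ.+ 2) q)) (cong ∣_∣ (sym n≡2q))) n≡)
        (ℕₚ.m<m+n ∣ q ∣ (ℕₚ.<-≤-trans (ℕₚ.n≢0⇒n>0 (λ z → q≢0 (ℤₚ.∣i∣≡0⇒i≡0 z))) (ℕₚ.m≤m+n ∣ q ∣ 0)))
      double : 2-adic q → 2-adic n
      double record { exponent = k ; odd-part = γ ; ≡power = p ; ≈𝟙 = o } = record { exponent = suc k ; odd-part = γ
        ; ≡power = trans (cong ι n≡2q) (trans (ι-* (ℤ.+ 2) q) (cong (λ z → 𝟚 * z) p)) ; ≈𝟙 = o }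

-- smoothness

opaque
  unfolding _+_ _*_ -_
  3∣θ³ : ι (ℤ.+ 3) ∣𝒪 (θ * (θ * θ))
  3∣θ³ = ⟨ ℤ.+ 0 , -[1+ 0 ] , ℤ.+ 0 ⟩ , refl
  5∣ρ²π : ι (ℤ.+ 5) ∣𝒪 (ρ₅ * (ρ₅ * π₅))
  5∣ρ²π = ⟨ ℤ.+ 1 , ℤ.+ 0 , ℤ.+ 0 ⟩ , refl

cop-powᵣ : ∀ {P x} n → Cop P x → Cop P (power x n)
cop-powᵣ zero c = cop-𝟙
cop-powᵣ (suc n) c = cop-* c (cop-powᵣ n c)

cop-5 : ∀ {P} → CopS P → Cop P (ι (ℤ.+ 5))
cop-5 c = cop-∣ʳ 5∣ρ²π (cop-* (CopS.cop-ρ c) (cop-* (CopS.cop-ρ c) (CopS.cop-π c)))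

-- An element divides its norm, so a norm of the form ±2ⁱ3ʲ5ᵏ leaves no primes other than those
-- above 2, 3 and 5.
smooth-by-norm : ∀ β i j k {n} → ι (N β) ≡ n * (power 𝟚 i * power (ι (ℤ.+ 3)) j * power (ι (ℤ.+ 5)) k) → n * n ≡ 𝟙 → Smooth β
smooth-by-norm β i j k {n} e n² P c = cop-∣ʳ (β ♯ * n , trans (sym (cancel n (power 𝟚 i * power (ι (ℤ.+ 3)) j * power (ι (ℤ.+ 5)) k) (ι (N β)) β (β ♯) e n² (*♯ β))) refl)
  (cop-* (cop-* (cop-powᵣ i (CopS.cop-2 c)) (cop-powᵣ j (cop-∣ʳ 3∣θ³ (cop-* (CopS.cop-θ c) (cop-* (CopS.cop-θ c) (CopS.cop-θ c)))))) (cop-powᵣ k (cop-5 c)))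
  where
  cancel : ∀ n m N b b′ → N ≡ n * m → n * n ≡ ι (ℤ.+ 1) → b * b′ ≡ N → b * (b′ * n) ≡ m
  cancel n m N b b′ h₁ h₂ h₃ = trans (𝒪I.identity (v 3F ⊗ (v 4F ⊗ v 0F)) (v 1F ⊕ v 0F ⊗ (v 2F ⊖ v 0F ⊗ v 1F) ⊕ v 1F ⊗ (v 0F ⊗ v 0F ⊖ # (ℤ.+ 1)) ⊕ v 0F ⊗ (v 3F ⊗ v 4F ⊖ v 2F)) refl (n ∷ m ∷ N ∷ b ∷ b′ ∷ [])) (trans (𝒪I.vanish h₃) (trans (𝒪I.vanish h₂) (𝒪I.vanish h₁)))

-- the two ways in which a point can be near a base point

-- The denominator is twice a nonzero rational integer, so its odd part is 1 modulo 2. As Z is z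
-- modulo 2 and τ inverts z there, the direction is τ and `no-point` applies.
near-standard : ∀ {α β} τ z → (∀ m {γ X} → Odd γ → (d : Datum α β X (𝟚 * times-power m γ)) → γ ≈ τ * Datum.Z d [ 𝟚 ] → ⊥) → 𝟙 ≈ τ * z [ 𝟚 ] →
  ∀ n → ¬ n ≡ ℤ.+ 0 → (∃ λ X → ∃ λ (d : Datum α β X (𝟚 * ι n)) → Datum.Z d ≈ z [ 𝟚 ]) → ⊥
near-standard {α} {β} τ z no-point τz n n≢0 (X , d , Z≈) = go (2-adic-form n n≢0)
  where
  go : 2-adic n → ⊥
  go record { exponent = k ; odd-part = γ ; ≡power = p ; ≈𝟙 = o } = transport p d Z≈
    where
    transport : ∀ {g} → g ≡ times-power k γ → (d : Datum α β X (𝟚 * g)) → Datum.Z d ≈ z [ 𝟚 ] → ⊥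
    transport refl d Z≈ = no-point k (≈𝟙⇒odd o) d (≈-trans o (≈-trans τz (≈-* ≈-refl (≈-sym Z≈))))

residual-four : ∀ β β₄ x → β ≡ ι (ℤ.+ 4) * β₄ → β * x ≡ ι (ℤ.+ 4) * (β₄ * x)
residual-four β β₄ x h₁ = trans (𝒪I.identity (v 0F ⊗ v 2F) (# (ℤ.+ 4) ⊗ (v 1F ⊗ v 2F) ⊕ v 2F ⊗ (v 0F ⊖ # (ℤ.+ 4) ⊗ v 1F)) refl (β ∷ β₄ ∷ x ∷ [])) (𝒪I.vanish h₁)
residual-sum : ∀ z α n → z * z + α * (n * n) ≡ z * z + α * (n * n)
residual-sum z α n = 𝒪I.identity (v 0F ⊗ v 0F ⊕ v 1F ⊗ (v 2F ⊗ v 2F)) (v 0F ⊗ v 0F ⊕ v 1F ⊗ (v 2F ⊗ v 2F)) refl (z ∷ α ∷ n ∷ [])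

-- With an odd denominator that is 1 modulo 2, the sum of the roots is z² + α modulo 4, and the odd
-- root equals it because 4 divides β.
near-residual : ∀ {α β β₄ X g} z → β ≡ 𝟜 * β₄ → Smooth β → Odd (z * z + α) → sieve? α β none (excludes₄ (z * z + α)) ≡ true →
  g ≈ 𝟙 [ 𝟚 ] → (d : Datum α β X g) → Datum.Z d ≈ z [ 𝟚 ] → ⊥
near-residual {α} {β} {β₄} {X} {g} z β≡ smooth-β o s g≈ d Z≈ = finish (select-odd d (odd-≈ (≈-sym (4⇒2 S≈)) o))
  where
  Z = Datum.Z d
  join : ∀ z α → z * z + α * (ι (ℤ.+ 1) * ι (ℤ.+ 1)) ≡ z * z + α
  join z α = 𝒪I.identity (v 0F ⊗ v 0F ⊕ v 1F ⊗ (# (ℤ.+ 1) ⊗ # (ℤ.+ 1))) (v 0F ⊗ v 0F ⊕ v 1F) refl (z ∷ α ∷ [])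
  S≈ : Z * Z + α * (g * g) ≈ z * z + α [ 𝟜 ]
  S≈ = ≈-trans (≈-+ (²-2⇒4 Z≈) (≈-* ≈-refl (²-2⇒4 g≈))) (≡⇒≈ (join z α))
  finish : OddRoot α β g Z → ⊥
  finish r = at (normal-form smooth-β (odd≢𝟘 (OddRoot.odd r)) (odd≢𝟘 (≈𝟙⇒odd g≈)) (root r))
    where
    x*1*1 : ∀ x → x ≡ x * (ι (ℤ.+ 1) * ι (ℤ.+ 1))
    x*1*1 x = 𝒪I.identity (v 0F) (v 0F ⊗ (# (ℤ.+ 1) ⊗ # (ℤ.+ 1))) refl (x ∷ [])
    at : NormalForm α β (OddRoot.X r) g → ⊥
    at nf = absurd (sieve none (excludes₄ (z * z + α)) s nf λ t → excludes₄-sound _ _ t (class₄ (NormalForm.X≡ nf) (OddRoot.odd r)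
      (≈-trans (odd-root (odd-4 (OddRoot.odd r)) (_ , residual-four β β₄ (g * g * (g * g)) β≡) (root r)) (≈-trans S≈ (≡⇒≈ (x*1*1 (z * z + α)))))))
      where
      absurd : false ≡ true → ⊥
      absurd ()

-- The first curve, and its exceptional class in the twisted case.

resistant : Class → Bool
resistant (cls true false false false true true) = true
resistant _ = false

-- The coefficients for ρ = θ, σ = θ₂ and the class pair (1 , π₅), which contains the ratios 2 and
-- -2.
αI βI bI β₄I rI : 𝒪
αI = ⟨ ℤ.+ 6 , ℤ.+ 27 , ℤ.+ 9 ⟩
βI = ⟨ ℤ.+ 72 , ℤ.+ 648 , ℤ.+ 204 ⟩
bI = ⟨ -[1+ 8 ] , ℤ.+ 0 , ℤ.+ 21 ⟩
β₄I = ⟨ ℤ.+ 18 , ℤ.+ 162 , ℤ.+ 51 ⟩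
rI = ⟨ -[1+ 0 ] , ℤ.+ 0 , ℤ.+ 4 ⟩

opaque
  unfolding _+_ _*_ -_ N div? zero%? dead?
  b≡I : bI ≡ αI * αI - 𝟜 * βI
  b≡I = refl
  β≡I : βI ≡ 𝟜 * β₄I
  β≡I = refl
  b≡twistI : bI ≡ twist * (rI * rI)
  b≡twistI = refl
  odd-α?I : odd? αI ≡ true
  odd-α?I = refl
  norm-βI : ι (N βI) ≡ ι (ℤ.+ 1) * (power 𝟚 6 * power (ι (ℤ.+ 3)) 3 * power (ι (ℤ.+ 5)) 3)
  norm-βI = refl
  norm-bI : ι (N bI) ≡ -𝟙 * (power 𝟚 0 * power (ι (ℤ.+ 3)) 3 * power (ι (ℤ.+ 5)) 3)
  norm-bI = refl
  sieve-αI : sieve? αI βI trivial-class (excludes₈ 𝟘) ≡ true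
  sieve-αI = refl
  sieve-dualI : sieve? (𝟘 - 𝟚 * αI) bI trivial-or-twist (excludes₈ 𝟘) ≡ true
  sieve-dualI = refl
  sieve-twistI : sieve? αI βI resistant (excludes₄ αI) ≡ true
  sieve-twistI = refl
  sieve-translate : sieve? (𝟘 - 𝟚 * αI) bI trivial-or-twist (excludes₄ 𝟙) ≡ true
  sieve-translate = refl

smooth-βI : Smooth βI
smooth-βI = smooth-by-norm βI 6 3 3 norm-βI (*-identityˡ 𝟙)
smooth-bI : Smooth bI
smooth-bI = smooth-by-norm bI 0 3 3 norm-bI -𝟙*-𝟙

-- Two points of the same torsor Y² = s h⁴ - α h² q² + β q⁴ differ by a point of trivial class,
-- which therefore lifts to the dual curve. The factors are the two roots of the lifted datum, and
-- its denominator is h² - h₀²q².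
translated-product : ∀ h h₀ q Y Y₀ s β α b → Y * Y ≡ s * (h * h) * (h * h) - α * (h * h) * (q * q) + β * (q * q) * (q * q) → Y₀ * Y₀ ≡ s * (h₀ * h₀) * (h₀ * h₀) - α * (h₀ * h₀) + β → b ≡ α * α - ι (ℤ.+ 4) * s * β → (ι (ℤ.+ 2) * s * (h * h) * (h₀ * h₀) - α * (h * h + h₀ * h₀ * (q * q)) + ι (ℤ.+ 2) * β * (q * q) + ι (ℤ.+ 2) * Y * Y₀) * ((h + h₀ * q) * (h + h₀ * q)) * ((ι (ℤ.+ 2) * s * (h * h) * (h₀ * h₀) - α * (h * h + h₀ * h₀ * (q * q)) + ι (ℤ.+ 2) * β * (q * q) - ι (ℤ.+ 2) * Y * Y₀) * ((h - h₀ * q) * (h - h₀ * q))) ≡ b * ((h * h - h₀ * h₀ * (q * q)) * (h * h - h₀ * h₀ * (q * q)) * ((h * h - h₀ * h₀ * (q * q)) * (h * h - h₀ * h₀ * (q * q))))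
translated-product h h₀ q Y Y₀ s β α b h₁ h₂ h₃ = trans (𝒪I.identity ((# (ℤ.+ 2) ⊗ v 5F ⊗ (v 0F ⊗ v 0F) ⊗ (v 1F ⊗ v 1F) ⊖ v 7F ⊗ (v 0F ⊗ v 0F ⊕ v 1F ⊗ v 1F ⊗ (v 2F ⊗ v 2F)) ⊕ # (ℤ.+ 2) ⊗ v 6F ⊗ (v 2F ⊗ v 2F) ⊕ # (ℤ.+ 2) ⊗ v 3F ⊗ v 4F) ⊗ ((v 0F ⊕ v 1F ⊗ v 2F) ⊗ (v 0F ⊕ v 1F ⊗ v 2F)) ⊗ ((# (ℤ.+ 2) ⊗ v 5F ⊗ (v 0F ⊗ v 0F) ⊗ (v 1F ⊗ v 1F) ⊖ v 7F ⊗ (v 0F ⊗ v 0F ⊕ v 1F ⊗ v 1F ⊗ (v 2F ⊗ v 2F)) ⊕ # (ℤ.+ 2) ⊗ v 6F ⊗ (v 2F ⊗ v 2F) ⊖ # (ℤ.+ 2) ⊗ v 3F ⊗ v 4F) ⊗ ((v 0F ⊖ v 1F ⊗ v 2F) ⊗ (v 0F ⊖ v 1F ⊗ v 2F)))) (v 8F ⊗ ((v 0F ⊗ v 0F ⊖ v 1F ⊗ v 1F ⊗ (v 2F ⊗ v 2F)) ⊗ (v 0F ⊗ v 0F ⊖ v 1F ⊗ v 1F ⊗ (v 2F ⊗ v 2F)) ⊗ ((v 0F ⊗ v 0F ⊖ v 1F ⊗ v 1F ⊗ (v 2F ⊗ v 2F)) ⊗ (v 0F ⊗ v 0F ⊖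 v 1F ⊗ v 1F ⊗ (v 2F ⊗ v 2F)))) ⊕ (# (ℤ.+ 0) ⊖ # (ℤ.+ 4) ⊗ (v 0F ⊗ v 0F ⊖ v 1F ⊗ v 1F ⊗ (v 2F ⊗ v 2F)) ⊗ (v 0F ⊗ v 0F ⊖ v 1F ⊗ v 1F ⊗ (v 2F ⊗ v 2F)) ⊗ v 4F ⊗ v 4F) ⊗ (v 3F ⊗ v 3F ⊖ (v 5F ⊗ (v 0F ⊗ v 0F) ⊗ (v 0F ⊗ v 0F) ⊖ v 7F ⊗ (v 0F ⊗ v 0F) ⊗ (v 2F ⊗ v 2F) ⊕ v 6F ⊗ (v 2F ⊗ v 2F) ⊗ (v 2F ⊗ v 2F))) ⊕ (# (ℤ.+ 0) ⊖ # (ℤ.+ 4) ⊗ (v 0F ⊗ v 0F ⊖ v 1F ⊗ v 1F ⊗ (v 2F ⊗ v 2F)) ⊗ (v 0F ⊗ v 0F ⊖ v 1F ⊗ v 1F ⊗ (v 2F ⊗ v 2F)) ⊗ (v 5F ⊗ (v 0F ⊗ v 0F) ⊗ (v 0F ⊗ v 0F) ⊖ v 7F ⊗ (v 0F ⊗ v 0F) ⊗ (v 2F ⊗ v 2F) ⊕ v 6F ⊗ (v 2F ⊗ v 2F) ⊗ (v 2F ⊗ v 2F))) ⊗ (v 4F ⊗ v 4F ⊖ (v 5F ⊗ (v 1F ⊗ v 1F) ⊗ (v 1F ⊗ v 1F) ⊖ v 7F ⊗ (v 1F ⊗ v 1F) ⊕ v 6F)) ⊕ (# (ℤ.+ 0)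 ⊖ (v 0F ⊗ v 0F ⊖ v 1F ⊗ v 1F ⊗ (v 2F ⊗ v 2F)) ⊗ (v 0F ⊗ v 0F ⊖ v 1F ⊗ v 1F ⊗ (v 2F ⊗ v 2F)) ⊗ ((v 0F ⊗ v 0F ⊖ v 1F ⊗ v 1F ⊗ (v 2F ⊗ v 2F)) ⊗ (v 0F ⊗ v 0F ⊖ v 1F ⊗ v 1F ⊗ (v 2F ⊗ v 2F)))) ⊗ (v 8F ⊖ (v 7F ⊗ v 7F ⊖ # (ℤ.+ 4) ⊗ v 5F ⊗ v 6F))) refl (h ∷ h₀ ∷ q ∷ Y ∷ Y₀ ∷ s ∷ β ∷ α ∷ b ∷ [])) (trans (𝒪I.vanish h₃) (trans (𝒪I.vanish h₂) (𝒪I.vanish h₁)))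
translated-sum : ∀ h h₀ q Y Y₀ s β α → Y * Y ≡ s * (h * h) * (h * h) - α * (h * h) * (q * q) + β * (q * q) * (q * q) → Y₀ * Y₀ ≡ s * (h₀ * h₀) * (h₀ * h₀) - α * (h₀ * h₀) + β → (ι (ℤ.+ 2) * s * (h * h) * (h₀ * h₀) - α * (h * h + h₀ * h₀ * (q * q)) + ι (ℤ.+ 2) * β * (q * q) + ι (ℤ.+ 2) * Y * Y₀) * ((h + h₀ * q) * (h + h₀ * q)) + (ι (ℤ.+ 2) * s * (h * h) * (h₀ * h₀) - α * (h * h + h₀ * h₀ * (q * q)) + ι (ℤ.+ 2) * β * (q * q) - ι (ℤ.+ 2) * Y * Y₀) * ((h - h₀ * q) * (h - h₀ * q)) ≡ ι (ℤ.+ 2) * (h₀ * Y + h * q * Y₀) * (ι (ℤ.+ 2) * (h₀ * Y + h * q * Y₀)) + (ι (ℤ.+ 0) - ι (ℤ.+ 2) * α) * ((h * h - h₀ * h₀ * (q * q)) * (h * h - h₀ * h₀ * (q * q)))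
translated-sum h h₀ q Y Y₀ s β α h₁ h₂ = trans (𝒪I.identity ((# (ℤ.+ 2) ⊗ v 5F ⊗ (v 0F ⊗ v 0F) ⊗ (v 1F ⊗ v 1F) ⊖ v 7F ⊗ (v 0F ⊗ v 0F ⊕ v 1F ⊗ v 1F ⊗ (v 2F ⊗ v 2F)) ⊕ # (ℤ.+ 2) ⊗ v 6F ⊗ (v 2F ⊗ v 2F) ⊕ # (ℤ.+ 2) ⊗ v 3F ⊗ v 4F) ⊗ ((v 0F ⊕ v 1F ⊗ v 2F) ⊗ (v 0F ⊕ v 1F ⊗ v 2F)) ⊕ (# (ℤ.+ 2) ⊗ v 5F ⊗ (v 0F ⊗ v 0F) ⊗ (v 1F ⊗ v 1F) ⊖ v 7F ⊗ (v 0F ⊗ v 0F ⊕ v 1F ⊗ v 1F ⊗ (v 2F ⊗ v 2F)) ⊕ # (ℤ.+ 2) ⊗ v 6F ⊗ (v 2F ⊗ v 2F) ⊖ # (ℤ.+ 2) ⊗ v 3F ⊗ v 4F) ⊗ ((v 0F ⊖ v 1F ⊗ v 2F) ⊗ (v 0F ⊖ v 1F ⊗ v 2F))) (# (ℤ.+ 2) ⊗ (v 1F ⊗ v 3F ⊕ v 0F ⊗ v 2F ⊗ v 4F) ⊗ (# (ℤ.+ 2) ⊗ (v 1F ⊗ v 3F ⊕ v 0F ⊗ v 2F ⊗ v 4F)) ⊕ (# (ℤ.+ 0) ⊖ # (ℤ.+ 2) ⊗ v 7F) ⊗ ((v 0F ⊗ v 0F ⊖ v 1F ⊗ v 1F ⊗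 (v 2F ⊗ v 2F)) ⊗ (v 0F ⊗ v 0F ⊖ v 1F ⊗ v 1F ⊗ (v 2F ⊗ v 2F))) ⊕ (# (ℤ.+ 0) ⊖ # (ℤ.+ 4) ⊗ v 1F ⊗ v 1F) ⊗ (v 3F ⊗ v 3F ⊖ (v 5F ⊗ (v 0F ⊗ v 0F) ⊗ (v 0F ⊗ v 0F) ⊖ v 7F ⊗ (v 0F ⊗ v 0F) ⊗ (v 2F ⊗ v 2F) ⊕ v 6F ⊗ (v 2F ⊗ v 2F) ⊗ (v 2F ⊗ v 2F))) ⊕ (# (ℤ.+ 0) ⊖ # (ℤ.+ 4) ⊗ v 0F ⊗ v 0F ⊗ v 2F ⊗ v 2F) ⊗ (v 4F ⊗ v 4F ⊖ (v 5F ⊗ (v 1F ⊗ v 1F) ⊗ (v 1F ⊗ v 1F) ⊖ v 7F ⊗ (v 1F ⊗ v 1F) ⊕ v 6F))) refl (h ∷ h₀ ∷ q ∷ Y ∷ Y₀ ∷ s ∷ β ∷ α ∷ [])) (trans (𝒪I.vanish h₂) (𝒪I.vanish h₁))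

-- The value of the resistant class, the known point (h₀ , 1 , Y₀) of its torsor, the quotient of βI
-- by the class, and a square root of `twist` modulo 8.
translator h₀ Y₀ βₛ τ₀ : 𝒪
translator = ⟦ cls true false false false true true ⟧ᶜ
h₀ = ⟨ ℤ.+ 0 , ℤ.+ 1 , ℤ.+ 0 ⟩
Y₀ = ⟨ ℤ.+ 1 , ℤ.+ 0 , ℤ.+ 1 ⟩
βₛ = ⟨ ℤ.+ 12 , ℤ.+ 144 , ℤ.+ 48 ⟩
τ₀ = ⟨ ℤ.+ 6 , ℤ.+ 1 , ℤ.+ 3 ⟩

resistant-value : ∀ s → resistant s ≡ true → ⟦ s ⟧ᶜ ≡ translator
resistant-value (cls true false false false true true) _ = refl

quotient-form : 𝒪 → 𝒪 → 𝒪
quotient-form h q = translator * (h * h) * (h * h) - αI * (h * h) * (q * q) + βₛ * (q * q) * (q * q)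

-- The root W of the translated point after the scaling that makes q equal to 1, with Y = 2y; hence
-- the coefficient 4 in front of y Y₀.
shift-value : 𝒪 → 𝒪 → 𝒪 → 𝒪
shift-value h q y = (𝟚 * translator * (h * h) * (h₀ * h₀) - αI * (h * h + h₀ * h₀ * (q * q)) + 𝟚 * βₛ * (q * q) + 𝟜 * (y * Y₀)) * ((h + h₀ * q) * (h + h₀ * q))

-- For a residue r of h / q and a residue of y: either r is even, or the torsor equation fails
-- modulo 8, or r differs from h₀ modulo 2 and the translated root is not a square modulo 8. These
-- three outcomes are refuted separately in `absurd`.
translation? : 𝒪 → 𝒪 → Bool
translation? r y = div? 2 r ∨ (not (div? 8 (𝟜 * (y * y) - quotient-form r 𝟙)) ∨ (not (div? 2 (r - h₀)) ∧ all𝒪 4 λ w → not (div? 8 (shift-value r 𝟙 y - w * w))))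

opaque
  unfolding _+_ _*_ -_ N div? zero%?
  βₛ≡ : βI ≡ translator * βₛ
  βₛ≡ = refl
  base-on-quotient : Y₀ * Y₀ ≡ translator * (h₀ * h₀) * (h₀ * h₀) - αI * (h₀ * h₀) + βₛ
  base-on-quotient = refl
  b≡ₛ : bI ≡ αI * αI - 𝟜 * translator * βₛ
  b≡ₛ = refl
  odd-Y₀? : odd? Y₀ ≡ true
  odd-Y₀? = refl
  twist? : div? 8 (twist - τ₀ * τ₀) ≡ true
  twist? = refl
  translation-check : all𝒪 4 (λ r → all𝒪 2 λ y → translation? r y) ≡ true
  translation-check = refl

tr₁ : ∀ t s h q α β βₛ → t * t ≡ s * (s * s * (h * h * (h * h)) - α * s * (h * h) * (q * q) + β * (q * q * (q * q))) → β ≡ s * βₛ → t * t ≡ s * s * (s * (h * h) * (h * h) - α * (h * h) * (q * q) + βₛ * (q * q) * (q * q))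
tr₁ t s h q α β βₛ h₁ h₂ = trans (𝒪I.identity (v 0F ⊗ v 0F) (v 1F ⊗ v 1F ⊗ (v 1F ⊗ (v 2F ⊗ v 2F) ⊗ (v 2F ⊗ v 2F) ⊖ v 4F ⊗ (v 2F ⊗ v 2F) ⊗ (v 3F ⊗ v 3F) ⊕ v 6F ⊗ (v 3F ⊗ v 3F) ⊗ (v 3F ⊗ v 3F)) ⊕ # (ℤ.+ 1) ⊗ (v 0F ⊗ v 0F ⊖ v 1F ⊗ (v 1F ⊗ v 1F ⊗ (v 2F ⊗ v 2F ⊗ (v 2F ⊗ v 2F)) ⊖ v 4F ⊗ v 1F ⊗ (v 2F ⊗ v 2F) ⊗ (v 3F ⊗ v 3F) ⊕ v 5F ⊗ (v 3F ⊗ v 3F ⊗ (v 3F ⊗ v 3F)))) ⊕ v 1F ⊗ v 3F ⊗ v 3F ⊗ v 3F ⊗ v 3F ⊗ (v 5F ⊖ v 1F ⊗ v 6F)) refl (t ∷ s ∷ h ∷ q ∷ α ∷ β ∷ βₛ ∷ [])) (trans (𝒪I.vanish h₂) (𝒪I.vanish h₁))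
tr₂ : ∀ t s h q g α β X̄ Z → t * t ≡ s * (s * s * (h * h * (h * h)) - α * s * (h * h) * (q * q) + β * (q * q * (q * q))) → s * (h * g * (h * g)) * X̄ ≡ β * (q * g * (q * g) * (q * g * (q * g))) → s * (h * g * (h * g)) + X̄ ≡ Z * Z + α * (q * g * (q * g)) → t * (g * g) * (t * (g * g)) ≡ s * h * g * Z * (s * h * g * Z)
tr₂ t s h q g α β X̄ Z h₁ h₂ h₃ = trans (𝒪I.identity (v 0F ⊗ (v 4F ⊗ v 4F) ⊗ (v 0F ⊗ (v 4F ⊗ v 4F))) (v 1F ⊗ v 2F ⊗ v 4F ⊗ v 8F ⊗ (v 1F ⊗ v 2F ⊗ v 4F ⊗ v 8F) ⊕ v 4F ⊗ v 4F ⊗ v 4F ⊗ v 4F ⊗ (v 0F ⊗ v 0F ⊖ v 1F ⊗ (v 1F ⊗ v 1F ⊗ (v 2F ⊗ v 2F ⊗ (v 2F ⊗ v 2F)) ⊖ v 5F ⊗ v 1F ⊗ (v 2F ⊗ v 2F) ⊗ (v 3F ⊗ v 3F) ⊕ v 6F ⊗ (v 3F ⊗ v 3F ⊗ (v 3F ⊗ v 3F)))) ⊕ (# (ℤ.+ 0) ⊖ v 1F) ⊗ (v 1F ⊗ (v 2F ⊗ v 4F ⊗ (v 2F ⊗ v 4F)) ⊗ v 7F ⊖ v 6F ⊗ (v 3F ⊗ v 4F ⊗ (v 3F ⊗ v 4F) ⊗ (v 3F ⊗ v 4F ⊗ (v 3F ⊗ v 4F)))) ⊕ v 1F ⊗ v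 1F ⊗ v 2F ⊗ v 4F ⊗ v 2F ⊗ v 4F ⊗ (v 1F ⊗ (v 2F ⊗ v 4F ⊗ (v 2F ⊗ v 4F)) ⊕ v 7F ⊖ (v 8F ⊗ v 8F ⊕ v 5F ⊗ (v 3F ⊗ v 4F ⊗ (v 3F ⊗ v 4F))))) refl (t ∷ s ∷ h ∷ q ∷ g ∷ α ∷ β ∷ X̄ ∷ Z ∷ [])) (trans (𝒪I.vanish h₃) (trans (𝒪I.vanish h₂) (𝒪I.vanish h₁)))
tr₃ : ∀ x Z z → Z ≡ ι (ℤ.+ 2) * z → x * Z * (x * Z) ≡ ι (ℤ.+ 2) * (ι (ℤ.+ 2) * (x * z * (x * z)))
tr₃ x Z z h₁ = trans (𝒪I.identity (v 0F ⊗ v 1F ⊗ (v 0F ⊗ v 1F)) (# (ℤ.+ 2) ⊗ (# (ℤ.+ 2) ⊗ (v 0F ⊗ v 2F ⊗ (v 0F ⊗ v 2F))) ⊕ v 0F ⊗ v 0F ⊗ (v 1F ⊕ # (ℤ.+ 2) ⊗ v 2F) ⊗ (v 1F ⊖ # (ℤ.+ 2) ⊗ v 2F)) refl (x ∷ Z ∷ z ∷ [])) (𝒪I.vanish h₁)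
tr₄ : ∀ s t Y k → t ≡ s * Y → t ≡ ι (ℤ.+ 2) * k → s * Y ≡ ι (ℤ.+ 2) * k
tr₄ s t Y k h₁ h₂ = trans (𝒪I.identity (v 0F ⊗ v 2F) (# (ℤ.+ 2) ⊗ v 3F ⊕ (# (ℤ.+ 0) ⊖ # (ℤ.+ 1)) ⊗ (v 1F ⊖ v 0F ⊗ v 2F) ⊕ # (ℤ.+ 1) ⊗ (v 1F ⊖ # (ℤ.+ 2) ⊗ v 3F)) refl (s ∷ t ∷ Y ∷ k ∷ [])) (trans (𝒪I.vanish h₂) (𝒪I.vanish h₁))
tr₅ : ∀ i h q y s α β h₀ Y₀ → (ι (ℤ.+ 2) * s * (h * h) * (h₀ * h₀) - α * (h * h + h₀ * h₀ * (q * q)) + ι (ℤ.+ 2) * β * (q * q) + ι (ℤ.+ 2) * (ι (ℤ.+ 2) * y) * Y₀) * ((h + h₀ * q) * (h + h₀ * q)) * (i * i * (i * i)) ≡ (ι (ℤ.+ 2) * s * (i * h * (i * h)) * (h₀ * h₀) - α * (i * h * (i * h) + h₀ * h₀ * (i * q * (i * q))) + ι (ℤ.+ 2) * β * (i * q * (i * q)) + ι (ℤ.+ 4) * (i * i * y * Y₀)) * ((i * h + h₀ * (i * q)) * (i * h + h₀ * (i * q)))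
tr₅ i h q y s α β h₀ Y₀ = 𝒪I.identity ((# (ℤ.+ 2) ⊗ v 4F ⊗ (v 1F ⊗ v 1F) ⊗ (v 7F ⊗ v 7F) ⊖ v 5F ⊗ (v 1F ⊗ v 1F ⊕ v 7F ⊗ v 7F ⊗ (v 2F ⊗ v 2F)) ⊕ # (ℤ.+ 2) ⊗ v 6F ⊗ (v 2F ⊗ v 2F) ⊕ # (ℤ.+ 2) ⊗ (# (ℤ.+ 2) ⊗ v 3F) ⊗ v 8F) ⊗ ((v 1F ⊕ v 7F ⊗ v 2F) ⊗ (v 1F ⊕ v 7F ⊗ v 2F)) ⊗ (v 0F ⊗ v 0F ⊗ (v 0F ⊗ v 0F))) ((# (ℤ.+ 2) ⊗ v 4F ⊗ (v 0F ⊗ v 1F ⊗ (v 0F ⊗ v 1F)) ⊗ (v 7F ⊗ v 7F) ⊖ v 5F ⊗ (v 0F ⊗ v 1F ⊗ (v 0F ⊗ v 1F) ⊕ v 7F ⊗ v 7F ⊗ (v 0F ⊗ v 2F ⊗ (v 0F ⊗ v 2F))) ⊕ # (ℤ.+ 2) ⊗ v 6F ⊗ (v 0F ⊗ v 2F ⊗ (v 0F ⊗ v 2F)) ⊕ # (ℤ.+ 4) ⊗ (v 0F ⊗ v 0F ⊗ v 3F ⊗ v 8F)) ⊗ ((v 0F ⊗ v 1F ⊕ v 7F ⊗ (v 0F ⊗ v 2F)) ⊗ (v 0F ⊗ v 1F ⊕ v 7F ⊗ (v 0F ⊗ v 2F)))) refl (i ∷ h ∷ q ∷ y ∷ s ∷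 α ∷ β ∷ h₀ ∷ Y₀ ∷ [])
tr₆ : ∀ i h q y s α β → ι (ℤ.+ 2) * y * (ι (ℤ.+ 2) * y) ≡ s * (h * h) * (h * h) - α * (h * h) * (q * q) + β * (q * q) * (q * q) → ι (ℤ.+ 4) * (i * i * y * (i * i * y)) ≡ s * (i * h * (i * h)) * (i * h * (i * h)) - α * (i * h * (i * h)) * (i * q * (i * q)) + β * (i * q * (i * q)) * (i * q * (i * q))
tr₆ i h q y s α β h₁ = trans (𝒪I.identity (# (ℤ.+ 4) ⊗ (v 0F ⊗ v 0F ⊗ v 3F ⊗ (v 0F ⊗ v 0F ⊗ v 3F))) (v 4F ⊗ (v 0F ⊗ v 1F ⊗ (v 0F ⊗ v 1F)) ⊗ (v 0F ⊗ v 1F ⊗ (v 0F ⊗ v 1F)) ⊖ v 5F ⊗ (v 0F ⊗ v 1F ⊗ (v 0F ⊗ v 1F)) ⊗ (v 0F ⊗ v 2F ⊗ (v 0F ⊗ v 2F)) ⊕ v 6F ⊗ (v 0F ⊗ v 2F ⊗ (v 0F ⊗ v 2F)) ⊗ (v 0F ⊗ v 2F ⊗ (v 0F ⊗ v 2F)) ⊕ v 0F ⊗ v 0F ⊗ v 0F ⊗ v 0F ⊗ (# (ℤ.+ 2) ⊗ v 3F ⊗ (# (ℤ.+ 2) ⊗ v 3F) ⊖ (v 4F ⊗ (v 1F ⊗ v 1F) ⊗ (v 1F ⊗ v 1F) ⊖ v 5F ⊗ (v 1F ⊗ v 1F) ⊗ (v 2F ⊗ v 2F) ⊕ v 6F ⊗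 (v 2F ⊗ v 2F) ⊗ (v 2F ⊗ v 2F)))) refl (i ∷ h ∷ q ∷ y ∷ s ∷ α ∷ β ∷ [])) (𝒪I.vanish h₁)
tr₇ : ∀ h h₀ q k → h * h - h₀ * h₀ * (q * q) ≡ ι (ℤ.+ 2) * k → h * h ≡ h₀ * q * (h₀ * q) + ι (ℤ.+ 2) * k
tr₇ h h₀ q k h₁ = trans (𝒪I.identity (v 0F ⊗ v 0F) (v 1F ⊗ v 2F ⊗ (v 1F ⊗ v 2F) ⊕ # (ℤ.+ 2) ⊗ v 3F ⊕ # (ℤ.+ 1) ⊗ (v 0F ⊗ v 0F ⊖ v 1F ⊗ v 1F ⊗ (v 2F ⊗ v 2F) ⊖ # (ℤ.+ 2) ⊗ v 3F)) refl (h ∷ h₀ ∷ q ∷ k ∷ [])) (𝒪I.vanish h₁)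
tr₈ : ∀ i h₀ q → i * (h₀ * q) ≡ h₀ * (i * q)
tr₈ i h₀ q = 𝒪I.identity (v 0F ⊗ (v 1F ⊗ v 2F)) (v 1F ⊗ (v 0F ⊗ v 2F)) refl (i ∷ h₀ ∷ q ∷ [])
tr₉ : ∀ W W̄ f α β b G → W * W̄ ≡ b * (G * G * (G * G)) → W + W̄ ≡ ι (ℤ.+ 2) * f * (ι (ℤ.+ 2) * f) + (ι (ℤ.+ 0) - ι (ℤ.+ 2) * α) * (G * G) → b ≡ α * α - ι (ℤ.+ 4) * β → (W + α * (G * G)) * (W + α * (G * G)) ≡ ι (ℤ.+ 4) * (f * f * W + β * (G * G * (G * G)))
tr₉ W W̄ f α β b G h₁ h₂ h₃ = trans (𝒪I.identity ((v 0F ⊕ v 3F ⊗ (v 6F ⊗ v 6F)) ⊗ (v 0F ⊕ v 3F ⊗ (v 6F ⊗ v 6F))) (# (ℤ.+ 4) ⊗ (v 2F ⊗ v 2F ⊗ v 0F ⊕ v 4F ⊗ (v 6F ⊗ v 6F ⊗ (v 6F ⊗ v 6F))) ⊕ (# (ℤ.+ 0) ⊖ # (ℤ.+ 1)) ⊗ (v 0F ⊗ v 1F ⊖ v 5F ⊗ (v 6F ⊗ v 6F ⊗ (v 6F ⊗ v 6F))) ⊕ v 0F ⊗ (v 0F ⊕ v 1F ⊖ (# (ℤ.+ 2) ⊗ v 2F ⊗ (# (ℤ.+ 2) ⊗ v 2F) ⊕ (# (ℤ.+ 0) ⊖ # (ℤ.+ 2) ⊗ v 3F) ⊗ (v 6F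 ⊗ v 6F))) ⊕ (# (ℤ.+ 0) ⊖ v 6F ⊗ v 6F ⊗ v 6F ⊗ v 6F) ⊗ (v 5F ⊖ (v 3F ⊗ v 3F ⊖ # (ℤ.+ 4) ⊗ v 4F))) refl (W ∷ W̄ ∷ f ∷ α ∷ β ∷ b ∷ G ∷ [])) (trans (𝒪I.vanish h₃) (trans (𝒪I.vanish h₂) (𝒪I.vanish h₁)))
tr₁₀ : ∀ x → ι (ℤ.+ 4) * x ≡ ι (ℤ.+ 2) * (ι (ℤ.+ 2) * x)
tr₁₀ x = 𝒪I.identity (# (ℤ.+ 4) ⊗ v 0F) (# (ℤ.+ 2) ⊗ (# (ℤ.+ 2) ⊗ v 0F)) refl (x ∷ [])
tr₁₁ : ∀ S n x → S * S ≡ ι (ℤ.+ 4) * x → S ≡ ι (ℤ.+ 2) * n → ι (ℤ.+ 4) * (n * n) ≡ ι (ℤ.+ 4) * x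
tr₁₁ S n x h₁ h₂ = trans (𝒪I.identity (# (ℤ.+ 4) ⊗ (v 1F ⊗ v 1F)) (# (ℤ.+ 4) ⊗ v 2F ⊕ # (ℤ.+ 1) ⊗ (v 0F ⊗ v 0F ⊖ # (ℤ.+ 4) ⊗ v 2F) ⊕ (# (ℤ.+ 0) ⊖ v 0F ⊖ # (ℤ.+ 2) ⊗ v 1F) ⊗ (v 0F ⊖ # (ℤ.+ 2) ⊗ v 1F)) refl (S ∷ n ∷ x ∷ [])) (trans (𝒪I.vanish h₂) (𝒪I.vanish h₁))
tr₁₂ : ∀ i f n W β β₄ G → n * n ≡ f * f * W + β * (G * G * (G * G)) → β ≡ ι (ℤ.+ 4) * β₄ → i * n * (i * n) ≡ i * f * (i * f) * W + ι (ℤ.+ 4) * (i * i * β₄ * (G * G * (G * G)))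
tr₁₂ i f n W β β₄ G h₁ h₂ = trans (𝒪I.identity (v 0F ⊗ v 2F ⊗ (v 0F ⊗ v 2F)) (v 0F ⊗ v 1F ⊗ (v 0F ⊗ v 1F) ⊗ v 3F ⊕ # (ℤ.+ 4) ⊗ (v 0F ⊗ v 0F ⊗ v 5F ⊗ (v 6F ⊗ v 6F ⊗ (v 6F ⊗ v 6F))) ⊕ v 0F ⊗ v 0F ⊗ (v 2F ⊗ v 2F ⊖ (v 1F ⊗ v 1F ⊗ v 3F ⊕ v 4F ⊗ (v 6F ⊗ v 6F ⊗ (v 6F ⊗ v 6F)))) ⊕ v 0F ⊗ v 0F ⊗ v 6F ⊗ v 6F ⊗ v 6F ⊗ v 6F ⊗ (v 4F ⊖ # (ℤ.+ 4) ⊗ v 5F)) refl (i ∷ f ∷ n ∷ W ∷ β ∷ β₄ ∷ G ∷ [])) (trans (𝒪I.vanish h₂) (𝒪I.vanish h₁))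
tr₁₃ : ∀ W → ι (ℤ.+ 1) * ι (ℤ.+ 1) * W ≡ W
tr₁₃ W = 𝒪I.identity (# (ℤ.+ 1) ⊗ # (ℤ.+ 1) ⊗ v 0F) (v 0F) refl (W ∷ [])
tr₁₄ : ∀ w → w * w ≡ ι (ℤ.+ 1) * (w * w)
tr₁₄ w = 𝒪I.identity (v 0F ⊗ v 0F) (# (ℤ.+ 1) ⊗ (v 0F ⊗ v 0F)) refl (w ∷ [])
tr₁₅ : ∀ y i → y * y * (i * i * (i * i)) ≡ i * i * y * (i * i * y)
tr₁₅ y i = 𝒪I.identity (v 0F ⊗ v 0F ⊗ (v 1F ⊗ v 1F ⊗ (v 1F ⊗ v 1F))) (v 1F ⊗ v 1F ⊗ v 0F ⊗ (v 1F ⊗ v 1F ⊗ v 0F)) refl (y ∷ i ∷ [])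
tr₁₆ : ∀ τ y i → τ * τ * (y * y) * (i * i * (i * i)) ≡ i * i * (τ * y) * (i * i * (τ * y))
tr₁₆ τ y i = 𝒪I.identity (v 0F ⊗ v 0F ⊗ (v 1F ⊗ v 1F) ⊗ (v 2F ⊗ v 2F ⊗ (v 2F ⊗ v 2F))) (v 2F ⊗ v 2F ⊗ (v 0F ⊗ v 1F) ⊗ (v 2F ⊗ v 2F ⊗ (v 0F ⊗ v 1F))) refl (τ ∷ y ∷ i ∷ [])
tr₁₇ : ∀ h₀ y x → x ≡ h₀ * (ι (ℤ.+ 2) * y) + x + ι (ℤ.+ 2) * (ι (ℤ.+ 0) - h₀ * y)
tr₁₇ h₀ y x = 𝒪I.identity (v 2F) (v 0F ⊗ (# (ℤ.+ 2) ⊗ v 1F) ⊕ v 2F ⊕ # (ℤ.+ 2) ⊗ (# (ℤ.+ 0) ⊖ v 0F ⊗ v 1F)) refl (h₀ ∷ y ∷ x ∷ [])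

-- The class itself passes the sieve, so the point is moved by the known point of its torsor. The
-- translate lies on the dual curve, where the sieve leaves only classes that are squares modulo 8,
-- whereas a finite check shows that its root is no square modulo 8.
module Translation {X g h q g′ t : 𝒪} (oX : Odd X) (og : Odd g) (d : Datum αI βI X g) (even-Z : 𝟚 ∣𝒪 Datum.Z d)
  (X≡ : X ≡ translator * (h * g′ * (h * g′))) (g≡ : g ≡ q * g′) (on-quartic : t * t ≡ quartic αI βI translator h q) where

  open Datum d

  oX′ = subst Odd X≡ oX
  os : Odd translator
  os = odd-*ˡ oX′
  oh : Odd h
  oh = odd-*ˡ (odd-*ˡ (odd-*ʳ oX′))
  og′ : Odd g′
  og′ = odd-*ʳ (odd-*ˡ (odd-*ʳ oX′))
  oq : Odd q
  oq = odd-*ˡ (subst Odd g≡ og)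

  -- The squares of t g′² and of s h g′ Z agree, so an even Z forces an even t.
  even-t : 𝟚 ∣𝒪 t
  even-t = euclid (cop-sym (odd-* og′ og′)) (subst (𝟚 ∣𝒪_) (*-swap t (g′ * g′)) (even-sq (_ ,
    trans (tr₂ t translator h q g′ αI βI X̄ Z on-quartic (subst₂ (λ x y → x * X̄ ≡ βI * (y * y * (y * y))) X≡ g≡ product) (subst₂ (λ x y → x + X̄ ≡ Z * Z + αI * (y * y)) X≡ g≡ sum))
      (tr₃ (translator * h * g′) Z (proj₁ even-Z) (proj₂ even-Z)))))

  module _ (y : 𝒪) (on-quotient : 𝟚 * y * (𝟚 * y) ≡ quotient-form h q) (i : 𝒪) (iq≈ : i * q ≈ 𝟙 [ 𝟠 ])
    (r : 𝒪) (ih≈ : i * h ≈ r [ 𝟜 ]) (y′ : 𝒪) (iiy≈ : i * i * y ≈ y′ [ 𝟚 ]) where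

    oi : Odd i
    oi = odd-*ˡ (≈𝟙⇒odd (8⇒2 iq≈))

    ih²≈ : i * h * (i * h) ≈ r * r [ 𝟠 ]
    ih²≈ = ²-4⇒8 ih≈

    iq²≈ : i * q * (i * q) ≈ 𝟙 * 𝟙 [ 𝟠 ]
    iq²≈ = ≈-* iq≈ iq≈

    quotient≈ : 𝟜 * (y′ * y′) ≈ quotient-form r 𝟙 [ 𝟠 ]
    quotient≈ = ≈-trans (≈-sym (4*-2⇒8 (≈-* iiy≈ iiy≈))) (≈-trans (≡⇒≈ (tr₆ i h q y translator αI βₛ on-quotient))
      (≈-+ (≈-- (≈-* (≈-* ≈-refl ih²≈) ih²≈) (≈-* (≈-* ≈-refl ih²≈) iq²≈)) (≈-* (≈-* ≈-refl iq²≈) iq²≈)))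

    W W̄ f G : 𝒪
    W = (𝟚 * translator * (h * h) * (h₀ * h₀) - αI * (h * h + h₀ * h₀ * (q * q)) + 𝟚 * βₛ * (q * q) + 𝟚 * (𝟚 * y) * Y₀) * ((h + h₀ * q) * (h + h₀ * q))
    W̄ = (𝟚 * translator * (h * h) * (h₀ * h₀) - αI * (h * h + h₀ * h₀ * (q * q)) + 𝟚 * βₛ * (q * q) - 𝟚 * (𝟚 * y) * Y₀) * ((h - h₀ * q) * (h - h₀ * q))
    f = h₀ * (𝟚 * y) + h * q * Y₀
    G = h * h - h₀ * h₀ * (q * q)

    W≈ : W * (i * i * (i * i)) ≈ shift-value r 𝟙 y′ [ 𝟠 ]
    W≈ = ≈-trans (≡⇒≈ (tr₅ i h q y translator αI βₛ h₀ Y₀))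
      (≈-* (≈-+ (≈-+ (≈-- (≈-* (≈-* ≈-refl ih²≈) ≈-refl) (≈-* ≈-refl (≈-+ ih²≈ (≈-* ≈-refl iq²≈)))) (≈-* ≈-refl iq²≈)) (4*-2⇒8 (≈-* iiy≈ ≈-refl)))
        (²-4⇒8 (≈-+ ih≈ (≈-* ≈-refl (8⇒4 iq≈)))))

    W*W̄ : W * W̄ ≡ bI * (G * G * (G * G))
    W*W̄ = translated-product h h₀ q (𝟚 * y) Y₀ translator βₛ αI bI on-quotient base-on-quotient b≡ₛ
    W+W̄ : W + W̄ ≡ 𝟚 * f * (𝟚 * f) + (𝟘 - 𝟚 * αI) * (G * G)
    W+W̄ = translated-sum h h₀ q (𝟚 * y) Y₀ translator βₛ αI on-quotient base-on-quotient

    contradiction : not (div? 2 (r - h₀)) ≡ true → all𝒪 4 (λ w → not (div? 8 (shift-value r 𝟙 y′ - w * w))) ≡ true → ⊥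
    contradiction far nonsquare = at (normal-form smooth-bI (odd≢𝟘 oW) (odd≢𝟘 oG) (datum W̄ (𝟚 * f) W*W̄ W+W̄))
      where
      not-square : ∀ w → shift-value r 𝟙 y′ ≈ w * w [ 𝟠 ] → ⊥
      not-square w e = go (all𝒪-sound 4 (λ w → not (div? 8 (shift-value r 𝟙 y′ - w * w))) nonsquare w)
        where
        go : (∃ λ z → w ≈ z [ 𝟜 ] × not (div? 8 (shift-value r 𝟙 y′ - z * z)) ≡ true) → ⊥
        go (z , w≈ , n) = not-true (div?-complete 8 (≈⇒∣- (≈-trans e (²-4⇒8 w≈)))) n
      -- An even denominator would give h ≡ h₀q modulo 2, against the assumption that r and h₀
      -- differ there.
      oG : Odd G
      oG = go (parity G)
        where
        go : 𝟚 ∣𝒪 G ⊎ Odd G → Odd G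
        go (inj₂ o) = o
        go (inj₁ (k , e)) = ⊥-elim (not-true (div?-complete 2 (≈⇒∣- (≈-trans (≈-sym (4⇒2 ih≈)) (≈-trans (≈-* ≈-refl (√-≈2 (by k (tr₇ h h₀ q k e))))
          (≈-trans (≡⇒≈ (tr₈ i h₀ q)) (≈-trans (≈-* ≈-refl (8⇒2 iq≈)) (≡⇒≈ (x*𝟙 h₀)))))))) far)
      ob : Odd bI
      ob = odd-≈ (by _ (odd-b βI (αI * αI) bI b≡I)) (odd-* (odd?-sound αI odd-α?I) (odd?-sound αI odd-α?I))
        where
        odd-b : ∀ β x b → b ≡ x - ι (ℤ.+ 4) * β → x ≡ b + ι (ℤ.+ 2) * (ι (ℤ.+ 2) * β)
        odd-b β x b h₁ = trans (𝒪I.identity (v 1F) (v 2F ⊕ # (ℤ.+ 2) ⊗ (# (ℤ.+ 2) ⊗ v 0F) ⊕ (# (ℤ.+ 0) ⊖ # (ℤ.+ 1)) ⊗ (v 2F ⊖ (v 1F ⊖ # (ℤ.+ 4) ⊗ v 0F))) refl (β ∷ x ∷ b ∷ [])) (𝒪I.vanish h₁)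
      oW : Odd W
      oW = odd-*ˡ (subst Odd (sym W*W̄) (odd-* ob (odd-* (odd-* oG oG) (odd-* oG oG))))
      of : Odd f
      of = odd-≈ (by _ (tr₁₇ h₀ y (h * q * Y₀))) (odd-* (odd-* oh oq) (odd?-sound Y₀ odd-Y₀?))
      S²≡ = tr₉ W W̄ f αI βI bI G W*W̄ W+W̄ b≡I
      -- From (W + αG²)² = 4 (f²W + βG⁴) the bracket on the right is a square; 4 divides β and f is
      -- odd, so W is a square modulo 4.
      square-mod-4 : ∃ λ w → W ≈ 𝟙 * (w * w) [ 𝟜 ]
      square-mod-4 = go (even-sq (_ , trans S²≡ (tr₁₀ (f * f * W + βI * (G * G * (G * G)))))) (odd-inverse of)
        where
        go : 𝟚 ∣𝒪 (W + αI * (G * G)) → (∃ λ j → j * f ≈ 𝟙 [ 𝟠 ]) → ∃ λ w → W ≈ 𝟙 * (w * w) [ 𝟜 ]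
        go (n , e) (j , jf≈) = j * n , ≈-sym (≈-trans (≡⇒≈ (sym (tr₁₄ (j * n)))) (≈-trans (by _ (tr₁₂ j f n W βI β₄I G (*-cancelˡ (ι≢𝟘 3) (tr₁₁ _ n _ S²≡ e)) β≡I))
          (≈-trans (≈-* (≈-* (8⇒4 jf≈) (8⇒4 jf≈)) ≈-refl) (≡⇒≈ (tr₁₃ W)))))
      at : NormalForm (𝟘 - 𝟚 * αI) bI W G → ⊥
      at nf = go (trivial-or-twist-square (NormalForm.class nf) (sieve trivial-or-twist (excludes₄ 𝟙) sieve-translate nf λ e → excludes₄-sound 𝟙 _ e
          (class₄ (NormalForm.X≡ nf) oW (proj₂ square-mod-4))) (NormalForm.X≡ nf))
        where
        z = NormalForm.h nf * NormalForm.g′ nf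
        go : W ≡ z * z ⊎ W ≡ twist * (z * z) → ⊥
        go (inj₁ e) = not-square (i * i * z) (≈-trans (≈-sym W≈) (≡⇒≈ (trans (cong (λ w → w * (i * i * (i * i))) e) (tr₁₅ z i))))
        -- The class `twist` is τ₀² modulo 8, so it too would make the translated root a square
        -- modulo 8.
        go (inj₂ e) = not-square (i * i * (τ₀ * z)) (≈-trans (≈-sym W≈) (≈-trans (≡⇒≈ (cong (λ w → w * (i * i * (i * i))) e))
          (≈-trans (≈-* (≈-* (≈?-sound 8 twist (τ₀ * τ₀) twist?) ≈-refl) ≈-refl) (≡⇒≈ (tr₁₆ τ₀ z i)))))

    absurd : translation? r y′ ≡ true → ⊥
    absurd = ∨-case (div? 2 r) _ (λ e → even-odd (div?-sound 2 r e) (odd-≈ (4⇒2 ih≈) (odd-* oi oh)))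
      (∨-case (not (div? 8 (𝟜 * (y′ * y′) - quotient-form r 𝟙))) _ (not-true (div?-complete 8 (≈⇒∣- quotient≈)))
        (λ e → let p = ∧-split (not (div? 2 (r - h₀))) (all𝒪 4 λ w → not (div? 8 (shift-value r 𝟙 y′ - w * w))) e in contradiction (proj₁ p) (proj₂ p)))

  impossible : ⊥
  impossible = on (sq-quotient (odd≢𝟘 os) (tr₁ t translator h q αI βI βₛ on-quartic βₛ≡)) even-t (odd-inverse oq)
    where
    on : (∃ λ Y → t ≡ translator * Y × quotient-form h q ≡ Y * Y) → 𝟚 ∣𝒪 t → (∃ λ i → i * q ≈ 𝟙 [ 𝟠 ]) → ⊥
    on (Y , t≡ , Q≡) (k , t≡2k) (i , iq≈) = halve (euclid (cop-sym os) (k , tr₄ translator t Y k t≡ t≡2k))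
      where
      halve : 𝟚 ∣𝒪 Y → ⊥
      halve (y , Y≡) = first (all𝒪-sound 4 (λ r → all𝒪 2 λ y → translation? r y) translation-check (i * h))
        where
        first : (∃ λ r → i * h ≈ r [ 𝟜 ] × all𝒪 2 (λ y → translation? r y) ≡ true) → ⊥
        first (r , ih≈ , c) = second (all𝒪-sound 2 (λ y → translation? r y) c (i * i * y))
          where
          second : (∃ λ y′ → i * i * y ≈ y′ [ 𝟚 ] × translation? r y′ ≡ true) → ⊥
          second (y′ , iiy≈ , e) = absurd y (trans (sym (cong (λ Y → Y * Y) Y≡)) (sym Q≡)) i iq≈ r ih≈ y′ iiy≈ e

resistant-⊥ : ∀ {X g} → Odd X → Odd g → (d : Datum αI βI X g) → 𝟚 ∣𝒪 Datum.Z d → (nf : NormalForm αI βI X g) → resistant (NormalForm.class nf) ≡ true → ⊥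
resistant-⊥ {X} {g} oX og d even-Z nf e = Translation.impossible oX og d even-Z
  (trans (NormalForm.X≡ nf) (cong (λ s → s * (NormalForm.h nf * NormalForm.g′ nf * (NormalForm.h nf * NormalForm.g′ nf))) value)) (NormalForm.g≡ nf)
  (trans (NormalForm.on-quartic nf) (cong (λ s → quartic αI βI s (NormalForm.h nf) (NormalForm.q nf)) value))
  where
  value = resistant-value (NormalForm.class nf) e

module DI = Descent αI βI bI β₄I rI b≡I β≡I b≡twistI (odd?-sound αI odd-α?I) smooth-βI smooth-bI resistant resistant-⊥ sieve-αI sieve-dualI sieve-twistI

-- The second and third curves.

αII βII bII β₄II rII : 𝒪
αII = ⟨ ℤ.+ 0 , ℤ.+ 24 , ℤ.+ 9 ⟩
βII = ⟨ ℤ.+ 36 , ℤ.+ 456 , ℤ.+ 144 ⟩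
bII = ⟨ ℤ.+ 45 , -[1+ 14 ] , ℤ.+ 0 ⟩
β₄II = ⟨ ℤ.+ 9 , ℤ.+ 114 , ℤ.+ 36 ⟩
rII = ⟨ ℤ.+ 5 , -[1+ 1 ] , ℤ.+ 3 ⟩

opaque
  unfolding _+_ _*_ -_ N div? zero%? dead?
  b≡II : bII ≡ αII * αII - 𝟜 * βII
  b≡II = refl
  β≡II : βII ≡ 𝟜 * β₄II
  β≡II = refl
  b≡twistII : bII ≡ twist * (rII * rII)
  b≡twistII = refl
  odd-α?II : odd? αII ≡ true
  odd-α?II = refl
  norm-βII : ι (N βII) ≡ ι (ℤ.+ 1) * (power 𝟚 6 * power (ι (ℤ.+ 3)) 3 * power (ι (ℤ.+ 5)) 3)
  norm-βII = refl
  norm-bII : ι (N bII) ≡ -𝟙 * (power 𝟚 0 * power (ι (ℤ.+ 3)) 3 * power (ι (ℤ.+ 5)) 3)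
  norm-bII = refl
  sieve-αII : sieve? αII βII trivial-class (excludes₈ 𝟘) ≡ true
  sieve-αII = refl
  sieve-dualII : sieve? (𝟘 - 𝟚 * αII) bII trivial-or-twist (excludes₈ 𝟘) ≡ true
  sieve-dualII = refl
  sieve-twistII : sieve? αII βII none (excludes₄ αII) ≡ true
  sieve-twistII = refl
  
  

smooth-βII : Smooth βII
smooth-βII = smooth-by-norm βII 6 3 3 norm-βII (*-identityˡ 𝟙)
smooth-bII : Smooth bII
smooth-bII = smooth-by-norm bII 0 3 3 norm-bII -𝟙*-𝟙

module DII = Descent αII βII bII β₄II rII b≡II β≡II b≡twistII (odd?-sound αII odd-α?II) smooth-βII smooth-bII none (λ _ _ _ _ _ ()) sieve-αII sieve-dualII sieve-twistII

-- The roles of θ and θ₂ are exchanged: here ρ = θ₂ and σ = θ, with class pair (-ε , ρ₅).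
αIII βIII bIII β₄III rIII : 𝒪
αIII = ⟨ -[1+ 2 ] , ℤ.+ 9 , ℤ.+ 15 ⟩
βIII = ⟨ -[1+ 83 ] , ℤ.+ 96 , ℤ.+ 24 ⟩
bIII = ⟨ -[1+ 59 ] , ℤ.+ 30 , -[1+ 104 ] ⟩
β₄III = ⟨ -[1+ 20 ] , ℤ.+ 24 , ℤ.+ 6 ⟩
rIII = ⟨ -[1+ 15 ] , ℤ.+ 5 , ℤ.+ 2 ⟩

opaque
  unfolding _+_ _*_ -_ N div? zero%? dead?
  b≡III : bIII ≡ αIII * αIII - 𝟜 * βIII
  b≡III = refl
  β≡III : βIII ≡ 𝟜 * β₄III
  β≡III = refl
  b≡twistIII : bIII ≡ twist * (rIII * rIII)
  b≡twistIII = refl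
  odd-α?III : odd? αIII ≡ true
  odd-α?III = refl
  norm-βIII : ι (N βIII) ≡ ι (ℤ.+ 1) * (power 𝟚 6 * power (ι (ℤ.+ 3)) 5 * power (ι (ℤ.+ 5)) 3)
  norm-βIII = refl
  norm-bIII : ι (N bIII) ≡ -𝟙 * (power 𝟚 0 * power (ι (ℤ.+ 3)) 5 * power (ι (ℤ.+ 5)) 3)
  norm-bIII = refl
  sieve-αIII : sieve? αIII βIII trivial-class (excludes₈ 𝟘) ≡ true
  sieve-αIII = refl
  sieve-dualIII : sieve? (𝟘 - 𝟚 * αIII) bIII trivial-or-twist (excludes₈ 𝟘) ≡ true
  sieve-dualIII = refl
  sieve-twistIII : sieve? αIII βIII none (excludes₄ αIII) ≡ true
  sieve-twistIII = refl
  
  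

smooth-βIII : Smooth βIII
smooth-βIII = smooth-by-norm βIII 6 5 3 norm-βIII (*-identityˡ 𝟙)
smooth-bIII : Smooth bIII
smooth-bIII = smooth-by-norm bIII 0 5 3 norm-bIII -𝟙*-𝟙

module DIII = Descent αIII βIII bIII β₄III rIII b≡III β≡III b≡twistIII (odd?-sound αIII odd-α?III) smooth-βIII smooth-bIII none (λ _ _ _ _ _ ()) sieve-αIII sieve-dualIII sieve-twistIII

-- Base points and the ratios that they determine.

θ₂ : 𝒪
θ₂ = ⟨ ℤ.+ 1 , -[1+ 0 ] , -[1+ 0 ] ⟩

opaque
  unfolding _+_ _*_ -_ _♯ Tr⟨_,_⟩
  trace-θ : Tr⟨ 𝟙 , θ ⟩ ≡ 𝟘 - θ
  trace-θ = refl
  trace-θ₂ : Tr⟨ 𝟙 , θ₂ ⟩ ≡ 𝟘 - θ₂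
  trace-θ₂ = refl

lift-determinant : ∀ u w u₀ w₀ u₁ w₁ a b e → u ≡ u₁ ℤ.+ ℤ.+ 8 ℤ.* a → w ≡ w₁ ℤ.+ ℤ.+ 8 ℤ.* b → u₁ ℤ.* w₀ ℤ.- u₀ ℤ.* w₁ ≡ ℤ.+ 4 ℤ.* e → u ℤ.* w₀ ℤ.- u₀ ℤ.* w ≡ ℤ.+ 4 ℤ.* (e ℤ.+ ℤ.+ 2 ℤ.* (a ℤ.* w₀ ℤ.- u₀ ℤ.* b))
lift-determinant u w u₀ w₀ u₁ w₁ a b e h₁ h₂ h₃ = trans (ℤI.identity (v 0F ⊗ v 3F ⊖ v 2F ⊗ v 1F) (# (ℤ.+ 4) ⊗ (v 8F ⊕ # (ℤ.+ 2) ⊗ (v 6F ⊗ v 3F ⊖ v 2F ⊗ v 7F)) ⊕ v 3F ⊗ (v 0F ⊖ (v 4F ⊕ # (ℤ.+ 8) ⊗ v 6F)) ⊕ (# (ℤ.+ 0) ⊖ v 2F) ⊗ (v 1F ⊖ (v 5F ⊕ # (ℤ.+ 8) ⊗ v 7F)) ⊕ # (ℤ.+ 1) ⊗ (v 4F ⊗ v 3F ⊖ v 2F ⊗ v 5F ⊖ # (ℤ.+ 4) ⊗ v 8F)) refl (u ∷ w ∷ u₀ ∷ w₀ ∷ u₁ ∷ w₁ ∷ a ∷ b ∷ e ∷ [])) (trans (ℤI.vanish {ℤ.+ 4 ℤ.* (e ℤ.+ ℤ.+ 2 ℤ.* (a ℤ.* w₀ ℤ.- u₀ ℤ.* b)) ℤ.+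 w₀ ℤ.* (u ℤ.- (u₁ ℤ.+ ℤ.+ 8 ℤ.* a)) ℤ.+ (ℤ.+ 0 ℤ.- u₀) ℤ.* (w ℤ.- (w₁ ℤ.+ ℤ.+ 8 ℤ.* b))} {ℤ.+ 1} h₃) (trans (ℤI.vanish {ℤ.+ 4 ℤ.* (e ℤ.+ ℤ.+ 2 ℤ.* (a ℤ.* w₀ ℤ.- u₀ ℤ.* b)) ℤ.+ w₀ ℤ.* (u ℤ.- (u₁ ℤ.+ ℤ.+ 8 ℤ.* a))} {ℤ.+ 0 ℤ.- u₀} h₂) (ℤI.vanish {ℤ.+ 4 ℤ.* (e ℤ.+ ℤ.+ 2 ℤ.* (a ℤ.* w₀ ℤ.- u₀ ℤ.* b))} {w₀} h₁)))
double : ∀ e f a → e ≡ ℤ.+ 2 ℤ.* f → e ℤ.+ ℤ.+ 2 ℤ.* a ≡ ℤ.+ 2 ℤ.* (f ℤ.+ a)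
double e f a h₁ = trans (ℤI.identity (v 0F ⊕ # (ℤ.+ 2) ⊗ v 2F) (# (ℤ.+ 2) ⊗ (v 1F ⊕ v 2F) ⊕ # (ℤ.+ 1) ⊗ (v 0F ⊖ # (ℤ.+ 2) ⊗ v 1F)) refl (e ∷ f ∷ a ∷ [])) (ℤI.vanish {ℤ.+ 2 ℤ.* (f ℤ.+ a)} {ℤ.+ 1} h₁)
vanishing : ∀ x y n → x ℤ.- y ≡ ℤ.+ 4 ℤ.* (ℤ.+ 2 ℤ.* n) → n ≡ ℤ.+ 0 → x ≡ y
vanishing x y n h₁ h₂ = trans (ℤI.identity (v 0F) (v 1F ⊕ # (ℤ.+ 1) ⊗ (v 0F ⊖ v 1F ⊖ # (ℤ.+ 4) ⊗ (# (ℤ.+ 2) ⊗ v 2F)) ⊕ # (ℤ.+ 8) ⊗ (v 2F ⊖ # (ℤ.+ 0))) refl (x ∷ y ∷ n ∷ [])) (trans (ℤI.vanish {y ℤ.+ ℤ.+ 1 ℤ.* (x ℤ.- y ℤ.- ℤ.+ 4 ℤ.* (ℤ.+ 2 ℤ.* n))} {ℤ.+ 8} h₂) (ℤI.vanish {y} {ℤ.+ 1} h₁))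
rearrange : ∀ x y → x - y ≡ x + (ι (ℤ.+ 0) - y)
rearrange x y = 𝒪I.identity (v 0F ⊖ v 1F) (v 0F ⊕ (# (ℤ.+ 0) ⊖ v 1F)) refl (x ∷ y ∷ [])

ι-determinant : ∀ u w u₀ w₀ {n} → u ℤ.* w₀ ℤ.- u₀ ℤ.* w ≡ ℤ.+ 4 ℤ.* n → ι u * ι w₀ - ι u₀ * ι w ≡ 𝟜 * ι n
ι-determinant u w u₀ w₀ {n} e = trans (sym (trans (ι-+ (u ℤ.* w₀) (ℤ.- (u₀ ℤ.* w))) (cong₂ _+_ (ι-* u w₀) (trans (ι-neg (u₀ ℤ.* w)) (cong -_ (ι-* u₀ w))))))
  (trans (cong ι e) (ι-* (ℤ.+ 4) n))

-- Congruence to the base point modulo 8 makes the determinant 8n with n rational, so D′ = 2n has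
-- the shape that `near-standard` refutes unless n = 0.
near-conclusion : ∀ {α β} τ z → (∀ m {γ X} → Odd γ → (d : Datum α β X (𝟚 * times-power m γ)) → γ ≈ τ * Datum.Z d [ 𝟚 ] → ⊥) → 𝟙 ≈ τ * z [ 𝟚 ] →
  ∀ u w u₀ w₀ u₁ w₁ a b e f → u ≡ u₁ ℤ.+ ℤ.+ 8 ℤ.* a → w ≡ w₁ ℤ.+ ℤ.+ 8 ℤ.* b → u₁ ℤ.* w₀ ℤ.- u₀ ℤ.* w₁ ≡ ℤ.+ 4 ℤ.* e → e ≡ ℤ.+ 2 ℤ.* f →
  (∀ D′ → ι u * ι w₀ - ι u₀ * ι w ≡ 𝟜 * D′ → ∃ λ X → ∃ λ (d : Datum α β X D′) → Datum.Z d ≈ z [ 𝟚 ]) → u ℤ.* w₀ ≡ u₀ ℤ.* w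
near-conclusion {α} {β} τ z no-point τz u w u₀ w₀ u₁ w₁ a b e f u≡ w≡ e≡ f≡ near = decide (n ℤ.≟ ℤ.+ 0)
  where
  n = f ℤ.+ (a ℤ.* w₀ ℤ.- u₀ ℤ.* b)
  D≡ : u ℤ.* w₀ ℤ.- u₀ ℤ.* w ≡ ℤ.+ 4 ℤ.* (ℤ.+ 2 ℤ.* n)
  D≡ = trans (lift-determinant u w u₀ w₀ u₁ w₁ a b e u≡ w≡ e≡) (cong (ℤ.+ 4 ℤ.*_) (double e f (a ℤ.* w₀ ℤ.- u₀ ℤ.* b) f≡))
  decide : Dec (n ≡ ℤ.+ 0) → u ℤ.* w₀ ≡ u₀ ℤ.* w
  decide (yes n≡0) = vanishing (u ℤ.* w₀) (u₀ ℤ.* w) n D≡ n≡0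
  decide (no n≢0) = ⊥-elim (near-standard τ z no-point τz n n≢0
    (near (𝟚 * ι n) (trans (ι-determinant u w u₀ w₀ D≡) (cong (λ x → 𝟜 * x) (ι-* (ℤ.+ 2) n)))))

odd-shape : ∀ a → ι (ℤ.+ 1) + ι (ℤ.+ 2) * a ≡ ι (ℤ.+ 1) + ι (ℤ.+ 2) * a
odd-shape a = 𝒪I.identity (# (ℤ.+ 1) ⊕ # (ℤ.+ 2) ⊗ v 0F) (# (ℤ.+ 1) ⊕ # (ℤ.+ 2) ⊗ v 0F) refl (a ∷ [])

-- The determinant is 4 modulo 8, so the denominator of the datum is an odd rational integer and
-- `near-residual` applies.
residual-conclusion : ∀ {α β β₄} z → β ≡ 𝟜 * β₄ → Smooth β → Odd (z * z + α) → sieve? α β none (excludes₄ (z * z + α)) ≡ true →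
  ∀ u w u₀ w₀ u₁ w₁ a b → u ≡ u₁ ℤ.+ ℤ.+ 8 ℤ.* a → w ≡ w₁ ℤ.+ ℤ.+ 8 ℤ.* b → u₁ ℤ.* w₀ ℤ.- u₀ ℤ.* w₁ ≡ ℤ.+ 4 ℤ.* ℤ.+ 1 →
  (∀ D′ → ι u * ι w₀ - ι u₀ * ι w ≡ 𝟜 * D′ → ∃ λ X → ∃ λ (d : Datum α β X D′) → Datum.Z d ≈ z [ 𝟚 ]) → ⊥
residual-conclusion {α} {β} z β≡ smooth odd s u w u₀ w₀ u₁ w₁ a b u≡ w≡ e≡ near = go (near (ι (ℤ.+ 1 ℤ.+ ℤ.+ 2 ℤ.* n)) (ι-determinant u w u₀ w₀ (lift-determinant u w u₀ w₀ u₁ w₁ a b (ℤ.+ 1) u≡ w≡ e≡)))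
  where
  n = a ℤ.* w₀ ℤ.- u₀ ℤ.* b
  go : (∃ λ X → ∃ λ (d : Datum α β X (ι (ℤ.+ 1 ℤ.+ ℤ.+ 2 ℤ.* n))) → Datum.Z d ≈ z [ 𝟚 ]) → ⊥
  go (X , d , Z≈) = near-residual z β≡ smooth odd s (by (ι n) (trans (ι-+ (ℤ.+ 1) (ℤ.+ 2 ℤ.* n)) (cong (λ x → 𝟙 + x) (ι-* (ℤ.+ 2) n)))) d Z≈

lift-residue : ∀ u u₁ a → u ≡ u₁ ℤ.+ ℤ.+ 8 ℤ.* a → u ≡ u₁ ℤ.+ ℤ.+ 8 ℤ.* a
lift-residue u u₁ a h₁ = trans (ℤI.identity (v 0F) (v 1F ⊕ # (ℤ.+ 8) ⊗ v 2F ⊕ # (ℤ.+ 1) ⊗ (v 0F ⊖ (v 1F ⊕ # (ℤ.+ 8) ⊗ v 2F))) refl (u ∷ u₁ ∷ a ∷ [])) (ℤI.vanish {u₁ ℤ.+ ℤ.+ 8 ℤ.* a} {ℤ.+ 1} h₁)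
ι-≈8 : ∀ {u u₁ a} → u ≡ u₁ ℤ.+ ℤ.+ 8 ℤ.* a → ι u ≈ ι u₁ [ 𝟠 ]
ι-≈8 {u} {u₁} {a} e = by (ι a) (trans (cong ι e) (trans (ι-+ u₁ (ℤ.+ 8 ℤ.* a)) (cong (λ x → ι u₁ + x) (ι-* (ℤ.+ 8) a))))

-- The ratio 2, written as 10 : 5. The factor 5 is π₅ times a square and moves the classes of u - θw
-- and u - θ₂w from (π₅ , 1) to (1 , π₅), those of the ratio -2 as well.
module BaseI₊ where
  k s κ c₀ d₀ ν₁ μ₁ : 𝒪
  k = ⟦ cls false false false false false false ⟧ᶜ
  s = ⟦ cls false false false false false true ⟧ᶜ
  κ = ⟨ ℤ.+ 1 , ℤ.+ 1 , ℤ.+ 0 ⟩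
  c₀ = ⟨ -[1+ 1 ] , ℤ.+ 2 , ℤ.+ 1 ⟩
  d₀ = ⟨ -[1+ 1 ] , ℤ.+ 0 , -[1+ 0 ] ⟩
  ν₁ = ⟨ ℤ.+ 0 , ℤ.+ 0 , ℤ.+ 0 ⟩
  μ₁ = ⟨ ℤ.+ 0 , ℤ.+ 0 , ℤ.+ 0 ⟩
  opaque
    unfolding _+_ _*_ -_ _♯ Tr⟨_,_⟩ div? zero%? N dead?
    κ≡ : κ ≡ k * k ♯ * s
    κ≡ = refl
    α≡ : αI ≡ κ * (ι (ℤ.+ 3) * θ * θ₂ + θ * θ + 𝟚 * θ ♯)
    α≡ = refl
    β≡ : βI ≡ κ * κ * ((θ * θ + θ * θ + θ ♯) * (θ₂ * θ₂ + θ * θ₂ + θ ♯))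
    β≡ = refl
    c₀≡ : k * (c₀ * c₀) ≡ ι (ℤ.+ 10) - θ * ι (ℤ.+ 5)
    c₀≡ = refl
    d₀≡ : s * (d₀ * d₀) ≡ ι (ℤ.+ 10) - θ₂ * ι (ℤ.+ 5)
    d₀≡ = refl
    odd-k : odd? k ≡ true
    odd-k = refl
    odd-s : odd? s ≡ true
    odd-s = refl
    c₁? : div? 8 (k * ((c₀ + 𝟚 * ν₁) * (c₀ + 𝟚 * ν₁)) - (ι (ℤ.+ 10) - θ * ι (ℤ.+ 5))) ≡ true
    c₁? = refl
    d₁? : div? 8 (s * ((d₀ + 𝟚 * μ₁) * (d₀ + 𝟚 * μ₁)) - (ι (ℤ.+ 10) - θ₂ * ι (ℤ.+ 5))) ≡ true
    d₁? = refl
  open Base-point θ θ₂ k s κ αI βI (ℤ.+ 10) (ℤ.+ 5) c₀ d₀ trace-θ κ≡ α≡ β≡ c₀≡ d₀≡ public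
  z₁ : 𝒪
  z₁ = Z-near ν₁ μ₁
  -- An inverse of z₁ modulo 2, as `τ?` verifies; likewise at the other base points.
  τ : 𝒪
  τ = ⟨ ℤ.+ 1 , ℤ.+ 1 , ℤ.+ 1 ⟩
  opaque
    unfolding _+_ _*_ -_ _♯ Tr⟨_,_⟩ div? zero%? N dead?
    τ? : div? 2 (𝟙 - τ * z₁) ≡ true
    τ? = refl
    sieve₁ : sieve? αI βI none (excludes₈ (αI * (τ * τ))) ≡ true
    sieve₁ = refl
  conclusion : ∀ {c d} u w a b → u ≡ ℤ.+ 10 ℤ.+ ℤ.+ 8 ℤ.* a → w ≡ ℤ.+ 5 ℤ.+ ℤ.+ 8 ℤ.* b → k * (c * c) ≡ ι u - θ * ι w → s * (d * d) ≡ ι u - θ₂ * ι w → u ℤ.* (ℤ.+ 5) ≡ ℤ.+ 10 ℤ.* w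
  conclusion u w a b u≡ w≡ c≡ d≡ = near-conclusion τ z₁ (DI.no-point τ sieve₁) (≈?-sound 2 𝟙 (τ * z₁) τ?) u w (ℤ.+ 10) (ℤ.+ 5) (ℤ.+ 10) (ℤ.+ 5) a b (ℤ.+ 0) (ℤ.+ 0) u≡ w≡ refl refl
    (λ D′ → near u w (ℤ.+ 10) (ℤ.+ 5) ν₁ μ₁ D′ (odd?-sound k odd-k) (odd?-sound s odd-s) (≈?-sound 8 _ _ c₁?) (≈?-sound 8 _ _ d₁?) (ι-≈8 {a = a} u≡) (ι-≈8 {a = b} w≡) c≡ d≡)

module BaseI₋ where
  k s κ c₀ d₀ ν₁ μ₁ : 𝒪
  k = ⟦ cls false false false false false false ⟧ᶜ
  s = ⟦ cls false false false false false true ⟧ᶜ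
  κ = ⟨ ℤ.+ 1 , ℤ.+ 1 , ℤ.+ 0 ⟩
  c₀ = ⟨ ℤ.+ 0 , ℤ.+ 0 , ℤ.+ 1 ⟩
  d₀ = ⟨ ℤ.+ 0 , ℤ.+ 0 , ℤ.+ 1 ⟩
  ν₁ = ⟨ ℤ.+ 0 , ℤ.+ 0 , ℤ.+ 0 ⟩
  μ₁ = ⟨ ℤ.+ 0 , ℤ.+ 0 , ℤ.+ 0 ⟩
  opaque
    unfolding _+_ _*_ -_ _♯ Tr⟨_,_⟩ div? zero%? N dead?
    κ≡ : κ ≡ k * k ♯ * s
    κ≡ = refl
    α≡ : αI ≡ κ * (ι (ℤ.+ 3) * θ * θ₂ + θ * θ + 𝟚 * θ ♯)
    α≡ = refl
    β≡ : βI ≡ κ * κ * ((θ * θ + θ * θ + θ ♯) * (θ₂ * θ₂ + θ * θ₂ + θ ♯))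
    β≡ = refl
    c₀≡ : k * (c₀ * c₀) ≡ ι (-[1+ 1 ]) - θ * ι (ℤ.+ 1)
    c₀≡ = refl
    d₀≡ : s * (d₀ * d₀) ≡ ι (-[1+ 1 ]) - θ₂ * ι (ℤ.+ 1)
    d₀≡ = refl
    odd-k : odd? k ≡ true
    odd-k = refl
    odd-s : odd? s ≡ true
    odd-s = refl
    c₁? : div? 8 (k * ((c₀ + 𝟚 * ν₁) * (c₀ + 𝟚 * ν₁)) - (ι (-[1+ 1 ]) - θ * ι (ℤ.+ 1))) ≡ true
    c₁? = refl
    d₁? : div? 8 (s * ((d₀ + 𝟚 * μ₁) * (d₀ + 𝟚 * μ₁)) - (ι (-[1+ 1 ]) - θ₂ * ι (ℤ.+ 1))) ≡ true
    d₁? = refl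
  open Base-point θ θ₂ k s κ αI βI (-[1+ 1 ]) (ℤ.+ 1) c₀ d₀ trace-θ κ≡ α≡ β≡ c₀≡ d₀≡ public
  z₁ : 𝒪
  z₁ = Z-near ν₁ μ₁
  τ : 𝒪
  τ = ⟨ ℤ.+ 1 , ℤ.+ 1 , ℤ.+ 1 ⟩
  opaque
    unfolding _+_ _*_ -_ _♯ Tr⟨_,_⟩ div? zero%? N dead?
    τ? : div? 2 (𝟙 - τ * z₁) ≡ true
    τ? = refl
    sieve₁ : sieve? αI βI none (excludes₈ (αI * (τ * τ))) ≡ true
    sieve₁ = refl
  conclusion : ∀ {c d} u w a b → u ≡ -[1+ 1 ] ℤ.+ ℤ.+ 8 ℤ.* a → w ≡ ℤ.+ 1 ℤ.+ ℤ.+ 8 ℤ.* b → k * (c * c) ≡ ι u - θ * ι w → s * (d * d) ≡ ι u - θ₂ * ι w → u ℤ.* (ℤ.+ 1) ≡ -[1+ 1 ] ℤ.* w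
  conclusion u w a b u≡ w≡ c≡ d≡ = near-conclusion τ z₁ (DI.no-point τ sieve₁) (≈?-sound 2 𝟙 (τ * z₁) τ?) u w (-[1+ 1 ]) (ℤ.+ 1) (-[1+ 1 ]) (ℤ.+ 1) a b (ℤ.+ 0) (ℤ.+ 0) u≡ w≡ refl refl
    (λ D′ → near u w (-[1+ 1 ]) (ℤ.+ 1) ν₁ μ₁ D′ (odd?-sound k odd-k) (odd?-sound s odd-s) (≈?-sound 8 _ _ c₁?) (≈?-sound 8 _ _ d₁?) (ι-≈8 {a = a} u≡) (ι-≈8 {a = b} w≡) c≡ d≡)

module BaseII₁ where
  k s κ c₀ d₀ ν₁ μ₁ : 𝒪
  k = ⟦ cls false true false false false false ⟧ᶜ
  s = ⟦ cls true true false false true false ⟧ᶜ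
  κ = ⟨ ℤ.+ 0 , ℤ.+ 1 , ℤ.+ 1 ⟩
  c₀ = ⟨ -[1+ 0 ] , ℤ.+ 0 , ℤ.+ 0 ⟩
  d₀ = ⟨ -[1+ 0 ] , ℤ.+ 0 , ℤ.+ 0 ⟩
  ν₁ = ⟨ ℤ.+ 0 , ℤ.+ 0 , ℤ.+ 0 ⟩
  μ₁ = ⟨ ℤ.+ 0 , ℤ.+ 0 , ℤ.+ 0 ⟩
  opaque
    unfolding _+_ _*_ -_ _♯ Tr⟨_,_⟩ div? zero%? N dead?
    κ≡ : κ ≡ k * k ♯ * s
    κ≡ = refl
    α≡ : αII ≡ κ * (ι (ℤ.+ 3) * θ * θ₂ + θ * θ + 𝟚 * θ ♯)
    α≡ = refl
    β≡ : βII ≡ κ * κ * ((θ * θ + θ * θ + θ ♯) * (θ₂ * θ₂ + θ * θ₂ + θ ♯))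
    β≡ = refl
    c₀≡ : k * (c₀ * c₀) ≡ ι (ℤ.+ 1) - θ * ι (ℤ.+ 1)
    c₀≡ = refl
    d₀≡ : s * (d₀ * d₀) ≡ ι (ℤ.+ 1) - θ₂ * ι (ℤ.+ 1)
    d₀≡ = refl
    odd-k : odd? k ≡ true
    odd-k = refl
    odd-s : odd? s ≡ true
    odd-s = refl
    c₁? : div? 8 (k * ((c₀ + 𝟚 * ν₁) * (c₀ + 𝟚 * ν₁)) - (ι (ℤ.+ 1) - θ * ι (ℤ.+ 1))) ≡ true
    c₁? = refl
    d₁? : div? 8 (s * ((d₀ + 𝟚 * μ₁) * (d₀ + 𝟚 * μ₁)) - (ι (ℤ.+ 1) - θ₂ * ι (ℤ.+ 1))) ≡ true
    d₁? = refl
  open Base-point θ θ₂ k s κ αII βII (ℤ.+ 1) (ℤ.+ 1) c₀ d₀ trace-θ κ≡ α≡ β≡ c₀≡ d₀≡ public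
  z₁ : 𝒪
  z₁ = Z-near ν₁ μ₁
  τ : 𝒪
  τ = ⟨ ℤ.+ 1 , -[1+ 0 ] , ℤ.+ 0 ⟩
  opaque
    unfolding _+_ _*_ -_ _♯ Tr⟨_,_⟩ div? zero%? N dead?
    τ? : div? 2 (𝟙 - τ * z₁) ≡ true
    τ? = refl
    sieve₁ : sieve? αII βII none (excludes₈ (αII * (τ * τ))) ≡ true
    sieve₁ = refl
  conclusion : ∀ {c d} u w a b → u ≡ ℤ.+ 1 ℤ.+ ℤ.+ 8 ℤ.* a → w ≡ ℤ.+ 1 ℤ.+ ℤ.+ 8 ℤ.* b → k * (c * c) ≡ ι u - θ * ι w → s * (d * d) ≡ ι u - θ₂ * ι w → u ℤ.* (ℤ.+ 1) ≡ ℤ.+ 1 ℤ.* w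
  conclusion u w a b u≡ w≡ c≡ d≡ = near-conclusion τ z₁ (DII.no-point τ sieve₁) (≈?-sound 2 𝟙 (τ * z₁) τ?) u w (ℤ.+ 1) (ℤ.+ 1) (ℤ.+ 1) (ℤ.+ 1) a b (ℤ.+ 0) (ℤ.+ 0) u≡ w≡ refl refl
    (λ D′ → near u w (ℤ.+ 1) (ℤ.+ 1) ν₁ μ₁ D′ (odd?-sound k odd-k) (odd?-sound s odd-s) (≈?-sound 8 _ _ c₁?) (≈?-sound 8 _ _ d₁?) (ι-≈8 {a = a} u≡) (ι-≈8 {a = b} w≡) c≡ d≡)

-- The ratio -4, in the same pair of classes as the ratio 1.
module BaseII₄ where
  k s κ c₀ d₀ ν₁ μ₁ : 𝒪
  k = ⟦ cls false true false false false false ⟧ᶜ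
  s = ⟦ cls true true false false true false ⟧ᶜ
  κ = ⟨ ℤ.+ 0 , ℤ.+ 1 , ℤ.+ 1 ⟩
  c₀ = ⟨ ℤ.+ 2 , -[1+ 0 ] , ℤ.+ 1 ⟩
  d₀ = ⟨ -[1+ 0 ] , ℤ.+ 0 , ℤ.+ 1 ⟩
  ν₁ = ⟨ ℤ.+ 0 , ℤ.+ 0 , ℤ.+ 0 ⟩
  μ₁ = ⟨ ℤ.+ 0 , ℤ.+ 0 , ℤ.+ 0 ⟩
  opaque
    unfolding _+_ _*_ -_ _♯ Tr⟨_,_⟩ div? zero%? N dead?
    κ≡ : κ ≡ k * k ♯ * s
    κ≡ = refl
    α≡ : αII ≡ κ * (ι (ℤ.+ 3) * θ * θ₂ + θ * θ + 𝟚 * θ ♯)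
    α≡ = refl
    β≡ : βII ≡ κ * κ * ((θ * θ + θ * θ + θ ♯) * (θ₂ * θ₂ + θ * θ₂ + θ ♯))
    β≡ = refl
    c₀≡ : k * (c₀ * c₀) ≡ ι (ℤ.+ 4) - θ * ι (-[1+ 0 ])
    c₀≡ = refl
    d₀≡ : s * (d₀ * d₀) ≡ ι (ℤ.+ 4) - θ₂ * ι (-[1+ 0 ])
    d₀≡ = refl
    odd-k : odd? k ≡ true
    odd-k = refl
    odd-s : odd? s ≡ true
    odd-s = refl
    c₁? : div? 8 (k * ((c₀ + 𝟚 * ν₁) * (c₀ + 𝟚 * ν₁)) - (ι (ℤ.+ 4) - θ * ι (-[1+ 0 ]))) ≡ true
    c₁? = refl
    d₁? : div? 8 (s * ((d₀ + 𝟚 * μ₁) * (d₀ + 𝟚 * μ₁)) - (ι (ℤ.+ 4) - θ₂ * ι (-[1+ 0 ]))) ≡ true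
    d₁? = refl
  open Base-point θ θ₂ k s κ αII βII (ℤ.+ 4) (-[1+ 0 ]) c₀ d₀ trace-θ κ≡ α≡ β≡ c₀≡ d₀≡ public
  z₁ : 𝒪
  z₁ = Z-near ν₁ μ₁
  τ : 𝒪
  τ = ⟨ ℤ.+ 2 , -[1+ 0 ] , ℤ.+ 0 ⟩
  opaque
    unfolding _+_ _*_ -_ _♯ Tr⟨_,_⟩ div? zero%? N dead?
    τ? : div? 2 (𝟙 - τ * z₁) ≡ true
    τ? = refl
    sieve₁ : sieve? αII βII none (excludes₈ (αII * (τ * τ))) ≡ true
    sieve₁ = refl
  conclusion : ∀ {c d} u w a b → u ≡ ℤ.+ 4 ℤ.+ ℤ.+ 8 ℤ.* a → w ≡ -[1+ 0 ] ℤ.+ ℤ.+ 8 ℤ.* b → k * (c * c) ≡ ι u - θ * ι w → s * (d * d) ≡ ι u - θ₂ * ι w → u ℤ.* (-[1+ 0 ]) ≡ ℤ.+ 4 ℤ.* w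
  conclusion u w a b u≡ w≡ c≡ d≡ = near-conclusion τ z₁ (DII.no-point τ sieve₁) (≈?-sound 2 𝟙 (τ * z₁) τ?) u w (ℤ.+ 4) (-[1+ 0 ]) (ℤ.+ 4) (-[1+ 0 ]) a b (ℤ.+ 0) (ℤ.+ 0) u≡ w≡ refl refl
    (λ D′ → near u w (ℤ.+ 4) (-[1+ 0 ]) ν₁ μ₁ D′ (odd?-sound k odd-k) (odd?-sound s odd-s) (≈?-sound 8 _ _ c₁?) (≈?-sound 8 _ _ d₁?) (ι-≈8 {a = a} u≡) (ι-≈8 {a = b} w≡) c≡ d≡)

-- The ratio -1, taken with ρ = θ₂; so c belongs to u - θ₂w and d to u - θw.
module BaseIII₁ where
  k s κ c₀ d₀ ν₁ μ₁ : 𝒪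
  k = ⟦ cls true true false false false false ⟧ᶜ
  s = ⟦ cls false false false false true false ⟧ᶜ
  κ = ⟨ -[1+ 1 ] , ℤ.+ 1 , ℤ.+ 0 ⟩
  c₀ = ⟨ -[1+ 0 ] , ℤ.+ 0 , ℤ.+ 1 ⟩
  d₀ = ⟨ -[1+ 0 ] , ℤ.+ 0 , ℤ.+ 0 ⟩
  ν₁ = ⟨ ℤ.+ 0 , ℤ.+ 0 , ℤ.+ 0 ⟩
  μ₁ = ⟨ ℤ.+ 0 , ℤ.+ 0 , ℤ.+ 0 ⟩
  opaque
    unfolding _+_ _*_ -_ _♯ Tr⟨_,_⟩ div? zero%? N dead?
    κ≡ : κ ≡ k * k ♯ * s
    κ≡ = refl
    α≡ : αIII ≡ κ * (ι (ℤ.+ 3) * θ₂ * θ + θ₂ * θ₂ + 𝟚 * θ₂ ♯)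
    α≡ = refl
    β≡ : βIII ≡ κ * κ * ((θ₂ * θ₂ + θ₂ * θ₂ + θ₂ ♯) * (θ * θ + θ₂ * θ + θ₂ ♯))
    β≡ = refl
    c₀≡ : k * (c₀ * c₀) ≡ ι (ℤ.+ 1) - θ₂ * ι (-[1+ 0 ])
    c₀≡ = refl
    d₀≡ : s * (d₀ * d₀) ≡ ι (ℤ.+ 1) - θ * ι (-[1+ 0 ])
    d₀≡ = refl
    odd-k : odd? k ≡ true
    odd-k = refl
    odd-s : odd? s ≡ true
    odd-s = refl
    c₁? : div? 8 (k * ((c₀ + 𝟚 * ν₁) * (c₀ + 𝟚 * ν₁)) - (ι (ℤ.+ 1) - θ₂ * ι (-[1+ 0 ]))) ≡ true
    c₁? = refl
    d₁? : div? 8 (s * ((d₀ + 𝟚 * μ₁) * (d₀ + 𝟚 * μ₁)) - (ι (ℤ.+ 1) - θ * ι (-[1+ 0 ]))) ≡ true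
    d₁? = refl
  open Base-point θ₂ θ k s κ αIII βIII (ℤ.+ 1) (-[1+ 0 ]) c₀ d₀ trace-θ₂ κ≡ α≡ β≡ c₀≡ d₀≡ public
  z₁ : 𝒪
  z₁ = Z-near ν₁ μ₁
  τ : 𝒪
  τ = ⟨ ℤ.+ 2 , ℤ.+ 0 , ℤ.+ 1 ⟩
  opaque
    unfolding _+_ _*_ -_ _♯ Tr⟨_,_⟩ div? zero%? N dead?
    τ? : div? 2 (𝟙 - τ * z₁) ≡ true
    τ? = refl
    sieve₁ : sieve? αIII βIII none (excludes₈ (αIII * (τ * τ))) ≡ true
    sieve₁ = refl
  conclusion : ∀ {c d} u w a b → u ≡ ℤ.+ 1 ℤ.+ ℤ.+ 8 ℤ.* a → w ≡ -[1+ 0 ] ℤ.+ ℤ.+ 8 ℤ.* b → k * (c * c) ≡ ι u - θ₂ * ι w → s * (d * d) ≡ ι u - θ * ι w → u ℤ.* (-[1+ 0 ]) ≡ ℤ.+ 1 ℤ.* w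
  conclusion u w a b u≡ w≡ c≡ d≡ = near-conclusion τ z₁ (DIII.no-point τ sieve₁) (≈?-sound 2 𝟙 (τ * z₁) τ?) u w (ℤ.+ 1) (-[1+ 0 ]) (ℤ.+ 1) (-[1+ 0 ]) a b (ℤ.+ 0) (ℤ.+ 0) u≡ w≡ refl refl
    (λ D′ → near u w (ℤ.+ 1) (-[1+ 0 ]) ν₁ μ₁ D′ (odd?-sound k odd-k) (odd?-sound s odd-s) (≈?-sound 8 _ _ c₁?) (≈?-sound 8 _ _ d₁?) (ι-≈8 {a = a} u≡) (ι-≈8 {a = b} w≡) c≡ d≡)

-- The residues (5 , 1), measured against the base point 1 : 1. The elements ν₁ and μ₁ describe the
-- square roots that residues of this kind prescribe modulo 4.
module BaseII₅ where
  k s κ c₀ d₀ ν₁ μ₁ : 𝒪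
  k = ⟦ cls false true false false false false ⟧ᶜ
  s = ⟦ cls true true false false true false ⟧ᶜ
  κ = ⟨ ℤ.+ 0 , ℤ.+ 1 , ℤ.+ 1 ⟩
  c₀ = ⟨ -[1+ 0 ] , ℤ.+ 0 , ℤ.+ 0 ⟩
  d₀ = ⟨ -[1+ 0 ] , ℤ.+ 0 , ℤ.+ 0 ⟩
  ν₁ = ⟨ ℤ.+ 2 , -[1+ 0 ] , ℤ.+ 0 ⟩
  μ₁ = ⟨ ℤ.+ 2 , ℤ.+ 1 , ℤ.+ 1 ⟩
  opaque
    unfolding _+_ _*_ -_ _♯ Tr⟨_,_⟩ div? zero%? N dead?
    κ≡ : κ ≡ k * k ♯ * s
    κ≡ = refl
    α≡ : αII ≡ κ * (ι (ℤ.+ 3) * θ * θ₂ + θ * θ + 𝟚 * θ ♯)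
    α≡ = refl
    β≡ : βII ≡ κ * κ * ((θ * θ + θ * θ + θ ♯) * (θ₂ * θ₂ + θ * θ₂ + θ ♯))
    β≡ = refl
    c₀≡ : k * (c₀ * c₀) ≡ ι (ℤ.+ 1) - θ * ι (ℤ.+ 1)
    c₀≡ = refl
    d₀≡ : s * (d₀ * d₀) ≡ ι (ℤ.+ 1) - θ₂ * ι (ℤ.+ 1)
    d₀≡ = refl
    odd-k : odd? k ≡ true
    odd-k = refl
    odd-s : odd? s ≡ true
    odd-s = refl
    c₁? : div? 8 (k * ((c₀ + 𝟚 * ν₁) * (c₀ + 𝟚 * ν₁)) - (ι (ℤ.+ 5) - θ * ι (ℤ.+ 1))) ≡ true
    c₁? = refl
    d₁? : div? 8 (s * ((d₀ + 𝟚 * μ₁) * (d₀ + 𝟚 * μ₁)) - (ι (ℤ.+ 5) - θ₂ * ι (ℤ.+ 1))) ≡ true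
    d₁? = refl
  open Base-point θ θ₂ k s κ αII βII (ℤ.+ 1) (ℤ.+ 1) c₀ d₀ trace-θ κ≡ α≡ β≡ c₀≡ d₀≡ public
  z₁ : 𝒪
  z₁ = Z-near ν₁ μ₁
  opaque
    unfolding _+_ _*_ -_ _♯ Tr⟨_,_⟩ div? zero%? N dead?
    odd-S : odd? (z₁ * z₁ + αII) ≡ true
    odd-S = refl
    sieve₀ : sieve? αII βII none (excludes₄ (z₁ * z₁ + αII)) ≡ true
    sieve₀ = refl
  impossible : ∀ {c d} u w a b → u ≡ ℤ.+ 5 ℤ.+ ℤ.+ 8 ℤ.* a → w ≡ ℤ.+ 1 ℤ.+ ℤ.+ 8 ℤ.* b → k * (c * c) ≡ ι u - θ * ι w → s * (d * d) ≡ ι u - θ₂ * ι w → ⊥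
  impossible u w a b u≡ w≡ c≡ d≡ = residual-conclusion z₁ β≡II smooth-βII (odd?-sound _ odd-S) sieve₀ u w (ℤ.+ 1) (ℤ.+ 1) (ℤ.+ 5) (ℤ.+ 1) a b u≡ w≡ refl
    (λ D′ → near u w (ℤ.+ 5) (ℤ.+ 1) ν₁ μ₁ D′ (odd?-sound k odd-k) (odd?-sound s odd-s) (≈?-sound 8 _ _ c₁?) (≈?-sound 8 _ _ d₁?) (ι-≈8 {a = a} u≡) (ι-≈8 {a = b} w≡) c≡ d≡)

module BaseIII₃ where
  k s κ c₀ d₀ ν₁ μ₁ : 𝒪
  k = ⟦ cls true true false false false false ⟧ᶜ
  s = ⟦ cls false false false false true false ⟧ᶜ
  κ = ⟨ -[1+ 1 ] , ℤ.+ 1 , ℤ.+ 0 ⟩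
  c₀ = ⟨ -[1+ 0 ] , ℤ.+ 0 , ℤ.+ 1 ⟩
  d₀ = ⟨ -[1+ 0 ] , ℤ.+ 0 , ℤ.+ 0 ⟩
  ν₁ = ⟨ ℤ.+ 4 , ℤ.+ 0 , ℤ.+ 1 ⟩
  μ₁ = ⟨ ℤ.+ 2 , -[1+ 0 ] , ℤ.+ 0 ⟩
  opaque
    unfolding _+_ _*_ -_ _♯ Tr⟨_,_⟩ div? zero%? N dead?
    κ≡ : κ ≡ k * k ♯ * s
    κ≡ = refl
    α≡ : αIII ≡ κ * (ι (ℤ.+ 3) * θ₂ * θ + θ₂ * θ₂ + 𝟚 * θ₂ ♯)
    α≡ = refl
    β≡ : βIII ≡ κ * κ * ((θ₂ * θ₂ + θ₂ * θ₂ + θ₂ ♯) * (θ * θ + θ₂ * θ + θ₂ ♯))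
    β≡ = refl
    c₀≡ : k * (c₀ * c₀) ≡ ι (ℤ.+ 1) - θ₂ * ι (-[1+ 0 ])
    c₀≡ = refl
    d₀≡ : s * (d₀ * d₀) ≡ ι (ℤ.+ 1) - θ * ι (-[1+ 0 ])
    d₀≡ = refl
    odd-k : odd? k ≡ true
    odd-k = refl
    odd-s : odd? s ≡ true
    odd-s = refl
    c₁? : div? 8 (k * ((c₀ + 𝟚 * ν₁) * (c₀ + 𝟚 * ν₁)) - (ι (-[1+ 2 ]) - θ₂ * ι (-[1+ 0 ]))) ≡ true
    c₁? = refl
    d₁? : div? 8 (s * ((d₀ + 𝟚 * μ₁) * (d₀ + 𝟚 * μ₁)) - (ι (-[1+ 2 ]) - θ * ι (-[1+ 0 ]))) ≡ true
    d₁? = refl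
  open Base-point θ₂ θ k s κ αIII βIII (ℤ.+ 1) (-[1+ 0 ]) c₀ d₀ trace-θ₂ κ≡ α≡ β≡ c₀≡ d₀≡ public
  z₁ : 𝒪
  z₁ = Z-near ν₁ μ₁
  opaque
    unfolding _+_ _*_ -_ _♯ Tr⟨_,_⟩ div? zero%? N dead?
    odd-S : odd? (z₁ * z₁ + αIII) ≡ true
    odd-S = refl
    sieve₀ : sieve? αIII βIII none (excludes₄ (z₁ * z₁ + αIII)) ≡ true
    sieve₀ = refl
  impossible : ∀ {c d} u w a b → u ≡ -[1+ 2 ] ℤ.+ ℤ.+ 8 ℤ.* a → w ≡ -[1+ 0 ] ℤ.+ ℤ.+ 8 ℤ.* b → k * (c * c) ≡ ι u - θ₂ * ι w → s * (d * d) ≡ ι u - θ * ι w → ⊥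
  impossible u w a b u≡ w≡ c≡ d≡ = residual-conclusion z₁ β≡III smooth-βIII (odd?-sound _ odd-S) sieve₀ u w (ℤ.+ 1) (-[1+ 0 ]) (-[1+ 2 ]) (-[1+ 0 ]) a b u≡ w≡ refl
    (λ D′ → near u w (-[1+ 2 ]) (-[1+ 0 ]) ν₁ μ₁ D′ (odd?-sound k odd-k) (odd?-sound s odd-s) (≈?-sound 8 _ _ c₁?) (≈?-sound 8 _ _ d₁?) (ι-≈8 {a = a} u≡) (ι-≈8 {a = b} w≡) c≡ d≡)

-- The quotient built from the quadratic cofactors of both linear forms.

opaque
  unfolding _+_ -_ _*_ _♯ Tr⟨_,_⟩

  Tr-linear : ∀ d w x y → Tr⟨ ι d + ι w * x , y ⟩ ≡ ι d * Tr⟨ 𝟙 , y ⟩ + ι w * Tr⟨ x , y ⟩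
  Tr-linear d w ⟨ a , b , c ⟩ ⟨ e , f , g ⟩ = components (Trᴱ (D ⊞ (W ⊠ x₃)) y₃) ((D ⊠ Trᴱ O y₃) ⊞ (W ⊠ Trᴱ x₃ y₃)) refl refl refl (a ∷ b ∷ c ∷ e ∷ f ∷ g ∷ d ∷ w ∷ d ∷ [])
    where
    D W O : 𝒪-Expr 9
    D = ⟪ v 6F , # (ℤ.+ 0) , # (ℤ.+ 0) ⟫
    W = ⟪ v 7F , # (ℤ.+ 0) , # (ℤ.+ 0) ⟫
    O = ⟪ # (ℤ.+ 1) , # (ℤ.+ 0) , # (ℤ.+ 0) ⟫

  Tr-𝟙² : ∀ x → Tr⟨ 𝟙 , x ⟩ * Tr⟨ 𝟙 , x ⟩ ≡ Tr⟨ 𝟙 , x * x ⟩ + 𝟚 * x ♯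
  Tr-𝟙² ⟨ a , b , c ⟩ = components (Trᴱ O x₃ ⊠ Trᴱ O x₃) (Trᴱ O (x₃ ⊠ x₃) ⊞ (⟪ # (ℤ.+ 2) , # (ℤ.+ 0) , # (ℤ.+ 0) ⟫ ⊠ (x₃ ♯ᴱ))) refl refl refl (a ∷ b ∷ c ∷ a ∷ b ∷ c ∷ a ∷ b ∷ c ∷ [])
    where
    O : 𝒪-Expr 9
    O = ⟪ # (ℤ.+ 1) , # (ℤ.+ 0) , # (ℤ.+ 0) ⟫

  Tr-Tr : ∀ x y → Tr⟨ x , y ⟩ * Tr⟨ 𝟙 , x * y ⟩ ≡ y ♯ * Tr⟨ 𝟙 , x * x ⟩ + x ♯ * Tr⟨ 𝟙 , y * y ⟩
  Tr-Tr ⟨ a , b , c ⟩ ⟨ d , e , f ⟩ = components (Trᴱ x₃ y₃ ⊠ Trᴱ O (x₃ ⊠ y₃)) (((y₃ ♯ᴱ) ⊠ Trᴱ O (x₃ ⊠ x₃)) ⊞ ((x₃ ♯ᴱ) ⊠ Trᴱ O (y₃ ⊠ y₃))) refl refl refl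
    (a ∷ b ∷ c ∷ d ∷ e ∷ f ∷ a ∷ b ∷ c ∷ [])
    where
    O : 𝒪-Expr 9
    O = ⟪ # (ℤ.+ 1) , # (ℤ.+ 0) , # (ℤ.+ 0) ⟫

  Tr-crossed : ∀ d w x y → Tr⟨ y * (ι d + ι w * x) , x * (ι d + ι w * y) ⟩ ≡
    ι d * ι d * Tr⟨ x , y ⟩ + ι d * ι w * (y ♯ * Tr⟨ 𝟙 , x ⟩ + x ♯ * Tr⟨ 𝟙 , y ⟩) + 𝟚 * (ι w * ι w * (x ♯ * y ♯))
  Tr-crossed d w ⟨ a , b , c ⟩ ⟨ e , f , g ⟩ = components (Trᴱ (y₃ ⊠ (D ⊞ (W ⊠ x₃))) (x₃ ⊠ (D ⊞ (W ⊠ y₃))))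
    ((((D ⊠ D) ⊠ Trᴱ x₃ y₃) ⊞ ((D ⊠ W) ⊠ (((y₃ ♯ᴱ) ⊠ Trᴱ O x₃) ⊞ ((x₃ ♯ᴱ) ⊠ Trᴱ O y₃)))) ⊞ (⟪ # (ℤ.+ 2) , # (ℤ.+ 0) , # (ℤ.+ 0) ⟫ ⊠ ((W ⊠ W) ⊠ ((x₃ ♯ᴱ) ⊠ (y₃ ♯ᴱ)))))
    refl refl refl (a ∷ b ∷ c ∷ e ∷ f ∷ g ∷ d ∷ w ∷ d ∷ [])
    where
    D W O : 𝒪-Expr 9
    D = ⟪ v 6F , # (ℤ.+ 0) , # (ℤ.+ 0) ⟫
    W = ⟪ v 7F , # (ℤ.+ 0) , # (ℤ.+ 0) ⟫
    O = ⟪ # (ℤ.+ 1) , # (ℤ.+ 0) , # (ℤ.+ 0) ⟫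

  Tr-straight : ∀ d w x y → Tr⟨ x * y , (ι d + ι w * x) * (ι d + ι w * y) ⟩ ≡
    ι d * ι d * Tr⟨ 𝟙 , x * y ⟩ + ι d * ι w * (y ♯ * Tr⟨ 𝟙 , x ⟩ + x ♯ * Tr⟨ 𝟙 , y ⟩) + 𝟚 * (ι w * ι w * (x ♯ * y ♯))
  Tr-straight d w ⟨ a , b , c ⟩ ⟨ e , f , g ⟩ = components (Trᴱ (x₃ ⊠ y₃) ((D ⊞ (W ⊠ x₃)) ⊠ (D ⊞ (W ⊠ y₃))))
    ((((D ⊠ D) ⊠ Trᴱ O (x₃ ⊠ y₃)) ⊞ ((D ⊠ W) ⊠ (((y₃ ♯ᴱ) ⊠ Trᴱ O x₃) ⊞ ((x₃ ♯ᴱ) ⊠ Trᴱ O y₃)))) ⊞ (⟪ # (ℤ.+ 2) , # (ℤ.+ 0) , # (ℤ.+ 0) ⟫ ⊠ ((W ⊠ W) ⊠ ((x₃ ♯ᴱ) ⊠ (y₃ ♯ᴱ)))))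
    refl refl refl (a ∷ b ∷ c ∷ e ∷ f ∷ g ∷ d ∷ w ∷ d ∷ [])
    where
    D W O : 𝒪-Expr 9
    D = ⟪ v 6F , # (ℤ.+ 0) , # (ℤ.+ 0) ⟫
    W = ⟪ v 7F , # (ℤ.+ 0) , # (ℤ.+ 0) ⟫
    O = ⟪ # (ℤ.+ 1) , # (ℤ.+ 0) , # (ℤ.+ 0) ⟫

-- A difference of squares (C + E)² - R² in which the known forms for C², E² and R² cancel down to a
-- multiple of D².
split-half : ∀ K M C E R P D V t₁ t₂ x → K * (C * C) ≡ D * D + D * V * t₁ + V * V * K → M * (E * E) ≡ D * D + D * V * t₂ + V * V * M → R * R ≡ P + ι (ℤ.+ 2) * (C * E) → K * M * P ≡ D * D * x + D * V * (M * t₁ + K * t₂) + ι (ℤ.+ 2) * (V * V * (K * M)) → K * M * ((C + E + R) * (C + E - R)) ≡ (K + M - x) * (D * D)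
split-half K M C E R P D V t₁ t₂ x h₁ h₂ h₃ h₄ = trans (𝒪I.identity (v 0F ⊗ v 1F ⊗ ((v 2F ⊕ v 3F ⊕ v 4F) ⊗ (v 2F ⊕ v 3F ⊖ v 4F))) ((v 0F ⊕ v 1F ⊖ v (Fin.suc 9F)) ⊗ (v 6F ⊗ v 6F) ⊕ v 1F ⊗ (v 0F ⊗ (v 2F ⊗ v 2F) ⊖ (v 6F ⊗ v 6F ⊕ v 6F ⊗ v 7F ⊗ v 8F ⊕ v 7F ⊗ v 7F ⊗ v 0F)) ⊕ v 0F ⊗ (v 1F ⊗ (v 3F ⊗ v 3F) ⊖ (v 6F ⊗ v 6F ⊕ v 6F ⊗ v 7F ⊗ v 9F ⊕ v 7F ⊗ v 7F ⊗ v 1F)) ⊕ (# (ℤ.+ 0) ⊖ v 0F ⊗ v 1F) ⊗ (v 4F ⊗ v 4F ⊖ (v 5F ⊕ # (ℤ.+ 2) ⊗ (v 2F ⊗ v 3F))) ⊕ (# (ℤ.+ 0) ⊖ # (ℤ.+ 1)) ⊗ (v 0F ⊗ v 1F ⊗ v 5F ⊖ (v 6F ⊗ v 6F ⊗ v (Fin.suc 9F) ⊕ v 6F ⊗ v 7F ⊗ (v 1F ⊗ v 8F ⊕ v 0F ⊗ v 9F) ⊕ # (ℤ.+ 2) ⊗ (v 7F ⊗ v 7F ⊗ (v 0F ⊗ v 1F))))) refl (K ∷ M ∷ C ∷ E ∷ R ∷ P ∷ D ∷ V ∷ t₁ ∷ t₂ ∷ x ∷ [])) (trans (𝒪I.vanish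 h₄) (trans (𝒪I.vanish h₃) (trans (𝒪I.vanish h₂) (𝒪I.vanish h₁))))
split-sum : ∀ K M C E R S D V t₁ t₂ p₁ p₂ a b → K * (C * C) ≡ D * D + D * V * t₁ + V * V * K → M * (E * E) ≡ D * D + D * V * t₂ + V * V * M → R * S ≡ E * p₁ + C * p₂ → a * a ≡ p₁ + ι (ℤ.+ 2) * C → b * b ≡ p₂ + ι (ℤ.+ 2) * E → K * p₁ ≡ D * t₁ + ι (ℤ.+ 2) * (V * K) → M * p₂ ≡ D * t₂ + ι (ℤ.+ 2) * (V * M) → K * M * ((C + E + R) * (C + E + S) + (C + E - R) * (C + E - S)) ≡ K * M * (a * b * (a * b)) + (ι (ℤ.+ 2) * K + ι (ℤ.+ 2) * M - t₁ * t₂) * (D * D)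
split-sum K M C E R S D V t₁ t₂ p₁ p₂ a b h₁ h₂ h₃ h₄ h₅ h₆ h₇ = trans (𝒪I.identity (v 0F ⊗ v 1F ⊗ ((v 2F ⊕ v 3F ⊕ v 4F) ⊗ (v 2F ⊕ v 3F ⊕ v 5F) ⊕ (v 2F ⊕ v 3F ⊖ v 4F) ⊗ (v 2F ⊕ v 3F ⊖ v 5F))) (v 0F ⊗ v 1F ⊗ (v (Fin.suc (Fin.suc (Fin.suc 9F))) ⊗ v (Fin.suc (Fin.suc (Fin.suc (Fin.suc 9F)))) ⊗ (v (Fin.suc (Fin.suc (Fin.suc 9F))) ⊗ v (Fin.suc (Fin.suc (Fin.suc (Fin.suc 9F)))))) ⊕ (# (ℤ.+ 2) ⊗ v 0F ⊕ # (ℤ.+ 2) ⊗ v 1F ⊖ v 8F ⊗ v 9F) ⊗ (v 6F ⊗ v 6F) ⊕ # (ℤ.+ 2) ⊗ v 1F ⊗ (v 0F ⊗ (v 2F ⊗ v 2F) ⊖ (v 6F ⊗ v 6F ⊕ v 6F ⊗ v 7F ⊗ v 8F ⊕ v 7F ⊗ v 7F ⊗ v 0F)) ⊕ # (ℤ.+ 2) ⊗ v 0F ⊗ (v 1F ⊗ (v 3F ⊗ v 3F) ⊖ (v 6F ⊗ v 6F ⊕ v 6F ⊗ v 7F ⊗ v 9F ⊕ v 7F ⊗ v 7F ⊗ v 1F)) ⊕ # (ℤ.+ 2) ⊗ v 0F ⊗ v 1F ⊗ (v 4F ⊗ v 5F ⊖ (v 3F ⊗ v (Fin.suc 9F) ⊕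 v 2F ⊗ v (Fin.suc (Fin.suc 9F)))) ⊕ (# (ℤ.+ 0) ⊖ v 0F ⊗ v 1F ⊗ v (Fin.suc (Fin.suc (Fin.suc (Fin.suc 9F)))) ⊗ v (Fin.suc (Fin.suc (Fin.suc (Fin.suc 9F))))) ⊗ (v (Fin.suc (Fin.suc (Fin.suc 9F))) ⊗ v (Fin.suc (Fin.suc (Fin.suc 9F))) ⊖ (v (Fin.suc 9F) ⊕ # (ℤ.+ 2) ⊗ v 2F)) ⊕ (# (ℤ.+ 0) ⊖ v 0F ⊗ v 1F ⊗ (v (Fin.suc 9F) ⊕ # (ℤ.+ 2) ⊗ v 2F)) ⊗ (v (Fin.suc (Fin.suc (Fin.suc (Fin.suc 9F)))) ⊗ v (Fin.suc (Fin.suc (Fin.suc (Fin.suc 9F)))) ⊖ (v (Fin.suc (Fin.suc 9F)) ⊕ # (ℤ.+ 2) ⊗ v 3F)) ⊕ (# (ℤ.+ 0) ⊖ v 1F ⊗ v (Fin.suc (Fin.suc 9F))) ⊗ (v 0F ⊗ v (Fin.suc 9F) ⊖ (v 6F ⊗ v 8F ⊕ # (ℤ.+ 2) ⊗ (v 7F ⊗ v 0F))) ⊕ (# (ℤ.+ 0) ⊖ v 6F ⊗ v 8F ⊖ # (ℤ.+ 2) ⊗ v 7F ⊗ v 0F) ⊗ (v 1F ⊗ v (Fin.suc (Fin.suc 9F)) ⊖ (v 6F ⊗ v 9F ⊕ # (ℤ.+ 2) ⊗ (v 7F ⊗ v 1F)))) refl (K ∷ M ∷ C ∷ E ∷ R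 ∷ S ∷ D ∷ V ∷ t₁ ∷ t₂ ∷ p₁ ∷ p₂ ∷ a ∷ b ∷ [])) (trans (𝒪I.vanish h₇) (trans (𝒪I.vanish h₆) (trans (𝒪I.vanish h₅) (trans (𝒪I.vanish h₄) (trans (𝒪I.vanish h₃) (trans (𝒪I.vanish h₂) (𝒪I.vanish h₁)))))))
split-assemble-product : ∀ K M κ F G F′ G′ β a b D → K * M * (F * G) ≡ a * (D * D) → K * M * (F′ * G′) ≡ b * (D * D) → κ ≡ K * M → β ≡ κ * κ * (a * b) → κ * κ * (F * F′) * (κ * κ * (G * G′)) ≡ β * (D * D * (D * D))
split-assemble-product K M κ F G F′ G′ β a b D h₁ h₂ h₃ h₄ = trans (𝒪I.identity (v 2F ⊗ v 2F ⊗ (v 3F ⊗ v 5F) ⊗ (v 2F ⊗ v 2F ⊗ (v 4F ⊗ v 6F))) (v 7F ⊗ (v (Fin.suc 9F) ⊗ v (Fin.suc 9F) ⊗ (v (Fin.suc 9F) ⊗ v (Fin.suc 9F))) ⊕ v 2F ⊗ v 2F ⊗ v 0F ⊗ v 1F ⊗ v 5F ⊗ v 6F ⊗ (v 0F ⊗ v 1F ⊗ (v 3F ⊗ v 4F) ⊖ v 8F ⊗ (v (Fin.suc 9F) ⊗ v (Fin.suc 9F))) ⊕ v 2F ⊗ v 2F ⊗ v 8F ⊗ v (Fin.suc 9F) ⊗ v (Fin.suc 9F) ⊗ (v 0F ⊗ v 1F ⊗ (v 5F ⊗ v 6F) ⊖ v 9F ⊗ (v (Fin.suc 9F) ⊗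 v (Fin.suc 9F))) ⊕ v 2F ⊗ v 2F ⊗ v 3F ⊗ v 4F ⊗ v 5F ⊗ v 6F ⊗ (v 2F ⊕ v 0F ⊗ v 1F) ⊗ (v 2F ⊖ v 0F ⊗ v 1F) ⊕ (# (ℤ.+ 0) ⊖ v (Fin.suc 9F) ⊗ v (Fin.suc 9F) ⊗ v (Fin.suc 9F) ⊗ v (Fin.suc 9F)) ⊗ (v 7F ⊖ v 2F ⊗ v 2F ⊗ (v 8F ⊗ v 9F))) refl (K ∷ M ∷ κ ∷ F ∷ G ∷ F′ ∷ G′ ∷ β ∷ a ∷ b ∷ D ∷ [])) (trans (𝒪I.vanish h₄) (trans (𝒪I.vanish h₃) (trans (𝒪I.vanish h₂) (𝒪I.vanish h₁))))
split-assemble-sum : ∀ K M κ F G x y α a D → K * M * (F + G) ≡ K * M * (x * y * (x * y)) + a * (D * D) → κ ≡ K * M → α ≡ κ * a → κ * κ * F + κ * κ * G ≡ κ * (x * y) * (κ * (x * y)) + α * (D * D)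
split-assemble-sum K M κ F G x y α a D h₁ h₂ h₃ = trans (𝒪I.identity (v 2F ⊗ v 2F ⊗ v 3F ⊕ v 2F ⊗ v 2F ⊗ v 4F) (v 2F ⊗ (v 5F ⊗ v 6F) ⊗ (v 2F ⊗ (v 5F ⊗ v 6F)) ⊕ v 7F ⊗ (v 9F ⊗ v 9F) ⊕ v 2F ⊗ (v 0F ⊗ v 1F ⊗ (v 3F ⊕ v 4F) ⊖ (v 0F ⊗ v 1F ⊗ (v 5F ⊗ v 6F ⊗ (v 5F ⊗ v 6F)) ⊕ v 8F ⊗ (v 9F ⊗ v 9F))) ⊕ (v 2F ⊗ (v 3F ⊕ v 4F) ⊖ v 2F ⊗ (v 5F ⊗ v 6F ⊗ (v 5F ⊗ v 6F))) ⊗ (v 2F ⊖ v 0F ⊗ v 1F) ⊕ (# (ℤ.+ 0) ⊖ v 9F ⊗ v 9F) ⊗ (v 7F ⊖ v 2F ⊗ v 8F)) refl (K ∷ M ∷ κ ∷ F ∷ G ∷ x ∷ y ∷ α ∷ a ∷ D ∷ [])) (trans (𝒪I.vanish h₃) (trans (𝒪I.vanish h₂) (𝒪I.vanish h₁)))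
pair-squares : ∀ x y → x * y * (x * y) ≡ x * x * (y * y)
pair-squares x y = 𝒪I.identity (v 0F ⊗ v 1F ⊗ (v 0F ⊗ v 1F)) (v 0F ⊗ v 0F ⊗ (v 1F ⊗ v 1F)) refl (x ∷ y ∷ [])
group-squares : ∀ k s x y → k * s * (x * y) ≡ k * x * (s * y)
group-squares k s x y = 𝒪I.identity (v 0F ⊗ v 1F ⊗ (v 2F ⊗ v 3F)) (v 0F ⊗ v 2F ⊗ (v 1F ⊗ v 3F)) refl (k ∷ s ∷ x ∷ y ∷ [])
group-scalars : ∀ K M x → K * M * x ≡ K * (M * x)
group-scalars K M x = 𝒪I.identity (v 0F ⊗ v 1F ⊗ v 2F) (v 0F ⊗ (v 1F ⊗ v 2F)) refl (K ∷ M ∷ x ∷ [])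
swap-scalars : ∀ K M x → K * M * x ≡ M * (K * x)
swap-scalars K M x = 𝒪I.identity (v 0F ⊗ v 1F ⊗ v 2F) (v 1F ⊗ (v 0F ⊗ v 2F)) refl (K ∷ M ∷ x ∷ [])
swap-factors : ∀ k s x → s * (k * x) ≡ k * (s * x)
swap-factors k s x = 𝒪I.identity (v 1F ⊗ (v 0F ⊗ v 2F)) (v 0F ⊗ (v 1F ⊗ v 2F)) refl (k ∷ s ∷ x ∷ [])

-- The analogue of Base-point built from c ± d, for k = 1 - ρ and s = 1 - σ with base point u = v.
module Split (k s κ α β : 𝒪) (κ≡ : κ ≡ k ♯ * s ♯)
  (α≡ : α ≡ κ * (𝟚 * k ♯ + 𝟚 * s ♯ - Tr⟨ 𝟙 , k ⟩ * Tr⟨ 𝟙 , s ⟩))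
  (β≡ : β ≡ κ * κ * ((k ♯ + s ♯ - Tr⟨ k , s ⟩) * (k ♯ + s ♯ - Tr⟨ 𝟙 , k * s ⟩))) where

  ♯-square : ∀ {k c} δ w → k * (c * c) ≡ ι δ + ι w * k → k ♯ * (c ♯ * c ♯) ≡ ι δ * ι δ + ι δ * ι w * Tr⟨ 𝟙 , k ⟩ + ι w * ι w * k ♯
  ♯-square {k} {c} δ w e = trans (cong (λ x → k ♯ * x) (sym (♯-* c c))) (trans (sym (♯-* k (c * c))) (trans (cong _♯ e) (♯-linear δ w k)))

  twice : ∀ D t V K → D * t + V * (ι (ℤ.+ 2) * K) ≡ D * t + ι (ℤ.+ 2) * (V * K)
  twice D t V K = 𝒪I.identity (v 0F ⊗ v 1F ⊕ v 2F ⊗ (# (ℤ.+ 2) ⊗ v 3F)) (v 0F ⊗ v 1F ⊕ # (ℤ.+ 2) ⊗ (v 2F ⊗ v 3F)) refl (D ∷ t ∷ V ∷ K ∷ [])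
  k*𝟙 : ∀ k → k * ι (ℤ.+ 1) ≡ k
  k*𝟙 k = 𝒪I.identity (v 0F ⊗ # (ℤ.+ 1)) (v 0F) refl (k ∷ [])

  Tr-square : ∀ {k c} δ w → k * (c * c) ≡ ι δ + ι w * k → k ♯ * Tr⟨ 𝟙 , c * c ⟩ ≡ ι δ * Tr⟨ 𝟙 , k ⟩ + 𝟚 * (ι w * k ♯)
  Tr-square {k} {c} δ w e = trans (♯-Tr k 𝟙 (c * c)) (trans (cong₂ Tr⟨_,_⟩ (k*𝟙 k) e) (trans (Tr-comm k (ι δ + ι w * k))
    (trans (Tr-linear δ w k k) (trans (cong (λ x → ι δ * Tr⟨ 𝟙 , k ⟩ + ι w * x) (Tr-self k)) (twice (ι δ) Tr⟨ 𝟙 , k ⟩ (ι w) (k ♯))))))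

  -- Written with the two other conjugates, the first root is κ² (c′ + d′)(c″ + d″)(c′ + d″)(c″ +
  -- d′) and the second has d replaced by -d. The four factors pair up as C + E ± R and C + E ± S,
  -- where R = c′d″ + c″d′ and S = c′d′ + c″d″, and κ² times the resultant of the two quadratic
  -- forms is β.
  split-datum : ∀ {c d} δ w → k * (c * c) ≡ ι δ + ι w * k → s * (d * d) ≡ ι δ + ι w * s → ∃ λ X → ∃ λ (D : Datum α β X (ι δ)) → Datum.Z D ≡ κ * (Tr⟨ 𝟙 , c ⟩ * Tr⟨ 𝟙 , d ⟩)
  split-datum {c} {d} δ w c≡ d≡ = _ , datum _ (κ * (Tr⟨ 𝟙 , c ⟩ * Tr⟨ 𝟙 , d ⟩))
      (split-assemble-product (k ♯) (s ♯) κ (c ♯ + d ♯ + R) (c ♯ + d ♯ - R) (c ♯ + d ♯ + S) (c ♯ + d ♯ - S) β _ _ (ι δ)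
        (split-half (k ♯) (s ♯) (c ♯) (d ♯) R Tr⟨ c * c , d * d ⟩ (ι δ) (ι w) Tr⟨ 𝟙 , k ⟩ Tr⟨ 𝟙 , s ⟩ Tr⟨ k , s ⟩ hc hd (Tr² c d) crossed)
        (split-half (k ♯) (s ♯) (c ♯) (d ♯) S Tr⟨ 𝟙 , c * d * (c * d) ⟩ (ι δ) (ι w) Tr⟨ 𝟙 , k ⟩ Tr⟨ 𝟙 , s ⟩ Tr⟨ 𝟙 , k * s ⟩ hc hd
          (trans (Tr-𝟙² (c * d)) (cong (λ x → Tr⟨ 𝟙 , c * d * (c * d) ⟩ + 𝟚 * x) (♯-* c d))) straight)
        κ≡ β≡)
      (split-assemble-sum (k ♯) (s ♯) κ ((c ♯ + d ♯ + R) * (c ♯ + d ♯ + S)) ((c ♯ + d ♯ - R) * (c ♯ + d ♯ - S)) Tr⟨ 𝟙 , c ⟩ Tr⟨ 𝟙 , d ⟩ α _ (ι δ)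
        (split-sum (k ♯) (s ♯) (c ♯) (d ♯) R S (ι δ) (ι w) Tr⟨ 𝟙 , k ⟩ Tr⟨ 𝟙 , s ⟩ Tr⟨ 𝟙 , c * c ⟩ Tr⟨ 𝟙 , d * d ⟩ Tr⟨ 𝟙 , c ⟩ Tr⟨ 𝟙 , d ⟩ hc hd (Tr-Tr c d) (Tr-𝟙² c) (Tr-𝟙² d)
          (Tr-square δ w c≡) (Tr-square δ w d≡)) κ≡ α≡)
    , refl
    where
    R S : 𝒪
    R = Tr⟨ c , d ⟩
    S = Tr⟨ 𝟙 , c * d ⟩
    hc = ♯-square δ w c≡
    hd = ♯-square δ w d≡
    crossed : k ♯ * s ♯ * Tr⟨ c * c , d * d ⟩ ≡ ι δ * ι δ * Tr⟨ k , s ⟩ + ι δ * ι w * (s ♯ * Tr⟨ 𝟙 , k ⟩ + k ♯ * Tr⟨ 𝟙 , s ⟩) + 𝟚 * (ι w * ι w * (k ♯ * s ♯))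
    crossed = trans (swap-scalars (k ♯) (s ♯) Tr⟨ c * c , d * d ⟩) (trans (cong (λ x → s ♯ * x) (♯-Tr k (c * c) (d * d))) (trans (♯-Tr s (k * (c * c)) (k * (d * d)))
      (trans (cong₂ Tr⟨_,_⟩ (cong (λ x → s * x) c≡) (trans (swap-factors k s (d * d)) (cong (λ x → k * x) d≡))) (Tr-crossed δ w k s))))
    straight : k ♯ * s ♯ * Tr⟨ 𝟙 , c * d * (c * d) ⟩ ≡ ι δ * ι δ * Tr⟨ 𝟙 , k * s ⟩ + ι δ * ι w * (s ♯ * Tr⟨ 𝟙 , k ⟩ + k ♯ * Tr⟨ 𝟙 , s ⟩) + 𝟚 * (ι w * ι w * (k ♯ * s ♯))
    straight = trans (cong₂ _*_ (sym (♯-* k s)) (cong Tr⟨ 𝟙 ,_⟩ (pair-squares c d))) (trans (♯-Tr (k * s) 𝟙 (c * c * (d * d)))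
      (trans (cong₂ Tr⟨_,_⟩ (k*𝟙 (k * s)) (trans (group-squares k s (c * c) (d * d)) (cong₂ _*_ c≡ d≡))) (Tr-straight δ w k s)))

-- The residues (0 , 3) in the class pair of 1 : 1. Now u - w is odd, while both roots turn out to
-- be even, so the sieve works with their halves.
module Split-II where
  k s κ α β β₄ γ₁ δ₁ h x₁ x₂ : 𝒪
  k = ⟦ cls false true false false false false ⟧ᶜ
  s = ⟦ cls true true false false true false ⟧ᶜ
  κ = ⟨ ℤ.+ 7 , -[1+ 1 ] , -[1+ 0 ] ⟩
  α = ⟨ -[1+ 88 ] , ℤ.+ 29 , ℤ.+ 2 ⟩
  β = ⟨ ℤ.+ 60 , -[1+ 39 ] , ℤ.+ 200 ⟩
  β₄ = ⟨ ℤ.+ 15 , -[1+ 9 ] , ℤ.+ 50 ⟩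
  γ₁ = ⟨ ℤ.+ 2 , ℤ.+ 1 , ℤ.+ 1 ⟩
  δ₁ = ⟨ ℤ.+ 5 , -[1+ 1 ] , ℤ.+ 1 ⟩
  h = ⟨ ℤ.+ 2 , ℤ.+ 1 , ℤ.+ 1 ⟩
  x₁ = ⟨ ℤ.+ 6 , ℤ.+ 2 , ℤ.+ 3 ⟩
  x₂ = ⟨ ℤ.+ 8 , -[1+ 0 ] , ℤ.+ 2 ⟩
  z₁ : 𝒪
  z₁ = κ * (Tr⟨ 𝟙 , γ₁ ⟩ * Tr⟨ 𝟙 , δ₁ ⟩)
  -- Half a root solves x² - hx + β₄ ≡ 0 modulo 4, whose solutions are x₁ and x₂; a class is
  -- excluded when it represents neither 2x₁ nor 2x₂ modulo 8.
  excluded-root? excluded? : 𝒪 → Bool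
  excluded-root? x = not (div? 4 (x * x - h * x + β₄)) ∨ (div? 4 (x - x₁) ∨ div? 4 (x - x₂))
  excluded? s = all𝒪 4 λ w → not (div? 8 (s * (w * w) - 𝟚 * x₁)) ∧ not (div? 8 (s * (w * w) - 𝟚 * x₂))
  opaque
    unfolding _+_ _*_ -_ _♯ Tr⟨_,_⟩ div? zero%? N dead?
    κ≡ : κ ≡ k ♯ * s ♯
    κ≡ = refl
    α≡ : α ≡ κ * (𝟚 * k ♯ + 𝟚 * s ♯ - Tr⟨ 𝟙 , k ⟩ * Tr⟨ 𝟙 , s ⟩)
    α≡ = refl
    β≡ : β ≡ κ * κ * ((k ♯ + s ♯ - Tr⟨ k , s ⟩) * (k ♯ + s ♯ - Tr⟨ 𝟙 , k * s ⟩))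
    β≡ = refl
    β₄≡ : β ≡ 𝟜 * β₄
    β₄≡ = refl
    odd-k : odd? k ≡ true
    odd-k = refl
    odd-s : odd? s ≡ true
    odd-s = refl
    odd-β₄ : odd? β₄ ≡ true
    odd-β₄ = refl
    k≡ : 𝟙 - θ ≡ k
    k≡ = refl
    s≡ : 𝟙 - θ₂ ≡ s
    s≡ = refl
    γ₁? : div? 8 (k * (γ₁ * γ₁) - (ι (ℤ.+ 0) - θ * ι (ℤ.+ 3))) ≡ true
    γ₁? = refl
    δ₁? : div? 8 (s * (δ₁ * δ₁) - (ι (ℤ.+ 0) - θ₂ * ι (ℤ.+ 3))) ≡ true
    δ₁? = refl
    h? : div? 8 (z₁ * z₁ + α * (ι -[1+ 2 ] * ι -[1+ 2 ]) - 𝟚 * h) ≡ true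
    h? = refl
    root-check : all𝒪 4 excluded-root? ≡ true
    root-check = refl
    norm-β : ι (N β) ≡ ι (ℤ.+ 1) * (power 𝟚 6 * power (ι (ℤ.+ 3)) 0 * power (ι (ℤ.+ 5)) 4)
    norm-β = refl
    sieve-roots : sieve? α β none excluded? ≡ true
    sieve-roots = refl
    nine : ι -[1+ 2 ] * ι -[1+ 2 ] ≡ 𝟙 + 𝟜 * 𝟚
    nine = refl

  smooth-β : Smooth β
  smooth-β = smooth-by-norm β 6 0 4 norm-β (*-identityˡ 𝟙)

  open Split k s κ α β κ≡ α≡ β≡

  shape : ∀ u w t k D → D ≡ u - w → ι (ℤ.+ 1) - t ≡ k → u - t * w ≡ D + w * k
  shape u w t k D h₁ h₂ = trans (𝒪I.identity (v 0F ⊖ v 2F ⊗ v 1F) (v 4F ⊕ v 1F ⊗ v 3F ⊕ (# (ℤ.+ 0) ⊖ # (ℤ.+ 1)) ⊗ (v 4F ⊖ (v 0F ⊖ v 1F)) ⊕ v 1F ⊗ (# (ℤ.+ 1) ⊖ v 2F ⊖ v 3F)) refl (u ∷ w ∷ t ∷ k ∷ D ∷ [])) (trans (𝒪I.vanish h₂) (𝒪I.vanish h₁))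
  half-root-sum : ∀ X X̄ x x̄ S h j → X + X̄ ≡ S → X ≡ ι (ℤ.+ 2) * x → X̄ ≡ ι (ℤ.+ 2) * x̄ → S ≡ ι (ℤ.+ 2) * h + ι (ℤ.+ 8) * j → ι (ℤ.+ 2) * (x + x̄) ≡ ι (ℤ.+ 2) * (h + ι (ℤ.+ 4) * j)
  half-root-sum X X̄ x x̄ S h j h₁ h₂ h₃ h₄ = trans (𝒪I.identity (# (ℤ.+ 2) ⊗ (v 2F ⊕ v 3F)) (# (ℤ.+ 2) ⊗ (v 5F ⊕ # (ℤ.+ 4) ⊗ v 6F) ⊕ # (ℤ.+ 1) ⊗ (v 0F ⊕ v 1F ⊖ v 4F) ⊕ (# (ℤ.+ 0) ⊖ # (ℤ.+ 1)) ⊗ (v 0F ⊖ # (ℤ.+ 2) ⊗ v 2F) ⊕ (# (ℤ.+ 0) ⊖ # (ℤ.+ 1)) ⊗ (v 1F ⊖ # (ℤ.+ 2) ⊗ v 3F) ⊕ # (ℤ.+ 1) ⊗ (v 4F ⊖ (# (ℤ.+ 2) ⊗ v 5F ⊕ # (ℤ.+ 8) ⊗ v 6F))) refl (X ∷ X̄ ∷ x ∷ x̄ ∷ S ∷ h ∷ j ∷ [])) (trans (𝒪I.vanish h₄) (trans (𝒪I.vanish h₃) (trans (𝒪I.vanish h₂) (𝒪I.vanish h₁))))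
  half-root-product : ∀ X X̄ x x̄ β β₄ g → X * X̄ ≡ β * g → X ≡ ι (ℤ.+ 2) * x → X̄ ≡ ι (ℤ.+ 2) * x̄ → β ≡ ι (ℤ.+ 4) * β₄ → ι (ℤ.+ 4) * (x * x̄) ≡ ι (ℤ.+ 4) * (β₄ * g)
  half-root-product X X̄ x x̄ β β₄ g h₁ h₂ h₃ h₄ = trans (𝒪I.identity (# (ℤ.+ 4) ⊗ (v 2F ⊗ v 3F)) (# (ℤ.+ 4) ⊗ (v 5F ⊗ v 6F) ⊕ # (ℤ.+ 1) ⊗ (v 0F ⊗ v 1F ⊖ v 4F ⊗ v 6F) ⊕ (# (ℤ.+ 0) ⊖ v 1F) ⊗ (v 0F ⊖ # (ℤ.+ 2) ⊗ v 2F) ⊕ (# (ℤ.+ 0) ⊖ # (ℤ.+ 2) ⊗ v 2F) ⊗ (v 1F ⊖ # (ℤ.+ 2) ⊗ v 3F) ⊕ v 6F ⊗ (v 4F ⊖ # (ℤ.+ 4) ⊗ v 5F)) refl (X ∷ X̄ ∷ x ∷ x̄ ∷ β ∷ β₄ ∷ g ∷ [])) (trans (𝒪I.vanish h₄) (trans (𝒪I.vanish h₃) (trans (𝒪I.vanish h₂) (𝒪I.vanish h₁))))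
  half-root : ∀ x x̄ h j β₄ g i → x + x̄ ≡ h + ι (ℤ.+ 4) * j → x * x̄ ≡ β₄ * g → g ≡ ι (ℤ.+ 1) + ι (ℤ.+ 4) * i → x * x - h * x + β₄ ≡ ι (ℤ.+ 4) * (x * j - β₄ * i)
  half-root x x̄ h j β₄ g i h₁ h₂ h₃ = trans (𝒪I.identity (v 0F ⊗ v 0F ⊖ v 2F ⊗ v 0F ⊕ v 4F) (# (ℤ.+ 4) ⊗ (v 0F ⊗ v 3F ⊖ v 4F ⊗ v 6F) ⊕ v 0F ⊗ (v 0F ⊕ v 1F ⊖ (v 2F ⊕ # (ℤ.+ 4) ⊗ v 3F)) ⊕ (# (ℤ.+ 0) ⊖ # (ℤ.+ 1)) ⊗ (v 0F ⊗ v 1F ⊖ v 4F ⊗ v 5F) ⊕ (# (ℤ.+ 0) ⊖ v 4F) ⊗ (v 5F ⊖ (# (ℤ.+ 1) ⊕ # (ℤ.+ 4) ⊗ v 6F))) refl (x ∷ x̄ ∷ h ∷ j ∷ β₄ ∷ g ∷ i ∷ [])) (trans (𝒪I.vanish h₃) (trans (𝒪I.vanish h₂) (𝒪I.vanish h₁)))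
  even-even : ∀ X X̄ S k h j → X + X̄ ≡ S → X ≡ ι (ℤ.+ 2) * k → S ≡ ι (ℤ.+ 2) * h + ι (ℤ.+ 8) * j → X̄ ≡ ι (ℤ.+ 2) * (h + ι (ℤ.+ 4) * j - k)
  even-even X X̄ S k h j h₁ h₂ h₃ = trans (𝒪I.identity (v 1F) (# (ℤ.+ 2) ⊗ (v 4F ⊕ # (ℤ.+ 4) ⊗ v 5F ⊖ v 3F) ⊕ # (ℤ.+ 1) ⊗ (v 0F ⊕ v 1F ⊖ v 2F) ⊕ (# (ℤ.+ 0) ⊖ # (ℤ.+ 1)) ⊗ (v 0F ⊖ # (ℤ.+ 2) ⊗ v 3F) ⊕ # (ℤ.+ 1) ⊗ (v 2F ⊖ (# (ℤ.+ 2) ⊗ v 4F ⊕ # (ℤ.+ 8) ⊗ v 5F))) refl (X ∷ X̄ ∷ S ∷ k ∷ h ∷ j ∷ [])) (trans (𝒪I.vanish h₃) (trans (𝒪I.vanish h₂) (𝒪I.vanish h₁)))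
  fourth-power : ∀ g j → g ≡ ι (ℤ.+ 1) + ι (ℤ.+ 4) * j → g * g ≡ ι (ℤ.+ 1) + ι (ℤ.+ 4) * (ι (ℤ.+ 2) * j + ι (ℤ.+ 4) * j * j)
  fourth-power g j h₁ = trans (𝒪I.identity (v 0F ⊗ v 0F) (# (ℤ.+ 1) ⊕ # (ℤ.+ 4) ⊗ (# (ℤ.+ 2) ⊗ v 1F ⊕ # (ℤ.+ 4) ⊗ v 1F ⊗ v 1F) ⊕ (v 0F ⊕ # (ℤ.+ 1) ⊕ # (ℤ.+ 4) ⊗ v 1F) ⊗ (v 0F ⊖ (# (ℤ.+ 1) ⊕ # (ℤ.+ 4) ⊗ v 1F))) refl (g ∷ j ∷ [])) (𝒪I.vanish h₁)
  square-three : ∀ g m j i → g * g ≡ m + ι (ℤ.+ 8) * j → m ≡ ι (ℤ.+ 1) + ι (ℤ.+ 4) * i → g * g ≡ ι (ℤ.+ 1) + ι (ℤ.+ 4) * (i + ι (ℤ.+ 2) * j)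
  square-three g m j i h₁ h₂ = trans (𝒪I.identity (v 0F ⊗ v 0F) (# (ℤ.+ 1) ⊕ # (ℤ.+ 4) ⊗ (v 3F ⊕ # (ℤ.+ 2) ⊗ v 2F) ⊕ # (ℤ.+ 1) ⊗ (v 0F ⊗ v 0F ⊖ (v 1F ⊕ # (ℤ.+ 8) ⊗ v 2F)) ⊕ # (ℤ.+ 1) ⊗ (v 1F ⊖ (# (ℤ.+ 1) ⊕ # (ℤ.+ 4) ⊗ v 3F))) refl (g ∷ m ∷ j ∷ i ∷ [])) (trans (𝒪I.vanish h₂) (𝒪I.vanish h₁))
  twice-≈ : ∀ x y j → x ≡ y + ι (ℤ.+ 4) * j → ι (ℤ.+ 2) * x ≡ ι (ℤ.+ 2) * y + ι (ℤ.+ 8) * j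
  twice-≈ x y j h₁ = trans (𝒪I.identity (# (ℤ.+ 2) ⊗ v 0F) (# (ℤ.+ 2) ⊗ v 1F ⊕ # (ℤ.+ 8) ⊗ v 2F ⊕ # (ℤ.+ 2) ⊗ (v 0F ⊖ (v 1F ⊕ # (ℤ.+ 4) ⊗ v 2F))) refl (x ∷ y ∷ j ∷ [])) (𝒪I.vanish h₁)
  minus-three : ∀ u w a b → u ≡ ℤ.+ 0 ℤ.+ ℤ.+ 8 ℤ.* a → w ≡ ℤ.+ 3 ℤ.+ ℤ.+ 8 ℤ.* b → u ℤ.- w ≡ ℤ.+ 0 ℤ.- ℤ.+ 3 ℤ.+ ℤ.+ 8 ℤ.* (a ℤ.- b)
  minus-three u w a b h₁ h₂ = trans (ℤI.identity (v 0F ⊖ v 1F) (# (ℤ.+ 0) ⊖ # (ℤ.+ 3) ⊕ # (ℤ.+ 8) ⊗ (v 2F ⊖ v 3F) ⊕ # (ℤ.+ 1) ⊗ (v 0F ⊖ (# (ℤ.+ 0) ⊕ # (ℤ.+ 8) ⊗ v 2F)) ⊕ (# (ℤ.+ 0) ⊖ # (ℤ.+ 1)) ⊗ (v 1F ⊖ (# (ℤ.+ 3) ⊕ # (ℤ.+ 8) ⊗ v 3F))) refl (u ∷ w ∷ a ∷ b ∷ [])) (trans (ℤI.vanish {ℤ.+ 0 ℤ.- ℤ.+ 3 ℤ.+ ℤ.+ 8 ℤ.* (a ℤ.- b) ℤ.+ ℤ.+ 1 ℤ.* (u ℤ.- (ℤ.+ 0 ℤ.+ ℤ.+ 8 ℤ.*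 a))} {ℤ.+ 0 ℤ.- ℤ.+ 1} h₂) (ℤI.vanish {ℤ.+ 0 ℤ.- ℤ.+ 3 ℤ.+ ℤ.+ 8 ℤ.* (a ℤ.- b)} {ℤ.+ 1} h₁))

  impossible : ∀ {c d} u w a b → u ≡ ℤ.+ 0 ℤ.+ ℤ.+ 8 ℤ.* a → w ≡ ℤ.+ 3 ℤ.+ ℤ.+ 8 ℤ.* b → k * (c * c) ≡ ι u - θ * ι w → s * (d * d) ≡ ι u - θ₂ * ι w → ⊥
  impossible {c} {d} u w a b u≡ w≡ c≡ d≡ = go
      (unit-root c γ₁ (odd?-sound k odd-k) (≈-trans (≡⇒≈ c≡) (≈-- (ι-≈8 {a = a} u≡) (≈-* ≈-refl (ι-≈8 {a = b} w≡)))) (≈?-sound 8 _ _ γ₁?))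
      (unit-root d δ₁ (odd?-sound s odd-s) (≈-trans (≡⇒≈ d≡) (≈-- (ι-≈8 {a = a} u≡) (≈-* ≈-refl (ι-≈8 {a = b} w≡)))) (≈?-sound 8 _ _ δ₁?))
    where
    δ = u ℤ.- w
    g = ι δ
    g≡ : g ≡ ι u - ι w
    g≡ = trans (ι-+ u (ℤ.- w)) (cong (λ x → ι u + x) (ι-neg w))
    g²≈ : g * g ≈ ι -[1+ 2 ] * ι -[1+ 2 ] [ 𝟠 ]
    g²≈ = ≈-* g≈ g≈
      where
      g≈ : g ≈ ι -[1+ 2 ] [ 𝟠 ]
      g≈ = ι-≈8 {a = a ℤ.- b} (minus-three u w a b u≡ w≡)
    g⁴≈ : g * g * (g * g) ≈ 𝟙 [ 𝟜 ]
    g⁴≈ = fourth g²≈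
      where
      fourth : g * g ≈ ι -[1+ 2 ] * ι -[1+ 2 ] [ 𝟠 ] → g * g * (g * g) ≈ 𝟙 [ 𝟜 ]
      fourth (by j e) = by _ (fourth-power (g * g) _ (square-three g _ j 𝟚 e nine))
    og : Odd g
    og = odd-*ˡ (odd-*ˡ (≈𝟙⇒odd (4⇒2 g⁴≈)))
    go : (∃ λ z → z * z ≡ c * c × z ≈ γ₁ [ 𝟜 ]) → (∃ λ z → z * z ≡ d * d × z ≈ δ₁ [ 𝟜 ]) → ⊥
    go (c′ , cc≡ , c≈) (d′ , dd≡ , d≈) = with-datum (split-datum {c′} {d′} δ w
        (trans (cong (λ z → k * z) cc≡) (trans c≡ (shape (ι u) (ι w) θ k g g≡ k≡)))
        (trans (cong (λ z → s * z) dd≡) (trans d≡ (shape (ι u) (ι w) θ₂ s g g≡ s≡))))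
      where
      with-datum : (∃ λ X → ∃ λ (D : Datum α β X g) → Datum.Z D ≡ κ * (Tr⟨ 𝟙 , c′ ⟩ * Tr⟨ 𝟙 , d′ ⟩)) → ⊥
      with-datum (X , D@(datum X̄ Z product sum) , Z≡) = halves (parity X) (parity X̄)
          (≈-trans (≈-+ (≈-* ≈-refl ≈-refl) ≈-refl) S≈)
        where
        Z≈ : Z ≈ z₁ [ 𝟜 ]
        Z≈ = ≈-trans (≡⇒≈ Z≡) (≈-* ≈-refl (≈-* (≈-Tr 𝟙 c≈) (≈-Tr 𝟙 d≈)))
        S≈ : Z * Z + α * (g * g) ≈ 𝟚 * h [ 𝟠 ]
        S≈ = ≈-trans (≈-+ (²-4⇒8 Z≈) (≈-* ≈-refl g²≈)) (≈?-sound 8 _ _ h?)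
        at-roots : ∀ x x̄ → X ≡ 𝟚 * x → X̄ ≡ 𝟚 * x̄ → Z * Z + α * (g * g) ≈ 𝟚 * h [ 𝟠 ] → ⊥
        at-roots x x̄ X≡ X̄≡ (by j S≡) = root-mod (all𝒪-sound 4 excluded-root? root-check x) g⁴≈
          where
          xx̄≡ : x * x̄ ≡ β₄ * (g * g * (g * g))
          xx̄≡ = *-cancelˡ (ι≢𝟘 3) (half-root-product X X̄ x x̄ β β₄ _ product X≡ X̄≡ β₄≡)
          x+x̄≡ = *-cancelˡ (ι≢𝟘 1) (half-root-sum X X̄ x x̄ _ h j sum X≡ X̄≡ S≡)
          ox : Odd x
          ox = odd-*ˡ (subst Odd (sym xx̄≡) (odd-* (odd?-sound β₄ odd-β₄) (odd-* (odd-* og og) (odd-* og og))))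
          X≢𝟘 : ¬ X ≡ 𝟘
          X≢𝟘 e = *≢𝟘 (ι≢𝟘 1) (odd≢𝟘 ox) (trans (sym X≡) e)
          nf = normal-form smooth-β X≢𝟘 (odd≢𝟘 og) D
          y = NormalForm.h nf * NormalForm.g′ nf
          class = ⟦ NormalForm.class nf ⟧ᶜ
          near-root : (w′ : 𝒪) → class * (w′ * w′) ≈ 𝟚 * x [ 𝟠 ] → x ≈ x₁ [ 𝟜 ] ⊎ x ≈ x₂ [ 𝟜 ] → not (div? 8 (class * (w′ * w′) - 𝟚 * x₁)) ∧ not (div? 8 (class * (w′ * w′) - 𝟚 * x₂)) ≡ true → ⊥
          near-root w′ e (inj₁ (by i p)) t = not-true (div?-complete 8 (≈⇒∣- (≈-trans e (by i (twice-≈ x x₁ i p))))) (proj₁ (∧-split _ _ t))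
          near-root w′ e (inj₂ (by i p)) t = not-true (div?-complete 8 (≈⇒∣- (≈-trans e (by i (twice-≈ x x₂ i p))))) (proj₂ (∧-split (not (div? 8 (class * (w′ * w′) - 𝟚 * x₁))) _ t))
          refute : x ≈ x₁ [ 𝟜 ] ⊎ x ≈ x₂ [ 𝟜 ] → ⊥
          refute near = absurd (sieve none excluded? sieve-roots nf λ t → at (all𝒪-sound 4 (λ w → not (div? 8 (class * (w * w) - 𝟚 * x₁)) ∧ not (div? 8 (class * (w * w) - 𝟚 * x₂))) t y))
            where
            absurd : false ≡ true → ⊥
            absurd ()
            at : (∃ λ r → y ≈ r [ 𝟜 ] × not (div? 8 (class * (r * r) - 𝟚 * x₁)) ∧ not (div? 8 (class * (r * r) - 𝟚 * x₂)) ≡ true) → ⊥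
            at (r , y≈ , t) = near-root r (≈-trans (≈-* ≈-refl (²-4⇒8 (≈-sym y≈))) (≡⇒≈ (trans (sym (NormalForm.X≡ nf)) X≡))) near t
          root-mod : (∃ λ r → x ≈ r [ 𝟜 ] × excluded-root? r ≡ true) → g * g * (g * g) ≈ 𝟙 [ 𝟜 ] → ⊥
          root-mod (r , x≈ , t) (by i g⁴≡) = ∨-case (not (div? 4 (r * r - h * r + β₄))) _
            (not-true (div?-complete 4 (∣-resp-≈ (≈-+ (≈-- (≈-* x≈ x≈) (≈-* ≈-refl x≈)) ≈-refl) (_ , half-root x x̄ h j β₄ _ i x+x̄≡ xx̄≡ g⁴≡))))
            (∨-case (div? 4 (r - x₁)) _ (λ e → refute (inj₁ (≈-trans x≈ (≈?-sound 4 r x₁ e)))) (λ e → refute (inj₂ (≈-trans x≈ (≈?-sound 4 r x₂ e))))) t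
        product-even : ∀ X X̄ k β β₄ g → X * X̄ ≡ β * g → β ≡ ι (ℤ.+ 4) * β₄ → X * X̄ ≡ ι (ℤ.+ 2) * (ι (ℤ.+ 2) * β₄ * g)
        product-even X X̄ k β β₄ g h₁ h₂ = trans (𝒪I.identity (v 0F ⊗ v 1F) (# (ℤ.+ 2) ⊗ (# (ℤ.+ 2) ⊗ v 4F ⊗ v 5F) ⊕ # (ℤ.+ 1) ⊗ (v 0F ⊗ v 1F ⊖ v 3F ⊗ v 5F) ⊕ v 5F ⊗ (v 3F ⊖ # (ℤ.+ 4) ⊗ v 4F)) refl (X ∷ X̄ ∷ k ∷ β ∷ β₄ ∷ g ∷ [])) (trans (𝒪I.vanish h₂) (𝒪I.vanish h₁))
        halves : 𝟚 ∣𝒪 X ⊎ Odd X → 𝟚 ∣𝒪 X̄ ⊎ Odd X̄ → Z * Z + α * (g * g) ≈ 𝟚 * h [ 𝟠 ] → ⊥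
        -- The sum of the roots is even, so one even root makes the other even; two odd roots would
        -- contradict their even product.
        halves (inj₁ (x , X≡)) _ (by j S≡) = at-roots x _ X≡ (even-even X X̄ _ x h j sum X≡ S≡) (by j S≡)
        halves (inj₂ _) (inj₁ (x̄ , X̄≡)) (by j S≡) = at-roots _ x̄ (even-even X̄ X _ x̄ h j (trans (+-swap X̄ X) sum) X̄≡ S≡) X̄≡ (by j S≡)
        halves (inj₂ oX) (inj₂ oX̄) _ = even-odd (_ , product-even X X̄ 𝟘 β β₄ _ product β₄≡) (odd-* oX oX̄)

-- two-covering descent

-- The value m is 1 + z / x. The five possibilities belong to z / x = 0, 1, -2, -3 and -5, the lines
-- through the listed points.
record Ratio (u w : ℤ) : Set where
  constructor ratio
  field
    m : ℤ
    known : m ≡ ℤ.+ 1 ⊎ m ≡ ℤ.+ 2 ⊎ m ≡ -[1+ 0 ] ⊎ m ≡ -[1+ 1 ] ⊎ m ≡ -[1+ 3 ]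
    u≡ : u ≡ m ℤ.* w

-- The classes of u - θw and u - θ₂w with the residues of u and w modulo 8 that the local tests
-- leave, up to a common sign. The numeral of a constructor names the curve that treats it.
data Listed : Class → Class → ℕ → ℕ → Set where
  I₂₁ : Listed (cls false false false false false true) (cls false false false false false false) 2 1
  I₆₅ : Listed (cls false false false false false true) (cls false false false false false false) 6 5
  I₂₅ : Listed (cls false false false false false false) (cls false false false false false true) 2 5
  I₆₁ : Listed (cls false false false false false false) (cls false false false false false true) 6 1
  II₀₃ : Listed (cls false true false false false false) (cls true true false false true false) 0 3
  -- The value 8 arises from the residue 0 under the change of sign i ↦ 8 - i.
  II₈₃ : Listed (cls false true false false false false) (cls true true false false true false) 8 3
  II₁₁ : Listed (cls false true false false false false) (cls true true false false true false) 1 1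
  II₄₇ : Listed (cls false true false false false false) (cls true true false false true false) 4 7
  II₅₁ : Listed (cls false true false false false false) (cls true true false false true false) 5 1
  III₁₇ : Listed (cls false false false false true false) (cls true true false false false false) 1 7
  III₅₇ : Listed (cls false false false false true false) (cls true true false false false false) 5 7

find : ∀ s₁ s₂ i j → Maybe (Listed s₁ s₂ i j)
find (cls false false false false false true) (cls false false false false false false) 2 1 = just I₂₁
find (cls false false false false false true) (cls false false false false false false) 6 5 = just I₆₅
find (cls false false false false false false) (cls false false false false false true) 2 5 = just I₂₅
find (cls false false false false false false) (cls false false false false false true) 6 1 = just I₆₁
find (cls false true false false false false) (cls true true false false true false) 0 3 = just II₀₃
find (cls false true false false false false) (cls true true false false true false) 8 3 = just II₈₃
find (cls false true false false false false) (cls true true false false true false) 1 1 = just II₁₁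
find (cls false true false false false false) (cls true true false false true false) 4 7 = just II₄₇
find (cls false true false false false false) (cls true true false false true false) 5 1 = just II₅₁
find (cls false false false false true false) (cls true true false false false false) 1 7 = just III₁₇
find (cls false false false false true false) (cls true true false false false false) 5 7 = just III₅₇
find _ _ _ _ = nothing

from-found : ∀ {A : Set} {m : Maybe A} → is-just m ≡ true → A
from-found {m = just a} _ = a

Square-classes : Class → Class → ℤ → ℤ → Set
Square-classes s₁ s₂ u w = (∃ λ c → ⟦ s₁ ⟧ᶜ * (c * c) ≡ ι u - θ * ι w) × (∃ λ d → ⟦ s₂ ⟧ᶜ * (d * d) ≡ ι u - θ₂ * ι w)

five-times : ∀ u i a → u ≡ i ℤ.+ ℤ.+ 8 ℤ.* a → ℤ.+ 5 ℤ.* u ≡ ℤ.+ 5 ℤ.* i ℤ.+ ℤ.+ 8 ℤ.* (ℤ.+ 5 ℤ.* a)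
five-times u i a h₁ = trans (ℤI.identity (# (ℤ.+ 5) ⊗ v 0F) (# (ℤ.+ 5) ⊗ v 1F ⊕ # (ℤ.+ 8) ⊗ (# (ℤ.+ 5) ⊗ v 2F) ⊕ # (ℤ.+ 5) ⊗ (v 0F ⊖ (v 1F ⊕ # (ℤ.+ 8) ⊗ v 2F))) refl (u ∷ i ∷ a ∷ [])) (ℤI.vanish {ℤ.+ 5 ℤ.* i ℤ.+ ℤ.+ 8 ℤ.* (ℤ.+ 5 ℤ.* a)} {ℤ.+ 5} h₁)
re-digit : ∀ u i a i′ e → u ≡ i ℤ.+ ℤ.+ 8 ℤ.* a → i ≡ i′ ℤ.+ ℤ.+ 8 ℤ.* e → u ≡ i′ ℤ.+ ℤ.+ 8 ℤ.* (e ℤ.+ a)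
re-digit u i a i′ e h₁ h₂ = trans (ℤI.identity (v 0F) (v 3F ⊕ # (ℤ.+ 8) ⊗ (v 4F ⊕ v 2F) ⊕ # (ℤ.+ 1) ⊗ (v 0F ⊖ (v 1F ⊕ # (ℤ.+ 8) ⊗ v 2F)) ⊕ # (ℤ.+ 1) ⊗ (v 1F ⊖ (v 3F ⊕ # (ℤ.+ 8) ⊗ v 4F))) refl (u ∷ i ∷ a ∷ i′ ∷ e ∷ [])) (trans (ℤI.vanish {i′ ℤ.+ ℤ.+ 8 ℤ.* (e ℤ.+ a) ℤ.+ ℤ.+ 1 ℤ.* (u ℤ.- (i ℤ.+ ℤ.+ 8 ℤ.* a))} {ℤ.+ 1} h₂) (ℤI.vanish {i′ ℤ.+ ℤ.+ 8 ℤ.* (e ℤ.+ a)} {ℤ.+ 1} h₁))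
ratio-5 : ∀ u w → u ℤ.* ℤ.+ 5 ≡ ℤ.+ 10 ℤ.* w → ℤ.+ 5 ℤ.* u ≡ ℤ.+ 5 ℤ.* (ℤ.+ 2 ℤ.* w)
ratio-5 u w h₁ = trans (ℤI.identity (# (ℤ.+ 5) ⊗ v 0F) (# (ℤ.+ 5) ⊗ (# (ℤ.+ 2) ⊗ v 1F) ⊕ # (ℤ.+ 1) ⊗ (v 0F ⊗ # (ℤ.+ 5) ⊖ # (ℤ.+ 10) ⊗ v 1F)) refl (u ∷ w ∷ [])) (ℤI.vanish {ℤ.+ 5 ℤ.* (ℤ.+ 2 ℤ.* w)} {ℤ.+ 1} h₁)
ratio-25 : ∀ u w → ℤ.+ 5 ℤ.* u ℤ.* ℤ.+ 5 ≡ ℤ.+ 10 ℤ.* (ℤ.+ 5 ℤ.* w) → ℤ.+ 25 ℤ.* u ≡ ℤ.+ 25 ℤ.* (ℤ.+ 2 ℤ.* w)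
ratio-25 u w h₁ = trans (ℤI.identity (# (ℤ.+ 25) ⊗ v 0F) (# (ℤ.+ 25) ⊗ (# (ℤ.+ 2) ⊗ v 1F) ⊕ # (ℤ.+ 1) ⊗ (# (ℤ.+ 5) ⊗ v 0F ⊗ # (ℤ.+ 5) ⊖ # (ℤ.+ 10) ⊗ (# (ℤ.+ 5) ⊗ v 1F))) refl (u ∷ w ∷ [])) (ℤI.vanish {ℤ.+ 25 ℤ.* (ℤ.+ 2 ℤ.* w)} {ℤ.+ 1} h₁)
ratio-5′ : ∀ u w p → ℤ.+ 5 ℤ.* u ℤ.* ℤ.+ 1 ≡ p ℤ.* (ℤ.+ 5 ℤ.* w) → ℤ.+ 5 ℤ.* u ≡ ℤ.+ 5 ℤ.* (p ℤ.* w)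
ratio-5′ u w p h₁ = trans (ℤI.identity (# (ℤ.+ 5) ⊗ v 0F) (# (ℤ.+ 5) ⊗ (v 2F ⊗ v 1F) ⊕ # (ℤ.+ 1) ⊗ (# (ℤ.+ 5) ⊗ v 0F ⊗ # (ℤ.+ 1) ⊖ v 2F ⊗ (# (ℤ.+ 5) ⊗ v 1F))) refl (u ∷ w ∷ p ∷ [])) (ℤI.vanish {ℤ.+ 5 ℤ.* (p ℤ.* w)} {ℤ.+ 1} h₁)
ratio-1 : ∀ u w p → u ℤ.* ℤ.+ 1 ≡ p ℤ.* w → u ≡ p ℤ.* w
ratio-1 u w p h₁ = trans (ℤI.identity (v 0F) (v 2F ⊗ v 1F ⊕ # (ℤ.+ 1) ⊗ (v 0F ⊗ # (ℤ.+ 1) ⊖ v 2F ⊗ v 1F)) refl (u ∷ w ∷ p ∷ [])) (ℤI.vanish {p ℤ.* w} {ℤ.+ 1} h₁)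
ratio-neg : ∀ u w p → u ℤ.* (ℤ.+ 0 ℤ.- ℤ.+ 1) ≡ p ℤ.* w → u ≡ (ℤ.+ 0 ℤ.- p) ℤ.* w
ratio-neg u w p h₁ = trans (ℤI.identity (v 0F) ((# (ℤ.+ 0) ⊖ v 2F) ⊗ v 1F ⊕ (# (ℤ.+ 0) ⊖ # (ℤ.+ 1)) ⊗ (v 0F ⊗ (# (ℤ.+ 0) ⊖ # (ℤ.+ 1)) ⊖ v 2F ⊗ v 1F)) refl (u ∷ w ∷ p ∷ [])) (ℤI.vanish {(ℤ.+ 0 ℤ.- p) ℤ.* w} {ℤ.+ 0 ℤ.- ℤ.+ 1} h₁)

opaque
  unfolding _+_ _*_ -_
  five-π : ⟦ cls false false false false false true ⟧ᶜ * (⟨ -[1+ 1 ] , ℤ.+ 1 , ℤ.+ 0 ⟩ * ⟨ -[1+ 1 ] , ℤ.+ 1 , ℤ.+ 0 ⟩) ≡ ι (ℤ.+ 5)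
  five-π = refl

λ₅ : 𝒪
λ₅ = ⟨ -[1+ 1 ] , ℤ.+ 1 , ℤ.+ 0 ⟩

five-form : ∀ u w x y ρ U W → x ≡ u - ρ * w → U ≡ ι (ℤ.+ 5) * u → W ≡ ι (ℤ.+ 5) * w → ι (ℤ.+ 5) * x ≡ U - ρ * W
five-form u w x y ρ U W h₁ h₂ h₃ = trans (𝒪I.identity (# (ℤ.+ 5) ⊗ v 2F) (v 5F ⊖ v 4F ⊗ v 6F ⊕ # (ℤ.+ 5) ⊗ (v 2F ⊖ (v 0F ⊖ v 4F ⊗ v 1F)) ⊕ (# (ℤ.+ 0) ⊖ # (ℤ.+ 1)) ⊗ (v 5F ⊖ # (ℤ.+ 5) ⊗ v 0F) ⊕ v 4F ⊗ (v 6F ⊖ # (ℤ.+ 5) ⊗ v 1F)) refl (u ∷ w ∷ x ∷ y ∷ ρ ∷ U ∷ W ∷ [])) (trans (𝒪I.vanish h₃) (trans (𝒪I.vanish h₂) (𝒪I.vanish h₁)))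
five-square : ∀ p l c x → p * (l * l) ≡ ι (ℤ.+ 5) → p * (c * c) ≡ x → ι (ℤ.+ 1) * ι (ℤ.+ 1) * (ι (ℤ.+ 1) * ι (ℤ.+ 1) * ι (ℤ.+ 1) * ι (ℤ.+ 1)) * (p * l * c * (p * l * c)) ≡ ι (ℤ.+ 5) * x
five-square p l c x h₁ h₂ = trans (𝒪I.identity (# (ℤ.+ 1) ⊗ # (ℤ.+ 1) ⊗ (# (ℤ.+ 1) ⊗ # (ℤ.+ 1) ⊗ # (ℤ.+ 1) ⊗ # (ℤ.+ 1)) ⊗ (v 0F ⊗ v 1F ⊗ v 2F ⊗ (v 0F ⊗ v 1F ⊗ v 2F))) (# (ℤ.+ 5) ⊗ v 3F ⊕ v 0F ⊗ v 2F ⊗ v 2F ⊗ (v 0F ⊗ (v 1F ⊗ v 1F) ⊖ # (ℤ.+ 5)) ⊕ # (ℤ.+ 5) ⊗ (v 0F ⊗ (v 2F ⊗ v 2F) ⊖ v 3F)) refl (p ∷ l ∷ c ∷ x ∷ [])) (trans (𝒪I.vanish h₂) (𝒪I.vanish h₁))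
five-times-square : ∀ p l d x → p * (l * l) ≡ ι (ℤ.+ 5) → ι (ℤ.+ 1) * ι (ℤ.+ 1) * (ι (ℤ.+ 1) * ι (ℤ.+ 1) * ι (ℤ.+ 1) * ι (ℤ.+ 1)) * (d * d) ≡ x → p * (l * d * (l * d)) ≡ ι (ℤ.+ 5) * x
five-times-square p l d x h₁ h₂ = trans (𝒪I.identity (v 0F ⊗ (v 1F ⊗ v 2F ⊗ (v 1F ⊗ v 2F))) (# (ℤ.+ 5) ⊗ v 3F ⊕ v 2F ⊗ v 2F ⊗ (v 0F ⊗ (v 1F ⊗ v 1F) ⊖ # (ℤ.+ 5)) ⊕ # (ℤ.+ 5) ⊗ (# (ℤ.+ 1) ⊗ # (ℤ.+ 1) ⊗ (# (ℤ.+ 1) ⊗ # (ℤ.+ 1) ⊗ # (ℤ.+ 1) ⊗ # (ℤ.+ 1)) ⊗ (v 2F ⊗ v 2F) ⊖ v 3F)) refl (p ∷ l ∷ d ∷ x ∷ [])) (trans (𝒪I.vanish h₂) (𝒪I.vanish h₁))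

-- As 5 = π₅λ₅², multiplication of u and w by 5 exchanges the class pairs (π₅ , 1) and (1 , π₅), so
-- one curve serves both.
scale-5 : ∀ {u w} → Square-classes (cls false false false false false true) (cls false false false false false false) u w →
  Square-classes (cls false false false false false false) (cls false false false false false true) (ℤ.+ 5 ℤ.* u) (ℤ.+ 5 ℤ.* w)
scale-5 {u} {w} ((c , p) , (d , q)) =
    (_ , trans (five-square π λ₅ c _ five-π p) (five-form (ι u) (ι w) _ 𝟘 θ _ _ refl (ι-* (ℤ.+ 5) u) (ι-* (ℤ.+ 5) w)))
  , (_ , trans (five-times-square π λ₅ d _ five-π q) (five-form (ι u) (ι w) _ 𝟘 θ₂ _ _ refl (ι-* (ℤ.+ 5) u) (ι-* (ℤ.+ 5) w)))
  where
  π = ⟦ cls false false false false false true ⟧ᶜ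

dispatch : ∀ {s₁ s₂ i j} → Listed s₁ s₂ i j → ∀ u w a b → u ≡ ℤ.+ i ℤ.+ ℤ.+ 8 ℤ.* a → w ≡ ℤ.+ j ℤ.+ ℤ.+ 8 ℤ.* b → Square-classes s₁ s₂ u w → Ratio u w
dispatch I₂₁ u w a b p q sc = scaled (scale-5 {u} {w} sc)
  where
  scaled : Square-classes (cls false false false false false false) (cls false false false false false true) (ℤ.+ 5 ℤ.* u) (ℤ.+ 5 ℤ.* w) → Ratio u w
  scaled ((c , e) , (d , f)) = ratio (ℤ.+ 2) (inj₂ (inj₁ refl)) (ℤₚ.*-cancelˡ-≡ (ℤ.+ 25) _ _ (ratio-25 u w
    (BaseI₊.conclusion (ℤ.+ 5 ℤ.* u) (ℤ.+ 5 ℤ.* w) (ℤ.+ 5 ℤ.* a) (ℤ.+ 5 ℤ.* b) (five-times u (ℤ.+ 2) a p) (five-times w (ℤ.+ 1) b q) e f)))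
dispatch I₆₅ u w a b p q sc = scaled (scale-5 {u} {w} sc)
  where
  scaled : Square-classes (cls false false false false false false) (cls false false false false false true) (ℤ.+ 5 ℤ.* u) (ℤ.+ 5 ℤ.* w) → Ratio u w
  scaled ((c , e) , (d , f)) = ratio -[1+ 1 ] (inj₂ (inj₂ (inj₂ (inj₁ refl)))) (ℤₚ.*-cancelˡ-≡ (ℤ.+ 5) _ _ (ratio-5′ u w -[1+ 1 ]
    (BaseI₋.conclusion (ℤ.+ 5 ℤ.* u) (ℤ.+ 5 ℤ.* w) (ℤ.+ 4 ℤ.+ ℤ.+ 5 ℤ.* a) (ℤ.+ 3 ℤ.+ ℤ.+ 5 ℤ.* b)
      (re-digit _ (ℤ.+ 30) (ℤ.+ 5 ℤ.* a) -[1+ 1 ] (ℤ.+ 4) (five-times u (ℤ.+ 6) a p) refl) (re-digit _ (ℤ.+ 25) (ℤ.+ 5 ℤ.* b) (ℤ.+ 1) (ℤ.+ 3) (five-times w (ℤ.+ 5) b q) refl) e f)))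
dispatch I₂₅ u w a b p q ((c , e) , (d , f)) = ratio (ℤ.+ 2) (inj₂ (inj₁ refl)) (ℤₚ.*-cancelˡ-≡ (ℤ.+ 5) _ _ (ratio-5 u w
  (BaseI₊.conclusion u w (-[1+ 0 ] ℤ.+ a) b (re-digit u (ℤ.+ 2) a (ℤ.+ 10) -[1+ 0 ] p refl) q e f)))
dispatch I₆₁ u w a b p q ((c , e) , (d , f)) = ratio -[1+ 1 ] (inj₂ (inj₂ (inj₂ (inj₁ refl)))) (ratio-1 u w -[1+ 1 ]
  (BaseI₋.conclusion u w (ℤ.+ 1 ℤ.+ a) b (re-digit u (ℤ.+ 6) a -[1+ 1 ] (ℤ.+ 1) p refl) q e f))
dispatch II₀₃ u w a b p q ((c , e) , (d , f)) = ⊥-elim (Split-II.impossible u w a b p q e f)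
dispatch II₈₃ u w a b p q ((c , e) , (d , f)) = ⊥-elim (Split-II.impossible u w (ℤ.+ 1 ℤ.+ a) b (re-digit u (ℤ.+ 8) a (ℤ.+ 0) (ℤ.+ 1) p refl) q e f)
dispatch II₁₁ u w a b p q ((c , e) , (d , f)) = ratio (ℤ.+ 1) (inj₁ refl) (ratio-1 u w (ℤ.+ 1) (BaseII₁.conclusion u w a b p q e f))
dispatch II₄₇ u w a b p q ((c , e) , (d , f)) = ratio -[1+ 3 ] (inj₂ (inj₂ (inj₂ (inj₂ refl)))) (ratio-neg u w (ℤ.+ 4)
  (BaseII₄.conclusion u w a (ℤ.+ 1 ℤ.+ b) p (re-digit w (ℤ.+ 7) b -[1+ 0 ] (ℤ.+ 1) q refl) e f))
dispatch II₅₁ u w a b p q ((c , e) , (d , f)) = ⊥-elim (BaseII₅.impossible u w a b p q e f)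
dispatch III₁₇ u w a b p q ((c , e) , (d , f)) = ratio -[1+ 0 ] (inj₂ (inj₂ (inj₁ refl))) (ratio-neg u w (ℤ.+ 1)
  (BaseIII₁.conclusion u w a (ℤ.+ 1 ℤ.+ b) p (re-digit w (ℤ.+ 7) b -[1+ 0 ] (ℤ.+ 1) q refl) f e))
dispatch III₅₇ u w a b p q ((c , e) , (d , f)) = ⊥-elim (BaseIII₃.impossible u w (ℤ.+ 1 ℤ.+ a) (ℤ.+ 1 ℤ.+ b)
  (re-digit u (ℤ.+ 5) a -[1+ 2 ] (ℤ.+ 1) p refl) (re-digit w (ℤ.+ 7) b -[1+ 0 ] (ℤ.+ 1) q refl) f e)

cop-combine : ∀ P x y k u w → x ≡ y + P * k → u * P + w * y ≡ ι (ℤ.+ 1) → (u - w * k) * P + w * x ≡ ι (ℤ.+ 1)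
cop-combine P x y k u w h₁ h₂ = trans (𝒪I.identity ((v 4F ⊖ v 5F ⊗ v 3F) ⊗ v 0F ⊕ v 5F ⊗ v 1F) (# (ℤ.+ 1) ⊕ v 5F ⊗ (v 1F ⊖ (v 2F ⊕ v 0F ⊗ v 3F)) ⊕ # (ℤ.+ 1) ⊗ (v 4F ⊗ v 0F ⊕ v 5F ⊗ v 2F ⊖ # (ℤ.+ 1))) refl (P ∷ x ∷ y ∷ k ∷ u ∷ w ∷ [])) (trans (𝒪I.vanish h₂) (𝒪I.vanish h₁))

cop-≈ : ∀ {P x y} → x ≈ y [ P ] → Cop P y → Cop P x
cop-≈ {P} {x} {y} (by k e) (cop {u} {w} f) = cop (cop-combine P x y k u w e f)

norm-mod : ∀ U V ρ n → U * U + ρ * U * V + n * (V * V) ≡ (ι (ℤ.+ 2) * ρ * ρ + n) * (V * V) + (U - ρ * V) * (U + ι (ℤ.+ 2) * ρ * V)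
norm-mod U V ρ n = 𝒪I.identity (v 0F ⊗ v 0F ⊕ v 2F ⊗ v 0F ⊗ v 1F ⊕ v 3F ⊗ (v 1F ⊗ v 1F)) ((# (ℤ.+ 2) ⊗ v 2F ⊗ v 2F ⊕ v 3F) ⊗ (v 1F ⊗ v 1F) ⊕ (v 0F ⊖ v 2F ⊗ v 1F) ⊗ (v 0F ⊕ # (ℤ.+ 2) ⊗ v 2F ⊗ v 1F)) refl (U ∷ V ∷ ρ ∷ n ∷ [])
shift-multiple : ∀ P P′ k x y z → P ≡ P′ * k → x ≡ y + P * z → x ≡ y + P′ * (k * z)
shift-multiple P P′ k x y z h₁ h₂ = trans (𝒪I.identity (v 3F) (v 4F ⊕ v 1F ⊗ (v 2F ⊗ v 5F) ⊕ v 5F ⊗ (v 0F ⊖ v 1F ⊗ v 2F) ⊕ # (ℤ.+ 1) ⊗ (v 3F ⊖ (v 4F ⊕ v 0F ⊗ v 5F))) refl (P ∷ P′ ∷ k ∷ x ∷ y ∷ z ∷ [])) (trans (𝒪I.vanish h₂) (𝒪I.vanish h₁))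
cofactor-mod : ∀ P P′ k Q R t V → P ≡ P′ * k → Q ≡ P * R + t * (V * (V * V)) → Q ≡ t * (V * (V * V)) + P′ * (k * R)
cofactor-mod P P′ k Q R t V h₁ h₂ = trans (𝒪I.identity (v 3F) (v 5F ⊗ (v 6F ⊗ (v 6F ⊗ v 6F)) ⊕ v 1F ⊗ (v 2F ⊗ v 4F) ⊕ v 4F ⊗ (v 0F ⊖ v 1F ⊗ v 2F) ⊕ # (ℤ.+ 1) ⊗ (v 3F ⊖ (v 0F ⊗ v 4F ⊕ v 5F ⊗ (v 6F ⊗ (v 6F ⊗ v 6F))))) refl (P ∷ P′ ∷ k ∷ Q ∷ R ∷ t ∷ V ∷ [])) (trans (𝒪I.vanish h₂) (𝒪I.vanish h₁))
U≡ : ∀ U V ρ → U ≡ ρ * V + (U - ρ * V)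
U≡ U V ρ = 𝒪I.identity (v 0F) (v 2F ⊗ v 1F ⊕ (v 0F ⊖ v 2F ⊗ v 1F)) refl (U ∷ V ∷ ρ ∷ [])
cop-UV : ∀ P′ k U V ρ u w → U - ρ * V ≡ P′ * k → u * U + w * V ≡ ι (ℤ.+ 1) → u * k * P′ + (u * ρ + w) * V ≡ ι (ℤ.+ 1)
cop-UV P′ k U V ρ u w h₁ h₂ = trans (𝒪I.identity (v 5F ⊗ v 1F ⊗ v 0F ⊕ (v 5F ⊗ v 4F ⊕ v 6F) ⊗ v 3F) (# (ℤ.+ 1) ⊕ (# (ℤ.+ 0) ⊖ v 5F) ⊗ (v 2F ⊖ v 4F ⊗ v 3F ⊖ v 0F ⊗ v 1F) ⊕ # (ℤ.+ 1) ⊗ (v 5F ⊗ v 2F ⊕ v 6F ⊗ v 3F ⊖ # (ℤ.+ 1))) refl (P′ ∷ k ∷ U ∷ V ∷ ρ ∷ u ∷ w ∷ [])) (trans (𝒪I.vanish h₂) (𝒪I.vanish h₁))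

-- Modulo P = u - ρw the adjugate is (2ρ² + ρ♯) w² and Q is t w³. Since P is coprime to w, its
-- common factors with the cofactor divide 2ρ² + ρ♯, t or 5, all of which are supported above 2, 3
-- and 5. For ρ = θ or θ₂ the first is the derivative of the minimal polynomial at ρ.
linear-class : ∀ {k Q t} ρ (trace : Tr⟨ 𝟙 , ρ ⟩ ≡ 𝟘 - ρ) u w → Cop (ι u) (ι w) → Odd (ι u - ρ * ι w) → Smooth (𝟚 * ρ * ρ + ρ ♯) → Smooth t →
  Q ≡ (ι u - ρ * ι w) * (ι u - ρ * ι w) ♯ + t * (ι w * (ι w * ι w)) → (ι u - ρ * ι w) * ((ι u - ρ * ι w) ♯ * (ι (ℤ.+ 5) * Q)) ≡ k * k →
  ∃ λ s → ∃ λ h → ι u - ρ * ι w ≡ ⟦ s ⟧ᶜ * (h * h)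
linear-class {k} {Q} {t} ρ trace u w uw o smooth-e smooth-t Q≡ k²≡ = smooth-part (odd≢𝟘 o) k²≡ coprime
  where
  P = ι u - ρ * ι w
  coprime : ∀ P′ → P′ ∣𝒪 P → CopS P′ → Cop P′ (P ♯ * (ι (ℤ.+ 5) * Q))
  coprime P′ (j , e) c = cop-* (cop-≈ (by _ (shift-multiple P P′ j (P ♯) ((𝟚 * ρ * ρ + ρ ♯) * (ι w * ι w)) _ e
      (trans (Trace-zero.♯-form ρ trace u w) (norm-mod (ι u) (ι w) ρ (ρ ♯))))) (cop-* (smooth-e P′ c) (cop-* cV cV)))
    (cop-* (cop-5 c) (cop-≈ (by _ (cofactor-mod P P′ j Q (P ♯) t (ι w) e Q≡)) (cop-* (smooth-t P′ c) (cop-* cV (cop-* cV cV)))))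
    where
    cV : Cop P′ (ι w)
    cV = from uw
      where
      from : Cop (ι u) (ι w) → Cop P′ (ι w)
      from (cop {x} {y} f) = cop (cop-UV P′ j (ι u) (ι w) ρ x y e f)

class-norm : ∀ P P♯ s s♯ h h♯ → P ≡ s * (h * h) → P♯ ≡ s♯ * (h♯ * h♯) → P * P♯ ≡ s * s♯ * (h * h♯ * (h * h♯))
class-norm P P♯ s s♯ h h♯ h₁ h₂ = trans (𝒪I.identity (v 0F ⊗ v 1F) (v 2F ⊗ v 3F ⊗ (v 4F ⊗ v 5F ⊗ (v 4F ⊗ v 5F)) ⊕ v 1F ⊗ (v 0F ⊖ v 2F ⊗ (v 4F ⊗ v 4F)) ⊕ v 2F ⊗ v 4F ⊗ v 4F ⊗ (v 1F ⊖ v 3F ⊗ (v 5F ⊗ v 5F))) refl (P ∷ P♯ ∷ s ∷ s♯ ∷ h ∷ h♯ ∷ [])) (trans (𝒪I.vanish h₂) (𝒪I.vanish h₁))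
norm-square : ∀ k A B x y a b → k * k ≡ ι (ℤ.+ 5) * (A * B) → A ≡ x * (a * a) → B ≡ y * (b * b) → k * k ≡ a * b * (a * b) * (ι (ℤ.+ 5) * (x * y))
norm-square k A B x y a b h₁ h₂ h₃ = trans (𝒪I.identity (v 0F ⊗ v 0F) (v 5F ⊗ v 6F ⊗ (v 5F ⊗ v 6F) ⊗ (# (ℤ.+ 5) ⊗ (v 3F ⊗ v 4F)) ⊕ # (ℤ.+ 1) ⊗ (v 0F ⊗ v 0F ⊖ # (ℤ.+ 5) ⊗ (v 1F ⊗ v 2F)) ⊕ # (ℤ.+ 5) ⊗ v 2F ⊗ (v 1F ⊖ v 3F ⊗ (v 5F ⊗ v 5F)) ⊕ # (ℤ.+ 5) ⊗ v 3F ⊗ v 5F ⊗ v 5F ⊗ (v 2F ⊖ v 4F ⊗ (v 6F ⊗ v 6F))) refl (k ∷ A ∷ B ∷ x ∷ y ∷ a ∷ b ∷ [])) (trans (𝒪I.vanish h₃) (trans (𝒪I.vanish h₂) (𝒪I.vanish h₁)))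

squared-♯ : ∀ {P s h} → P ≡ s * (h * h) → P ♯ ≡ s ♯ * (h ♯ * h ♯)
squared-♯ {P} {s} {h} e = trans (cong _♯ e) (trans (♯-* s (h * h)) (cong (λ x → s ♯ * x) (♯-* h h)))

♯≢𝟘 : ∀ {x} → ¬ x ≡ 𝟘 → ¬ x ♯ ≡ 𝟘
♯≢𝟘 {x} n e = n (N≡0⇒≡𝟘 x (cong c₁ (trans (sym (*♯ x)) (trans (cong (λ y → x * y) e) (*𝟘 x)))))

-- The norm of P is the norm of its class times a square, and likewise for Q, so these squares can
-- be divided out of the equation for k².
norm-condition : ∀ {k P Q s t h g} → ¬ h ≡ 𝟘 → ¬ g ≡ 𝟘 → k * k ≡ ι (ℤ.+ 5) * (P * P ♯ * (Q * Q ♯)) → P ≡ s * (h * h) → Q ≡ t * (g * g) →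
  ∃ λ j → j * j ≡ ι (ℤ.+ 5) * (s * s ♯ * (t * t ♯))
norm-condition {k} {P} {Q} {s} {t} {h} {g} h≢0 g≢0 k²≡ P≡ Q≡ = go (sq-quotient (*≢𝟘 (*≢𝟘 h≢0 (♯≢𝟘 h≢0)) (*≢𝟘 g≢0 (♯≢𝟘 g≢0)))
    (norm-square k (P * P ♯) (Q * Q ♯) (s * s ♯) (t * t ♯) (h * h ♯) (g * g ♯) k²≡ (class-norm P (P ♯) s (s ♯) h (h ♯) P≡ (squared-♯ P≡)) (class-norm Q (Q ♯) t (t ♯) g (g ♯) Q≡ (squared-♯ Q≡))))
  where
  go : (∃ λ j → k ≡ h * h ♯ * (g * g ♯) * j × ι (ℤ.+ 5) * (s * s ♯ * (t * t ♯)) ≡ j * j) → ∃ λ j → j * j ≡ ι (ℤ.+ 5) * (s * s ♯ * (t * t ♯))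
  go (j , _ , e) = j , sym e

-- elimination of pairs of classes

module Locally (R : ResiduePrime) where
  open ResiduePrime R
  open Local R

  misses? : 𝒪 → 𝒪 → Bool
  misses? x s = allUpTo p λ c → unit? (x - s * (ι (ℤ.+ c) * ι (ℤ.+ c)))

  -- Runs over the pairs of residues of (u , w) other than (0 , 0), which coprimality forbids, and
  -- asks that one of the linear forms miss its class.
  no-points? : 𝒪 → 𝒪 → Bool
  no-points? s t = allUpTo p λ i → allUpTo p λ j → ((i ℕ.≡ᵇ 0) ∧ (j ℕ.≡ᵇ 0)) ∨ (misses? (ι (ℤ.+ i) - θ * ι (ℤ.+ j)) s ∨ misses? (ι (ℤ.+ i) - θ₂ * ι (ℤ.+ j)) t)

  misses?-sound : ∀ {x y s c} → s * (c * c) ≡ y → y ≈ x [ π ] → misses? x s ≡ true → ⊥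
  misses?-sound {x} {y} {s} {c} e y≈ t = unit?-sound _ (allUpTo-sound p (λ c → unit? (x - s * (ι (ℤ.+ c) * ι (ℤ.+ c)))) t {residueℕ c} (ℤD.n%ℕd<d (residueℤ c) p))
    (≈⇒∣- (≈-trans (≈-sym y≈) (≈-trans (≡⇒≈ (sym e)) (≈-* ≈-refl (≈-* (≈residue c) (≈residue c))))))

  no-points : ∀ {U V s t c d} → Cop U V → s * (c * c) ≡ U - θ * V → t * (d * d) ≡ U - θ₂ * V → no-points? s t ≡ true → ⊥
  no-points {U} {V} {s} {t} {c} {d} UV e f n = ∨-case ((i ℕ.≡ᵇ 0) ∧ (j ℕ.≡ᵇ 0)) _ both-zero
      (∨-case (misses? (ι (ℤ.+ i) - θ * ι (ℤ.+ j)) s) _ (misses?-sound {c = c} e (≈-- (≈residue U) (≈-* ≈-refl (≈residue V))))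
        (misses?-sound {c = d} f (≈-- (≈residue U) (≈-* ≈-refl (≈residue V)))))
      (allUpTo-sound p (test i) (allUpTo-sound p (λ i → allUpTo p (test i)) n {i} (ℤD.n%ℕd<d (residueℤ U) p)) {j} (ℤD.n%ℕd<d (residueℤ V) p))
    where
    i = residueℕ U
    j = residueℕ V
    test : ℕ → ℕ → Bool
    test i j = ((i ℕ.≡ᵇ 0) ∧ (j ℕ.≡ᵇ 0)) ∨ (misses? (ι (ℤ.+ i) - θ * ι (ℤ.+ j)) s ∨ misses? (ι (ℤ.+ i) - θ₂ * ι (ℤ.+ j)) t)
    both-zero : (i ℕ.≡ᵇ 0) ∧ (j ℕ.≡ᵇ 0) ≡ true → ⊥
    both-zero z = not-both (residue≡0⇒∣ U (ℕₚ.≡ᵇ⇒≡ i 0 (≡true⇒T (proj₁ (∧-split (i ℕ.≡ᵇ 0) (j ℕ.≡ᵇ 0) z)))))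
      (cop-∣ʳ (residue≡0⇒∣ V (ℕₚ.≡ᵇ⇒≡ j 0 (≡true⇒T (proj₂ (∧-split (i ℕ.≡ᵇ 0) (j ℕ.≡ᵇ 0) z))))) UV)

misses₈? : 𝒪 → 𝒪 → Bool
misses₈? x s = all𝒪 4 λ c → not (div? 8 (x - s * (c * c)))

misses₈?-sound : ∀ {x y s c} → s * (c * c) ≡ y → y ≈ x [ 𝟠 ] → misses₈? x s ≡ true → ⊥
misses₈?-sound {x} {y} {s} {c} e y≈ t = go (all𝒪-sound 4 (λ c → not (div? 8 (x - s * (c * c)))) t c)
  where
  go : (∃ λ r → c ≈ r [ 𝟜 ] × not (div? 8 (x - s * (r * r))) ≡ true) → ⊥
  go (r , c≈ , n) = not-true (div?-complete 8 (≈⇒∣- (≈-trans (≈-sym y≈) (≈-trans (≡⇒≈ (sym e)) (≈-* ≈-refl (²-4⇒8 c≈)))))) n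

flip : Class → Class
flip (cls n e t h q p) = cls (not n) e t h q p

norm-nonsquare? : 𝒪 → 𝒪 → Bool
norm-nonsquare? s t = Local.not-square? at-θ 8 (ι (ℤ.+ 5) * (s * s ♯ * (t * t ♯))) ∨ Local.not-square? at-π₅ 8 (ι (ℤ.+ 5) * (s * s ♯ * (t * t ♯)))

even-class? : Class → Bool
even-class? s = Class.s2 s

listed? : Class → Class → ℕ → ℕ → Bool
listed? s t i j = is-just (find s t i j) ∨ is-just (find (flip s) (flip t) (8 ℕ.∸ i) (8 ℕ.∸ j))

residues? : Class → Class → ℕ → ℕ → Bool
residues? s t i j = (div? 2 (ι (ℤ.+ i)) ∧ div? 2 (ι (ℤ.+ j))) ∨ (listed? s t i j ∨ (misses₈? (ι (ℤ.+ i) - θ * ι (ℤ.+ j)) ⟦ s ⟧ᶜ ∨ misses₈? (ι (ℤ.+ i) - θ₂ * ι (ℤ.+ j)) ⟦ t ⟧ᶜ))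

global? : 𝒪 → 𝒪 → Bool
global? s t = norm-nonsquare? s t ∨ (Locally.no-points? at-θ s t ∨ Locally.no-points? at-π₅ s t)

-- A pair of classes must involve the prime 2, impossible as both linear forms are odd, or fail a
-- condition at 3 or 5, or have only listed residues among those that it represents modulo 8.
pair? : Class → Class → Bool
pair? s t = (even-class? s ∨ even-class? t) ∨ (global? ⟦ s ⟧ᶜ ⟦ t ⟧ᶜ ∨ allUpTo 8 λ i → allUpTo 8 λ j → residues? s t i j)

opaque
  unfolding _+_ _*_ -_ _♯ div? zero%? N
  pairs-check : allClasses (λ s → allClasses λ t → pair? s t) ≡ true
  pairs-check = refl
  parity-check : allUpTo 8 (λ i → allUpTo 8 λ j → (div? 2 (ι (ℤ.+ i)) ∧ div? 2 (ι (ℤ.+ j))) ∨ (odd? (ι (ℤ.+ i) - θ * ι (ℤ.+ j)) ∧ odd? (ι (ℤ.+ i) - θ₂ * ι (ℤ.+ j)))) ≡ true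
  parity-check = refl
  θ♯≡ : θ ♯ ≡ θ * θ - ι (ℤ.+ 3)
  θ♯≡ = refl
  θ₂♯≡ : θ₂ ♯ ≡ θ₂ * θ₂ - ι (ℤ.+ 3)
  θ₂♯≡ = refl
  θ³≡ : θ * θ * θ ≡ ι (ℤ.+ 3) * θ - ι (ℤ.+ 3)
  θ³≡ = refl
  θ₂³≡ : θ₂ * θ₂ * θ₂ ≡ ι (ℤ.+ 3) * θ₂ - ι (ℤ.+ 7)
  θ₂³≡ = refl
  norm-derivative-θ : ι (N (𝟚 * θ * θ + θ ♯)) ≡ ι (ℤ.+ 1) * (power 𝟚 0 * power (ι (ℤ.+ 3)) 3 * power (ι (ℤ.+ 5)) 1)
  norm-derivative-θ = refl
  norm-derivative-θ₂ : ι (N (𝟚 * θ₂ * θ₂ + θ₂ ♯)) ≡ ι (ℤ.+ 1) * (power 𝟚 0 * power (ι (ℤ.+ 3)) 5 * power (ι (ℤ.+ 5)) 1)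
  norm-derivative-θ₂ = refl
  norm-4 : ι (N 𝟜) ≡ ι (ℤ.+ 1) * (power 𝟚 6 * power (ι (ℤ.+ 3)) 0 * power (ι (ℤ.+ 5)) 0)
  norm-4 = refl
  norm--4 : ι (N (ι -[1+ 3 ])) ≡ -𝟙 * (power 𝟚 6 * power (ι (ℤ.+ 3)) 0 * power (ι (ℤ.+ 5)) 0)
  norm--4 = refl
  -4≡ : ι -[1+ 3 ] ≡ 𝟘 - 𝟜
  -4≡ = refl
  not-sign : ∀ n → -𝟙 ⁺ not n ≡ 𝟘 - -𝟙 ⁺ n
  not-sign true = refl
  not-sign false = refl

cubic : ∀ U V ρ n F m → F ≡ U * U + ρ * U * V + n * (V * V) → n ≡ ρ * ρ - ι (ℤ.+ 3) → ρ * ρ * ρ ≡ ι (ℤ.+ 3) * ρ - m → (U - ρ * V) * F ≡ U * U * U - ι (ℤ.+ 3) * U * (V * V) + m * (V * V * V)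
cubic U V ρ n F m h₁ h₂ h₃ = trans (𝒪I.identity ((v 0F ⊖ v 2F ⊗ v 1F) ⊗ v 4F) (v 0F ⊗ v 0F ⊗ v 0F ⊖ # (ℤ.+ 3) ⊗ v 0F ⊗ (v 1F ⊗ v 1F) ⊕ v 5F ⊗ (v 1F ⊗ v 1F ⊗ v 1F) ⊕ (v 0F ⊖ v 2F ⊗ v 1F) ⊗ (v 4F ⊖ (v 0F ⊗ v 0F ⊕ v 2F ⊗ v 0F ⊗ v 1F ⊕ v 3F ⊗ (v 1F ⊗ v 1F))) ⊕ (v 0F ⊗ v 1F ⊗ v 1F ⊖ v 2F ⊗ v 1F ⊗ v 1F ⊗ v 1F) ⊗ (v 3F ⊖ (v 2F ⊗ v 2F ⊖ # (ℤ.+ 3))) ⊕ (# (ℤ.+ 0) ⊖ v 1F ⊗ v 1F ⊗ v 1F) ⊗ (v 2F ⊗ v 2F ⊗ v 2F ⊖ (# (ℤ.+ 3) ⊗ v 2F ⊖ v 5F))) refl (U ∷ V ∷ ρ ∷ n ∷ F ∷ m ∷ [])) (trans (𝒪I.vanish h₃) (trans (𝒪I.vanish h₂) (𝒪I.vanish h₁)))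
cubic-difference : ∀ A B U V a b → A ≡ U * U * U - ι (ℤ.+ 3) * U * (V * V) + ι (ℤ.+ 3) * (V * V * V) → B ≡ U * U * U - ι (ℤ.+ 3) * U * (V * V) + ι (ℤ.+ 7) * (V * V * V) → B ≡ A + ι (ℤ.+ 4) * (V * (V * V))
cubic-difference A B U V a b h₁ h₂ = trans (𝒪I.identity (v 1F) (v 0F ⊕ # (ℤ.+ 4) ⊗ (v 3F ⊗ (v 3F ⊗ v 3F)) ⊕ (# (ℤ.+ 0) ⊖ # (ℤ.+ 1)) ⊗ (v 0F ⊖ (v 2F ⊗ v 2F ⊗ v 2F ⊖ # (ℤ.+ 3) ⊗ v 2F ⊗ (v 3F ⊗ v 3F) ⊕ # (ℤ.+ 3) ⊗ (v 3F ⊗ v 3F ⊗ v 3F))) ⊕ # (ℤ.+ 1) ⊗ (v 1F ⊖ (v 2F ⊗ v 2F ⊗ v 2F ⊖ # (ℤ.+ 3) ⊗ v 2F ⊗ (v 3F ⊗ v 3F) ⊕ # (ℤ.+ 7) ⊗ (v 3F ⊗ v 3F ⊗ v 3F)))) refl (A ∷ B ∷ U ∷ V ∷ a ∷ b ∷ [])) (trans (𝒪I.vanish h₂) (𝒪I.vanish h₁))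
cubic-difference′ : ∀ A B V t → B ≡ A + ι (ℤ.+ 4) * (V * (V * V)) → t ≡ ι (ℤ.+ 0) - ι (ℤ.+ 4) → A ≡ B + t * (V * (V * V))
cubic-difference′ A B V t h₁ h₂ = trans (𝒪I.identity (v 0F) (v 1F ⊕ v 3F ⊗ (v 2F ⊗ (v 2F ⊗ v 2F)) ⊕ (# (ℤ.+ 0) ⊖ # (ℤ.+ 1)) ⊗ (v 1F ⊖ (v 0F ⊕ # (ℤ.+ 4) ⊗ (v 2F ⊗ (v 2F ⊗ v 2F)))) ⊕ (# (ℤ.+ 0) ⊖ v 2F ⊗ v 2F ⊗ v 2F) ⊗ (v 3F ⊖ (# (ℤ.+ 0) ⊖ # (ℤ.+ 4)))) refl (A ∷ B ∷ V ∷ t ∷ [])) (trans (𝒪I.vanish h₂) (𝒪I.vanish h₁))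
regroup : ∀ P p B → P * (p * (ι (ℤ.+ 5) * B)) ≡ ι (ℤ.+ 5) * (P * p * B)
regroup P p B = 𝒪I.identity (v 0F ⊗ (v 1F ⊗ (# (ℤ.+ 5) ⊗ v 2F))) (# (ℤ.+ 5) ⊗ (v 0F ⊗ v 1F ⊗ v 2F)) refl (P ∷ p ∷ B ∷ [])
regroup′ : ∀ Q q A → Q * (q * (ι (ℤ.+ 5) * A)) ≡ ι (ℤ.+ 5) * (A * (Q * q))
regroup′ Q q A = 𝒪I.identity (v 0F ⊗ (v 1F ⊗ (# (ℤ.+ 5) ⊗ v 2F))) (# (ℤ.+ 5) ⊗ (v 2F ⊗ (v 0F ⊗ v 1F))) refl (Q ∷ q ∷ A ∷ [])
flip-value : ∀ x y z → (ι (ℤ.+ 0) - x) * y * z ≡ ι (ℤ.+ 0) - x * y * z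
flip-value x y z = 𝒪I.identity ((# (ℤ.+ 0) ⊖ v 0F) ⊗ v 1F ⊗ v 2F) (# (ℤ.+ 0) ⊖ v 0F ⊗ v 1F ⊗ v 2F) refl (x ∷ y ∷ z ∷ [])
flip-square : ∀ s f c x y U V ρ → f ≡ ι (ℤ.+ 0) - s → s * (c * c) ≡ x → x ≡ U - ρ * V → f * (c * c) ≡ ι (ℤ.+ 0) - U - ρ * (ι (ℤ.+ 0) - V)
flip-square s f c x y U V ρ h₁ h₂ h₃ = trans (𝒪I.identity (v 1F ⊗ (v 2F ⊗ v 2F)) (# (ℤ.+ 0) ⊖ v 5F ⊖ v 7F ⊗ (# (ℤ.+ 0) ⊖ v 6F) ⊕ v 2F ⊗ v 2F ⊗ (v 1F ⊖ (# (ℤ.+ 0) ⊖ v 0F)) ⊕ (# (ℤ.+ 0) ⊖ # (ℤ.+ 1)) ⊗ (v 0F ⊗ (v 2F ⊗ v 2F) ⊖ v 3F) ⊕ (# (ℤ.+ 0) ⊖ # (ℤ.+ 1)) ⊗ (v 3F ⊖ (v 5F ⊖ v 7F ⊗ v 6F))) refl (s ∷ f ∷ c ∷ x ∷ y ∷ U ∷ V ∷ ρ ∷ [])) (trans (𝒪I.vanish h₃) (trans (𝒪I.vanish h₂) (𝒪I.vanish h₁)))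
even-class-value : ∀ a b c d e → a * b * (ι (ℤ.+ 2) * c * d * e) ≡ ι (ℤ.+ 2) * (a * b * c * d * e)
even-class-value a b c d e = 𝒪I.identity (v 0F ⊗ v 1F ⊗ (# (ℤ.+ 2) ⊗ v 2F ⊗ v 3F ⊗ v 4F)) (# (ℤ.+ 2) ⊗ (v 0F ⊗ v 1F ⊗ v 2F ⊗ v 3F ⊗ v 4F)) refl (a ∷ b ∷ c ∷ d ∷ e ∷ [])
negate-digit : ∀ u i a i′ → u ≡ i ℤ.+ ℤ.+ 8 ℤ.* a → i′ ≡ ℤ.+ 8 ℤ.- i → ℤ.+ 0 ℤ.- u ≡ i′ ℤ.+ ℤ.+ 8 ℤ.* (ℤ.+ 0 ℤ.- ℤ.+ 1 ℤ.- a)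
negate-digit u i a i′ h₁ h₂ = trans (ℤI.identity (# (ℤ.+ 0) ⊖ v 0F) (v 3F ⊕ # (ℤ.+ 8) ⊗ (# (ℤ.+ 0) ⊖ # (ℤ.+ 1) ⊖ v 2F) ⊕ (# (ℤ.+ 0) ⊖ # (ℤ.+ 1)) ⊗ (v 0F ⊖ (v 1F ⊕ # (ℤ.+ 8) ⊗ v 2F)) ⊕ (# (ℤ.+ 0) ⊖ # (ℤ.+ 1)) ⊗ (v 3F ⊖ (# (ℤ.+ 8) ⊖ v 1F))) refl (u ∷ i ∷ a ∷ i′ ∷ [])) (trans (ℤI.vanish {i′ ℤ.+ ℤ.+ 8 ℤ.* (ℤ.+ 0 ℤ.- ℤ.+ 1 ℤ.- a) ℤ.+ (ℤ.+ 0 ℤ.- ℤ.+ 1) ℤ.* (u ℤ.- (i ℤ.+ ℤ.+ 8 ℤ.* a))} {ℤ.+ 0 ℤ.- ℤ.+ 1} h₂) (ℤI.vanish {i′ ℤ.+ ℤ.+ 8 ℤ.* (ℤ.+ 0 ℤ.- ℤ.+ 1 ℤ.- a)} {ℤ.+ 0 ℤ.- ℤ.+ 1} h₁))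
negate-ratio : ∀ u w m → ℤ.+ 0 ℤ.- u ≡ m ℤ.* (ℤ.+ 0 ℤ.- w) → u ≡ m ℤ.* w
negate-ratio u w m h₁ = trans (ℤI.identity (v 0F) (v 2F ⊗ v 1F ⊕ (# (ℤ.+ 0) ⊖ # (ℤ.+ 1)) ⊗ (# (ℤ.+ 0) ⊖ v 0F ⊖ v 2F ⊗ (# (ℤ.+ 0) ⊖ v 1F))) refl (u ∷ w ∷ m ∷ [])) (ℤI.vanish {m ℤ.* w} {ℤ.+ 0 ℤ.- ℤ.+ 1} h₁)

flip-class : ∀ s → ⟦ flip s ⟧ᶜ ≡ 𝟘 - ⟦ s ⟧ᶜ
flip-class (cls n e t h q p) = trans (cong (λ x → x * ε ⁺ e * (𝟚 ⁺ t * θ ⁺ h * ρ₅ ⁺ q * π₅ ⁺ p)) (not-sign n)) (flip-value (-𝟙 ⁺ n) (ε ⁺ e) (𝟚 ⁺ t * θ ⁺ h * ρ₅ ⁺ q * π₅ ⁺ p))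

ι-0- : ∀ u → ι (ℤ.+ 0 ℤ.- u) ≡ 𝟘 - ι u
ι-0- u = trans (ι-+ (ℤ.+ 0) (ℤ.- u)) (cong (λ x → 𝟘 + x) (ι-neg u))

flip-squares : ∀ {s t u w} → Square-classes s t u w → Square-classes (flip s) (flip t) (ℤ.+ 0 ℤ.- u) (ℤ.+ 0 ℤ.- w)
flip-squares {s} {t} {u} {w} ((c , e) , (d , f)) = (c , side s θ e) , (d , side t θ₂ f)
  where
  side : ∀ s ρ {c} → ⟦ s ⟧ᶜ * (c * c) ≡ ι u - ρ * ι w → ⟦ flip s ⟧ᶜ * (c * c) ≡ ι (ℤ.+ 0 ℤ.- u) - ρ * ι (ℤ.+ 0 ℤ.- w)
  side s ρ {c} e = trans (flip-square ⟦ s ⟧ᶜ ⟦ flip s ⟧ᶜ c _ 𝟘 (ι u) (ι w) ρ (flip-class s) e refl) (cong₂ (λ x y → x - ρ * y) (sym (ι-0- u)) (sym (ι-0- w)))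

even-class : ∀ s → even-class? s ≡ true → 𝟚 ∣𝒪 ⟦ s ⟧ᶜ
even-class (cls n e true h q p) _ = _ , even-class-value (-𝟙 ⁺ n) (ε ⁺ e) (θ ⁺ h) (ρ₅ ⁺ q) (π₅ ⁺ p)

complement : ∀ {i} → i ℕ.< 8 → ℤ.+ (8 ℕ.∸ i) ≡ ℤ.+ 8 ℤ.- ℤ.+ i
complement {i} i<8 = sym (trans (ℤₚ.m-n≡m⊖n 8 i) (ℤₚ.⊖-≥ (ℕₚ.<⇒≤ i<8)))

negated : ∀ {u w} → Ratio (ℤ.+ 0 ℤ.- u) (ℤ.+ 0 ℤ.- w) → Ratio u w
negated {u} {w} (ratio m k e) = ratio m k (negate-ratio u w m e)

listed-ratio : ∀ s t i j → i ℕ.< 8 → j ℕ.< 8 → listed? s t i j ≡ true → ∀ u w a b → u ≡ ℤ.+ i ℤ.+ ℤ.+ 8 ℤ.* a → w ≡ ℤ.+ j ℤ.+ ℤ.+ 8 ℤ.* b → Square-classes s t u w → Ratio u w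
listed-ratio s t i j i<8 j<8 l u w a b u≡ w≡ sc = ∨-case (is-just (find s t i j)) _ (λ e → dispatch (from-found e) u w a b u≡ w≡ sc)
  (λ e → negated (dispatch (from-found e) (ℤ.+ 0 ℤ.- u) (ℤ.+ 0 ℤ.- w) (ℤ.+ 0 ℤ.- ℤ.+ 1 ℤ.- a) (ℤ.+ 0 ℤ.- ℤ.+ 1 ℤ.- b)
    (negate-digit u (ℤ.+ i) a _ u≡ (complement i<8)) (negate-digit w (ℤ.+ j) b _ w≡ (complement j<8)) (flip-squares sc))) l

-- The hypothesis on k is the equation of the sextic, written as five times the norms of the two
-- linear forms.
module Cover (u w : ℤ) (k : 𝒪) (uw : Cop (ι u) (ι w))
  (k²≡ : k * k ≡ ι (ℤ.+ 5) * ((ι u - θ * ι w) * (ι u - θ * ι w) ♯ * ((ι u - θ₂ * ι w) * (ι u - θ₂ * ι w) ♯))) where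

  P Q : 𝒪
  P = ι u - θ * ι w
  Q = ι u - θ₂ * ι w

  i j : ℕ
  i = u ℤD.%ℕ 8
  j = w ℤD.%ℕ 8
  i<8 = ℤD.n%ℕd<d u 8
  j<8 = ℤD.n%ℕd<d w 8

  digit-form : ∀ n → n ≡ ℤ.+ (n ℤD.%ℕ 8) ℤ.+ ℤ.+ 8 ℤ.* (n ℤD./ℕ 8)
  digit-form n = trans (ℤD.a≡a%ℕn+[a/ℕn]*n n 8) (cong (λ x → ℤ.+ (n ℤD.%ℕ 8) ℤ.+ x) (ℤₚ.*-comm (n ℤD./ℕ 8) (ℤ.+ 8)))

  u≈ : ι u ≈ ι (ℤ.+ i) [ 𝟠 ]
  u≈ = ι-≈8 {a = u ℤD./ℕ 8} (digit-form u)
  w≈ : ι w ≈ ι (ℤ.+ j) [ 𝟠 ]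
  w≈ = ι-≈8 {a = w ℤD./ℕ 8} (digit-form w)
  P≈ : P ≈ ι (ℤ.+ i) - θ * ι (ℤ.+ j) [ 𝟠 ]
  P≈ = ≈-- u≈ (≈-* ≈-refl w≈)
  Q≈ : Q ≈ ι (ℤ.+ i) - θ₂ * ι (ℤ.+ j) [ 𝟠 ]
  Q≈ = ≈-- u≈ (≈-* ≈-refl w≈)

  not-both-even : div? 2 (ι (ℤ.+ i)) ∧ div? 2 (ι (ℤ.+ j)) ≡ true → ⊥
  not-both-even e = even-odd (∣-resp-≈ (≈-sym (8⇒2 w≈)) (div?-sound 2 _ (proj₂ d)))
      (cop-sym (cop-∣ˡ (∣-resp-≈ (≈-sym (8⇒2 u≈)) (div?-sound 2 _ (proj₁ d))) uw))
    where
    d = ∧-split (div? 2 (ι (ℤ.+ i))) (div? 2 (ι (ℤ.+ j))) e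

  odds : Odd P × Odd Q
  odds = ∨-case (div? 2 (ι (ℤ.+ i)) ∧ div? 2 (ι (ℤ.+ j))) _ (λ e → ⊥-elim (not-both-even e)) both
      (allUpTo-sound 8 (test i) (allUpTo-sound 8 (λ i → allUpTo 8 (test i)) parity-check {i} i<8) {j} j<8)
    where
    test : ℕ → ℕ → Bool
    test i j = (div? 2 (ι (ℤ.+ i)) ∧ div? 2 (ι (ℤ.+ j))) ∨ (odd? (ι (ℤ.+ i) - θ * ι (ℤ.+ j)) ∧ odd? (ι (ℤ.+ i) - θ₂ * ι (ℤ.+ j)))
    both : odd? (ι (ℤ.+ i) - θ * ι (ℤ.+ j)) ∧ odd? (ι (ℤ.+ i) - θ₂ * ι (ℤ.+ j)) ≡ true → Odd P × Odd Q
    both e = odd-≈ (≈-sym (8⇒2 P≈)) (odd?-sound _ (proj₁ s)) , odd-≈ (≈-sym (8⇒2 Q≈)) (odd?-sound _ (proj₂ s))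
      where
      s = ∧-split (odd? (ι (ℤ.+ i) - θ * ι (ℤ.+ j))) (odd? (ι (ℤ.+ i) - θ₂ * ι (ℤ.+ j))) e

  -- The two cubics differ by 4w³; so the primes common to P and the norm of Q, or to Q and the norm
  -- of P, lie above 2.
  cubics : Q * Q ♯ ≡ P * P ♯ + 𝟜 * (ι w * (ι w * ι w))
  cubics = cubic-difference (P * P ♯) (Q * Q ♯) (ι u) (ι w) 𝟘 𝟘
    (cubic (ι u) (ι w) θ (θ ♯) (P ♯) (ι (ℤ.+ 3)) (Trace-zero.♯-form θ trace-θ u w) θ♯≡ θ³≡)
    (cubic (ι u) (ι w) θ₂ (θ₂ ♯) (Q ♯) (ι (ℤ.+ 7)) (Trace-zero.♯-form θ₂ trace-θ₂ u w) θ₂♯≡ θ₂³≡)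

  class-P : ∃ λ s → ∃ λ h → P ≡ ⟦ s ⟧ᶜ * (h * h)
  class-P = linear-class {k} {Q * Q ♯} {𝟜} θ trace-θ u w uw (proj₁ odds) (smooth-by-norm _ 0 3 1 norm-derivative-θ (*-identityˡ 𝟙)) (smooth-by-norm 𝟜 6 0 0 norm-4 (*-identityˡ 𝟙)) cubics
    (trans (regroup P (P ♯) (Q * Q ♯)) (sym k²≡))

  class-Q : ∃ λ s → ∃ λ h → Q ≡ ⟦ s ⟧ᶜ * (h * h)
  class-Q = linear-class {k} {P * P ♯} {ι -[1+ 3 ]} θ₂ trace-θ₂ u w uw (proj₂ odds) (smooth-by-norm _ 0 5 1 norm-derivative-θ₂ (*-identityˡ 𝟙)) (smooth-by-norm (ι -[1+ 3 ]) 6 0 0 norm--4 -𝟙*-𝟙)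
    (cubic-difference′ (P * P ♯) (Q * Q ♯) (ι w) (ι -[1+ 3 ]) cubics -4≡) (trans (regroup′ Q (Q ♯) (P * P ♯)) (sym k²≡))

  conclude : (∃ λ s → ∃ λ h → P ≡ ⟦ s ⟧ᶜ * (h * h)) → (∃ λ s → ∃ λ h → Q ≡ ⟦ s ⟧ᶜ * (h * h)) → Ratio u w
  conclude (s , c , P≡) (t , d , Q≡) = ∨-case (even-class? s ∨ even-class? t) _ (λ e → ⊥-elim (evens e)) (∨-case (global? ⟦ s ⟧ᶜ ⟦ t ⟧ᶜ) _ (λ e → ⊥-elim (globals e)) locals)
      (allClasses-sound (pair? s) (allClasses-sound (λ s → allClasses (pair? s)) pairs-check s) t)
    where
    oP = subst Odd P≡ (proj₁ odds)
    oQ = subst Odd Q≡ (proj₂ odds)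
    nonzero : ∀ {s h} → Odd (s * (h * h)) → ¬ h ≡ 𝟘
    nonzero o = odd≢𝟘 (odd-*ˡ (odd-*ʳ o))
    n□ = norm-condition {k} (nonzero oP) (nonzero oQ) k²≡ P≡ Q≡
    evens : even-class? s ∨ even-class? t ≡ true → ⊥
    evens = ∨-case (even-class? s) _ (λ e → even-odd (even-class s e) (odd-*ˡ oP)) (λ e → even-odd (even-class t e) (odd-*ˡ oQ))
    globals : global? ⟦ s ⟧ᶜ ⟦ t ⟧ᶜ ≡ true → ⊥
    globals = ∨-case (norm-nonsquare? ⟦ s ⟧ᶜ ⟦ t ⟧ᶜ) _
      (∨-case (Local.not-square? at-θ 8 (ι (ℤ.+ 5) * (⟦ s ⟧ᶜ * ⟦ s ⟧ᶜ ♯ * (⟦ t ⟧ᶜ * ⟦ t ⟧ᶜ ♯)))) _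
        (λ e → Local.not-square?-sound at-θ 8 _ (proj₁ n□) e (≡⇒≈ (proj₂ n□))) (λ e → Local.not-square?-sound at-π₅ 8 _ (proj₁ n□) e (≡⇒≈ (proj₂ n□))))
      (∨-case (Locally.no-points? at-θ ⟦ s ⟧ᶜ ⟦ t ⟧ᶜ) _ (Locally.no-points at-θ {c = c} {d = d} uw (sym P≡) (sym Q≡)) (Locally.no-points at-π₅ {c = c} {d = d} uw (sym P≡) (sym Q≡)))
    locals : allUpTo 8 (λ i → allUpTo 8 λ j → residues? s t i j) ≡ true → Ratio u w
    locals e = ∨-case (div? 2 (ι (ℤ.+ i)) ∧ div? 2 (ι (ℤ.+ j))) _ (λ e → ⊥-elim (not-both-even e))
      (∨-case (listed? s t i j) _ (λ l → listed-ratio s t i j i<8 j<8 l u w (u ℤD./ℕ 8) (w ℤD./ℕ 8) (digit-form u) (digit-form w) ((c , sym P≡) , (d , sym Q≡)))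
        (∨-case (misses₈? (ι (ℤ.+ i) - θ * ι (ℤ.+ j)) ⟦ s ⟧ᶜ) _ (λ m → ⊥-elim (misses₈?-sound {c = c} (sym P≡) P≈ m)) (λ m → ⊥-elim (misses₈?-sound {c = d} (sym Q≡) Q≈ m))))
      (allUpTo-sound 8 (residues? s t i) (allUpTo-sound 8 (λ i → allUpTo 8 (residues? s t i)) e {i} i<8) {j} j<8)

  result : Ratio u w
  result = conclude class-P class-Q

-- rational points

ιℚ : ℤ → ℚ
ιℚ n = mkℚ n 0 (Coprimality.sym (Coprimality.1-coprimeTo ∣ n ∣))

ι+-cross : ∀ a b → a ≡ a → (a ℤ.+ b) ℤ.* ℤ.+ 1 ≡ (a ℤ.* ℤ.+ 1 ℤ.+ b ℤ.* ℤ.+ 1) ℤ.* ℤ.+ 1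
ι+-cross a b h₁ = trans (ℤI.identity ((v 0F ⊕ v 1F) ⊗ # (ℤ.+ 1)) ((v 0F ⊗ # (ℤ.+ 1) ⊕ v 1F ⊗ # (ℤ.+ 1)) ⊗ # (ℤ.+ 1) ⊕ # (ℤ.+ 0) ⊗ (v 0F ⊖ v 0F)) refl (a ∷ b ∷ [])) (ℤI.vanish {(a ℤ.* ℤ.+ 1 ℤ.+ b ℤ.* ℤ.+ 1) ℤ.* ℤ.+ 1} {ℤ.+ 0} h₁)
ι*-cross : ∀ a b → a ≡ a → a ℤ.* b ℤ.* ℤ.+ 1 ≡ a ℤ.* b ℤ.* ℤ.+ 1
ι*-cross a b h₁ = trans (ℤI.identity (v 0F ⊗ v 1F ⊗ # (ℤ.+ 1)) (v 0F ⊗ v 1F ⊗ # (ℤ.+ 1) ⊕ # (ℤ.+ 0) ⊗ (v 0F ⊖ v 0F)) refl (a ∷ b ∷ [])) (ℤI.vanish {a ℤ.* b ℤ.* ℤ.+ 1} {ℤ.+ 0} h₁)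

ιℚ-+ : ∀ m n → ιℚ (m ℤ.+ n) ≡ ιℚ m ℚ.+ ιℚ n
ιℚ-+ m n = ℚₚ.toℚᵘ-injective (ℚᵘₚ.≃-trans (*≡* (ι+-cross m n refl)) (ℚᵘₚ.≃-sym (ℚₚ.toℚᵘ-homo-+ (ιℚ m) (ιℚ n))))

ιℚ-* : ∀ m n → ιℚ (m ℤ.* n) ≡ ιℚ m ℚ.* ιℚ n
ιℚ-* m n = ℚₚ.toℚᵘ-injective (ℚᵘₚ.≃-trans (*≡* refl) (ℚᵘₚ.≃-sym (ℚₚ.toℚᵘ-homo-* (ιℚ m) (ιℚ n))))

ιℚ-neg : ∀ m → ιℚ (ℤ.- m) ≡ ℚ.- ιℚ m
ιℚ-neg (ℤ.+ zero) = refl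
ιℚ-neg (ℤ.+ suc n) = refl
ιℚ-neg -[1+ n ] = refl

ℚ-algebra : ℤ-Algebra
ℚ-algebra = record
  { isCommutativeRing = ℚₚ.+-*-isCommutativeRing
  ; ι = ιℚ ; ι-+ = ιℚ-+ ; ι-* = ιℚ-* ; ι-neg = ιℚ-neg ; ι-0 = refl ; ι-1 = refl }

module ℚI = Identities ℚ-algebra

module _ (R : ℤ-Algebra) where
  private
    module R = ℤ-Algebra R
    module RI = Identities R

  -- Carries an equation between integer polynomials from ℚ down to ℤ, where the embedding is
  -- injective, and from there up to `𝒪`.
  ι-⟦⟧ : ∀ {n} (e : Expr n) ρ → R.ι (ℤI.⟦ e ⟧ ρ) ≡ RI.⟦ e ⟧ (map R.ι ρ)
  ι-⟦⟧ (v i) ρ = sym (Vecₚ.lookup-map i R.ι ρ)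
  ι-⟦⟧ (# k) ρ = refl
  ι-⟦⟧ (e ⊕ f) ρ = trans (R.ι-+ _ _) (cong₂ R._+_ (ι-⟦⟧ e ρ) (ι-⟦⟧ f ρ))
  ι-⟦⟧ (e ⊗ f) ρ = trans (R.ι-* _ _) (cong₂ R._*_ (ι-⟦⟧ e ρ) (ι-⟦⟧ f ρ))
  ι-⟦⟧ (e ⊖ f) ρ = trans (R.ι-+ _ _) (cong₂ R._+_ (ι-⟦⟧ e ρ) (trans (R.ι-neg _) (cong R.-_ (ι-⟦⟧ f ρ))))

ιℚ-injective : ∀ {m n} → ιℚ m ≡ ιℚ n → m ≡ n
ιℚ-injective e = cong ℚ.numerator e

numerator-denominator : ∀ a b .(c : Coprime ∣ a ∣ (suc b)) → mkℚ a b c ℚ.* ιℚ (ℤ.+ suc b) ≡ ιℚ a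
numerator-denominator a b c = ℚₚ.toℚᵘ-injective (ℚᵘₚ.≃-trans (ℚₚ.toℚᵘ-homo-* (mkℚ a b c) (ιℚ (ℤ.+ suc b)))
  (*≡* (trans (ℤₚ.*-identityʳ _) (cong (a ℤ.*_) (cong (λ x → ℤ.+ suc x) (sym (ℕₚ.*-identityʳ b)))))))

inverse : ∀ {p} → p ≢ 0ℚ → ∃ λ i → p ℚ.* i ≡ 1ℚ
inverse {p} p≢0 = ℚ.1/_ p {{ℚ.≢-nonZero p≢0}} , ℚₚ.*-inverseʳ p {{ℚ.≢-nonZero p≢0}}

cancel-unit : ∀ p i q → p ℚ.* i ≡ ιℚ (ℤ.+ 1) → p ℚ.* q ≡ ιℚ (ℤ.+ 0) → q ≡ ιℚ (ℤ.+ 0)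
cancel-unit p i q h₁ h₂ = trans (ℚI.identity (v 2F) (# (ℤ.+ 0) ⊕ (# (ℤ.+ 0) ⊖ v 2F) ⊗ (v 0F ⊗ v 1F ⊖ # (ℤ.+ 1)) ⊕ v 1F ⊗ (v 0F ⊗ v 2F ⊖ # (ℤ.+ 0))) refl (p ∷ i ∷ q ∷ [])) (trans (ℚI.vanish {ιℚ (ℤ.+ 0) ℚ.+ (ιℚ (ℤ.+ 0) ℚ.- q) ℚ.* (p ℚ.* i ℚ.- ιℚ (ℤ.+ 1))} {i} h₂) (ℚI.vanish {ιℚ (ℤ.+ 0)} {ιℚ (ℤ.+ 0) ℚ.- q} h₁))

ℚ-product≡0 : ∀ p q → p ℚ.* q ≡ 0ℚ → p ≡ 0ℚ ⊎ q ≡ 0ℚ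
ℚ-product≡0 p q e = decide (p ℚₚ.≟ 0ℚ)
  where
  decide : Dec (p ≡ 0ℚ) → p ≡ 0ℚ ⊎ q ≡ 0ℚ
  decide (yes p≡0) = inj₁ p≡0
  decide (no p≢0) = inj₂ (cancel-unit p (proj₁ (inverse p≢0)) q (proj₂ (inverse p≢0)) e)

-- coprime integers stay coprime in 𝒪

bezout-cop₁ : ∀ x y m n s → ι (ℤ.+ 1) + y * n ≡ x * m → s * s ≡ ι (ℤ.+ 1) → s * x * (s * m) + (ι (ℤ.+ 0) - y) * n ≡ ι (ℤ.+ 1)
bezout-cop₁ x y m n s h₁ h₂ = trans (𝒪I.identity (v 4F ⊗ v 0F ⊗ (v 4F ⊗ v 2F) ⊕ (# (ℤ.+ 0) ⊖ v 1F) ⊗ v 3F) (# (ℤ.+ 1) ⊕ (# (ℤ.+ 0) ⊖ # (ℤ.+ 1)) ⊗ (# (ℤ.+ 1) ⊕ v 1F ⊗ v 3F ⊖ v 0F ⊗ v 2F) ⊕ v 0F ⊗ v 2F ⊗ (v 4F ⊗ v 4F ⊖ # (ℤ.+ 1))) refl (x ∷ y ∷ m ∷ n ∷ s ∷ [])) (trans (𝒪I.vanish h₂) (𝒪I.vanish h₁))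
bezout-cop₂ : ∀ x y m n s → ι (ℤ.+ 1) + x * m ≡ y * n → s * s ≡ ι (ℤ.+ 1) → (ι (ℤ.+ 0) - s * x) * (s * m) + y * n ≡ ι (ℤ.+ 1)
bezout-cop₂ x y m n s h₁ h₂ = trans (𝒪I.identity ((# (ℤ.+ 0) ⊖ v 4F ⊗ v 0F) ⊗ (v 4F ⊗ v 2F) ⊕ v 1F ⊗ v 3F) (# (ℤ.+ 1) ⊕ (# (ℤ.+ 0) ⊖ # (ℤ.+ 1)) ⊗ (# (ℤ.+ 1) ⊕ v 0F ⊗ v 2F ⊖ v 1F ⊗ v 3F) ⊕ (# (ℤ.+ 0) ⊖ v 0F ⊗ v 2F) ⊗ (v 4F ⊗ v 4F ⊖ # (ℤ.+ 1))) refl (x ∷ y ∷ m ∷ n ∷ s ∷ [])) (trans (𝒪I.vanish h₂) (𝒪I.vanish h₁))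

sign-form : ∀ a → ∃ λ s → s * s ≡ 𝟙 × ι a ≡ s * ι (ℤ.+ ∣ a ∣)
sign-form (ℤ.+ n) = 𝟙 , *-identityˡ 𝟙 , sym (*-identityˡ (ι (ℤ.+ n)))
sign-form -[1+ n ] = -𝟙 , -𝟙*-𝟙 , trans (cong ι (sym (ℤₚ.-1*i≡-i (ℤ.+ suc n)))) (ι-* -[1+ 0 ] (ℤ.+ suc n))

cop-ι : ∀ a b → Coprime ∣ a ∣ b → Cop (ι a) (ι (ℤ.+ b))
cop-ι a b c = go (Coprimality.coprime-Bézout c) (sign-form a)
  where
  ι-linear : ∀ y n x m → 1 ℕ.+ y ℕ.* n ≡ x ℕ.* m → 𝟙 + ι (ℤ.+ y) * ι (ℤ.+ n) ≡ ι (ℤ.+ x) * ι (ℤ.+ m)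
  ι-linear y n x m e = trans (cong (λ z → 𝟙 + z) (trans (sym (ι-* (ℤ.+ y) (ℤ.+ n))) (cong ι (sym (ℤₚ.pos-* y n)))))
    (trans (sym (ι-+ (ℤ.+ 1) (ℤ.+ (y ℕ.* n)))) (trans (cong (λ z → ι (ℤ.+ z)) e) (trans (cong ι (ℤₚ.pos-* x m)) (ι-* (ℤ.+ x) (ℤ.+ m)))))
  go : GCD.Bézout.Identity 1 ∣ a ∣ b → (∃ λ s → s * s ≡ 𝟙 × ι a ≡ s * ι (ℤ.+ ∣ a ∣)) → Cop (ι a) (ι (ℤ.+ b))
  go (GCD.Bézout.+- x y e) (s , s² , a≡) = subst (λ A → Cop A (ι (ℤ.+ b))) (sym a≡) (cop (bezout-cop₁ (ι (ℤ.+ x)) (ι (ℤ.+ y)) (ι (ℤ.+ ∣ a ∣)) (ι (ℤ.+ b)) s (ι-linear y b x ∣ a ∣ e) s²))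
  go (GCD.Bézout.-+ x y e) (s , s² , a≡) = subst (λ A → Cop A (ι (ℤ.+ b))) (sym a≡) (cop (bezout-cop₂ (ι (ℤ.+ x)) (ι (ℤ.+ y)) (ι (ℤ.+ ∣ a ∣)) (ι (ℤ.+ b)) s (ι-linear x ∣ a ∣ y b e) s²))

-- The substitution x = lW, z = l(U - W) behind the proof: with s = z³ + 3xz², five times the sextic
-- is (s + x³)(s + 5x³), and U³ - 3UW² becomes s - 2x³ for l = 1.
clear-scale : ∀ y l U W A B C E → y ℚ.* y ≡ l ℚ.* W ℚ.* (l ℚ.* W ℚ.* (l ℚ.* W ℚ.* (l ℚ.* W ℚ.* (l ℚ.* W ℚ.* (l ℚ.* W ℚ.* ιℚ (ℤ.+ 1)))))) ℚ.+ A ℚ.* (l ℚ.* W ℚ.* (l ℚ.* W ℚ.* (l ℚ.* W ℚ.* (l ℚ.* W ℚ.* ιℚ (ℤ.+ 1))))) ℚ.* (l ℚ.* (U ℚ.- W) ℚ.* (l ℚ.* (U ℚ.- W) ℚ.* ιℚ (ℤ.+ 1))) ℚ.+ B ℚ.* (l ℚ.* W ℚ.* (l ℚ.* W ℚ.* (l ℚ.* W ℚ.* ιℚ (ℤ.+ 1)))) ℚ.* (l ℚ.* (U ℚ.- W) ℚ.* (l ℚ.* (U ℚ.- W) ℚ.* (l ℚ.* (U ℚ.- W) ℚ.* ιℚ (ℤ.+ 1)))) ℚ.+ C ℚ.* (l ℚ.* W ℚ.* (l ℚ.* W ℚ.* ιℚ (ℤ.+ 1))) ℚ.* (l ℚ.*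 (U ℚ.- W) ℚ.* (l ℚ.* (U ℚ.- W) ℚ.* (l ℚ.* (U ℚ.- W) ℚ.* (l ℚ.* (U ℚ.- W) ℚ.* ιℚ (ℤ.+ 1))))) ℚ.+ B ℚ.* (l ℚ.* W) ℚ.* (l ℚ.* (U ℚ.- W) ℚ.* (l ℚ.* (U ℚ.- W) ℚ.* (l ℚ.* (U ℚ.- W) ℚ.* (l ℚ.* (U ℚ.- W) ℚ.* (l ℚ.* (U ℚ.- W) ℚ.* ιℚ (ℤ.+ 1)))))) ℚ.+ E ℚ.* (l ℚ.* (U ℚ.- W) ℚ.* (l ℚ.* (U ℚ.- W) ℚ.* (l ℚ.* (U ℚ.- W) ℚ.* (l ℚ.* (U ℚ.- W) ℚ.* (l ℚ.* (U ℚ.- W) ℚ.* (l ℚ.* (U ℚ.- W) ℚ.* ιℚ (ℤ.+ 1))))))) → ιℚ (ℤ.+ 5) ℚ.* A ≡ ιℚ (ℤ.+ 18) → ιℚ (ℤ.+ 5) ℚ.* B ≡ ιℚ (ℤ.+ 6) → ιℚ (ℤ.+ 5) ℚ.* C ≡ ιℚ (ℤ.+ 9) → ιℚ (ℤ.+ 5) ℚ.* E ≡ ιℚ (ℤ.+ 1) → ιℚ (ℤ.+ 5) ℚ.* (y ℚ.* y) ≡ l ℚ.* l ℚ.* l ℚ.* l ℚ.* l ℚ.* l ℚ.* ((U ℚ.* U ℚ.* U ℚ.- ιℚ (ℤ.+ 3) ℚ.* U ℚ.* (W ℚ.* W) ℚ.+ ιℚ (ℤ.+ 3) ℚ.* (W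 ℚ.* W ℚ.* W)) ℚ.* (U ℚ.* U ℚ.* U ℚ.- ιℚ (ℤ.+ 3) ℚ.* U ℚ.* (W ℚ.* W) ℚ.+ ιℚ (ℤ.+ 7) ℚ.* (W ℚ.* W ℚ.* W)))
clear-scale y l U W A B C E h₁ h₂ h₃ h₄ h₅ = trans (ℚI.identity (# (ℤ.+ 5) ⊗ (v 0F ⊗ v 0F)) (v 1F ⊗ v 1F ⊗ v 1F ⊗ v 1F ⊗ v 1F ⊗ v 1F ⊗ ((v 2F ⊗ v 2F ⊗ v 2F ⊖ # (ℤ.+ 3) ⊗ v 2F ⊗ (v 3F ⊗ v 3F) ⊕ # (ℤ.+ 3) ⊗ (v 3F ⊗ v 3F ⊗ v 3F)) ⊗ (v 2F ⊗ v 2F ⊗ v 2F ⊖ # (ℤ.+ 3) ⊗ v 2F ⊗ (v 3F ⊗ v 3F) ⊕ # (ℤ.+ 7) ⊗ (v 3F ⊗ v 3F ⊗ v 3F))) ⊕ # (ℤ.+ 5) ⊗ (v 0F ⊗ v 0F ⊖ (v 1F ⊗ v 3F ⊗ (v 1F ⊗ v 3F ⊗ (v 1F ⊗ v 3F ⊗ (v 1F ⊗ v 3F ⊗ (v 1F ⊗ v 3F ⊗ (v 1F ⊗ v 3F ⊗ # (ℤ.+ 1)))))) ⊕ v 4F ⊗ (v 1F ⊗ v 3F ⊗ (v 1F ⊗ v 3F ⊗ (v 1F ⊗ v 3F ⊗ (v 1F ⊗ v 3F ⊗ # (ℤ.+ 1))))) ⊗ (v 1F ⊗ (v 2F ⊖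 v 3F) ⊗ (v 1F ⊗ (v 2F ⊖ v 3F) ⊗ # (ℤ.+ 1))) ⊕ v 5F ⊗ (v 1F ⊗ v 3F ⊗ (v 1F ⊗ v 3F ⊗ (v 1F ⊗ v 3F ⊗ # (ℤ.+ 1)))) ⊗ (v 1F ⊗ (v 2F ⊖ v 3F) ⊗ (v 1F ⊗ (v 2F ⊖ v 3F) ⊗ (v 1F ⊗ (v 2F ⊖ v 3F) ⊗ # (ℤ.+ 1)))) ⊕ v 6F ⊗ (v 1F ⊗ v 3F ⊗ (v 1F ⊗ v 3F ⊗ # (ℤ.+ 1))) ⊗ (v 1F ⊗ (v 2F ⊖ v 3F) ⊗ (v 1F ⊗ (v 2F ⊖ v 3F) ⊗ (v 1F ⊗ (v 2F ⊖ v 3F) ⊗ (v 1F ⊗ (v 2F ⊖ v 3F) ⊗ # (ℤ.+ 1))))) ⊕ v 5F ⊗ (v 1F ⊗ v 3F) ⊗ (v 1F ⊗ (v 2F ⊖ v 3F) ⊗ (v 1F ⊗ (v 2F ⊖ v 3F) ⊗ (v 1F ⊗ (v 2F ⊖ v 3F) ⊗ (v 1F ⊗ (v 2F ⊖ v 3F) ⊗ (v 1F ⊗ (v 2F ⊖ v 3F) ⊗ # (ℤ.+ 1)))))) ⊕ v 7F ⊗ (v 1F ⊗ (v 2F ⊖ v 3F) ⊗ (v 1F ⊗ (v 2F ⊖ v 3F) ⊗ (v 1F ⊗ (v 2F ⊖ v 3F) ⊗ (v 1F ⊗ (v 2F ⊖ v 3F) ⊗ (v 1F ⊗ (v 2F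 ⊖ v 3F) ⊗ (v 1F ⊗ (v 2F ⊖ v 3F) ⊗ # (ℤ.+ 1))))))))) ⊕ v 1F ⊗ v 3F ⊗ (v 1F ⊗ v 3F) ⊗ (v 1F ⊗ v 3F) ⊗ (v 1F ⊗ v 3F) ⊗ (v 1F ⊗ (v 2F ⊖ v 3F) ⊗ (v 1F ⊗ (v 2F ⊖ v 3F))) ⊗ (# (ℤ.+ 5) ⊗ v 4F ⊖ # (ℤ.+ 18)) ⊕ (v 1F ⊗ v 3F ⊗ (v 1F ⊗ v 3F) ⊗ (v 1F ⊗ v 3F) ⊗ (v 1F ⊗ (v 2F ⊖ v 3F) ⊗ (v 1F ⊗ (v 2F ⊖ v 3F)) ⊗ (v 1F ⊗ (v 2F ⊖ v 3F))) ⊕ v 1F ⊗ v 3F ⊗ (v 1F ⊗ (v 2F ⊖ v 3F) ⊗ (v 1F ⊗ (v 2F ⊖ v 3F)) ⊗ (v 1F ⊗ (v 2F ⊖ v 3F)) ⊗ (v 1F ⊗ (v 2F ⊖ v 3F)) ⊗ (v 1F ⊗ (v 2F ⊖ v 3F)))) ⊗ (# (ℤ.+ 5) ⊗ v 5F ⊖ # (ℤ.+ 6)) ⊕ v 1F ⊗ v 3F ⊗ (v 1F ⊗ v 3F) ⊗ (v 1F ⊗ (v 2F ⊖ v 3F) ⊗ (v 1F ⊗ (v 2F ⊖ v 3F)) ⊗ (v 1F ⊗ (v 2F ⊖ v 3F)) ⊗ (v 1F ⊗ (v 2F ⊖ v 3F))) ⊗ (# (ℤ.+ 5) ⊗ v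 6F ⊖ # (ℤ.+ 9)) ⊕ v 1F ⊗ (v 2F ⊖ v 3F) ⊗ (v 1F ⊗ (v 2F ⊖ v 3F)) ⊗ (v 1F ⊗ (v 2F ⊖ v 3F)) ⊗ (v 1F ⊗ (v 2F ⊖ v 3F)) ⊗ (v 1F ⊗ (v 2F ⊖ v 3F)) ⊗ (v 1F ⊗ (v 2F ⊖ v 3F)) ⊗ (# (ℤ.+ 5) ⊗ v 7F ⊖ # (ℤ.+ 1))) refl (y ∷ l ∷ U ∷ W ∷ A ∷ B ∷ C ∷ E ∷ [])) (trans (ℚI.vanish {l ℚ.* l ℚ.* l ℚ.* l ℚ.* l ℚ.* l ℚ.* ((U ℚ.* U ℚ.* U ℚ.- ιℚ (ℤ.+ 3) ℚ.* U ℚ.* (W ℚ.* W) ℚ.+ ιℚ (ℤ.+ 3) ℚ.* (W ℚ.* W ℚ.* W)) ℚ.* (U ℚ.* U ℚ.* U ℚ.- ιℚ (ℤ.+ 3) ℚ.* U ℚ.* (W ℚ.* W) ℚ.+ ιℚ (ℤ.+ 7) ℚ.* (W ℚ.* W ℚ.* W))) ℚ.+ ιℚ (ℤ.+ 5) ℚ.* (y ℚ.* y ℚ.- (l ℚ.* W ℚ.* (l ℚ.* W ℚ.* (l ℚ.* W ℚ.* (l ℚ.* W ℚ.* (l ℚ.* W ℚ.* (l ℚ.* W ℚ.* ιℚ (ℤ.+ 1)))))) ℚ.+ A ℚ.* (l ℚ.* W ℚ.* (l ℚ.* W ℚ.* (l ℚ.* W ℚ.* (l ℚ.* W ℚ.*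 ιℚ (ℤ.+ 1))))) ℚ.* (l ℚ.* (U ℚ.- W) ℚ.* (l ℚ.* (U ℚ.- W) ℚ.* ιℚ (ℤ.+ 1))) ℚ.+ B ℚ.* (l ℚ.* W ℚ.* (l ℚ.* W ℚ.* (l ℚ.* W ℚ.* ιℚ (ℤ.+ 1)))) ℚ.* (l ℚ.* (U ℚ.- W) ℚ.* (l ℚ.* (U ℚ.- W) ℚ.* (l ℚ.* (U ℚ.- W) ℚ.* ιℚ (ℤ.+ 1)))) ℚ.+ C ℚ.* (l ℚ.* W ℚ.* (l ℚ.* W ℚ.* ιℚ (ℤ.+ 1))) ℚ.* (l ℚ.* (U ℚ.- W) ℚ.* (l ℚ.* (U ℚ.- W) ℚ.* (l ℚ.* (U ℚ.- W) ℚ.* (l ℚ.* (U ℚ.- W) ℚ.* ιℚ (ℤ.+ 1))))) ℚ.+ B ℚ.* (l ℚ.* W) ℚ.* (l ℚ.* (U ℚ.- W) ℚ.* (l ℚ.* (U ℚ.- W) ℚ.* (l ℚ.* (U ℚ.- W) ℚ.* (l ℚ.* (U ℚ.- W) ℚ.* (l ℚ.* (U ℚ.- W) ℚ.* ιℚ (ℤ.+ 1)))))) ℚ.+ E ℚ.* (l ℚ.* (U ℚ.- W) ℚ.* (l ℚ.* (U ℚ.- W) ℚ.* (l ℚ.* (U ℚ.- W) ℚ.* (l ℚ.* (U ℚ.- W) ℚ.* (l ℚ.* (U ℚ.- W) ℚ.* (l ℚ.* (U ℚ.- W) ℚ.* ιℚ (ℤ.+ 1))))))))) ℚ.+ l ℚ.*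 W ℚ.* (l ℚ.* W) ℚ.* (l ℚ.* W) ℚ.* (l ℚ.* W) ℚ.* (l ℚ.* (U ℚ.- W) ℚ.* (l ℚ.* (U ℚ.- W))) ℚ.* (ιℚ (ℤ.+ 5) ℚ.* A ℚ.- ιℚ (ℤ.+ 18)) ℚ.+ (l ℚ.* W ℚ.* (l ℚ.* W) ℚ.* (l ℚ.* W) ℚ.* (l ℚ.* (U ℚ.- W) ℚ.* (l ℚ.* (U ℚ.- W)) ℚ.* (l ℚ.* (U ℚ.- W))) ℚ.+ l ℚ.* W ℚ.* (l ℚ.* (U ℚ.- W) ℚ.* (l ℚ.* (U ℚ.- W)) ℚ.* (l ℚ.* (U ℚ.- W)) ℚ.* (l ℚ.* (U ℚ.- W)) ℚ.* (l ℚ.* (U ℚ.- W)))) ℚ.* (ιℚ (ℤ.+ 5) ℚ.* B ℚ.- ιℚ (ℤ.+ 6)) ℚ.+ l ℚ.* W ℚ.* (l ℚ.* W) ℚ.* (l ℚ.* (U ℚ.- W) ℚ.* (l ℚ.* (U ℚ.- W)) ℚ.* (l ℚ.* (U ℚ.- W)) ℚ.* (l ℚ.* (U ℚ.- W))) ℚ.* (ιℚ (ℤ.+ 5) ℚ.* C ℚ.- ιℚ (ℤ.+ 9))} {l ℚ.* (U ℚ.- W) ℚ.* (l ℚ.* (U ℚ.- W)) ℚ.* (l ℚ.* (U ℚ.- W)) ℚ.* (l ℚ.* (U ℚ.- W)) ℚ.* (l ℚ.* (U ℚ.- W)) ℚ.* (l ℚ.* (U ℚ.- W))} h₅) (trans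 (ℚI.vanish {l ℚ.* l ℚ.* l ℚ.* l ℚ.* l ℚ.* l ℚ.* ((U ℚ.* U ℚ.* U ℚ.- ιℚ (ℤ.+ 3) ℚ.* U ℚ.* (W ℚ.* W) ℚ.+ ιℚ (ℤ.+ 3) ℚ.* (W ℚ.* W ℚ.* W)) ℚ.* (U ℚ.* U ℚ.* U ℚ.- ιℚ (ℤ.+ 3) ℚ.* U ℚ.* (W ℚ.* W) ℚ.+ ιℚ (ℤ.+ 7) ℚ.* (W ℚ.* W ℚ.* W))) ℚ.+ ιℚ (ℤ.+ 5) ℚ.* (y ℚ.* y ℚ.- (l ℚ.* W ℚ.* (l ℚ.* W ℚ.* (l ℚ.* W ℚ.* (l ℚ.* W ℚ.* (l ℚ.* W ℚ.* (l ℚ.* W ℚ.* ιℚ (ℤ.+ 1)))))) ℚ.+ A ℚ.* (l ℚ.* W ℚ.* (l ℚ.* W ℚ.* (l ℚ.* W ℚ.* (l ℚ.* W ℚ.* ιℚ (ℤ.+ 1))))) ℚ.* (l ℚ.* (U ℚ.- W) ℚ.* (l ℚ.* (U ℚ.- W) ℚ.* ιℚ (ℤ.+ 1))) ℚ.+ B ℚ.* (l ℚ.* W ℚ.* (l ℚ.* W ℚ.* (l ℚ.* W ℚ.* ιℚ (ℤ.+ 1)))) ℚ.* (l ℚ.* (U ℚ.- W) ℚ.* (l ℚ.* (U ℚ.- W) ℚ.* (l ℚ.* (U ℚ.- W) ℚ.* ιℚ (ℤ.+ 1)))) ℚ.+ C ℚ.* (l ℚ.* W ℚ.* (l ℚ.*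 W ℚ.* ιℚ (ℤ.+ 1))) ℚ.* (l ℚ.* (U ℚ.- W) ℚ.* (l ℚ.* (U ℚ.- W) ℚ.* (l ℚ.* (U ℚ.- W) ℚ.* (l ℚ.* (U ℚ.- W) ℚ.* ιℚ (ℤ.+ 1))))) ℚ.+ B ℚ.* (l ℚ.* W) ℚ.* (l ℚ.* (U ℚ.- W) ℚ.* (l ℚ.* (U ℚ.- W) ℚ.* (l ℚ.* (U ℚ.- W) ℚ.* (l ℚ.* (U ℚ.- W) ℚ.* (l ℚ.* (U ℚ.- W) ℚ.* ιℚ (ℤ.+ 1)))))) ℚ.+ E ℚ.* (l ℚ.* (U ℚ.- W) ℚ.* (l ℚ.* (U ℚ.- W) ℚ.* (l ℚ.* (U ℚ.- W) ℚ.* (l ℚ.* (U ℚ.- W) ℚ.* (l ℚ.* (U ℚ.- W) ℚ.* (l ℚ.* (U ℚ.- W) ℚ.* ιℚ (ℤ.+ 1))))))))) ℚ.+ l ℚ.* W ℚ.* (l ℚ.* W) ℚ.* (l ℚ.* W) ℚ.* (l ℚ.* W) ℚ.* (l ℚ.* (U ℚ.- W) ℚ.* (l ℚ.* (U ℚ.- W))) ℚ.* (ιℚ (ℤ.+ 5) ℚ.* A ℚ.- ιℚ (ℤ.+ 18)) ℚ.+ (l ℚ.* W ℚ.* (l ℚ.* W) ℚ.* (l ℚ.* W) ℚ.* (l ℚ.* (U ℚ.- W) ℚ.* (l ℚ.* (U ℚ.- W)) ℚ.* (l ℚ.* (U ℚ.- W))) ℚ.+ l ℚ.* W ℚ.*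 (l ℚ.* (U ℚ.- W) ℚ.* (l ℚ.* (U ℚ.- W)) ℚ.* (l ℚ.* (U ℚ.- W)) ℚ.* (l ℚ.* (U ℚ.- W)) ℚ.* (l ℚ.* (U ℚ.- W)))) ℚ.* (ιℚ (ℤ.+ 5) ℚ.* B ℚ.- ιℚ (ℤ.+ 6))} {l ℚ.* W ℚ.* (l ℚ.* W) ℚ.* (l ℚ.* (U ℚ.- W) ℚ.* (l ℚ.* (U ℚ.- W)) ℚ.* (l ℚ.* (U ℚ.- W)) ℚ.* (l ℚ.* (U ℚ.- W)))} h₄) (trans (ℚI.vanish {l ℚ.* l ℚ.* l ℚ.* l ℚ.* l ℚ.* l ℚ.* ((U ℚ.* U ℚ.* U ℚ.- ιℚ (ℤ.+ 3) ℚ.* U ℚ.* (W ℚ.* W) ℚ.+ ιℚ (ℤ.+ 3) ℚ.* (W ℚ.* W ℚ.* W)) ℚ.* (U ℚ.* U ℚ.* U ℚ.- ιℚ (ℤ.+ 3) ℚ.* U ℚ.* (W ℚ.* W) ℚ.+ ιℚ (ℤ.+ 7) ℚ.* (W ℚ.* W ℚ.* W))) ℚ.+ ιℚ (ℤ.+ 5) ℚ.* (y ℚ.* y ℚ.- (l ℚ.* W ℚ.* (l ℚ.* W ℚ.* (l ℚ.* W ℚ.* (l ℚ.* W ℚ.* (l ℚ.* W ℚ.* (l ℚ.* W ℚ.* ιℚ (ℤ.+ 1)))))) ℚ.+ A ℚ.* (l ℚ.* W ℚ.* (l ℚ.* W ℚ.* (l ℚ.* W ℚ.* (l ℚ.*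 W ℚ.* ιℚ (ℤ.+ 1))))) ℚ.* (l ℚ.* (U ℚ.- W) ℚ.* (l ℚ.* (U ℚ.- W) ℚ.* ιℚ (ℤ.+ 1))) ℚ.+ B ℚ.* (l ℚ.* W ℚ.* (l ℚ.* W ℚ.* (l ℚ.* W ℚ.* ιℚ (ℤ.+ 1)))) ℚ.* (l ℚ.* (U ℚ.- W) ℚ.* (l ℚ.* (U ℚ.- W) ℚ.* (l ℚ.* (U ℚ.- W) ℚ.* ιℚ (ℤ.+ 1)))) ℚ.+ C ℚ.* (l ℚ.* W ℚ.* (l ℚ.* W ℚ.* ιℚ (ℤ.+ 1))) ℚ.* (l ℚ.* (U ℚ.- W) ℚ.* (l ℚ.* (U ℚ.- W) ℚ.* (l ℚ.* (U ℚ.- W) ℚ.* (l ℚ.* (U ℚ.- W) ℚ.* ιℚ (ℤ.+ 1))))) ℚ.+ B ℚ.* (l ℚ.* W) ℚ.* (l ℚ.* (U ℚ.- W) ℚ.* (l ℚ.* (U ℚ.- W) ℚ.* (l ℚ.* (U ℚ.- W) ℚ.* (l ℚ.* (U ℚ.- W) ℚ.* (l ℚ.* (U ℚ.- W) ℚ.* ιℚ (ℤ.+ 1)))))) ℚ.+ E ℚ.* (l ℚ.* (U ℚ.- W) ℚ.* (l ℚ.* (U ℚ.- W) ℚ.* (l ℚ.* (U ℚ.- W) ℚ.* (l ℚ.* (U ℚ.- W) ℚ.* (l ℚ.* (U ℚ.- W) ℚ.* (l ℚ.* (U ℚ.- W) ℚ.* ιℚ (ℤ.+ 1))))))))) ℚ.+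 l ℚ.* W ℚ.* (l ℚ.* W) ℚ.* (l ℚ.* W) ℚ.* (l ℚ.* W) ℚ.* (l ℚ.* (U ℚ.- W) ℚ.* (l ℚ.* (U ℚ.- W))) ℚ.* (ιℚ (ℤ.+ 5) ℚ.* A ℚ.- ιℚ (ℤ.+ 18))} {l ℚ.* W ℚ.* (l ℚ.* W) ℚ.* (l ℚ.* W) ℚ.* (l ℚ.* (U ℚ.- W) ℚ.* (l ℚ.* (U ℚ.- W)) ℚ.* (l ℚ.* (U ℚ.- W))) ℚ.+ l ℚ.* W ℚ.* (l ℚ.* (U ℚ.- W) ℚ.* (l ℚ.* (U ℚ.- W)) ℚ.* (l ℚ.* (U ℚ.- W)) ℚ.* (l ℚ.* (U ℚ.- W)) ℚ.* (l ℚ.* (U ℚ.- W)))} h₃) (trans (ℚI.vanish {l ℚ.* l ℚ.* l ℚ.* l ℚ.* l ℚ.* l ℚ.* ((U ℚ.* U ℚ.* U ℚ.- ιℚ (ℤ.+ 3) ℚ.* U ℚ.* (W ℚ.* W) ℚ.+ ιℚ (ℤ.+ 3) ℚ.* (W ℚ.* W ℚ.* W)) ℚ.* (U ℚ.* U ℚ.* U ℚ.- ιℚ (ℤ.+ 3) ℚ.* U ℚ.* (W ℚ.* W) ℚ.+ ιℚ (ℤ.+ 7) ℚ.* (W ℚ.* W ℚ.* W))) ℚ.+ ιℚ (ℤ.+ 5) ℚ.* (y ℚ.* y ℚ.- (l ℚ.* W ℚ.* (l ℚ.* W ℚ.* (l ℚ.* W ℚ.* (l ℚ.* W ℚ.*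 (l ℚ.* W ℚ.* (l ℚ.* W ℚ.* ιℚ (ℤ.+ 1)))))) ℚ.+ A ℚ.* (l ℚ.* W ℚ.* (l ℚ.* W ℚ.* (l ℚ.* W ℚ.* (l ℚ.* W ℚ.* ιℚ (ℤ.+ 1))))) ℚ.* (l ℚ.* (U ℚ.- W) ℚ.* (l ℚ.* (U ℚ.- W) ℚ.* ιℚ (ℤ.+ 1))) ℚ.+ B ℚ.* (l ℚ.* W ℚ.* (l ℚ.* W ℚ.* (l ℚ.* W ℚ.* ιℚ (ℤ.+ 1)))) ℚ.* (l ℚ.* (U ℚ.- W) ℚ.* (l ℚ.* (U ℚ.- W) ℚ.* (l ℚ.* (U ℚ.- W) ℚ.* ιℚ (ℤ.+ 1)))) ℚ.+ C ℚ.* (l ℚ.* W ℚ.* (l ℚ.* W ℚ.* ιℚ (ℤ.+ 1))) ℚ.* (l ℚ.* (U ℚ.- W) ℚ.* (l ℚ.* (U ℚ.- W) ℚ.* (l ℚ.* (U ℚ.- W) ℚ.* (l ℚ.* (U ℚ.- W) ℚ.* ιℚ (ℤ.+ 1))))) ℚ.+ B ℚ.* (l ℚ.* W) ℚ.* (l ℚ.* (U ℚ.- W) ℚ.* (l ℚ.* (U ℚ.- W) ℚ.* (l ℚ.* (U ℚ.- W) ℚ.* (l ℚ.* (U ℚ.- W) ℚ.* (l ℚ.* (U ℚ.- W) ℚ.* ιℚ (ℤ.+ 1)))))) ℚ.+ E ℚ.* (l ℚ.* (U ℚ.- W) ℚ.* (l ℚ.* (U ℚ.- W) ℚ.* (l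 ℚ.* (U ℚ.- W) ℚ.* (l ℚ.* (U ℚ.- W) ℚ.* (l ℚ.* (U ℚ.- W) ℚ.* (l ℚ.* (U ℚ.- W) ℚ.* ιℚ (ℤ.+ 1)))))))))} {l ℚ.* W ℚ.* (l ℚ.* W) ℚ.* (l ℚ.* W) ℚ.* (l ℚ.* W) ℚ.* (l ℚ.* (U ℚ.- W) ℚ.* (l ℚ.* (U ℚ.- W)))} h₂) (ℚI.vanish {l ℚ.* l ℚ.* l ℚ.* l ℚ.* l ℚ.* l ℚ.* ((U ℚ.* U ℚ.* U ℚ.- ιℚ (ℤ.+ 3) ℚ.* U ℚ.* (W ℚ.* W) ℚ.+ ιℚ (ℤ.+ 3) ℚ.* (W ℚ.* W ℚ.* W)) ℚ.* (U ℚ.* U ℚ.* U ℚ.- ιℚ (ℤ.+ 3) ℚ.* U ℚ.* (W ℚ.* W) ℚ.+ ιℚ (ℤ.+ 7) ℚ.* (W ℚ.* W ℚ.* W)))} {ιℚ (ℤ.+ 5)} h₁)))))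
unscale : ∀ y l i F → ιℚ (ℤ.+ 5) ℚ.* (y ℚ.* y) ≡ l ℚ.* l ℚ.* l ℚ.* l ℚ.* l ℚ.* l ℚ.* F → l ℚ.* i ≡ ιℚ (ℤ.+ 1) → ιℚ (ℤ.+ 5) ℚ.* (y ℚ.* (i ℚ.* i ℚ.* i) ℚ.* (y ℚ.* (i ℚ.* i ℚ.* i))) ≡ F
unscale y l i F h₁ h₂ = trans (ℚI.identity (# (ℤ.+ 5) ⊗ (v 0F ⊗ (v 2F ⊗ v 2F ⊗ v 2F) ⊗ (v 0F ⊗ (v 2F ⊗ v 2F ⊗ v 2F)))) (v 3F ⊕ v 2F ⊗ v 2F ⊗ v 2F ⊗ v 2F ⊗ v 2F ⊗ v 2F ⊗ (# (ℤ.+ 5) ⊗ (v 0F ⊗ v 0F) ⊖ v 1F ⊗ v 1F ⊗ v 1F ⊗ v 1F ⊗ v 1F ⊗ v 1F ⊗ v 3F) ⊕ v 3F ⊗ (# (ℤ.+ 1) ⊕ v 1F ⊗ v 2F ⊕ v 1F ⊗ v 1F ⊗ (v 2F ⊗ v 2F) ⊕ v 1F ⊗ v 1F ⊗ v 1F ⊗ (v 2F ⊗ v 2F ⊗ v 2F) ⊕ v 1F ⊗ v 1F ⊗ v 1F ⊗ v 1F ⊗ (v 2F ⊗ v 2F ⊗ v 2F ⊗ v 2F) ⊕ v 1F ⊗ v 1F ⊗ v 1F ⊗ v 1F ⊗ v 1F ⊗ (v 2F ⊗ v 2F ⊗ v 2F ⊗ v 2F ⊗ v 2F)) ⊗ (v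 1F ⊗ v 2F ⊖ # (ℤ.+ 1))) refl (y ∷ l ∷ i ∷ F ∷ [])) (trans (ℚI.vanish {F ℚ.+ i ℚ.* i ℚ.* i ℚ.* i ℚ.* i ℚ.* i ℚ.* (ιℚ (ℤ.+ 5) ℚ.* (y ℚ.* y) ℚ.- l ℚ.* l ℚ.* l ℚ.* l ℚ.* l ℚ.* l ℚ.* F)} {F ℚ.* (ιℚ (ℤ.+ 1) ℚ.+ l ℚ.* i ℚ.+ l ℚ.* l ℚ.* (i ℚ.* i) ℚ.+ l ℚ.* l ℚ.* l ℚ.* (i ℚ.* i ℚ.* i) ℚ.+ l ℚ.* l ℚ.* l ℚ.* l ℚ.* (i ℚ.* i ℚ.* i ℚ.* i) ℚ.+ l ℚ.* l ℚ.* l ℚ.* l ℚ.* l ℚ.* (i ℚ.* i ℚ.* i ℚ.* i ℚ.* i))} h₂) (ℚI.vanish {F} {i ℚ.* i ℚ.* i ℚ.* i ℚ.* i ℚ.* i} h₁))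
clear-denominator : ∀ r b a F → ιℚ (ℤ.+ 5) ℚ.* (r ℚ.* r) ≡ F → r ℚ.* b ≡ a → ιℚ (ℤ.+ 5) ℚ.* (a ℚ.* a) ≡ F ℚ.* (b ℚ.* b)
clear-denominator r b a F h₁ h₂ = trans (ℚI.identity (# (ℤ.+ 5) ⊗ (v 2F ⊗ v 2F)) (v 3F ⊗ (v 1F ⊗ v 1F) ⊕ v 1F ⊗ v 1F ⊗ (# (ℤ.+ 5) ⊗ (v 0F ⊗ v 0F) ⊖ v 3F) ⊕ (# (ℤ.+ 0) ⊖ # (ℤ.+ 5) ⊗ (v 2F ⊕ v 0F ⊗ v 1F)) ⊗ (v 0F ⊗ v 1F ⊖ v 2F)) refl (r ∷ b ∷ a ∷ F ∷ [])) (trans (ℚI.vanish {F ℚ.* (b ℚ.* b) ℚ.+ b ℚ.* b ℚ.* (ιℚ (ℤ.+ 5) ℚ.* (r ℚ.* r) ℚ.- F)} {ιℚ (ℤ.+ 0) ℚ.- ιℚ (ℤ.+ 5) ℚ.* (a ℚ.+ r ℚ.* b)} h₂) (ℚI.vanish {F ℚ.* (b ℚ.* b)} {b ℚ.* b} h₁))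
-- On the line z = cx the sextic is t²x⁶, so y² - t²x⁶ factors into two linear terms in y.
on-line : ∀ y x c t A B C E → y ℚ.* y ≡ x ℚ.* (x ℚ.* (x ℚ.* (x ℚ.* (x ℚ.* (x ℚ.* ιℚ (ℤ.+ 1)))))) ℚ.+ A ℚ.* (x ℚ.* (x ℚ.* (x ℚ.* (x ℚ.* ιℚ (ℤ.+ 1))))) ℚ.* (c ℚ.* x ℚ.* (c ℚ.* x ℚ.* ιℚ (ℤ.+ 1))) ℚ.+ B ℚ.* (x ℚ.* (x ℚ.* (x ℚ.* ιℚ (ℤ.+ 1)))) ℚ.* (c ℚ.* x ℚ.* (c ℚ.* x ℚ.* (c ℚ.* x ℚ.* ιℚ (ℤ.+ 1)))) ℚ.+ C ℚ.* (x ℚ.* (x ℚ.* ιℚ (ℤ.+ 1))) ℚ.* (c ℚ.* x ℚ.* (c ℚ.* x ℚ.* (c ℚ.* x ℚ.* (c ℚ.* x ℚ.* ιℚ (ℤ.+ 1))))) ℚ.+ B ℚ.* x ℚ.* (c ℚ.* x ℚ.* (c ℚ.* x ℚ.* (c ℚ.* x ℚ.* (c ℚ.* x ℚ.* (c ℚ.* x ℚ.* ιℚ (ℤ.+ 1)))))) ℚ.+ E ℚ.* (c ℚ.* x ℚ.* (c ℚ.* x ℚ.* (c ℚ.* x ℚ.* (c ℚ.* x ℚ.* (c ℚ.* x ℚ.* (c ℚ.* x ℚ.* ιℚ (ℤ.+ 1))))))) → ιℚ (ℤ.+ 1) ℚ.+ A ℚ.* (c ℚ.* c) ℚ.+ B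 ℚ.* (c ℚ.* c ℚ.* c) ℚ.+ C ℚ.* (c ℚ.* c ℚ.* c ℚ.* c) ℚ.+ B ℚ.* (c ℚ.* c ℚ.* c ℚ.* c ℚ.* c) ℚ.+ E ℚ.* (c ℚ.* c ℚ.* c ℚ.* c ℚ.* c ℚ.* c) ≡ t ℚ.* t → (y ℚ.- t ℚ.* (x ℚ.* x ℚ.* x)) ℚ.* (y ℚ.- (ιℚ (ℤ.+ 0) ℚ.- t) ℚ.* (x ℚ.* x ℚ.* x)) ≡ ιℚ (ℤ.+ 0)
on-line y x c t A B C E h₁ h₂ = trans (ℚI.identity ((v 0F ⊖ v 3F ⊗ (v 1F ⊗ v 1F ⊗ v 1F)) ⊗ (v 0F ⊖ (# (ℤ.+ 0) ⊖ v 3F) ⊗ (v 1F ⊗ v 1F ⊗ v 1F))) (# (ℤ.+ 0) ⊕ # (ℤ.+ 1) ⊗ (v 0F ⊗ v 0F ⊖ (v 1F ⊗ (v 1F ⊗ (v 1F ⊗ (v 1F ⊗ (v 1F ⊗ (v 1F ⊗ # (ℤ.+ 1)))))) ⊕ v 4F ⊗ (v 1F ⊗ (v 1F ⊗ (v 1F ⊗ (v 1F ⊗ # (ℤ.+ 1))))) ⊗ (v 2F ⊗ v 1F ⊗ (v 2F ⊗ v 1F ⊗ # (ℤ.+ 1))) ⊕ v 5F ⊗ (v 1F ⊗ (v 1F ⊗ (v 1F ⊗ # (ℤ.+ 1)))) ⊗ (v 2F ⊗ v 1F ⊗ (v 2F ⊗ v 1F ⊗ (v 2F ⊗ v 1F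 ⊗ # (ℤ.+ 1)))) ⊕ v 6F ⊗ (v 1F ⊗ (v 1F ⊗ # (ℤ.+ 1))) ⊗ (v 2F ⊗ v 1F ⊗ (v 2F ⊗ v 1F ⊗ (v 2F ⊗ v 1F ⊗ (v 2F ⊗ v 1F ⊗ # (ℤ.+ 1))))) ⊕ v 5F ⊗ v 1F ⊗ (v 2F ⊗ v 1F ⊗ (v 2F ⊗ v 1F ⊗ (v 2F ⊗ v 1F ⊗ (v 2F ⊗ v 1F ⊗ (v 2F ⊗ v 1F ⊗ # (ℤ.+ 1)))))) ⊕ v 7F ⊗ (v 2F ⊗ v 1F ⊗ (v 2F ⊗ v 1F ⊗ (v 2F ⊗ v 1F ⊗ (v 2F ⊗ v 1F ⊗ (v 2F ⊗ v 1F ⊗ (v 2F ⊗ v 1F ⊗ # (ℤ.+ 1))))))))) ⊕ v 1F ⊗ v 1F ⊗ v 1F ⊗ v 1F ⊗ v 1F ⊗ v 1F ⊗ (# (ℤ.+ 1) ⊕ v 4F ⊗ (v 2F ⊗ v 2F) ⊕ v 5F ⊗ (v 2F ⊗ v 2F ⊗ v 2F) ⊕ v 6F ⊗ (v 2F ⊗ v 2F ⊗ v 2F ⊗ v 2F) ⊕ v 5F ⊗ (v 2F ⊗ v 2F ⊗ v 2F ⊗ v 2F ⊗ v 2F) ⊕ v 7F ⊗ (v 2F ⊗ v 2F ⊗ v 2F ⊗ v 2F ⊗ v 2F ⊗ v 2F) ⊖ v 3F ⊗ v 3F)) refl (y ∷ x ∷ c ∷ t ∷ A ∷ B ∷ C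 ∷ E ∷ [])) (trans (ℚI.vanish {ιℚ (ℤ.+ 0) ℚ.+ ιℚ (ℤ.+ 1) ℚ.* (y ℚ.* y ℚ.- (x ℚ.* (x ℚ.* (x ℚ.* (x ℚ.* (x ℚ.* (x ℚ.* ιℚ (ℤ.+ 1)))))) ℚ.+ A ℚ.* (x ℚ.* (x ℚ.* (x ℚ.* (x ℚ.* ιℚ (ℤ.+ 1))))) ℚ.* (c ℚ.* x ℚ.* (c ℚ.* x ℚ.* ιℚ (ℤ.+ 1))) ℚ.+ B ℚ.* (x ℚ.* (x ℚ.* (x ℚ.* ιℚ (ℤ.+ 1)))) ℚ.* (c ℚ.* x ℚ.* (c ℚ.* x ℚ.* (c ℚ.* x ℚ.* ιℚ (ℤ.+ 1)))) ℚ.+ C ℚ.* (x ℚ.* (x ℚ.* ιℚ (ℤ.+ 1))) ℚ.* (c ℚ.* x ℚ.* (c ℚ.* x ℚ.* (c ℚ.* x ℚ.* (c ℚ.* x ℚ.* ιℚ (ℤ.+ 1))))) ℚ.+ B ℚ.* x ℚ.* (c ℚ.* x ℚ.* (c ℚ.* x ℚ.* (c ℚ.* x ℚ.* (c ℚ.* x ℚ.* (c ℚ.* x ℚ.* ιℚ (ℤ.+ 1)))))) ℚ.+ E ℚ.* (c ℚ.* x ℚ.* (c ℚ.* x ℚ.* (c ℚ.* x ℚ.* (c ℚ.* x ℚ.* (c ℚ.* x ℚ.* (c ℚ.* x ℚ.* ιℚ (ℤ.+ 1)))))))))} {x ℚ.* x ℚ.* x ℚ.* x ℚ.* x ℚ.*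 x} h₂) (ℚI.vanish {ιℚ (ℤ.+ 0)} {ιℚ (ℤ.+ 1)} h₁))

five-F : ∀ k A F b → ι (ℤ.+ 5) * A * (ι (ℤ.+ 5) * A) ≡ b * b * (ι (ℤ.+ 5) * F) → ι (ℤ.+ 5) * A * (ι (ℤ.+ 5) * A) ≡ b * b * (ι (ℤ.+ 5) * F)
five-F k A F b h₁ = trans (𝒪I.identity (# (ℤ.+ 5) ⊗ v 1F ⊗ (# (ℤ.+ 5) ⊗ v 1F)) (v 3F ⊗ v 3F ⊗ (# (ℤ.+ 5) ⊗ v 2F) ⊕ # (ℤ.+ 1) ⊗ (# (ℤ.+ 5) ⊗ v 1F ⊗ (# (ℤ.+ 5) ⊗ v 1F) ⊖ v 3F ⊗ v 3F ⊗ (# (ℤ.+ 5) ⊗ v 2F))) refl (k ∷ A ∷ F ∷ b ∷ [])) (𝒪I.vanish h₁)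
square-5 : ∀ A F b → ι (ℤ.+ 5) * (A * A) ≡ F * (b * b) → ι (ℤ.+ 5) * A * (ι (ℤ.+ 5) * A) ≡ b * b * (ι (ℤ.+ 5) * F)
square-5 A F b h₁ = trans (𝒪I.identity (# (ℤ.+ 5) ⊗ v 0F ⊗ (# (ℤ.+ 5) ⊗ v 0F)) (v 2F ⊗ v 2F ⊗ (# (ℤ.+ 5) ⊗ v 1F) ⊕ # (ℤ.+ 5) ⊗ (# (ℤ.+ 5) ⊗ (v 0F ⊗ v 0F) ⊖ v 1F ⊗ (v 2F ⊗ v 2F))) refl (A ∷ F ∷ b ∷ [])) (𝒪I.vanish h₁)
combine-ratio : ∀ x z l U W m → x ≡ l ℚ.* W → z ≡ l ℚ.* (U ℚ.- W) → U ≡ m ℚ.* W → z ≡ (m ℚ.- ιℚ (ℤ.+ 1)) ℚ.* x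
combine-ratio x z l U W m h₁ h₂ h₃ = trans (ℚI.identity (v 1F) ((v 5F ⊖ # (ℤ.+ 1)) ⊗ v 0F ⊕ (# (ℤ.+ 0) ⊖ v 5F ⊕ # (ℤ.+ 1)) ⊗ (v 0F ⊖ v 2F ⊗ v 4F) ⊕ # (ℤ.+ 1) ⊗ (v 1F ⊖ v 2F ⊗ (v 3F ⊖ v 4F)) ⊕ v 2F ⊗ (v 3F ⊖ v 5F ⊗ v 4F)) refl (x ∷ z ∷ l ∷ U ∷ W ∷ m ∷ [])) (trans (ℚI.vanish {(m ℚ.- ιℚ (ℤ.+ 1)) ℚ.* x ℚ.+ (ιℚ (ℤ.+ 0) ℚ.- m ℚ.+ ιℚ (ℤ.+ 1)) ℚ.* (x ℚ.- l ℚ.* W) ℚ.+ ιℚ (ℤ.+ 1) ℚ.* (z ℚ.- l ℚ.* (U ℚ.- W))} {l} h₃) (trans (ℚI.vanish {(m ℚ.- ιℚ (ℤ.+ 1)) ℚ.* x ℚ.+ (ιℚ (ℤ.+ 0) ℚ.- m ℚ.+ ιℚ (ℤ.+ 1)) ℚ.* (x ℚ.- l ℚ.* W)} {ιℚ (ℤ.+ 1)} h₂) (ℚI.vanish {(m ℚ.- ιℚ (ℤ.+ 1)) ℚ.* x} {ιℚ (ℤ.+ 0) ℚ.- m ℚ.+ ιℚ (ℤ.+ 1)} h₁)))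
-≡0 : ∀ x y → x ℚ.- y ≡ ιℚ (ℤ.+ 0) → x ≡ y
-≡0 x y h₁ = trans (ℚI.identity (v 0F) (v 1F ⊕ # (ℤ.+ 1) ⊗ (v 0F ⊖ v 1F ⊖ # (ℤ.+ 0))) refl (x ∷ y ∷ [])) (ℚI.vanish {y} {ιℚ (ℤ.+ 1)} h₁)
scaled-y : ∀ y z x c t q → y ≡ t ℚ.* (x ℚ.* x ℚ.* x) → z ≡ c ℚ.* x → q ℚ.* (c ℚ.* c ℚ.* c) ≡ t → y ≡ z ℚ.* z ℚ.* z ℚ.* q
scaled-y y z x c t q h₁ h₂ h₃ = trans (ℚI.identity (v 0F) (v 1F ⊗ v 1F ⊗ v 1F ⊗ v 5F ⊕ # (ℤ.+ 1) ⊗ (v 0F ⊖ v 4F ⊗ (v 2F ⊗ v 2F ⊗ v 2F)) ⊕ (# (ℤ.+ 0) ⊖ v 5F ⊗ (v 1F ⊗ v 1F ⊕ v 1F ⊗ v 3F ⊗ v 2F ⊕ v 3F ⊗ v 3F ⊗ v 2F ⊗ v 2F)) ⊗ (v 1F ⊖ v 3F ⊗ v 2F) ⊕ (# (ℤ.+ 0) ⊖ v 2F ⊗ v 2F ⊗ v 2F) ⊗ (v 5F ⊗ (v 3F ⊗ v 3F ⊗ v 3F) ⊖ v 4F)) refl (y ∷ z ∷ x ∷ c ∷ t ∷ q ∷ [])) (trans (ℚI.vanish {z ℚ.* z ℚ.* z ℚ.* q ℚ.+ ιℚ (ℤ.+ 1) ℚ.* (y ℚ.- t ℚ.* (x ℚ.*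 x ℚ.* x)) ℚ.+ (ιℚ (ℤ.+ 0) ℚ.- q ℚ.* (z ℚ.* z ℚ.+ z ℚ.* c ℚ.* x ℚ.+ c ℚ.* c ℚ.* x ℚ.* x)) ℚ.* (z ℚ.- c ℚ.* x)} {ιℚ (ℤ.+ 0) ℚ.- x ℚ.* x ℚ.* x} h₃) (trans (ℚI.vanish {z ℚ.* z ℚ.* z ℚ.* q ℚ.+ ιℚ (ℤ.+ 1) ℚ.* (y ℚ.- t ℚ.* (x ℚ.* x ℚ.* x))} {ιℚ (ℤ.+ 0) ℚ.- q ℚ.* (z ℚ.* z ℚ.+ z ℚ.* c ℚ.* x ℚ.+ c ℚ.* c ℚ.* x ℚ.* x)} h₂) (ℚI.vanish {z ℚ.* z ℚ.* z ℚ.* q} {ιℚ (ℤ.+ 1)} h₁)))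
scaled-x : ∀ x z c q → z ≡ c ℚ.* x → q ℚ.* c ≡ ιℚ (ℤ.+ 1) → x ≡ z ℚ.* q
scaled-x x z c q h₁ h₂ = trans (ℚI.identity (v 0F) (v 1F ⊗ v 3F ⊕ (# (ℤ.+ 0) ⊖ v 3F) ⊗ (v 1F ⊖ v 2F ⊗ v 0F) ⊕ (# (ℤ.+ 0) ⊖ v 0F) ⊗ (v 3F ⊗ v 2F ⊖ # (ℤ.+ 1))) refl (x ∷ z ∷ c ∷ q ∷ [])) (trans (ℚI.vanish {z ℚ.* q ℚ.+ (ιℚ (ℤ.+ 0) ℚ.- q) ℚ.* (z ℚ.- c ℚ.* x)} {ιℚ (ℤ.+ 0) ℚ.- x} h₂) (ℚI.vanish {z ℚ.* q} {ιℚ (ℤ.+ 0) ℚ.- q} h₁))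

cubic-product : ∀ {n} → Expr n → Expr n → Expr n
cubic-product U W = (U ⊗ U ⊗ U ⊖ # (ℤ.+ 3) ⊗ U ⊗ (W ⊗ W) ⊕ # (ℤ.+ 3) ⊗ (W ⊗ W ⊗ W)) ⊗ (U ⊗ U ⊗ U ⊖ # (ℤ.+ 3) ⊗ U ⊗ (W ⊗ W) ⊕ # (ℤ.+ 7) ⊗ (W ⊗ W ⊗ W))

-- Clearing denominators gives (5a)² = b² · 5F with F the product of the two norms; cancelling b²
-- shows that 5F is a square in `𝒪`.
covered : ∀ u w a b → Cop (ι u) (ι w) → ℤI.⟦ # (ℤ.+ 5) ⊗ (v 2F ⊗ v 2F) ⟧ (u ∷ w ∷ a ∷ ℤ.+ suc b ∷ []) ≡ ℤI.⟦ cubic-product (v 0F) (v 1F) ⊗ (v 3F ⊗ v 3F) ⟧ (u ∷ w ∷ a ∷ ℤ.+ suc b ∷ []) → Ratio u w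
covered u w a b uw e = go (sq-quotient (ι≢𝟘 b) (square-5 (ι a) F (ι (ℤ.+ suc b))
    (trans (sym (ι-⟦⟧ 𝒪-algebra (# (ℤ.+ 5) ⊗ (v 2F ⊗ v 2F)) (u ∷ w ∷ a ∷ ℤ.+ suc b ∷ []))) (trans (cong ι e) (ι-⟦⟧ 𝒪-algebra (cubic-product (v 0F) (v 1F) ⊗ (v 3F ⊗ v 3F)) (u ∷ w ∷ a ∷ ℤ.+ suc b ∷ []))))))
  where
  F : 𝒪
  F = 𝒪I.⟦ cubic-product (v 0F) (v 1F) ⟧ (ι u ∷ ι w ∷ [])
  go : (∃ λ k → ι (ℤ.+ 5) * ι a ≡ ι (ℤ.+ suc b) * k × ι (ℤ.+ 5) * F ≡ k * k) → Ratio u w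
  go (k , _ , e) = Cover.result u w k uw (trans (sym e) (cong (λ x → ι (ℤ.+ 5) * x) (sym (cong₂ _*_
    (cubic (ι u) (ι w) θ (θ ♯) _ (ι (ℤ.+ 3)) (Trace-zero.♯-form θ trace-θ u w) θ♯≡ θ³≡)
    (cubic (ι u) (ι w) θ₂ (θ₂ ♯) _ (ι (ℤ.+ 7)) (Trace-zero.♯-form θ₂ trace-θ₂ u w) θ₂♯≡ θ₂³≡)))))

scaled-point : ∀ {y l} u w → Cop (ι u) (ι w) → l ≢ 0ℚ → XEq (l ℚ.* ιℚ w , y , l ℚ.* (ιℚ u ℚ.- ιℚ w)) → Ratio u w
scaled-point {y} {l} u w uw l≢0 on-X = go r refl
  where
  inv = inverse l≢0
  i = proj₁ inv
  r = y ℚ.* (i ℚ.* i ℚ.* i)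
  F = ℚI.⟦ cubic-product (v 0F) (v 1F) ⟧ (ιℚ u ∷ ιℚ w ∷ [])
  5r²≡F : ιℚ (ℤ.+ 5) ℚ.* (r ℚ.* r) ≡ F
  5r²≡F = unscale y l i F (clear-scale y l (ιℚ u) (ιℚ w) (ℤ.+ 18 ℚ./ 5) (ℤ.+ 6 ℚ./ 5) (ℤ.+ 9 ℚ./ 5) (ℤ.+ 1 ℚ./ 5) on-X refl refl refl refl) (proj₂ inv)
  go : ∀ q → r ≡ q → Ratio u w
  go (mkℚ a b c) r≡ = covered u w a b uw (ιℚ-injective (trans (ι-⟦⟧ ℚ-algebra (# (ℤ.+ 5) ⊗ (v 2F ⊗ v 2F)) (u ∷ w ∷ a ∷ ℤ.+ suc b ∷ []))
    (trans (clear-denominator r (ιℚ (ℤ.+ suc b)) (ιℚ a) F 5r²≡F (trans (cong (ℚ._* ιℚ (ℤ.+ suc b)) r≡) (numerator-denominator a b c)))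
      (sym (ι-⟦⟧ ℚ-algebra (cubic-product (v 0F) (v 1F) ⊗ (v 3F ⊗ v 3F)) (u ∷ w ∷ a ∷ ℤ.+ suc b ∷ []))))))

-- the listed points

MapsTo : Triple → Fin 10 → Set
MapsTo P i = P ∼ listed i

ratio-z : ∀ {x z} l u w → x ≡ l ℚ.* ιℚ w → z ≡ l ℚ.* (ιℚ u ℚ.- ιℚ w) → (r : Ratio u w) → z ≡ (ιℚ (Ratio.m r) ℚ.- 1ℚ) ℚ.* x
ratio-z {x} {z} l u w x≡ z≡ (ratio m _ u≡) = combine-ratio x z l (ιℚ u) (ιℚ w) (ιℚ m) x≡ z≡ (trans (cong ιℚ u≡) (ιℚ-* m w))

on-line-point : ∀ x y z c t → XEq (x , y , z) → z ≡ c ℚ.* x →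
  1ℚ ℚ.+ (ℤ.+ 18 ℚ./ 5) ℚ.* (c ℚ.* c) ℚ.+ (ℤ.+ 6 ℚ./ 5) ℚ.* (c ℚ.* c ℚ.* c) ℚ.+ (ℤ.+ 9 ℚ./ 5) ℚ.* (c ℚ.* c ℚ.* c ℚ.* c) ℚ.+ (ℤ.+ 6 ℚ./ 5) ℚ.* (c ℚ.* c ℚ.* c ℚ.* c ℚ.* c)
    ℚ.+ (ℤ.+ 1 ℚ./ 5) ℚ.* (c ℚ.* c ℚ.* c ℚ.* c ℚ.* c ℚ.* c) ≡ t ℚ.* t → y ≡ t ℚ.* (x ℚ.* x ℚ.* x) ⊎ y ≡ (0ℚ ℚ.- t) ℚ.* (x ℚ.* x ℚ.* x)
on-line-point x y z c t on-X refl value = go (ℚ-product≡0 _ _ (on-line y x c t (ℤ.+ 18 ℚ./ 5) (ℤ.+ 6 ℚ./ 5) (ℤ.+ 9 ℚ./ 5) (ℤ.+ 1 ℚ./ 5) on-X value))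
  where
  X = x ℚ.* x ℚ.* x
  go : y ℚ.- t ℚ.* X ≡ 0ℚ ⊎ y ℚ.- (0ℚ ℚ.- t) ℚ.* X ≡ 0ℚ → y ≡ t ℚ.* X ⊎ y ≡ (0ℚ ℚ.- t) ℚ.* X
  go (inj₁ e) = inj₁ (-≡0 y _ e)
  go (inj₂ e) = inj₂ (-≡0 y _ e)

affine-point : ∀ {x y z c t} q s → x ≢ 0ℚ → z ≡ c ℚ.* x → y ≡ t ℚ.* (x ℚ.* x ℚ.* x) → q ℚ.* c ≡ 1ℚ → s ℚ.* (c ℚ.* c ℚ.* c) ≡ t → (x , y , z) ∼ (q , s , 1ℚ)
affine-point {x} {y} {z} {c} {t} q s x≢0 z≡ y≡ qc sc = z , z≢0 , x≡ , scaled-y y z x c t s y≡ z≡ sc , sym (ℚₚ.*-identityʳ z)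
  where
  x≡ = scaled-x x z c q z≡ qc
  z≢0 : z ≢ 0ℚ
  z≢0 e = x≢0 (trans x≡ (trans (cong (ℚ._* q) e) (ℚₚ.*-zeroˡ q)))

infinite-y : ∀ y x t → y ≡ t ℚ.* (x ℚ.* x ℚ.* x) → y ≡ x ℚ.* x ℚ.* x ℚ.* t
infinite-y y x t h₁ = trans (ℚI.identity (v 0F) (v 1F ⊗ v 1F ⊗ v 1F ⊗ v 2F ⊕ # (ℤ.+ 1) ⊗ (v 0F ⊖ v 2F ⊗ (v 1F ⊗ v 1F ⊗ v 1F))) refl (y ∷ x ∷ t ∷ [])) (ℚI.vanish {x ℚ.* x ℚ.* x ℚ.* t} {ιℚ (ℤ.+ 1)} h₁)

infinite-point : ∀ {x y z t} → x ≢ 0ℚ → z ≡ 0ℚ ℚ.* x → y ≡ t ℚ.* (x ℚ.* x ℚ.* x) → (x , y , z) ∼ (1ℚ , t , 0ℚ)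
infinite-point {x} {y} {z} {t} x≢0 z≡ y≡ = x , x≢0 , sym (ℚₚ.*-identityʳ x) , infinite-y y x t y≡ , trans z≡ (ℚₚ.*-comm 0ℚ x)

either : ∀ {A B C : Set} → A ⊎ B → (A → C) → (B → C) → C
either (inj₁ a) f g = f a
either (inj₂ b) f g = g b

-- The constants 1, 3, 3, 1 and 21 are the square roots of the sextic at x = 1 and z = 0, 1, -2, -3
-- and -5; the sign of the root selects one of the two points of the line.
on-known-line : ∀ x y z m → x ≢ 0ℚ → XEq (x , y , z) → z ≡ (ιℚ m ℚ.- 1ℚ) ℚ.* x →
  m ≡ ℤ.+ 1 ⊎ m ≡ ℤ.+ 2 ⊎ m ≡ -[1+ 0 ] ⊎ m ≡ -[1+ 1 ] ⊎ m ≡ -[1+ 3 ] → ∃ (MapsTo (x , y , z))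
on-known-line x y z m x≢0 on-X z≡ (inj₁ refl) = either (on-line-point x y z (ιℚ m ℚ.- 1ℚ) 1ℚ on-X z≡ refl)
  (λ y≡ → 6F , infinite-point x≢0 z≡ y≡) (λ y≡ → 7F , infinite-point x≢0 z≡ y≡)
on-known-line x y z m x≢0 on-X z≡ (inj₂ (inj₁ refl)) = either (on-line-point x y z (ιℚ m ℚ.- 1ℚ) (ℤ.+ 3 ℚ./ 1) on-X z≡ refl)
  (λ y≡ → 4F , affine-point {c = ιℚ m ℚ.- 1ℚ} {t = (ℤ.+ 3 ℚ./ 1)} _ _ x≢0 z≡ y≡ refl refl) (λ y≡ → 5F , affine-point {c = ιℚ m ℚ.- 1ℚ} {t = (0ℚ ℚ.- ℤ.+ 3 ℚ./ 1)} _ _ x≢0 z≡ y≡ refl refl)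
on-known-line x y z m x≢0 on-X z≡ (inj₂ (inj₂ (inj₁ refl))) = either (on-line-point x y z (ιℚ m ℚ.- 1ℚ) (ℤ.+ 3 ℚ./ 1) on-X z≡ refl)
  (λ y≡ → 8F , affine-point {c = ιℚ m ℚ.- 1ℚ} {t = (ℤ.+ 3 ℚ./ 1)} _ _ x≢0 z≡ y≡ refl refl) (λ y≡ → 9F , affine-point {c = ιℚ m ℚ.- 1ℚ} {t = (0ℚ ℚ.- ℤ.+ 3 ℚ./ 1)} _ _ x≢0 z≡ y≡ refl refl)
on-known-line x y z m x≢0 on-X z≡ (inj₂ (inj₂ (inj₂ (inj₁ refl)))) = either (on-line-point x y z (ιℚ m ℚ.- 1ℚ) 1ℚ on-X z≡ refl)
  (λ y≡ → 0F , affine-point {c = ιℚ m ℚ.- 1ℚ} {t = 1ℚ} _ _ x≢0 z≡ y≡ refl refl) (λ y≡ → 1F , affine-point {c = ιℚ m ℚ.- 1ℚ} {t = (0ℚ ℚ.- 1ℚ)} _ _ x≢0 z≡ y≡ refl refl)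
on-known-line x y z m x≢0 on-X z≡ (inj₂ (inj₂ (inj₂ (inj₂ refl)))) = either (on-line-point x y z (ιℚ m ℚ.- 1ℚ) (ℤ.+ 21 ℚ./ 1) on-X z≡ refl)
  (λ y≡ → 2F , affine-point {c = ιℚ m ℚ.- 1ℚ} {t = (ℤ.+ 21 ℚ./ 1)} _ _ x≢0 z≡ y≡ refl refl) (λ y≡ → 3F , affine-point {c = ιℚ m ℚ.- 1ℚ} {t = (0ℚ ℚ.- ℤ.+ 21 ℚ./ 1)} _ _ x≢0 z≡ y≡ refl refl)

recover-x : ∀ x d i → d ℚ.* i ≡ ιℚ (ℤ.+ 1) → x ≡ x ℚ.* i ℚ.* d
recover-x x d i h₁ = trans (ℚI.identity (v 0F) (v 0F ⊗ v 2F ⊗ v 1F ⊕ (# (ℤ.+ 0) ⊖ v 0F) ⊗ (v 1F ⊗ v 2F ⊖ # (ℤ.+ 1))) refl (x ∷ d ∷ i ∷ [])) (ℚI.vanish {x ℚ.* i ℚ.* d} {ιℚ (ℤ.+ 0) ℚ.- x} h₁)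
recover-z : ∀ x z j t n d i → x ℚ.* j ≡ ιℚ (ℤ.+ 1) → z ℚ.* j ≡ t → t ℚ.* d ≡ n → d ℚ.* i ≡ ιℚ (ℤ.+ 1) → z ≡ x ℚ.* i ℚ.* (n ℚ.+ d ℚ.- d)
recover-z x z j t n d i h₁ h₂ h₃ h₄ = trans (ℚI.identity (v 1F) (v 0F ⊗ v 6F ⊗ (v 4F ⊕ v 5F ⊖ v 5F) ⊕ (# (ℤ.+ 0) ⊖ v 1F) ⊗ (v 0F ⊗ v 2F ⊖ # (ℤ.+ 1)) ⊕ v 0F ⊗ (v 1F ⊗ v 2F ⊖ v 3F) ⊕ v 0F ⊗ v 6F ⊗ (v 3F ⊗ v 5F ⊖ v 4F) ⊕ (# (ℤ.+ 0) ⊖ v 0F ⊗ v 3F ⊕ # (ℤ.+ 0)) ⊗ (v 5F ⊗ v 6F ⊖ # (ℤ.+ 1))) refl (x ∷ z ∷ j ∷ t ∷ n ∷ d ∷ i ∷ [])) (trans (ℚI.vanish {x ℚ.* i ℚ.* (n ℚ.+ d ℚ.- d) ℚ.+ (ιℚ (ℤ.+ 0) ℚ.- z) ℚ.* (x ℚ.* j ℚ.- ιℚ (ℤ.+ 1)) ℚ.+ x ℚ.* (z ℚ.* j ℚ.- t) ℚ.+ x ℚ.* i ℚ.* (t ℚ.* d ℚ.- n)} {ιℚ (ℤ.+ 0) ℚ.- x ℚ.* t ℚ.+ ιℚ (ℤ.+ 0)} h₄) (trans (ℚI.vanish {x ℚ.* i ℚ.* (n ℚ.+ d ℚ.- d)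 ℚ.+ (ιℚ (ℤ.+ 0) ℚ.- z) ℚ.* (x ℚ.* j ℚ.- ιℚ (ℤ.+ 1)) ℚ.+ x ℚ.* (z ℚ.* j ℚ.- t)} {x ℚ.* i} h₃) (trans (ℚI.vanish {x ℚ.* i ℚ.* (n ℚ.+ d ℚ.- d) ℚ.+ (ιℚ (ℤ.+ 0) ℚ.- z) ℚ.* (x ℚ.* j ℚ.- ιℚ (ℤ.+ 1))} {x} h₂) (ℚI.vanish {x ℚ.* i ℚ.* (n ℚ.+ d ℚ.- d)} {ιℚ (ℤ.+ 0) ℚ.- z} h₁))))

complete : ∀ P → OnX P → ∃ (MapsTo P)
complete (x , y , z) (nz , on-X) = decide (x ℚₚ.≟ 0ℚ)
  where
  at-zero : x ≡ 0ℚ → Dec (z ≡ 0ℚ) → ⊥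
  at-zero refl (yes refl) = nz (refl , either (ℚ-product≡0 y y on-X) (λ e → e) (λ e → e) , refl)
  -- The case x = 0 is the pair (u , w) = (1 , 0) with scale z, and none of the five ratios is
  -- compatible with it.
  at-zero refl (no z≢0) = degenerate (scaled-point {y} {z} (ℤ.+ 1) (ℤ.+ 0) (cop-sym cop-𝟙) z≢0
      (subst₂ (λ x z → XEq (x , y , z)) (sym (ℚₚ.*-zeroʳ z)) (sym (ℚₚ.*-identityʳ z)) on-X))
    where
    degenerate : Ratio (ℤ.+ 1) (ℤ.+ 0) → ⊥
    degenerate (ratio m _ e) = 1≢0 (trans e (ℤₚ.*-zeroʳ m))
      where
      1≢0 : ℤ.+ 1 ≢ ℤ.+ 0
      1≢0 ()
  at-nonzero : x ≢ 0ℚ → ∃ (MapsTo (x , y , z))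
  at-nonzero x≢0 = go (z ℚ.* j) refl
    where
    inv = inverse x≢0
    j = proj₁ inv
    go : ∀ t → z ℚ.* j ≡ t → ∃ (MapsTo (x , y , z))
    -- With z / x = n / d in lowest terms, u = n + d and w = d are coprime.
    go (mkℚ n d-1 c) t≡ = finish (scaled-point {y} {x ℚ.* i} (n ℤ.+ ℤ.+ suc d-1) (ℤ.+ suc d-1) coprime l≢0 (subst₂ (λ x z → XEq (x , y , z)) x≡ z≡ on-X))
      where
      d = ℤ.+ suc d-1
      d≢0 : ιℚ d ≢ 0ℚ
      d≢0 ()
      i = proj₁ (inverse d≢0)
      x≡ : x ≡ x ℚ.* i ℚ.* ιℚ d
      x≡ = recover-x x (ιℚ d) i (proj₂ (inverse d≢0))
      z≡ : z ≡ x ℚ.* i ℚ.* (ιℚ (n ℤ.+ d) ℚ.- ιℚ d)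
      z≡ = trans (recover-z x z j _ (ιℚ n) (ιℚ d) i (proj₂ inv) t≡ (numerator-denominator n d-1 c) (proj₂ (inverse d≢0)))
        (cong (λ s → x ℚ.* i ℚ.* (s ℚ.- ιℚ d)) (sym (ιℚ-+ n d)))
      l≢0 : x ℚ.* i ≢ 0ℚ
      l≢0 e = x≢0 (trans x≡ (trans (cong (ℚ._* ιℚ d) e) (ℚₚ.*-zeroˡ (ιℚ d))))
      coprime : Cop (ι (n ℤ.+ d)) (ι d)
      coprime = cop-sym (cop-≈ (by 𝟙 (trans (ι-+ n d) (cong (λ x → ι n + x) (sym (x*𝟙 (ι d)))))) (cop-sym (cop-ι n (suc d-1) (Coprimality.recompute c))))
      finish : Ratio (n ℤ.+ d) d → ∃ (MapsTo (x , y , z))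
      finish r = on-known-line x y z (Ratio.m r) x≢0 on-X (ratio-z (x ℚ.* i) (n ℤ.+ d) d x≡ z≡ r) (Ratio.known r)
  decide : Dec (x ≡ 0ℚ) → ∃ (MapsTo (x , y , z))
  decide (yes x≡0) = ⊥-elim (at-zero x≡0 (z ℚₚ.≟ 0ℚ))
  decide (no x≢0) = at-nonzero x≢0

-- The ten points lie on the curve and are pairwise inequivalent.

on-curve : ∀ i → OnX (listed i)
on-curve 0F = (λ { (() , _) }) , refl
on-curve 1F = (λ { (() , _) }) , refl
on-curve 2F = (λ { (() , _) }) , refl
on-curve 3F = (λ { (() , _) }) , refl
on-curve 4F = (λ { (() , _) }) , refl
on-curve 5F = (λ { (() , _) }) , refl
on-curve 6F = (λ { (() , _) }) , refl
on-curve 7F = (λ { (() , _) }) , refl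
on-curve 8F = (λ { (() , _) }) , refl
on-curve 9F = (λ { (() , _) }) , refl

data Normalised : Triple → Set where
  affine : ∀ {x y} → Normalised (x , y , 1ℚ)
  infinite : ∀ {y} → Normalised (1ℚ , y , 0ℚ)

normalised : ∀ i → Normalised (listed i)
normalised 0F = affine
normalised 1F = affine
normalised 2F = affine
normalised 3F = affine
normalised 4F = affine
normalised 5F = affine
normalised 6F = infinite
normalised 7F = infinite
normalised 8F = affine
normalised 9F = affine

unscaled : ∀ {l x y z x′ y′ z′} → l ≡ 1ℚ → x ≡ l ℚ.* x′ → y ≡ cube l ℚ.* y′ → z ≡ l ℚ.* z′ → (x , y , z) ≡ (x′ , y′ , z′)
unscaled refl p q r = cong₂ _,_ (trans p (ℚₚ.*-identityˡ _)) (cong₂ _,_ (trans q (ℚₚ.*-identityˡ _)) (trans r (ℚₚ.*-identityˡ _)))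

-- Between representatives normalised by z = 1, or by x = 1 and z = 0, the scaling factor can only
-- be 1.
∼⇒≡ : ∀ {P Q} → Normalised P → Normalised Q → P ∼ Q → P ≡ Q
∼⇒≡ affine affine (l , _ , p , q , r) = unscaled (sym (trans r (ℚₚ.*-identityʳ l))) p q r
∼⇒≡ infinite infinite (l , _ , p , q , r) = unscaled (sym (trans p (ℚₚ.*-identityʳ l))) p q r
∼⇒≡ affine infinite (l , _ , _ , _ , r) = ⊥-elim (1≢0 (trans r (ℚₚ.*-zeroʳ l)))
  where
  1≢0 : 1ℚ ≢ 0ℚ
  1≢0 ()
∼⇒≡ infinite affine (l , l≢0 , _ , _ , r) = ⊥-elim (l≢0 (sym (trans r (ℚₚ.*-identityʳ l))))

listed-injective : ∀ i j → listed i ≡ listed j → i ≡ j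
listed-injective = from-yes (all? λ i → all? λ j → (≡-dec ℚₚ._≟_ (≡-dec ℚₚ._≟_ ℚₚ._≟_) (listed i) (listed j)) →-dec (i Finₚ.≟ j))

theorem7p3 : ((i : Fin 10) → OnX (listed i))
  × ((P : Defs.Triple) → OnX P → ∃ λ (i : Fin 10) → P ∼ listed i)
  × ((i j : Fin 10) → listed i ∼ listed j → i ≡ j)
theorem7p3 = on-curve , complete , λ i j e → listed-injective i j (∼⇒≡ (normalised i) (normalised j) e)
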